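{- Over primes $p \equiv 1 \pmod 4$, $\mathrm{FK}_4(G_p) = \Theta(p^{1/3})$; that is, there are constants $0<c_1\le c_2$ such that $c_1 p^{1/3} \le \mathrm{FK}_4(G_p) \le c_2 p^{1/3}$ for all sufficiently large primes $p\equiv 1 \pmod 4$.
   Context: For a prime $p \equiv 1 \pmod 4$, the Paley graph $G_p$ has vertex set $\mathbb{F}_p$, with distinct $a,b$ adjacent iff $a-b$ is a nonzero square in $\mathbb{F}_p$. For a graph $G$ on vertex set $V$, a degree 4 pseudoexpectation for the clique problem is a linear functional $\widetilde{\mathbb{E}}$ on real polynomials of degree at most $4$ in $(x_i)_{i\in V}$ with $\widetilde{\mathbb{E}}[1]=1$, $\widetilde{\mathbb{E}}[(x_i^2-x_i)q]=0$ and $\widetilde{\mathbb{E}}[x_ix_jq]=0$ (for distinct non-adjacent $i,j$) for all $q$ of degree at most $2$, and $\widetilde{\mathbb{E}}[q^2]\ge 0$ for all $q$ of degree at most $2$. It is given by Feige-Krauthgamer (FK) pseudomoments if there are reals $\alpha_1,\dots,\alpha_4$ (with $\alpha_0=1$) such that $\widetilde{\mathbb{E}}[\prod_{i\in T}x_i^{k_i}]=\alpha_{|T|}$ whenever the set $T$ (all $k_i\ge1$) is a clique of $G$ and $0$ otherwise. $\mathrm{FK}_4(G)$ is the maximum of $\sum_{i\in V}\widetilde{\mathbb{E}}[x_i]$ over all such pseudoexpectations given by FK pseudomoments.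
   Formalization: The moments α₁,…,α₄, the coefficients of the test polynomials q and the constants c₁, c₂ are rational instead of real, so the upper bound on FK₄ is stated only for pseudoexpectations given by rational FK pseudomoments. -}

module Defs where

open import Data.Nat as ℕ using (ℕ; zero; suc; _%_)
open import Data.Fin as Fin using (Fin; toℕ)
open import Data.Fin.Properties using () renaming (_≟_ to _≟ᶠ_)
open import Data.Bool using (Bool; true; false; if_then_else_; _∧_; not)
open import Data.List as List using (List; []; _∷_; _++_; map; concatMap; foldr; length; deduplicate; allFin)
open import Data.Bool.ListAction using (all; any)
open import Data.Integer using (+_)
open import Data.Rational using (ℚ; 0ℚ; 1ℚ; _+_; _*_; _≤_; _/_)
open import Data.Product using (_×_; _,_)

-- Graphs on vertex set Fin n, given by a Boolean adjacency test
-- (only consulted on distinct vertices).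

Graph : ℕ → Set
Graph n = Fin n → Fin n → Bool

modN : ℕ → ℕ → ℕ
modN n zero    = n
modN n (suc k) = n % suc k

isSquareMod : (p : ℕ) → ℕ → Bool
isSquareMod p d = any (λ (x : Fin p) → modN (toℕ x ℕ.* toℕ x) p ℕ.≡ᵇ modN d p) (allFin p)

paley : (p : ℕ) → Graph p
paley p a b =
  not (toℕ a ℕ.≡ᵇ toℕ b) ∧ isSquareMod p (toℕ a ℕ.+ (p ℕ.∸ toℕ b))

-- Monomials are lists of variables (repetitions allowed); the support of a
-- monomial is the deduplicated list.

Monomial : ℕ → Set
Monomial n = List (Fin n)

support : ∀ {n} → Monomial n → List (Fin n)
support = deduplicate _≟ᶠ_

isClique : ∀ {n} → Graph n → List (Fin n) → Bool
isClique G T = all (λ i → all (λ j → if toℕ i ℕ.≡ᵇ toℕ j then true else G i j) T) T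

FKParams : Set
FKParams = ℚ × ℚ × ℚ × ℚ

αAt : FKParams → ℕ → ℚ
αAt _                 0 = 1ℚ
αAt (a₁ , _ , _ , _)  1 = a₁
αAt (_ , a₂ , _ , _)  2 = a₂
αAt (_ , _ , a₃ , _)  3 = a₃
αAt (_ , _ , _ , a₄)  4 = a₄
αAt _                 _ = 0ℚ   -- never used (degree ≤ 4)

Ẽ : ∀ {n} → Graph n → FKParams → Monomial n → ℚ
Ẽ G α m = let T = support m in
  if isClique G T then αAt α (length T) else 0ℚ

sumℚ : List ℚ → ℚ
sumℚ = foldr _+_ 0ℚ

-- A real-coefficient (here: rational) polynomial of degree ≤ 2:
--   q = c₀ + Σ_i c₁ i x_i + Σ_{i,j} c₂ i j x_i x_j
record Poly≤2 (n : ℕ) : Set where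
  constructor poly
  field
    c₀ : ℚ
    c₁ : Fin n → ℚ
    c₂ : Fin n → Fin n → ℚ

terms : ∀ {n} → Poly≤2 n → List (ℚ × Monomial n)
terms {n} (poly c₀ c₁ c₂) =
  (c₀ , []) ∷
  (map (λ i → c₁ i , i ∷ []) (allFin n) ++
   concatMap (λ i → map (λ j → c₂ i j , i ∷ j ∷ []) (allFin n)) (allFin n))

ẼSq : ∀ {n} → Graph n → FKParams → Poly≤2 n → ℚ
ẼSq G α q =
  sumℚ (concatMap (λ t → map (λ s → (Data.Product.proj₁ t * Data.Product.proj₁ s)
                                     * Ẽ G α (Data.Product.proj₂ t ++ Data.Product.proj₂ s))
                              (terms q))
                  (terms q))

-- FK pseudomoments α give a degree-4 pseudoexpectation: Ẽ[1] = 1 and the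
-- ideal constraints hold by construction, so it remains Ẽ[q²] ≥ 0.
FKFeasible : ∀ {n} → Graph n → FKParams → Set
FKFeasible G α = ∀ q → 0ℚ ≤ ẼSq G α q

FKValue : ∀ {n} → Graph n → FKParams → ℚ
FKValue {n} G α = sumℚ (map (λ i → Ẽ G α (i ∷ [])) (allFin n))

cube : ℚ → ℚ
cube x = x * x * x

ℕtoℚ : ℕ → ℚ
ℕtoℚ k = + k / 1

{-# OPTIONS --safe #-}

-- With τ ≈ p^{-2/3} / 100, the moments (τ, 2τ², 8τ³, 64τ⁴) are feasible and have value pτ. Completing
-- squares, positivity reduces to bounds on quadratic forms built from the matrix S_ij = χ(i - j), most of
-- which follow from S² = pI - J. The remaining one is the cross-ratio form
-- χ((i - k)(i - l)(j - k)(j - l)) on functions of the edges, which needs the norm bound O(p^{4/3}). Indexing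
-- an edge by (i, j - i) turns this form into a convolution over the affine group. Its fourth moment is a
-- fourth moment of sums of χ over split quartics, bounded by the sum over all monic quartics, and the
-- Radon transform over the lines of the plane gains the multiplicity p of the large representation.
-- The functions depending on the slope j - i only are handled separately, through an explicit kernel.
--
-- For the upper bound, let A be the adjacency matrix and o any vertex. The squares of combinations of 1 and
-- Σ x_i, and of x_o, x_o Σ_j A_oj x_j and the Kelner polynomial (Σ_j S_oj x_j)², give inequalities between
-- the moments. If the value were much larger than p^{1/3}, the Kelner polynomial would have too small a
-- square for its correlation with x_o Σ_j A_oj x_j.

module Submission where

open import Defs
open import Data.Nat using (ℕ; _%_)
open import Data.Nat.Primality using (Prime)
open import Data.Rational using (ℚ; 0ℚ; _≤_; _<_; _*_)
open import Data.Product using (Σ; _×_)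
open import Data.Sum using (_⊎_)
open import Relation.Binary.PropositionalEquality using (_≡_)

open import Algebra.Bundles using (CommutativeRing)
open import Algebra.Structures using (IsCommutativeRing)
import Algebra.Solver.Ring
import Algebra.Solver.Ring.AlmostCommutativeRing as ACR
open import Data.Bool as 𝔹 using (Bool; true; false; if_then_else_)
open import Data.Bool.ListAction using (any)
open import Data.Empty using (⊥; ⊥-elim)
open import Data.Fin as Fin using (Fin; zero; suc; toℕ)
open import Data.Fin.Permutation using (permutation)
open import Data.Fin.Properties using (_≟_; any?; toℕ-injective; toℕ-fromℕ<; toℕ<n)
open import Data.Integer as ℤ using (ℤ)
open import Data.Integer.DivMod using (_/ℕ_; n%ℕd<d; a≡a%ℕn+[a/ℕn]*n)
import Data.Integer.Properties as ℤ
import Data.Integer.Tactic.RingSolver as ℤSolver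
open import Data.List using (List; []; _∷_; _++_; map; concatMap; length; filter; tabulate; allFin)
open import Data.List.Properties using (filter-idem; map-++; map-tabulate; map-∘)
open import Data.Maybe using (Maybe)
open import Data.Nat as ℕ using (zero; suc)
open import Data.Nat.Coprimality using (prime⇒coprime; coprime-Bézout)
open import Data.Nat.DivMod using (m≡m%n+[m/n]*n)
open import Data.Nat.GCD using (module Bézout)
import Data.Nat.Properties as ℕ
open import Data.Product using (_,_; proj₁; proj₂; ∃)
open import Data.Rational hiding (_≟_)
open import Data.Rational.Properties hiding (_≟_)
import Data.Rational.Properties as ℚP
open import Data.Rational.Unnormalised using (mkℚᵘ)
import Data.Rational.Unnormalised as ℚᵘ
import Data.Rational.Unnormalised.Properties as ℚᵘ
open import Data.Sum as Sum using (inj₁; inj₂; [_,_]′)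
open import Function using (case_of_)
open import Level using (0ℓ)
open import Relation.Binary.Definitions using (tri<; tri≈; tri>)
open import Relation.Binary.PropositionalEquality
open import Relation.Nullary using (Dec; yes; no; does; ¬_; contradiction)
open import Relation.Nullary.Decidable using (¬?; dec-true; dec-false)
open import Relation.Nullary.Decidable.Core using (dec⇒maybe)
open import Tactic.RingSolver.Core.AlmostCommutativeRing using (AlmostCommutativeRing; fromCommutativeRing)
open import Algebra.Properties.Semiring.Sum (CommutativeRing.semiring +-*-commutativeRing)
  using (sum; ∑-distrib-+; ∑-comm; *-distribˡ-sum; *-distribʳ-sum; sum-cong-≗; sum-permute)

-- The exponent comes from comparing two terms in the edge coefficients: the diagonal is of order
-- τ², the cross-ratio form of order τ⁴ρ with ρ its norm bound. A Hilbert-Schmidt bound for the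
-- square of its operator on the p²-dimensional space of edge functions would give only ρ =
-- O(p^(3/2)), too much for τ ≈ p^(-2/3); the multiplicity p improves it to O(p^(5/4)). The average
-- over all monic quartics is elementary, since the value at a point different from three others is
-- uniform given the other three values; restricting to split quartics costs a factor 256 because
-- fourth powers are nonnegative.
--
-- In the upper bound let m be the integer part of p^(1/3), and let x, Y, Z, w be the moments a₁,
-- a₂, a₃, |a₄| times m², m⁴, m⁶, m⁸. For x ≥ 2 the tests yield x² ≤ Y, Y² ≤ xZ, w ≤ LZ and Z² ≤
-- Cx(2Z + w) with constants L and C, so x³ ≤ Z ≤ C′x and x is bounded. Rounding all estimates to
-- integer powers of m keeps roots such as √p out of the rational arithmetic.

ℚ-ring : AlmostCommutativeRing 0ℓ 0ℓ
ℚ-ring = fromCommutativeRing +-*-commutativeRing (λ x → dec⇒maybe (0ℚ ℚP.≟ x))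

infix 9 #_
#_ : ℕ → ℚ
# k = ℕtoℚ k

open import Tactic.RingSolver.NonReflective ℚ-ring using (solve) renaming (_⊜_ to infix 4 _:=_)
open import Tactic.RingSolver.Core.Expression using (Expr) renaming (Κ to con; _⊕_ to infixl 6 _:+_; _⊗_ to infixl 7 _:*_; ⊝_ to infix 8 :-_)

infixl 6 _:-_
_:-_ : ∀ {n} → Expr ℚ n → Expr ℚ n → Expr ℚ n
a :- b = a :+ (:- b)

infix 9 :#_
:#_ : ∀ {n} → ℕ → Expr ℚ n
:# k = con (# k)

-- Order and squares in the rationals

sq : ℚ → ℚ
sq x = x * x

0≤1 : 0ℚ ≤ 1ℚ
0≤1 = *≤* (ℤ.+≤+ ℕ.z≤n)

≤-eq : ∀ {a b} → a ≡ b → a ≤ b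
≤-eq refl = ≤-refl

diff≥0 : ∀ {a b} → a ≤ b → 0ℚ ≤ b - a
diff≥0 {a} {b} a≤b = subst (_≤ b - a) (+-inverseʳ a) (+-monoˡ-≤ (- a) a≤b)

private
  move = solve 2 (λ a b → a :+ (b :- a) := b) refl

≤-by : ∀ {a b c} → 0ℚ ≤ c → b ≡ a + c → a ≤ b
≤-by {a} {b} {c} 0≤c refl = subst (_≤ a + c) (+-identityʳ a) (+-monoʳ-≤ a 0≤c)

diff≥0⇒≤ : ∀ {a b} → 0ℚ ≤ b - a → a ≤ b
diff≥0⇒≤ {a} {b} h = ≤-by h (sym (move a b))

+-≥0 : ∀ {a b} → 0ℚ ≤ a → 0ℚ ≤ b → 0ℚ ≤ a + b
+-≥0 p q = +-mono-≤ p q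

*-≥0 : ∀ {a b} → 0ℚ ≤ a → 0ℚ ≤ b → 0ℚ ≤ a * b
*-≥0 {a} {b} p q = subst (_≤ a * b) (*-zeroʳ a) (*-monoˡ-≤-nonNeg a {{nonNegative p}} q)

*-mono : ∀ {a b c d} → 0ℚ ≤ a → 0ℚ ≤ d → a ≤ b → c ≤ d → a * c ≤ b * d
*-mono {a} {b} {c} {d} 0≤a 0≤d a≤b c≤d =
  ≤-trans (*-monoˡ-≤-nonNeg a {{nonNegative 0≤a}} c≤d) (*-monoʳ-≤-nonNeg d {{nonNegative 0≤d}} a≤b)

*-monoˡ : ∀ {a b} c → 0ℚ ≤ c → a ≤ b → c * a ≤ c * b
*-monoˡ c 0≤c a≤b = *-monoˡ-≤-nonNeg c {{nonNegative 0≤c}} a≤b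

private
  neg-sq = solve 1 (λ a → (:- a) :* (:- a) := a :* a) refl
  neg-neg = solve 1 (λ a → :- (:- a) := a) refl

neg-≥0 : ∀ {a} → a ≤ 0ℚ → 0ℚ ≤ - a
neg-≥0 {a} h = subst (0ℚ ≤_) (+-identityˡ (- a)) (diff≥0 h)

sq≥0 : ∀ a → 0ℚ ≤ sq a
sq≥0 a with ≤-total 0ℚ a
... | inj₁ p = *-≥0 p p
... | inj₂ p = subst (0ℚ ≤_) (neg-sq a) (*-≥0 (neg-≥0 p) (neg-≥0 p))

0<1 : 0ℚ < 1ℚ
0<1 = *<* (ℤ.+<+ (ℕ.s≤s ℕ.z≤n))

≤-split : ∀ a b → a ≤ b ⊎ b < a
≤-split a b with a ≤? b
... | yes p = inj₁ p
... | no p = inj₂ (≰⇒> p)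

*->0 : ∀ {a b} → 0ℚ < a → 0ℚ < b → 0ℚ < a * b
*->0 {a} {b} p q = subst (_< a * b) (*-zeroʳ a) (*-monoʳ-<-pos a {{positive p}} q)

cancel-≤ : ∀ {a b} c → 0ℚ < c → c * a ≤ c * b → a ≤ b
cancel-≤ c 0<c = *-cancelˡ-≤-pos c {{positive 0<c}}

private
  *-zero-of : ∀ {a b} → 0ℚ < a → a * b ≤ 0ℚ → b ≤ 0ℚ
  *-zero-of {a} p q = cancel-≤ a p (subst (a * _ ≤_) (sym (*-zeroʳ a)) q)

cancel-≡0 : ∀ {a} c → 0ℚ < c → c * a ≡ 0ℚ → a ≡ 0ℚ
cancel-≡0 {a} c p q = ≤-antisym (*-zero-of p (≤-eq q))
  (cancel-≤ c p (≤-eq (trans (*-zeroʳ c) (sym q))))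

sq-≤⇒≤ : ∀ {t s} → 0ℚ ≤ s → sq t ≤ sq s → t ≤ s
sq-≤⇒≤ {t} {s} 0≤s h with ≤-split t s
... | inj₁ p = p
... | inj₂ s<t = ⊥-elim (<-irrefl refl (<-≤-trans lt h))
  where
  0<t : 0ℚ < t
  0<t = ≤-<-trans 0≤s s<t
  lt : sq s < sq t
  lt = ≤-<-trans (*-monoˡ-≤-nonNeg s {{nonNegative 0≤s}} (<⇒≤ s<t)) (*-monoˡ-<-pos t {{positive 0<t}} s<t)

sq-≤⇒-≤ : ∀ {t s} → 0ℚ ≤ s → sq t ≤ sq s → - s ≤ t
sq-≤⇒-≤ {t} {s} 0≤s h = subst (- s ≤_) (neg-neg t)
  (neg-antimono-≤ (sq-≤⇒≤ {t = - t} 0≤s (subst (_≤ sq s) (sym (neg-sq t)) h)))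

-- Finite sums, Kronecker deltas and the Cauchy-Schwarz inequality

abstract
  ∑ : ∀ {n} → (Fin n → ℚ) → ℚ
  ∑ = sum

  ∑-zero : (f : Fin zero → ℚ) → ∑ f ≡ 0ℚ
  ∑-zero f = refl

  ∑-suc : ∀ {n} (f : Fin (suc n) → ℚ) → ∑ f ≡ f zero + ∑ (λ x → f (suc x))
  ∑-suc f = refl

  ∑-cong : ∀ {n} {f g : Fin n → ℚ} → (∀ x → f x ≡ g x) → ∑ f ≡ ∑ g
  ∑-cong h = sum-cong-≗ h

  ∑-+ : ∀ {n} (f g : Fin n → ℚ) → ∑ (λ x → f x + g x) ≡ ∑ f + ∑ g
  ∑-+ = ∑-distrib-+

  ∑-*ˡ : ∀ {n} c (f : Fin n → ℚ) → ∑ (λ x → c * f x) ≡ c * ∑ f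
  ∑-*ˡ c f = sym (*-distribˡ-sum c f)

  ∑-*ʳ : ∀ {n} c (f : Fin n → ℚ) → ∑ (λ x → f x * c) ≡ ∑ f * c
  ∑-*ʳ c f = sym (*-distribʳ-sum c f)

  ∑-swap : ∀ {n m} (f : Fin n → Fin m → ℚ) → ∑ (λ x → ∑ (λ y → f x y)) ≡ ∑ (λ y → ∑ (λ x → f x y))
  ∑-swap = ∑-comm

  ∑-perm : ∀ {n} (π π⁻¹ : Fin n → Fin n) → (∀ x → π (π⁻¹ x) ≡ x) → (∀ x → π⁻¹ (π x) ≡ x) →
    ∀ (f : Fin n → ℚ) → ∑ (λ x → f (π x)) ≡ ∑ f
  ∑-perm π π⁻¹ h h′ f = sym (sum-permute f (permutation π π⁻¹ h h′))

infix 5 ∑-syntax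
∑-syntax : ∀ {n} → (Fin n → ℚ) → ℚ
∑-syntax = ∑
syntax ∑-syntax (λ x → e) = ∑[ x ] e

∑-cong₂ : ∀ {n m} {f g : Fin n → Fin m → ℚ} → (∀ x y → f x y ≡ g x y) → (∑[ x ] ∑[ y ] f x y) ≡ (∑[ x ] ∑[ y ] g x y)
∑-cong₂ h = ∑-cong λ x → ∑-cong λ y → h x y

private
  neg-as-* = solve 1 (λ a → :- a := (:- con 1ℚ) :* a) refl

∑-neg : ∀ {n} (f : Fin n → ℚ) → (∑[ x ] - f x) ≡ - ∑ f
∑-neg f = trans (∑-cong λ x → neg-as-* (f x)) (trans (∑-*ˡ (- 1ℚ) f) (sym (neg-as-* (∑ f))))

∑-minus : ∀ {n} (f g : Fin n → ℚ) → (∑[ x ] (f x - g x)) ≡ ∑ f - ∑ g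
∑-minus f g = trans (∑-+ f (λ x → - g x)) (cong (∑ f +_) (∑-neg g))

∑-0 : ∀ n → (∑ {n} λ _ → 0ℚ) ≡ 0ℚ
∑-0 n = trans (∑-cong {n} {g = λ x → 0ℚ * 0ℚ} λ _ → refl) (trans (∑-*ˡ {n} 0ℚ (λ _ → 0ℚ)) (*-zeroˡ (∑ {n} λ _ → 0ℚ)))

∑-≡0 : ∀ {n} {f : Fin n → ℚ} → (∀ x → f x ≡ 0ℚ) → ∑ f ≡ 0ℚ
∑-≡0 {n} h = trans (∑-cong h) (∑-0 n)

∑-mono : ∀ {n} {f g : Fin n → ℚ} → (∀ x → f x ≤ g x) → ∑ f ≤ ∑ g
∑-mono {zero} {f} {g} h = ≤-eq (trans (∑-zero f) (sym (∑-zero g)))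
∑-mono {suc n} {f} {g} h = subst₂ _≤_ (sym (∑-suc f)) (sym (∑-suc g)) (+-mono-≤ (h zero) (∑-mono (λ x → h (suc x))))

∑-≥0 : ∀ {n} {f : Fin n → ℚ} → (∀ x → 0ℚ ≤ f x) → 0ℚ ≤ ∑ f
∑-≥0 {n} {f} h = subst (_≤ ∑ f) (∑-0 n) (∑-mono h)

∑-term≤ : ∀ {n} {f : Fin n → ℚ} → (∀ x → 0ℚ ≤ f x) → ∀ a → f a ≤ ∑ f
∑-term≤ {suc n} {f} h zero = ≤-by (∑-≥0 (λ x → h (suc x))) (∑-suc f)
∑-term≤ {suc n} {f} h (suc a) = ≤-trans (∑-term≤ (λ x → h (suc x)) a) (≤-by (h zero) (trans (∑-suc f) (+-comm (f zero) _)))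

#-toℚᵘ : ∀ k → toℚᵘ (# k) ℚᵘ.≃ mkℚᵘ (ℤ.+ k) 0
#-toℚᵘ k = toℚᵘ-fromℚᵘ (mkℚᵘ (ℤ.+ k) 0)

#-+ : ∀ a b → # (a ℕ.+ b) ≡ # a + # b
#-+ a b = toℚᵘ-injective (ℚᵘ.≃-trans (#-toℚᵘ (a ℕ.+ b)) (ℚᵘ.≃-trans (ℚᵘ.*≡* eq)
  (ℚᵘ.≃-trans (ℚᵘ.+-cong (ℚᵘ.≃-sym (#-toℚᵘ a)) (ℚᵘ.≃-sym (#-toℚᵘ b))) (ℚᵘ.≃-sym (toℚᵘ-homo-+ (# a) (# b))))))
  where
  eq : ℤ.+ (a ℕ.+ b) ℤ.* ℤ.+ 1 ≡ (ℤ.+ a ℤ.* ℤ.+ 1 ℤ.+ ℤ.+ b ℤ.* ℤ.+ 1) ℤ.* ℤ.+ 1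
  eq = cong (ℤ._* ℤ.+ 1) (sym (cong₂ ℤ._+_ (ℤ.*-identityʳ (ℤ.+ a)) (ℤ.*-identityʳ (ℤ.+ b))))

#-* : ∀ a b → # (a ℕ.* b) ≡ # a * # b
#-* a b = toℚᵘ-injective (ℚᵘ.≃-trans (#-toℚᵘ (a ℕ.* b)) (ℚᵘ.≃-trans (ℚᵘ.*≡* eq)
  (ℚᵘ.≃-trans (ℚᵘ.*-cong (ℚᵘ.≃-sym (#-toℚᵘ a)) (ℚᵘ.≃-sym (#-toℚᵘ b))) (ℚᵘ.≃-sym (toℚᵘ-homo-* (# a) (# b))))))
  where
  eq : ℤ.+ (a ℕ.* b) ℤ.* ℤ.+ 1 ≡ (ℤ.+ a ℤ.* ℤ.+ b) ℤ.* ℤ.+ 1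
  eq = cong (ℤ._* ℤ.+ 1) (ℤ.pos-* a b)

#-mono : ∀ {a b} → a ℕ.≤ b → # a ≤ # b
#-mono {a} {b} h = toℚᵘ-cancel-≤ (ℚᵘ.≤-respʳ-≃ (ℚᵘ.≃-sym (#-toℚᵘ b)) (ℚᵘ.≤-respˡ-≃ (ℚᵘ.≃-sym (#-toℚᵘ a))
  (ℚᵘ.*≤* (ℤ.*-monoʳ-≤-nonNeg (ℤ.+ 1) (ℤ.+≤+ h)))))

#≥0 : ∀ k → 0ℚ ≤ # k
#≥0 k = #-mono {0} {k} ℕ.z≤n

1≤#suc : ∀ k → 1ℚ ≤ # suc k
1≤#suc k = #-mono {1} {suc k} (ℕ.s≤s ℕ.z≤n)

private
  const-step = solve 2 (λ n c → c :+ n :* c := (con 1ℚ :+ n) :* c) refl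

∑-const : ∀ n c → (∑ {n} λ _ → c) ≡ # n * c
∑-const zero c = trans (∑-zero _) (sym (*-zeroˡ c))
∑-const (suc n) c = trans (∑-suc {n} λ _ → c) (trans (cong (λ z → c + z) (∑-const n c)) (trans (const-step (# n) c) (cong (_* c) (sym (#-+ 1 n)))))

∑-* : ∀ {n m} (f : Fin n → ℚ) (g : Fin m → ℚ) → ∑ f * ∑ g ≡ (∑[ x ] ∑[ y ] f x * g y)
∑-* f g = trans (sym (∑-*ʳ (∑ g) f)) (∑-cong λ x → sym (∑-*ˡ (f x) g))

δ : ∀ {n} → Fin n → Fin n → ℚ
δ i j = if does (i ≟ j) then 1ℚ else 0ℚ

δ-refl : ∀ {n} (i : Fin n) → δ i i ≡ 1ℚ
δ-refl i with i ≟ i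
... | yes _ = refl
... | no ¬p = contradiction refl ¬p

δ-≢ : ∀ {n} {i j : Fin n} → i ≢ j → δ i j ≡ 0ℚ
δ-≢ {i = i} {j} ne with i ≟ j
... | yes p = contradiction p ne
... | no _ = refl

δ-≡ : ∀ {n} {i j : Fin n} → i ≡ j → δ i j ≡ 1ℚ
δ-≡ {i = i} refl = δ-refl i

δ-sym : ∀ {n} (i j : Fin n) → δ i j ≡ δ j i
δ-sym i j with i ≟ j
... | yes refl = sym (δ-refl i)
... | no ne = sym (δ-≢ (λ e → ne (sym e)))

δ-idem : ∀ {n} (i j : Fin n) → δ i j * δ i j ≡ δ i j
δ-idem i j with i ≟ j
... | yes refl = refl
... | no ne = refl

δ≥0 : ∀ {n} (i j : Fin n) → 0ℚ ≤ δ i j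
δ≥0 i j with i ≟ j
... | yes _ = 0≤1
... | no _ = ≤-refl

δ-⇔ : ∀ {n m} {i j : Fin n} {k l : Fin m} → (i ≡ j → k ≡ l) → (k ≡ l → i ≡ j) → δ i j ≡ δ k l
δ-⇔ {i = i} {j} {k} {l} f g with i ≟ j
... | yes p = sym (δ-≡ (f p))
... | no np = sym (δ-≢ (λ q → np (g q)))

δ-* : ∀ {n} (i j : Fin n) {a b : ℚ} → (i ≡ j → a ≡ b) → δ i j * a ≡ δ i j * b
δ-* i j {a} {b} h with i ≟ j
... | yes p = cong (1ℚ *_) (h p)
... | no _ = trans (*-zeroˡ a) (sym (*-zeroˡ b))

∑-δˡ : ∀ {n} (i : Fin n) (f : Fin n → ℚ) → (∑[ x ] δ i x * f x) ≡ f i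
∑-δˡ {suc n} zero f = trans (∑-suc λ x → δ zero x * f x) (trans (cong₂ _+_ (*-identityˡ (f zero))
   (∑-≡0 λ x → trans (cong (_* f (suc x)) (δ-≢ {i = zero} {suc x} λ ())) (*-zeroˡ (f (suc x))))) (+-identityʳ _))
∑-δˡ {suc n} (suc i) f = trans (∑-suc λ x → δ (suc i) x * f x) (trans (cong₂ _+_ (trans (cong (_* f zero) (δ-≢ {i = suc i} {zero} λ ())) (*-zeroˡ (f zero)))
   (trans (∑-cong λ x → cong (_* f (suc x)) (δ-⇔ {i = suc i} {suc x} {i} {x} Data.Fin.Properties.suc-injective (cong suc))) (∑-δˡ i (λ x → f (suc x))))) (+-identityˡ _))

∑-δʳ : ∀ {n} (i : Fin n) (f : Fin n → ℚ) → (∑[ x ] δ x i * f x) ≡ f i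
∑-δʳ i f = trans (∑-cong λ x → cong (_* f x) (δ-sym x i)) (∑-δˡ i f)

∑-δ : ∀ {n} (i : Fin n) → (∑[ x ] δ i x) ≡ 1ℚ
∑-δ i = trans (∑-cong λ x → sym (*-identityʳ (δ i x))) (∑-δˡ i (λ _ → 1ℚ))

infix 9 ‖_‖²
‖_‖² : ∀ {n} → (Fin n → ℚ) → ℚ
‖ x ‖² = ∑[ i ] sq (x i)

‖‖²≥0 : ∀ {n} (x : Fin n → ℚ) → 0ℚ ≤ ‖ x ‖²
‖‖²≥0 x = ∑-≥0 λ i → sq≥0 (x i)

infix 9 ‖_‖²₂
‖_‖²₂ : ∀ {n m} → (Fin n → Fin m → ℚ) → ℚ
‖ x ‖²₂ = ∑[ i ] ‖ x i ‖²

‖‖²₂≥0 : ∀ {n m} (x : Fin n → Fin m → ℚ) → 0ℚ ≤ ‖ x ‖²₂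
‖‖²₂≥0 x = ∑-≥0 λ i → ‖‖²≥0 (x i)

-- Positive linear functionals, of which nested finite sums of any depth are instances through
-- `_⊛_`: interchange of sums and Cauchy-Schwarz are then proved once for all numbers of indices.
record Linear {X : Set} (L : (X → ℚ) → ℚ) : Set where
  field
    L-cong : ∀ {f g : X → ℚ} → (∀ x → f x ≡ g x) → L f ≡ L g
    L-+ : ∀ (f g : X → ℚ) → L (λ x → f x + g x) ≡ L f + L g
    L-* : ∀ c (f : X → ℚ) → L (λ x → c * f x) ≡ c * L f
    L-≥0 : ∀ {f : X → ℚ} → (∀ x → 0ℚ ≤ f x) → 0ℚ ≤ L f

  L-neg : ∀ (f : X → ℚ) → L (λ x → - f x) ≡ - L f
  L-neg f = trans (L-cong λ x → neg-as-* (f x)) (trans (L-* (- 1ℚ) f) (sym (neg-as-* (L f))))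

  L-minus : ∀ (f g : X → ℚ) → L (λ x → f x - g x) ≡ L f - L g
  L-minus f g = trans (L-+ f (λ x → - g x)) (cong (L f +_) (L-neg g))

  L-mono : ∀ {f g : X → ℚ} → (∀ x → f x ≤ g x) → L f ≤ L g
  L-mono {f} {g} h = diff≥0⇒≤ (subst (0ℚ ≤_) (L-minus g f) (L-≥0 λ x → diff≥0 (h x)))

∑-linear : ∀ {n} → Linear {Fin n} ∑
∑-linear = record { L-cong = ∑-cong ; L-+ = ∑-+ ; L-* = ∑-*ˡ ; L-≥0 = ∑-≥0 }

infixr 5 _⊛_
_⊛_ : ∀ {X Y : Set} {L : (X → ℚ) → ℚ} {M : (Y → ℚ) → ℚ} → Linear L → Linear M →
  Linear {X × Y} (λ f → L λ x → M λ y → f (x , y))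
l ⊛ m = record
  { L-cong = λ h → L.L-cong λ x → M.L-cong λ y → h (x , y)
  ; L-+ = λ f g → trans (L.L-cong λ x → M.L-+ (λ y → f (x , y)) (λ y → g (x , y))) (L.L-+ _ _)
  ; L-* = λ c f → trans (L.L-cong λ x → M.L-* c (λ y → f (x , y))) (L.L-* c _)
  ; L-≥0 = λ h → L.L-≥0 λ x → M.L-≥0 λ y → h (x , y) }
  where module L = Linear l ; module M = Linear m

∑²-linear : ∀ {n m} → Linear {Fin n × Fin m} (λ f → ∑[ i ] ∑[ j ] f (i , j))
∑²-linear = ∑-linear ⊛ ∑-linear

private
  at-corner = solve 3 (λ a b c → a :* (con 1ℚ :* con 1ℚ) :+ (b :+ b) :* (con 1ℚ :* con 0ℚ) :+ c :* (con 0ℚ :* con 0ℚ) := a) refl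
  at-min = solve 3 (λ a b c → a :* ((:- b) :* (:- b)) :+ (b :+ b) :* ((:- b) :* a) :+ c :* (a :* a) := a :* (a :* c :- b :* b)) refl
  at-null = solve 2 (λ b c → con 0ℚ :* ((:- (c :+ con 1ℚ)) :* (:- (c :+ con 1ℚ))) :+ (b :+ b) :* ((:- (c :+ con 1ℚ)) :* (b :+ b))
      :+ c :* ((b :+ b) :* (b :+ b))
    := :- ((b :+ b) :* (b :+ b))) refl
  sq-double = solve 1 (λ b → (b :+ b) :* (b :+ b) := :# 4 :* (b :* b)) refl

0<# : ∀ k → 0ℚ < # suc k
0<# k = <-≤-trans 0<1 (1≤#suc k)

-- For a > 0 the form at (-b, a) equals a(ac - b²). A negative a is excluded by (1, 0), and for a =
-- 0 the point (-(c + 1), 2b) gives -4b², which forces b = 0. This serves both Cauchy-Schwarz and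
-- the tests of the upper bound, where the form is the pseudoexpectation of a square.
discriminant : ∀ a b c → (∀ s t → 0ℚ ≤ a * sq s + (b + b) * (s * t) + c * sq t) → sq b ≤ a * c
discriminant a b c h = [ nonpositive , positive-leading ]′ (≤-split a 0ℚ)
  where
  positive-leading : 0ℚ < a → sq b ≤ a * c
  positive-leading 0<a = diff≥0⇒≤ (cancel-≤ a 0<a (subst₂ _≤_ (sym (*-zeroʳ a)) (at-min a b c) (h (- b) a)))
  degenerate : a ≡ 0ℚ → sq b ≤ a * c
  degenerate refl = subst (sq b ≤_) (sym (*-zeroˡ c)) (cancel-≤ (# 4) (0<# 3)
    (subst₂ _≤_ (sq-double b) (sym (*-zeroʳ (# 4))) (subst₂ _≤_ (neg-neg _) refl (neg-antimono-≤ (subst (0ℚ ≤_) (at-null b c) (h (- (c + 1ℚ)) (b + b)))))))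
  nonpositive : a ≤ 0ℚ → sq b ≤ a * c
  nonpositive a≤0 = degenerate (≤-antisym a≤0 (subst (0ℚ ≤_) (at-corner a b c) (h 1ℚ 0ℚ)))

module _ {X : Set} {L : (X → ℚ) → ℚ} (l : Linear L) where
  open Linear l
  private
    expand = solve 4 (λ s t f g → (s :* f :+ t :* g) :* (s :* f :+ t :* g)
      := s :* s :* (f :* f) :+ ((s :* t :+ s :* t) :* (f :* g) :+ t :* t :* (g :* g))) refl
    regroup = solve 5 (λ s t F P G → s :* s :* F :+ ((s :* t :+ s :* t) :* P :+ t :* t :* G)
      := F :* (s :* s) :+ (P :+ P) :* (s :* t) :+ G :* (t :* t)) refl

  L-cauchy-schwarz : ∀ (f g : X → ℚ) → sq (L λ x → f x * g x) ≤ L (λ x → sq (f x)) * L (λ x → sq (g x))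
  L-cauchy-schwarz f g = discriminant F P G λ s t →
    subst (0ℚ ≤_) (eq s t) (L-≥0 λ x → sq≥0 (s * f x + t * g x))
    where
    F = L λ x → sq (f x) ; G = L λ x → sq (g x) ; P = L λ x → f x * g x
    eq : ∀ s t → L (λ x → sq (s * f x + t * g x)) ≡ F * sq s + (P + P) * (s * t) + G * sq t
    eq s t = trans (L-cong λ x → expand s t (f x) (g x)) (trans (L-+ (λ x → sq s * (f x * f x)) (λ x → (s * t + s * t) * (f x * g x) + sq t * (g x * g x)))
      (trans (cong₂ _+_ (L-* (sq s) (λ x → f x * f x)) (trans (L-+ (λ x → (s * t + s * t) * (f x * g x)) (λ x → sq t * (g x * g x)))
        (cong₂ _+_ (L-* (s * t + s * t) (λ x → f x * g x)) (L-* (sq t) (λ x → g x * g x))))) (regroup s t F P G)))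

cauchy-schwarz : ∀ {n} (f g : Fin n → ℚ) → sq (∑[ i ] f i * g i) ≤ ‖ f ‖² * ‖ g ‖²
cauchy-schwarz f g = L-cauchy-schwarz ∑-linear f g

cauchy-schwarz₂ : ∀ {n m} (f g : Fin n → Fin m → ℚ) → sq (∑[ i ] ∑[ j ] f i j * g i j) ≤ ‖ f ‖²₂ * ‖ g ‖²₂
cauchy-schwarz₂ {n} {m} f g = L-cauchy-schwarz (∑²-linear {n} {m}) (λ ij → f (proj₁ ij) (proj₂ ij)) (λ ij → g (proj₁ ij) (proj₂ ij))

∑-sq : ∀ {n m} (a : Fin n → Fin m → ℚ) (x : Fin m → ℚ) →
  (∑[ i ] sq (∑[ j ] a i j * x j)) ≡ (∑[ j ] ∑[ k ] x j * x k * (∑[ i ] a i j * a i k))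
∑-sq a x = trans (∑-cong λ i → trans (∑-* (λ j → a i j * x j) (λ k → a i k * x k)) (∑-cong₂ λ j k → shuffle (a i j) (x j) (a i k) (x k)))
  (trans (∑-swap λ i j → ∑[ k ] x j * x k * (a i j * a i k))
  (∑-cong λ j → trans (∑-swap λ i k → x j * x k * (a i j * a i k)) (∑-cong λ k → ∑-*ˡ (x j * x k) λ i → a i j * a i k)))
  where
  shuffle = solve 4 (λ a x b y → a :* x :* (b :* y) := x :* y :* (a :* b)) refl

∑-sum-zero-≤0 : ∀ {n} {f : Fin n → ℚ} → (∀ x → f x ≤ 0ℚ) → ∑ f ≡ 0ℚ → ∀ x → f x ≡ 0ℚ
∑-sum-zero-≤0 {n} {f} h e x = ≤-antisym (h x) (subst₂ _≤_ (neg-neg 0ℚ) (neg-neg (f x)) (neg-antimono-≤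
  (subst (- f x ≤_) (trans (∑-neg f) (cong -_ e)) (∑-term≤ (λ y → neg-≥0 (h y)) x))))

indicator : ∀ {P : Set} → Dec P → ℚ
indicator d = if does d then 1ℚ else 0ℚ

indicator-yes : ∀ {P : Set} (d : Dec P) → P → indicator d ≡ 1ℚ
indicator-yes (yes _) p = refl
indicator-yes (no ¬p) p = contradiction p ¬p

indicator-no : ∀ {P : Set} (d : Dec P) → ¬ P → indicator d ≡ 0ℚ
indicator-no (yes p) ¬p = contradiction p ¬p
indicator-no (no _) ¬p = refl

module _ {X : Set} {L : (X → ℚ) → ℚ} (l : Linear L) where
  open Linear l

  L-0 : L (λ _ → 0ℚ) ≡ 0ℚ
  L-0 = trans (L-cong λ x → sym (*-zeroˡ 0ℚ)) (trans (L-* 0ℚ (λ _ → 0ℚ)) (*-zeroˡ (L λ _ → 0ℚ)))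

  L-*ʳ : ∀ c (f : X → ℚ) → L (λ x → f x * c) ≡ L f * c
  L-*ʳ c f = trans (L-cong λ x → *-comm (f x) c) (trans (L-* c f) (*-comm c (L f)))

  L-∑ : ∀ {n} (f : X → Fin n → ℚ) → L (λ x → ∑[ y ] f x y) ≡ (∑[ y ] L (λ x → f x y))
  L-∑ {zero} f = trans (L-cong λ x → ∑-zero (f x)) (trans L-0 (sym (∑-zero λ y → L λ x → f x y)))
  L-∑ {suc n} f = trans (L-cong λ x → ∑-suc (f x)) (trans (L-+ (λ x → f x zero) (λ x → ∑[ y ] f x (suc y)))
    (trans (cong (L (λ x → f x zero) +_) (L-∑ λ x y → f x (suc y))) (sym (∑-suc λ y → L λ x → f x y))))

N⁴ : ℕ → Set
N⁴ n = Fin n × Fin n × Fin n × Fin n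

∑⁴ : ∀ {n} → (N⁴ n → ℚ) → ℚ
∑⁴ f = ∑[ a ] ∑[ b ] ∑[ c ] ∑[ d ] f (a , b , c , d)

∑⁴-linear : ∀ {n} → Linear (∑⁴ {n})
∑⁴-linear = ∑-linear ⊛ ∑-linear ⊛ ∑-linear ⊛ ∑-linear

L-∑⁴ : ∀ {X : Set} {L : (X → ℚ) → ℚ} (l : Linear L) {n} (f : X → N⁴ n → ℚ) → L (λ x → ∑⁴ (f x)) ≡ ∑⁴ (λ y → L (λ x → f x y))
L-∑⁴ l f = trans (L-∑ l λ x a → ∑[ b ] ∑[ c ] ∑[ d ] f x (a , b , c , d)) (∑-cong λ a →
  trans (L-∑ l λ x b → ∑[ c ] ∑[ d ] f x (a , b , c , d)) (∑-cong λ b →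
  trans (L-∑ l λ x c → ∑[ d ] f x (a , b , c , d)) (∑-cong λ c → L-∑ l λ x d → f x (a , b , c , d))))

∑⁴-const : ∀ n c → ∑⁴ {n} (λ _ → c) ≡ # n * (# n * (# n * (# n * c)))
∑⁴-const n c = trans (∑-cong λ _ → trans (∑-cong λ _ → trans (∑-cong λ _ → ∑-const n c) (∑-const n _)) (∑-const n _)) (∑-const n _)

∑⁴-product : ∀ {n} (f g h k : Fin n → ℚ) → ∑⁴ (λ (a , b , c , d) → f a * (g b * (h c * k d))) ≡ ∑ f * (∑ g * (∑ h * ∑ k))
∑⁴-product f g h k = trans (∑-cong λ a → trans (∑-cong λ b → trans (∑-cong λ c → trans (∑-*ˡ (f a) (λ d → g b * (h c * k d))) (cong (f a *_)
    (trans (∑-*ˡ (g b) (λ d → h c * k d)) (cong (g b *_) (∑-*ˡ (h c) k)))))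
  (trans (∑-*ˡ (f a) (λ c → g b * (h c * ∑ k))) (cong (f a *_) (trans (∑-*ˡ (g b) (λ c → h c * ∑ k)) (cong (g b *_) (∑-*ʳ (∑ k) h))))))
  (trans (∑-*ˡ (f a) (λ b → g b * (∑ h * ∑ k))) (cong (f a *_) (∑-*ʳ (∑ h * ∑ k) g)))) (∑-*ʳ (∑ g * (∑ h * ∑ k)) f)

pow4 : ℚ → ℚ
pow4 x = x * (x * (x * x))

δ⁴ : ∀ {n} → N⁴ n → N⁴ n → ℚ
δ⁴ (a , b , c , d) (a′ , b′ , c′ , d′) = δ a a′ * (δ b b′ * (δ c c′ * δ d d′))

δ⁴-cases : ∀ {n} (x y : N⁴ n) → (x ≡ y × δ⁴ x y ≡ 1ℚ) ⊎ δ⁴ x y ≡ 0ℚ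
δ⁴-cases (a , b , c , d) (a′ , b′ , c′ , d′) with a ≟ a′
... | no _ = inj₂ (*-zeroˡ (δ b b′ * (δ c c′ * δ d d′)))
... | yes refl with b ≟ b′
... | no _ = inj₂ (trans (cong (1ℚ *_) (*-zeroˡ (δ c c′ * δ d d′))) refl)
... | yes refl with c ≟ c′
... | no _ = inj₂ (trans (cong (λ t → 1ℚ * (1ℚ * t)) (*-zeroˡ (δ d d′))) refl)
... | yes refl with d ≟ d′
... | no _ = inj₂ refl
... | yes refl = inj₁ (refl , refl)

δ⁴≥0 : ∀ {n} (x y : N⁴ n) → 0ℚ ≤ δ⁴ x y
δ⁴≥0 (a , b , c , d) (a′ , b′ , c′ , d′) = *-≥0 (δ≥0 a a′) (*-≥0 (δ≥0 b b′) (*-≥0 (δ≥0 c c′) (δ≥0 d d′)))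

∑⁴-δ : ∀ {n} (x : N⁴ n) (f : N⁴ n → ℚ) → ∑⁴ (λ y → δ⁴ x y * f y) ≡ f x
∑⁴-δ (a , b , c , d) f = trans (∑-cong λ a′ → trans (∑-cong λ b′ → trans (∑-cong λ c′ →
    trans (∑-cong λ d′ → assoc₄ (δ a a′) (δ b b′) (δ c c′) (δ d d′) (f (a′ , b′ , c′ , d′)))
    (∑-δˡ d λ d′ → δ c c′ * (δ b b′ * (δ a a′ * f (a′ , b′ , c′ , d′)))))
  (∑-δˡ c λ c′ → δ b b′ * (δ a a′ * f (a′ , b′ , c′ , d))))
  (∑-δˡ b λ b′ → δ a a′ * f (a′ , b′ , c , d)))
  (∑-δˡ a λ a′ → f (a′ , b , c , d))
  where
  assoc₄ = solve 5 (λ a b c d f → a :* (b :* (c :* d)) :* f := d :* (c :* (b :* (a :* f)))) refl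

≡0-* : ∀ {a} b → a ≡ 0ℚ → a * b ≡ 0ℚ
≡0-* b refl = *-zeroˡ b

abs-bound : ∀ {t s} → 0ℚ ≤ s → sq t ≤ sq s → 0ℚ ≤ t + s
abs-bound {t} {s} 0≤s h = subst (0ℚ ≤_) (cong (λ u → t + u) (neg-neg s)) (diff≥0 (sq-≤⇒-≤ {t} {s} 0≤s h))

infix 4 _∈±_
_∈±_ : ℚ → ℚ → Set
t ∈± s = (t ≤ s) × (- s ≤ t)

sq-≤⇒∈± : ∀ {t s} → 0ℚ ≤ s → sq t ≤ sq s → t ∈± s
sq-≤⇒∈± {t} {s} 0≤s h = sq-≤⇒≤ {t} {s} 0≤s h , sq-≤⇒-≤ {t} {s} 0≤s h

private
  neg-+ = solve 2 (λ a b → :- a :+ :- b := :- (a :+ b)) refl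
  neg-* = solve 2 (λ a b → a :* (:- b) := :- (a :* b)) refl
  difference-of-squares = solve 2 (λ s t → (s :- t) :* (t :- (:- s)) := s :* s :- t :* t) refl
  product-sq = solve 2 (λ s t → s :* s :* (t :* t) := s :* t :* (s :* t)) refl

±-+ : ∀ {t s t′ s′} → t ∈± s → t′ ∈± s′ → t + t′ ∈± s + s′
±-+ {t} {s} {t′} {s′} (p , q) (p′ , q′) = +-mono-≤ p p′ , subst (_≤ t + t′) (neg-+ s s′) (+-mono-≤ q q′)

±-neg : ∀ {t s} → t ∈± s → - t ∈± s
±-neg {t} {s} (p , q) = subst (- t ≤_) (neg-neg s) (neg-antimono-≤ q) , neg-antimono-≤ p

±-*ˡ : ∀ {t s} c → 0ℚ ≤ c → t ∈± s → c * t ∈± c * s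
±-*ˡ {t} {s} c 0≤c (p , q) = *-monoˡ c 0≤c p , subst (_≤ c * t) (neg-* c s) (*-monoˡ c 0≤c q)

±-sq : ∀ {t s} → t ∈± s → sq t ≤ sq s
±-sq {t} {s} (p , q) = diff≥0⇒≤ (subst (0ℚ ≤_) (difference-of-squares s t) (*-≥0 (diff≥0 p) (diff≥0 q)))

±-* : ∀ {t s t′ s′} → 0ℚ ≤ s → 0ℚ ≤ s′ → t ∈± s → t′ ∈± s′ → t * t′ ∈± s * s′
±-* {t} {s} {t′} {s′} a b h h′ = sq-≤⇒∈± {t * t′} (*-≥0 a b) (subst₂ _≤_ (product-sq t t′) (product-sq s s′) (*-mono (sq≥0 t) (sq≥0 s′) (±-sq {t} {s} h) (±-sq {t′} {s′} h′)))

±-≥0 : ∀ {t} → 0ℚ ≤ t → t ∈± t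
±-≥0 {t} h = ≤-refl , ≤-trans (neg-antimono-≤ h) h

±-widen : ∀ {t s s′} → s ≤ s′ → t ∈± s → t ∈± s′
±-widen h (p , q) = ≤-trans p h , ≤-trans (neg-antimono-≤ h) q

-- Finite fields of odd order and the quadratic character

record OddField (n : ℕ) : Set where
  infixl 6 _⊕_
  infixl 7 _⊗_
  infix 8 ⊖_
  field
    _⊕_ _⊗_ : Fin n → Fin n → Fin n
    ⊖_ inv : Fin n → Fin n
    𝟘 𝟙 : Fin n
    isCommutativeRing : IsCommutativeRing _≡_ _⊕_ _⊗_ ⊖_ 𝟘 𝟙
    -- The image of ℤ supplies the integer coefficients in polynomial identities over the field.
    fromℤ : ℤ → Fin n
    fromℤ-+ : ∀ a b → fromℤ (a ℤ.+ b) ≡ fromℤ a ⊕ fromℤ b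
    fromℤ-* : ∀ a b → fromℤ (a ℤ.* b) ≡ fromℤ a ⊗ fromℤ b
    fromℤ-neg : ∀ a → fromℤ (ℤ.- a) ≡ ⊖ fromℤ a
    fromℤ-0 : fromℤ (ℤ.+ 0) ≡ 𝟘
    fromℤ-1 : fromℤ (ℤ.+ 1) ≡ 𝟙
    -- With this value inversion is an involution of the whole field, so that sums over the field
    -- can be reindexed by it.
    inv-𝟘 : inv 𝟘 ≡ 𝟘
    ⊗-inv : ∀ x → x ≢ 𝟘 → x ⊗ inv x ≡ 𝟙
    𝟙≢𝟘 : 𝟙 ≢ 𝟘
    𝟙⊕𝟙≢𝟘 : 𝟙 ⊕ 𝟙 ≢ 𝟘

  infixl 6 _⊝_
  _⊝_ : Fin n → Fin n → Fin n
  x ⊝ y = x ⊕ ⊖ y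

module FieldSolver {n : ℕ} (F : OddField n) where
  open OddField F

  private
    fromℤ-≟ : ∀ a b → Maybe (fromℤ a ≡ fromℤ b)
    fromℤ-≟ a b = Data.Maybe.map (cong fromℤ) (dec⇒maybe (a ℤ.≟ b))
    F-ring = ACR.fromCommutativeRing (record { isCommutativeRing = isCommutativeRing })
    ℤ-coeffs = CommutativeRing.rawRing ℤ.+-*-commutativeRing
    fromℤ-morphism : ℤ-coeffs ACR.-Raw-AlmostCommutative⟶ F-ring
    fromℤ-morphism = record { ⟦_⟧ = fromℤ ; +-homo = fromℤ-+ ; *-homo = fromℤ-* ; -‿homo = fromℤ-neg ; 0-homo = fromℤ-0 ; 1-homo = fromℤ-1 }
  open Algebra.Solver.Ring ℤ-coeffs F-ring fromℤ-morphism fromℤ-≟ public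
    using (Polynomial) renaming (solve to solveᶠ; _:+_ to _:⊕_; _:*_ to _:⊗_; _:-_ to _:⊝_; :-_ to :⊖_; _:=_ to _:≡_; con to conᶠ)

  :𝟙 : ∀ {k} → Polynomial k
  :𝟙 = conᶠ (ℤ.+ 1)

module Field {n : ℕ} (F : OddField n) where
  open OddField F public
  open FieldSolver F
  open IsCommutativeRing isCommutativeRing public using () renaming
    (+-comm to ⊕-comm; *-comm to ⊗-comm; +-identityˡ to ⊕-identityˡ; +-identityʳ to ⊕-identityʳ; *-identityˡ to ⊗-identityˡ; *-identityʳ to ⊗-identityʳ; zeroˡ to ⊗-zeroˡ; zeroʳ to ⊗-zeroʳ; -‿inverseʳ to ⊕-inverseʳ; *-assoc to ⊗-assoc)

  ⊗-cancelˡ-inv : ∀ a x → a ≢ 𝟘 → inv a ⊗ (a ⊗ x) ≡ x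
  ⊗-cancelˡ-inv a x ne = trans (solveᶠ 3 (λ a b x → b :⊗ (a :⊗ x) :≡ (a :⊗ b) :⊗ x) refl a (inv a) x) (trans (cong (_⊗ x) (⊗-inv a ne)) (⊗-identityˡ x))

  ⊗-cancelˡ-inv′ : ∀ a x → a ≢ 𝟘 → a ⊗ (inv a ⊗ x) ≡ x
  ⊗-cancelˡ-inv′ a x ne = trans (solveᶠ 3 (λ a b x → a :⊗ (b :⊗ x) :≡ (a :⊗ b) :⊗ x) refl a (inv a) x) (trans (cong (_⊗ x) (⊗-inv a ne)) (⊗-identityˡ x))

  ⊗-cancelˡ : ∀ a {x y} → a ≢ 𝟘 → a ⊗ x ≡ a ⊗ y → x ≡ y
  ⊗-cancelˡ a {x} {y} ne e = trans (sym (⊗-cancelˡ-inv a x ne)) (trans (cong (inv a ⊗_) e) (⊗-cancelˡ-inv a y ne))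

  ⊗-≡𝟘 : ∀ x y → x ⊗ y ≡ 𝟘 → x ≡ 𝟘 ⊎ y ≡ 𝟘
  ⊗-≡𝟘 x y e with x ≟ 𝟘
  ... | yes p = inj₁ p
  ... | no ne = inj₂ (⊗-cancelˡ x ne (trans e (sym (⊗-zeroʳ x))))

  ⊗-≢𝟘 : ∀ {x y} → x ≢ 𝟘 → y ≢ 𝟘 → x ⊗ y ≢ 𝟘
  ⊗-≢𝟘 {x} {y} p q e with ⊗-≡𝟘 x y e
  ... | inj₁ r = p r
  ... | inj₂ r = q r

  inv-≢𝟘 : ∀ {x} → x ≢ 𝟘 → inv x ≢ 𝟘
  inv-≢𝟘 {x} ne e = 𝟙≢𝟘 (trans (sym (⊗-inv x ne)) (trans (cong (x ⊗_) e) (⊗-zeroʳ x)))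

  inv-involutive : ∀ x → inv (inv x) ≡ x
  inv-involutive x with x ≟ 𝟘
  ... | yes refl = trans (cong inv inv-𝟘) inv-𝟘
  ... | no ne = ⊗-cancelˡ (inv x) (inv-≢𝟘 ne) (trans (⊗-inv (inv x) (inv-≢𝟘 ne)) (trans (sym (⊗-inv x ne)) (⊗-comm x (inv x))))

  ⊝-≡𝟘 : ∀ {x y} → x ⊝ y ≡ 𝟘 → x ≡ y
  ⊝-≡𝟘 {x} {y} e = trans (solveᶠ 2 (λ x y → x :≡ (x :⊝ y) :⊕ y) refl x y) (trans (cong (_⊕ y) e) (⊕-identityˡ y))

  ⊝-self : ∀ x → x ⊝ x ≡ 𝟘
  ⊝-self = ⊕-inverseʳ

  ⊝-≢𝟘 : ∀ {x y} → x ≢ y → x ⊝ y ≢ 𝟘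
  ⊝-≢𝟘 ne e = ne (⊝-≡𝟘 e)

  ∑-shift : ∀ a (f : Fin n → ℚ) → (∑[ x ] f (x ⊕ a)) ≡ ∑ f
  ∑-shift a = ∑-perm (_⊕ a) (_⊝ a)
    (solveᶠ 2 (λ a x → (x :⊝ a) :⊕ a :≡ x) refl a) (solveᶠ 2 (λ a x → (x :⊕ a) :⊝ a :≡ x) refl a)

  ∑-unshift : ∀ a (f : Fin n → ℚ) → (∑[ x ] f (x ⊝ a)) ≡ ∑ f
  ∑-unshift a = ∑-shift (⊖ a)

  ∑-reflect : ∀ a (f : Fin n → ℚ) → (∑[ x ] f (a ⊝ x)) ≡ ∑ f
  ∑-reflect a = ∑-perm (a ⊝_) (a ⊝_) i i
    where
    i : ∀ x → a ⊝ (a ⊝ x) ≡ x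
    i = solveᶠ 2 (λ a x → a :⊝ (a :⊝ x) :≡ x) refl a

  ∑-scale : ∀ a → a ≢ 𝟘 → (f : Fin n → ℚ) → (∑[ x ] f (a ⊗ x)) ≡ ∑ f
  ∑-scale a ne = ∑-perm (a ⊗_) (inv a ⊗_) (λ x → ⊗-cancelˡ-inv′ a x ne) (λ x → ⊗-cancelˡ-inv a x ne)

  ∑-affine : ∀ a b → a ≢ 𝟘 → (f : Fin n → ℚ) → (∑[ x ] f (b ⊕ a ⊗ x)) ≡ ∑ f
  ∑-affine a b ne f = trans (∑-scale a ne (λ y → f (b ⊕ y))) (trans (∑-cong λ y → cong f (⊕-comm b y)) (∑-shift b f))

  ∑-inv : (f : Fin n → ℚ) → (∑[ x ] f (inv x)) ≡ ∑ f
  ∑-inv = ∑-perm inv inv inv-involutive inv-involutive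

  IsSquare : Fin n → Set
  IsSquare x = ∃ λ y → y ⊗ y ≡ x

  isSquare? : ∀ x → Dec (IsSquare x)
  isSquare? x = any? λ y → y ⊗ y ≟ x

  χ : Fin n → ℚ
  χ x = if does (x ≟ 𝟘) then 0ℚ else (if does (isSquare? x) then 1ℚ else - 1ℚ)

  χ-𝟘 : χ 𝟘 ≡ 0ℚ
  χ-𝟘 with 𝟘 ≟ 𝟘
  ... | yes _ = refl
  ... | no ne = ⊥-elim (ne refl)

  χ-square : ∀ {x} → x ≢ 𝟘 → IsSquare x → χ x ≡ 1ℚ
  χ-square {x} ne s with x ≟ 𝟘
  ... | yes e = ⊥-elim (ne e)
  ... | no _ with isSquare? x
  ... | yes _ = refl
  ... | no ns = ⊥-elim (ns s)

  χ-nonsquare : ∀ {x} → ¬ IsSquare x → χ x ≡ - 1ℚ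
  χ-nonsquare {x} ns with x ≟ 𝟘
  ... | yes refl = ⊥-elim (ns (𝟘 , ⊗-zeroˡ 𝟘))
  ... | no _ with isSquare? x
  ... | yes s = ⊥-elim (ns s)
  ... | no _ = refl

  χ-values : ∀ x → x ≢ 𝟘 → χ x ≡ 1ℚ ⊎ χ x ≡ - 1ℚ
  χ-values x ne = case isSquare? x of λ
    { (yes s) → inj₁ (χ-square ne s)
    ; (no ns) → inj₂ (χ-nonsquare ns) }

  χ-sq : ∀ {x} → x ≢ 𝟘 → χ x * χ x ≡ 1ℚ
  χ-sq {x} ne with χ-values x ne
  ... | inj₁ e = cong₂ _*_ e e
  ... | inj₂ e = cong₂ _*_ e e

  χ-sq≤1 : ∀ x → χ x * χ x ≤ 1ℚ
  χ-sq≤1 x with x ≟ 𝟘 in eq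
  ... | yes refl = subst (_≤ 1ℚ) refl 0≤1
  ... | no ne with isSquare? x
  ... | yes _ = ≤-refl
  ... | no _ = ≤-refl

  χ≤1 : ∀ x → χ x ≤ 1ℚ
  χ≤1 x = sq-≤⇒≤ 0≤1 (χ-sq≤1 x)

  -1≤χ : ∀ x → - 1ℚ ≤ χ x
  -1≤χ x = sq-≤⇒-≤ 0≤1 (χ-sq≤1 x)

  ⊖-≡𝟘 : ∀ {x} → ⊖ x ≡ 𝟘 → x ≡ 𝟘
  ⊖-≡𝟘 {x} e = trans (solveᶠ 1 (λ x → x :≡ :⊖ (:⊖ x)) refl x) (trans (cong ⊖_ e) (trans (sym (⊕-identityˡ (⊖ 𝟘))) (⊝-self 𝟘)))

  square-roots : ∀ {y z} → y ⊗ y ≡ z ⊗ z → y ≡ z ⊎ y ≡ ⊖ z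
  square-roots {y} {z} e with ⊗-≡𝟘 (y ⊝ z) (y ⊕ z) (trans (solveᶠ 2 (λ y z → (y :⊝ z) :⊗ (y :⊕ z) :≡ y :⊗ y :⊝ z :⊗ z) refl y z) (trans (cong (_⊝ z ⊗ z) e) (⊝-self (z ⊗ z))))
  ... | inj₁ p = inj₁ (⊝-≡𝟘 p)
  ... | inj₂ p = inj₂ (trans (solveᶠ 2 (λ y z → y :≡ (y :⊕ z) :⊝ z) refl y z) (trans (cong (_⊝ z) p) (⊕-identityˡ (⊖ z))))

  ⊖-≢-self : ∀ {z} → z ≢ 𝟘 → z ≢ ⊖ z
  ⊖-≢-self {z} ne e = ⊗-≢𝟘 𝟙⊕𝟙≢𝟘 ne (trans (cong (_⊗ z) (cong₂ _⊕_ (sym fromℤ-1) (sym fromℤ-1))) (trans (solveᶠ 1 (λ z → (:𝟙 :⊕ :𝟙) :⊗ z :≡ z :⊕ z) refl z) (trans (cong (z ⊕_) e) (⊝-self z))))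

  -- A nonzero square z² has exactly the roots z and -z, distinct because 1 + 1 ≠ 0. This count is
  -- how χ enters: a sum over y of a function of y² becomes a sum over x with weight 1 + χ(x).
  square-count : ∀ x → (∑[ y ] δ (y ⊗ y) x) ≡ 1ℚ + χ x
  square-count x with x ≟ 𝟘
  ... | yes refl = trans (∑-cong λ y → δ-⇔ {k = 𝟘} {l = y} (λ e → sym (root e)) λ { refl → ⊗-zeroˡ 𝟘 }) (trans (∑-δ 𝟘) refl)
    where
    root : ∀ {y} → y ⊗ y ≡ 𝟘 → y ≡ 𝟘
    root {y} e with ⊗-≡𝟘 y y e
    ... | inj₁ p = p
    ... | inj₂ p = p
  ... | no ne with isSquare? x
  ... | no ns = ∑-≡0 λ y → δ-≢ λ e → ns (y , e)
  ... | yes (z , refl) = trans (∑-cong two) (trans (∑-+ (λ y → δ z y) (λ y → δ (⊖ z) y)) (cong₂ _+_ (∑-δ z) (∑-δ (⊖ z))))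
    where
    z≢𝟘 : z ≢ 𝟘
    z≢𝟘 refl = ne (⊗-zeroˡ 𝟘)
    two : ∀ y → δ (y ⊗ y) (z ⊗ z) ≡ δ z y + δ (⊖ z) y
    two y with z ≟ y
    ... | yes refl = trans (δ-refl (z ⊗ z)) (cong (λ t → 1ℚ + t) (sym (δ-≢ (λ e → ⊖-≢-self z≢𝟘 (sym e)))))
    ... | no z≢y with ⊖ z ≟ y
    ... | yes refl = δ-≡ (solveᶠ 1 (λ z → (:⊖ z) :⊗ (:⊖ z) :≡ z :⊗ z) refl z)
    ... | no -z≢y = δ-≢ λ e → contra (square-roots e)
      where
      contra : y ≡ z ⊎ y ≡ ⊖ z → ⊥
      contra (inj₁ p) = z≢y (sym p)
      contra (inj₂ p) = -z≢y (sym p)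

  private
    cancel-N : ∀ a b → a ≡ a * 1ℚ + b → b ≡ 0ℚ
    cancel-N a b e = trans (l a b) (trans (cong (λ t → t - a) (sym e)) (+-inverseʳ a))
      where
      l = solve 2 (λ a b → b := (a :* con 1ℚ :+ b) :- a) refl

  ∑-square : (f : Fin n → ℚ) → (∑[ y ] f (y ⊗ y)) ≡ (∑[ x ] (1ℚ + χ x) * f x)
  ∑-square f = trans (∑-cong λ y → sym (∑-δˡ (y ⊗ y) f)) (trans (∑-swap λ y x → δ (y ⊗ y) x * f x)
    (∑-cong λ x → trans (∑-*ʳ (f x) (λ y → δ (y ⊗ y) x)) (cong (_* f x) (square-count x))))

  -- Summing 1 + χ(x), the number of square roots of x, counts every y once.
  ∑-χ : ∑ χ ≡ 0ℚ
  ∑-χ = cancel-N (# n) (∑ χ) (trans (sym (trans (∑-const n 1ℚ) (*-identityʳ (# n)))) (trans (∑-square (λ _ → 1ℚ)) (trans (∑-cong λ x → *-identityʳ (1ℚ + χ x)) (trans (∑-+ (λ _ → 1ℚ) χ) (cong (_+ ∑ χ) (∑-const n 1ℚ))))))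

  square-⊗ : ∀ {x y} → IsSquare x → IsSquare y → IsSquare (x ⊗ y)
  square-⊗ (z , refl) (w , refl) = z ⊗ w , solveᶠ 2 (λ z w → (z :⊗ w) :⊗ (z :⊗ w) :≡ (z :⊗ z) :⊗ (w :⊗ w)) refl z w

  square-quotient : ∀ {x y} → x ≢ 𝟘 → IsSquare x → IsSquare (x ⊗ y) → IsSquare y
  square-quotient {y = y} ne (z , refl) (w , e) = inv z ⊗ w ,
    trans (solveᶠ 2 (λ i w → (i :⊗ w) :⊗ (i :⊗ w) :≡ i :⊗ (i :⊗ (w :⊗ w))) refl (inv z) w)
    (trans (cong (λ t → inv z ⊗ (inv z ⊗ t)) (trans e (⊗-assoc z z y)))
    (trans (cong (inv z ⊗_) (⊗-cancelˡ-inv z (z ⊗ y) z≢)) (⊗-cancelˡ-inv z y z≢)))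
    where
    z≢ : z ≢ 𝟘
    z≢ refl = ne (⊗-zeroˡ 𝟘)

  χ-square-⊗ : ∀ {x} → x ≢ 𝟘 → IsSquare x → ∀ y → χ (x ⊗ y) ≡ χ y
  χ-square-⊗ {x} ne s y with y ≟ 𝟘
  ... | yes refl = trans (cong χ (⊗-zeroʳ x)) χ-𝟘
  ... | no y≢ with isSquare? y
  ... | yes t = χ-square (⊗-≢𝟘 ne y≢) (square-⊗ s t)
  ... | no nt = χ-nonsquare λ u → nt (square-quotient ne s u)

  -- For a nonsquare x no summand of Σ_y (χ(y) + χ(xy)) = 0 is positive, so all vanish.
  χ-nonsquare-⊗ : ∀ {x} → ¬ IsSquare x → ∀ y → χ (x ⊗ y) ≡ - χ y
  χ-nonsquare-⊗ {x} ns y = trans (l (χ y) (χ (x ⊗ y))) (trans (cong (λ t → t - χ y) (∑-sum-zero-≤0 nonpos total y)) (+-identityˡ (- χ y)))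
    where
    l = solve 2 (λ a b → b := (a :+ b) :- a) refl
    x≢ : x ≢ 𝟘
    x≢ refl = ns (𝟘 , ⊗-zeroˡ 𝟘)
    total : (∑[ y ] (χ y + χ (x ⊗ y))) ≡ 0ℚ
    total = trans (∑-+ χ (λ y → χ (x ⊗ y))) (trans (cong₂ _+_ ∑-χ (trans (∑-scale x x≢ χ) ∑-χ)) refl)
    nonpos : ∀ y → χ y + χ (x ⊗ y) ≤ 0ℚ
    nonpos y with y ≟ 𝟘
    ... | yes refl = ≤-eq (trans (+-identityˡ (χ (x ⊗ 𝟘))) (trans (cong χ (⊗-zeroʳ x)) χ-𝟘))
    ... | no y≢ with isSquare? y
    ... | yes s = ≤-eq (cong (λ t → 1ℚ + t) (χ-nonsquare λ u → ns (square-quotient y≢ s (subst IsSquare (⊗-comm x y) u))))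
    ... | no _ = subst (- 1ℚ + χ (x ⊗ y) ≤_) refl (+-monoʳ-≤ (- 1ℚ) (χ≤1 (x ⊗ y)))

  -- Multiplication by a nonzero square preserves squares and nonsquares; for a nonsquare the
  -- vanishing of `∑ χ` forces it to exchange them.
  χ-⊗ : ∀ x y → χ (x ⊗ y) ≡ χ x * χ y
  χ-⊗ x y with x ≟ 𝟘
  ... | yes refl = trans (cong χ (⊗-zeroˡ y)) (trans χ-𝟘 (sym (*-zeroˡ (χ y))))
  ... | no ne with isSquare? x
  ... | yes s = trans (χ-square-⊗ ne s y) (sym (*-identityˡ (χ y)))
  ... | no ns = trans (χ-nonsquare-⊗ ns y) (l (χ y))
    where
    l = solve 1 (λ a → :- a := (:- con 1ℚ) :* a) refl

  χ-𝟙 : χ 𝟙 ≡ 1ℚ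
  χ-𝟙 = χ-square 𝟙≢𝟘 (𝟙 , ⊗-identityˡ 𝟙)

  χ-inv : ∀ x → χ (inv x) ≡ χ x
  χ-inv x with x ≟ 𝟘
  ... | yes refl = trans (cong χ inv-𝟘) χ-𝟘
  ... | no ne with isSquare? x
  ... | yes (z , e) = χ-square (inv-≢𝟘 ne) (square-quotient ne (z , e) (𝟙 , trans (⊗-identityˡ 𝟙) (sym (⊗-inv x ne))))
  ... | no ns = χ-nonsquare λ s → ns (square-quotient (inv-≢𝟘 ne) s (𝟙 , trans (⊗-identityˡ 𝟙) (trans (sym (⊗-inv x ne)) (⊗-comm x (inv x)))))

  ∑-χ-affine : ∀ a b → a ≢ 𝟘 → (∑[ x ] χ (b ⊕ a ⊗ x)) ≡ 0ℚ
  ∑-χ-affine a b ne = trans (∑-affine a b ne χ) ∑-χ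

  -- For x ≠ 0 the product is χ(x²(1 + c/x)) = χ(1 + c/x), and 1/x runs through the nonzero
  -- elements. The full sum of χ(1 + cy) over y vanishes, and its missing term at y = 0 is χ(1) = 1.
  χ-shift-correlation : ∀ c → c ≢ 𝟘 → (∑[ x ] χ x * χ (x ⊕ c)) ≡ - 1ℚ
  χ-shift-correlation c ne = trans (∑-cong term) (trans (∑-inv (λ y → χ (𝟙 ⊕ c ⊗ y) - δ 𝟘 y))
    (trans (∑-minus (λ y → χ (𝟙 ⊕ c ⊗ y)) (δ 𝟘)) (cong₂ _-_ (∑-χ-affine c 𝟙 ne) (∑-δ 𝟘))))
    where
    term : ∀ x → χ x * χ (x ⊕ c) ≡ χ (𝟙 ⊕ c ⊗ inv x) - δ 𝟘 (inv x)
    term x with x ≟ 𝟘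
    ... | yes refl = trans (*-zeroˡ (χ (𝟘 ⊕ c))) (sym (trans (cong₂ _-_ (trans (cong χ (trans (cong (λ t → 𝟙 ⊕ c ⊗ t) inv-𝟘) (trans (cong (𝟙 ⊕_) (⊗-zeroʳ c)) (⊕-identityʳ 𝟙)))) χ-𝟙) (δ-≡ (sym inv-𝟘))) refl))
    ... | no x≢ = trans (trans (cong₂ _*_ (sym (χ-≢ x≢)) refl) (trans (cong (λ t → χ x * χ t) (sym fac)) (trans (cong (χ x *_) (χ-⊗ x (𝟙 ⊕ c ⊗ inv x))) (trans (sym (*-assoc (χ x) (χ x) (χ (𝟙 ⊕ c ⊗ inv x)))) (trans (cong (_* χ (𝟙 ⊕ c ⊗ inv x)) (χ-sq x≢)) (*-identityˡ (χ (𝟙 ⊕ c ⊗ inv x))))))))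
        (trans (sym (+-identityʳ (χ (𝟙 ⊕ c ⊗ inv x)))) (cong (λ t → χ (𝟙 ⊕ c ⊗ inv x) - t) (sym (δ-≢ {i = 𝟘} {j = inv x} λ e → inv-≢𝟘 x≢ (sym e)))))
      where
      χ-≢ : ∀ {x} → x ≢ 𝟘 → χ x ≡ (if does (isSquare? x) then 1ℚ else - 1ℚ)
      χ-≢ {x} ne with x ≟ 𝟘
      ... | yes e = ⊥-elim (ne e)
      ... | no _ = refl
      fac : x ⊗ (𝟙 ⊕ c ⊗ inv x) ≡ x ⊕ c
      fac = trans (cong (λ t → x ⊗ (t ⊕ c ⊗ inv x)) (sym fromℤ-1)) (trans (solveᶠ 3 (λ x c i → x :⊗ (:𝟙 :⊕ c :⊗ i) :≡ x :⊕ c :⊗ (x :⊗ i)) refl x c (inv x)) (cong (x ⊕_) (trans (cong (c ⊗_) (⊗-inv x x≢)) (⊗-identityʳ c))))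

#-injective : ∀ {a b} → # a ≡ # b → a ≡ b
#-injective {a} {b} e = ℤ.+-injective (ℤ.*-cancelʳ-≡ (ℤ.+ a) (ℤ.+ b) (ℤ.+ 1) (ℚᵘ.drop-*≡* (ℚᵘ.≃-trans (ℚᵘ.≃-sym (#-toℚᵘ a)) (ℚᵘ.≃-trans (ℚᵘ.≃-reflexive (cong toℚᵘ e)) (#-toℚᵘ b)))))

IsNat : ℚ → Set
IsNat q = ∃ λ k → q ≡ # k

∑-isNat : ∀ {n} (f : Fin n → ℚ) → (∀ x → IsNat (f x)) → IsNat (∑ f)
∑-isNat {zero} f h = 0 , ∑-zero f
∑-isNat {suc n} f h with h zero | ∑-isNat (λ x → f (suc x)) (λ x → h (suc x))
... | a , p | b , q = a ℕ.+ b , trans (∑-suc f) (trans (cong₂ _+_ p q) (sym (#-+ a b)))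

infix 7 _<δ_
_<δ_ : ∀ {n} → Fin n → Fin n → ℚ
i <δ j = indicator (toℕ i ℕ.<? toℕ j)

private
  indicator-isNat : ∀ {P : Set} (d : Dec P) → IsNat (indicator d)
  indicator-isNat (yes _) = 1 , refl
  indicator-isNat (no _) = 0 , refl

  <δ-yes : ∀ {n} {i j : Fin n} → toℕ i ℕ.< toℕ j → i <δ j ≡ 1ℚ
  <δ-yes {i = i} {j} = indicator-yes (toℕ i ℕ.<? toℕ j)

  <δ-no : ∀ {n} {i j : Fin n} → ¬ (toℕ i ℕ.< toℕ j) → i <δ j ≡ 0ℚ
  <δ-no {i = i} {j} = indicator-no (toℕ i ℕ.<? toℕ j)

trichotomy : ∀ {n} (i j : Fin n) → 1ℚ ≡ i <δ j + j <δ i + δ i j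
trichotomy i j with ℕ.<-cmp (toℕ i) (toℕ j)
... | tri< p ne q = sym (cong₂ _+_ (cong₂ _+_ (<δ-yes p) (<δ-no q)) (δ-≢ λ e → ne (cong toℕ e)))
... | tri≈ p e q = sym (cong₂ _+_ (cong₂ _+_ (<δ-no p) (<δ-no q)) (δ-≡ (toℕ-injective e)))
... | tri> p ne q = sym (cong₂ _+_ (cong₂ _+_ (<δ-no p) (<δ-yes q)) (δ-≢ λ e → ne (cong toℕ e)))

-- An orbit of size two is represented by its member with x < σ x, so for integer values the sum has
-- the parity of its part on the fixed points.
∑-involution : ∀ {n} (σ : Fin n → Fin n) → (∀ x → σ (σ x) ≡ x) → (f : Fin n → ℚ) → (∀ x → f (σ x) ≡ f x) →
  ∑ f ≡ (∑[ x ] f x * (x <δ σ x)) + (∑[ x ] f x * (x <δ σ x)) + (∑[ x ] f x * δ x (σ x))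
∑-involution σ inv f inv-f = trans (∑-cong λ x → trans (trans (sym (*-identityʳ (f x))) (cong (f x *_) (trichotomy x (σ x)))) (split (f x) (x <δ σ x) (σ x <δ x) (δ x (σ x))))
  (trans (∑-+ (λ x → f x * (x <δ σ x) + f x * (σ x <δ x)) (λ x → f x * δ x (σ x)))
  (cong (_+ (∑[ x ] f x * δ x (σ x))) (trans (∑-+ (λ x → f x * (x <δ σ x)) (λ x → f x * (σ x <δ x))) (cong ((∑[ x ] f x * (x <δ σ x)) +_)
   (trans (∑-cong λ x → cong₂ _*_ (sym (inv-f x)) (cong (σ x <δ_) (sym (inv x)))) (∑-perm σ σ inv inv (λ x → f x * (x <δ σ x))))))))
  where
  split = solve 4 (λ a b c d → a :* (b :+ c :+ d) := a :* b :+ a :* c :+ a :* d) refl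

module _ {n : ℕ} (F : OddField n) where
  open Field F
  private
    -- Indicator of the nonzero squares; subtracting `δ 𝟘 x` corrects the value 1/2 that (1 + χ)/2
    -- takes at zero.
    s : Fin n → ℚ
    s x = ½ * ((1ℚ + χ x) - δ 𝟘 x)
    s-isNat : ∀ x → IsNat (s x)
    s-isNat x with 𝟘 ≟ x
    ... | yes refl rewrite χ-𝟘 = 0 , refl
    ... | no ne with χ-values x (λ e → ne (sym e))
    ... | inj₁ e rewrite e = 1 , refl
    ... | inj₂ e rewrite e = 0 , refl
    s-inv : ∀ x → s (inv x) ≡ s x
    s-inv x = cong₂ (λ a b → ½ * ((1ℚ + a) - b)) (χ-inv x)
      (δ-⇔ (λ e → trans (sym inv-𝟘) (trans (cong inv e) (inv-involutive x))) (λ e → trans (sym inv-𝟘) (cong inv e)))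
    ∑-s : ∑ s ≡ ½ * (# n * 1ℚ + 0ℚ - 1ℚ)
    ∑-s = trans (∑-*ˡ ½ (λ x → (1ℚ + χ x) - δ 𝟘 x)) (cong (½ *_) (trans (∑-minus (λ x → 1ℚ + χ x) (δ 𝟘))
      (cong₂ _-_ (trans (∑-+ (λ _ → 1ℚ) χ) (cong₂ _+_ (∑-const n 1ℚ) ∑-χ)) (∑-δ 𝟘))))

  -- Inversion is an involution of the (n - 1) / 2 nonzero squares; were -1 a nonsquare it would
  -- fix only 1, so their number would be odd.
  χ-⊖𝟙 : ∀ k → n ≡ 1 ℕ.+ 4 ℕ.* k → χ (⊖ 𝟙) ≡ 1ℚ
  χ-⊖𝟙 k eq with χ-values (⊖ 𝟙) (λ e → 𝟙≢𝟘 (⊖-≡𝟘 e))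
  ... | inj₁ e = e
  ... | inj₂ e with ∑-isNat (λ x → s x * (x <δ inv x)) (λ x → nat-* (s-isNat x) (indicator-isNat (toℕ x ℕ.<? toℕ (inv x))))
    where
    nat-* : ∀ {a b} → IsNat a → IsNat b → IsNat (a * b)
    nat-* (a , refl) (b , refl) = a ℕ.* b , sym (#-* a b)
  ... | a , A = ⊥-elim (ℕ.even≢odd k a (#-injective (trans (trans (#-* 2 k) (trans count (sym (cong (λ t → 1ℚ + t) (#-* 2 a))))) (trans (sym (#-+ 1 (2 ℕ.* a))) refl))))
    where
    fixed : ∀ x → s x * δ x (inv x) ≡ δ 𝟙 x
    fixed x with 𝟙 ≟ x
    ... | yes refl = cong₂ _*_ (cong₂ (λ a b → ½ * ((1ℚ + a) - b)) χ-𝟙 (δ-≢ λ e → 𝟙≢𝟘 (sym e))) (δ-≡ (trans (sym (⊗-inv 𝟙 𝟙≢𝟘)) (⊗-identityˡ (inv 𝟙))))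
    ... | no ne with 𝟘 ≟ x
    ... | yes refl rewrite χ-𝟘 = *-zeroˡ (δ x (inv x))
    ... | no x≢ with ⊖ 𝟙 ≟ x
    ... | yes refl rewrite e = *-zeroˡ (δ (⊖ 𝟙) (inv (⊖ 𝟙)))
    ... | no x≢′ = trans (cong (½ * (1ℚ + χ x - 0ℚ) *_) (δ-≢ λ i → contra (square-roots (trans (cong (x ⊗_) i) (trans (⊗-inv x λ z → x≢ (sym z)) (sym (⊗-identityˡ 𝟙))))))) (*-zeroʳ (½ * (1ℚ + χ x - 0ℚ)))
      where
      contra : x ≡ 𝟙 ⊎ x ≡ ⊖ 𝟙 → ⊥
      contra (inj₁ p) = ne (sym p)
      contra (inj₂ p) = x≢′ (sym p)
    l1 = solve 1 (λ k → con ½ :* ((con 1ℚ :+ :# 4 :* k) :* con 1ℚ :+ con 0ℚ :- con 1ℚ) := :# 2 :* k) refl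
    l2 = solve 1 (λ a → a :+ a :+ con 1ℚ := con 1ℚ :+ :# 2 :* a) refl
    count : # 2 * # k ≡ 1ℚ + # 2 * # a
    count = trans (sym (l1 (# k))) (trans (cong (λ t → ½ * (t * 1ℚ + 0ℚ - 1ℚ)) (sym (trans (cong #_ eq) (trans (#-+ 1 (4 ℕ.* k)) (cong (λ t → 1ℚ + t) (#-* 4 k))))))
      (trans (sym ∑-s) (trans (∑-involution inv inv-involutive s s-inv) (trans (cong₂ _+_ (cong₂ _+_ A A) (trans (∑-cong fixed) (∑-δ 𝟙))) (l2 (# a))))))

-- Fourth moment of character sums over monic quartics

module FourthMoment {n : ℕ} (F : OddField n) where
  open Field F
  open FieldSolver F

  private
    N = # n

  N≥0 : 0ℚ ≤ # n
  N≥0 = #≥0 n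

  0<N : 0ℚ < # n
  0<N = positive-size 𝟘
    where
    positive-size : ∀ {m} → Fin m → 0ℚ < # m
    positive-size {suc m} _ = 0<# m

  quartic : N⁴ n → Fin n → Fin n
  quartic (c₃ , c₂ , c₁ , c₀) x = (((x ⊕ c₃) ⊗ x ⊕ c₂) ⊗ x ⊕ c₁) ⊗ x ⊕ c₀

  fromRoots : N⁴ n → N⁴ n
  fromRoots (i , j , k , l) =
    ⊖ (i ⊕ j ⊕ k ⊕ l) , i ⊗ j ⊕ i ⊗ k ⊕ i ⊗ l ⊕ j ⊗ k ⊕ j ⊗ l ⊕ k ⊗ l ,
    ⊖ (i ⊗ j ⊗ k ⊕ i ⊗ j ⊗ l ⊕ i ⊗ k ⊗ l ⊕ j ⊗ k ⊗ l) , i ⊗ j ⊗ k ⊗ l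

  quartic-fromRoots : ∀ i j k l x → quartic (fromRoots (i , j , k , l)) x ≡ (x ⊝ i) ⊗ ((x ⊝ j) ⊗ ((x ⊝ k) ⊗ (x ⊝ l)))
  quartic-fromRoots = solveᶠ 5 (λ i j k l x →
    (((x :⊕ (:⊖ (i :⊕ j :⊕ k :⊕ l))) :⊗ x :⊕ (i :⊗ j :⊕ i :⊗ k :⊕ i :⊗ l :⊕ j :⊗ k :⊕ j :⊗ l :⊕ k :⊗ l)) :⊗ x
      :⊕ (:⊖ (i :⊗ j :⊗ k :⊕ i :⊗ j :⊗ l :⊕ i :⊗ k :⊗ l :⊕ j :⊗ k :⊗ l))) :⊗ x :⊕ i :⊗ j :⊗ k :⊗ l
    :≡ (x :⊝ i) :⊗ ((x :⊝ j) :⊗ ((x :⊝ k) :⊗ (x :⊝ l)))) refl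

  quarticSum : N⁴ n → ℚ
  quarticSum c = ∑[ x ] χ (quartic c x)

  rootSum : N⁴ n → ℚ
  rootSum (i , j , k , l) = ∑[ x ] χ (x ⊝ i) * (χ (x ⊝ j) * (χ (x ⊝ k) * χ (x ⊝ l)))

  rootSum-fromRoots : ∀ τ → rootSum τ ≡ quarticSum (fromRoots τ)
  rootSum-fromRoots (i , j , k , l) = ∑-cong λ x → sym (trans (cong χ (quartic-fromRoots i j k l x))
    (trans (χ-⊗ (x ⊝ i) _) (cong (χ (x ⊝ i) *_) (trans (χ-⊗ (x ⊝ j) _) (cong (χ (x ⊝ j) *_) (χ-⊗ (x ⊝ k) (x ⊝ l)))))))

  private
    module L4 = Linear (∑⁴-linear {n})

    row : N⁴ n → Fin n → ℚ
    row (a , b , c , d) x = δ a x + δ b x + δ c x + δ d x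

    row≥0 : ∀ τ x → 0ℚ ≤ row τ x
    row≥0 (a , b , c , d) x = +-≥0 (+-≥0 (+-≥0 (δ≥0 a x) (δ≥0 b x)) (δ≥0 c x)) (δ≥0 d x)

    ∑-row : ∀ τ → ∑ (row τ) ≡ # 4
    ∑-row (a , b , c , d) = trans (∑-+ (λ x → δ a x + δ b x + δ c x) (δ d)) (cong₂ _+_ (trans (∑-+ (λ x → δ a x + δ b x) (δ c))
      (cong₂ _+_ (trans (∑-+ (δ a) (δ b)) (cong₂ _+_ (∑-δ a) (∑-δ b))) (∑-δ c))) (∑-δ d))

    -- `row τ x` is the multiplicity of x in τ, so `box τ σ` is at least 1 when every entry of σ
    -- occurs in τ, while its sum over all σ is 4⁴.
    box : N⁴ n → N⁴ n → ℚ
    box τ (a , b , c , d) = row τ a * (row τ b * (row τ c * row τ d))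

    box≥0 : ∀ τ σ → 0ℚ ≤ box τ σ
    box≥0 τ (a , b , c , d) = *-≥0 (row≥0 τ a) (*-≥0 (row≥0 τ b) (*-≥0 (row≥0 τ c) (row≥0 τ d)))

    ∑-box : ∀ τ → ∑⁴ (box τ) ≡ # 256
    ∑-box τ = trans (∑⁴-product (row τ) (row τ) (row τ) (row τ)) (cong₂ _*_ (∑-row τ) (cong₂ _*_ (∑-row τ) (cong₂ _*_ (∑-row τ) (∑-row τ))))

    row-root : ∀ ((i , j , k , l) : N⁴ n) x → x ≡ i ⊎ x ≡ j ⊎ x ≡ k ⊎ x ≡ l → 1ℚ ≤ row (i , j , k , l) x
    row-root (i , j , k , l) x = [ first , [ second , [ third , fourth ]′ ]′ ]′
      where
      at : ∀ {i x : Fin n} → x ≡ i → 1ℚ ≤ δ i x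
      at e = ≤-eq (sym (δ-≡ (sym e)))
      first : x ≡ i → 1ℚ ≤ row (i , j , k , l) x
      first e = ≤-trans (at e) (≤-by (+-≥0 (+-≥0 (δ≥0 j x) (δ≥0 k x)) (δ≥0 l x)) (s (δ i x) (δ j x) (δ k x) (δ l x)))
        where
        s = solve 4 (λ a b c d → a :+ b :+ c :+ d := a :+ (b :+ c :+ d)) refl
      second : x ≡ j → 1ℚ ≤ row (i , j , k , l) x
      second e = ≤-trans (at e) (≤-by (+-≥0 (+-≥0 (δ≥0 i x) (δ≥0 k x)) (δ≥0 l x)) (s (δ i x) (δ j x) (δ k x) (δ l x)))
        where
        s = solve 4 (λ a b c d → a :+ b :+ c :+ d := b :+ (a :+ c :+ d)) refl
      third : x ≡ k → 1ℚ ≤ row (i , j , k , l) x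
      third e = ≤-trans (at e) (≤-by (+-≥0 (+-≥0 (δ≥0 i x) (δ≥0 j x)) (δ≥0 l x)) (s (δ i x) (δ j x) (δ k x) (δ l x)))
        where
        s = solve 4 (λ a b c d → a :+ b :+ c :+ d := c :+ (a :+ b :+ d)) refl
      fourth : x ≡ l → 1ℚ ≤ row (i , j , k , l) x
      fourth e = ≤-trans (at e) (≤-by (+-≥0 (+-≥0 (δ≥0 i x) (δ≥0 j x)) (δ≥0 k x)) (s (δ i x) (δ j x) (δ k x) (δ l x)))
        where
        s = solve 4 (λ a b c d → a :+ b :+ c :+ d := d :+ (a :+ b :+ c)) refl

    four-factors : ∀ {w x y z} → w ⊗ (x ⊗ (y ⊗ z)) ≡ 𝟘 → w ≡ 𝟘 ⊎ x ≡ 𝟘 ⊎ y ≡ 𝟘 ⊎ z ≡ 𝟘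
    four-factors {w} {x} {y} {z} e = Sum.map₂ (λ e₁ → Sum.map₂ (⊗-≡𝟘 y z) (⊗-≡𝟘 x (y ⊗ z) e₁)) (⊗-≡𝟘 w (x ⊗ (y ⊗ z)) e)

    quartic-root : ∀ τ x → quartic (fromRoots τ) x ≡ 𝟘 → 1ℚ ≤ row τ x
    quartic-root (i , j , k , l) x e = row-root (i , j , k , l) x (Sum.map (⊝-≡𝟘 {x} {i}) (Sum.map (⊝-≡𝟘 {x} {j}) (Sum.map (⊝-≡𝟘 {x} {k}) (⊝-≡𝟘 {x} {l})))
      (four-factors {x ⊝ i} {x ⊝ j} {x ⊝ k} {x ⊝ l} (trans (sym (quartic-fromRoots i j k l x)) e)))

    1≤* : ∀ {a b} → 1ℚ ≤ a → 1ℚ ≤ b → 1ℚ ≤ a * b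
    1≤* p q = *-mono 0≤1 (≤-trans 0≤1 q) p q

    same-roots : ∀ τ σ → fromRoots σ ≡ fromRoots τ → 1ℚ ≤ box τ σ
    same-roots τ (a , b , c , d) e = 1≤* (r a (fst a b c d)) (1≤* (r b (snd a b c d)) (1≤* (r c (thd a b c d)) (r d (fth a b c d))))
      where
      r : ∀ x → (x ⊝ a) ⊗ ((x ⊝ b) ⊗ ((x ⊝ c) ⊗ (x ⊝ d))) ≡ 𝟘 → 1ℚ ≤ row τ x
      r x z = quartic-root τ x (trans (cong (λ t → quartic t x) (sym e)) (trans (quartic-fromRoots a b c d x) z))
      fst : ∀ a b c d → (a ⊝ a) ⊗ ((a ⊝ b) ⊗ ((a ⊝ c) ⊗ (a ⊝ d))) ≡ 𝟘
      fst a b c d = trans (cong (_⊗ ((a ⊝ b) ⊗ ((a ⊝ c) ⊗ (a ⊝ d)))) (⊝-self a)) (⊗-zeroˡ _)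
      snd : ∀ a b c d → (b ⊝ a) ⊗ ((b ⊝ b) ⊗ ((b ⊝ c) ⊗ (b ⊝ d))) ≡ 𝟘
      snd a b c d = trans (cong ((b ⊝ a) ⊗_) (trans (cong (_⊗ ((b ⊝ c) ⊗ (b ⊝ d))) (⊝-self b)) (⊗-zeroˡ _))) (⊗-zeroʳ _)
      thd : ∀ a b c d → (c ⊝ a) ⊗ ((c ⊝ b) ⊗ ((c ⊝ c) ⊗ (c ⊝ d))) ≡ 𝟘
      thd a b c d = trans (cong (λ t → (c ⊝ a) ⊗ ((c ⊝ b) ⊗ t)) (trans (cong (_⊗ (c ⊝ d)) (⊝-self c)) (⊗-zeroˡ _))) (trans (cong ((c ⊝ a) ⊗_) (⊗-zeroʳ _)) (⊗-zeroʳ _))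
      fth : ∀ a b c d → (d ⊝ a) ⊗ ((d ⊝ b) ⊗ ((d ⊝ c) ⊗ (d ⊝ d))) ≡ 𝟘
      fth a b c d = trans (cong (λ t → (d ⊝ a) ⊗ ((d ⊝ b) ⊗ t)) (trans (cong ((d ⊝ c) ⊗_) (⊝-self d)) (⊗-zeroʳ _))) (trans (cong ((d ⊝ a) ⊗_) (⊗-zeroʳ _)) (⊗-zeroʳ _))

    factorizations : N⁴ n → ℚ
    factorizations c = ∑⁴ λ τ → δ⁴ (fromRoots τ) c

    collision : ∀ c τ σ → δ⁴ (fromRoots τ) c * δ⁴ (fromRoots σ) c ≤ δ⁴ (fromRoots τ) c * box τ σ
    collision c τ σ with δ⁴-cases (fromRoots σ) c
    ... | inj₂ z = ≤-trans (≤-eq (trans (cong (δ⁴ (fromRoots τ) c *_) z) (*-zeroʳ (δ⁴ (fromRoots τ) c)))) (*-≥0 (δ⁴≥0 (fromRoots τ) c) (box≥0 τ σ))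
    ... | inj₁ (p , u) with δ⁴-cases (fromRoots τ) c
    ... | inj₂ z = ≤-eq (trans (trans (cong (_* δ⁴ (fromRoots σ) c) z) (*-zeroˡ (δ⁴ (fromRoots σ) c))) (sym (trans (cong (_* box τ σ) z) (*-zeroˡ (box τ σ)))))
    ... | inj₁ (q , _) = *-monoˡ (δ⁴ (fromRoots τ) c) (δ⁴≥0 (fromRoots τ) c) (≤-trans (≤-eq u) (same-roots τ σ (trans p (sym q))))

    -- The square counts pairs (τ, σ) of factorizations of c. Every entry of σ is a root of c, hence
    -- an entry of τ, so each τ leaves at most 4⁴ = 256 choices of σ. Dividing by the count then
    -- bounds it by 256.
    factorizations-sq : ∀ c → sq (factorizations c) ≤ # 256 * factorizations c
    factorizations-sq c = subst₂ _≤_ e₁ e₂ (L4.L-mono λ τ → L4.L-mono λ σ → collision c τ σ)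
      where
      D : N⁴ n → ℚ
      D τ = δ⁴ (fromRoots τ) c
      e₁ : ∑⁴ (λ τ → ∑⁴ λ σ → D τ * D σ) ≡ sq (factorizations c)
      e₁ = trans (L4.L-cong λ τ → L4.L-* (D τ) D) (L-*ʳ ∑⁴-linear (∑⁴ D) D)
      e₂ : ∑⁴ (λ τ → ∑⁴ λ σ → D τ * box τ σ) ≡ # 256 * factorizations c
      e₂ = trans (L4.L-cong λ τ → trans (L4.L-* (D τ) (box τ)) (trans (cong (D τ *_) (∑-box τ)) (*-comm (D τ) (# 256)))) (L4.L-* (# 256) D)

    factorizations≤ : ∀ c → factorizations c ≤ # 256
    factorizations≤ c = [ (λ p → p) ,
      (λ q → cancel-≤ (factorizations c) (<-trans (0<# 255) q) (≤-trans (factorizations-sq c) (≤-eq (*-comm (# 256) (factorizations c))))) ]′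
      (≤-split (factorizations c) (# 256))

  -- Each quartic has at most 256 ordered root tuples, and since φ ≥ 0 the quartics that do not
  -- split can only enlarge the right-hand side.
  ∑-fromRoots : (φ : N⁴ n → ℚ) → (∀ c → 0ℚ ≤ φ c) → ∑⁴ (λ τ → φ (fromRoots τ)) ≤ # 256 * ∑⁴ φ
  ∑-fromRoots φ φ≥0 = subst₂ _≤_ (sym e) (L4.L-* (# 256) φ) (L4.L-mono λ c → *-mono (L4.L-≥0 λ τ → δ⁴≥0 (fromRoots τ) c) (φ≥0 c) (factorizations≤ c) ≤-refl)
    where
    e : ∑⁴ (λ τ → φ (fromRoots τ)) ≡ ∑⁴ (λ c → factorizations c * φ c)
    e = trans (L4.L-cong λ τ → sym (∑⁴-δ (fromRoots τ) φ)) (trans (L-∑⁴ ∑⁴-linear λ τ c → δ⁴ (fromRoots τ) c * φ c) (L4.L-cong λ c → L-*ʳ ∑⁴-linear (φ c) (λ τ → δ⁴ (fromRoots τ) c)))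

  private
    prod : N⁴ n → N⁴ n → ℚ
    prod (a , b , c , d) q = χ (quartic q a) * (χ (quartic q b) * (χ (quartic q c) * χ (quartic q d)))

    -- The fourth power of `quarticSum` is expanded over four evaluation points; for fixed points
    -- the sum runs over the coefficients of the quartic.
    T : N⁴ n → ℚ
    T x = ∑⁴ (prod x)

    ∑⁴-shift : ∀ (u₃ u₂ u₁ u₀ : Fin n) f → ∑⁴ (λ (c₃ , c₂ , c₁ , c₀) → f (c₃ ⊕ u₃ , c₂ ⊕ u₂ , c₁ ⊕ u₁ , c₀ ⊕ u₀)) ≡ ∑⁴ f
    ∑⁴-shift u₃ u₂ u₁ u₀ f = trans (∑-cong λ c₃ → trans (∑-cong λ c₂ → trans (∑-cong λ c₁ →
        ∑-shift u₀ λ c₀ → f (c₃ ⊕ u₃ , c₂ ⊕ u₂ , c₁ ⊕ u₁ , c₀))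
      (∑-shift u₁ λ c₁ → ∑[ c₀ ] f (c₃ ⊕ u₃ , c₂ ⊕ u₂ , c₁ , c₀)))
      (∑-shift u₂ λ c₂ → ∑[ c₁ ] ∑[ c₀ ] f (c₃ ⊕ u₃ , c₂ , c₁ , c₀)))
      (∑-shift u₃ λ c₃ → ∑[ c₂ ] ∑[ c₁ ] ∑[ c₀ ] f (c₃ , c₂ , c₁ , c₀))

    -- Adding t (x - b)(x - c)(x - d) to a quartic moves its value at a freely and fixes those at b, c, d.
    isolated : ∀ a b c d → a ≢ b → a ≢ c → a ≢ d → T (a , b , c , d) ≡ 0ℚ
    isolated a b c d a≢b a≢c a≢d = cancel-≡0 N 0<N (trans (sym (∑-const n (T (a , b , c , d)))) (trans (∑-cong λ t → trans (sym (shifted t)) (L4.L-cong (moved t)))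
      (trans (sym (L-∑ ∑⁴-linear λ q t → χ (quartic q a ⊕ v ⊗ t) * rest q)) (trans (L4.L-cong λ q → trans (∑-*ʳ (rest q) λ t → χ (quartic q a ⊕ v ⊗ t))
        (trans (cong (_* rest q) (∑-χ-affine v (quartic q a) v≢𝟘)) (*-zeroˡ (rest q)))) (L-0 ∑⁴-linear)))))
      where
      v : Fin n
      v = (a ⊝ b) ⊗ ((a ⊝ c) ⊗ (a ⊝ d))
      v≢𝟘 : v ≢ 𝟘
      v≢𝟘 = ⊗-≢𝟘 (⊝-≢𝟘 a≢b) (⊗-≢𝟘 (⊝-≢𝟘 a≢c) (⊝-≢𝟘 a≢d))
      rest : N⁴ n → ℚ
      rest q = χ (quartic q b) * (χ (quartic q c) * χ (quartic q d))
      add : Fin n → N⁴ n → N⁴ n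
      add t (c₃ , c₂ , c₁ , c₀) = c₃ ⊕ t , c₂ ⊕ ⊖ (t ⊗ (b ⊕ c ⊕ d)) , c₁ ⊕ t ⊗ (b ⊗ c ⊕ b ⊗ d ⊕ c ⊗ d) , c₀ ⊕ ⊖ (t ⊗ (b ⊗ c ⊗ d))
      shifted : ∀ t → ∑⁴ (λ q → prod (a , b , c , d) (add t q)) ≡ T (a , b , c , d)
      shifted t = ∑⁴-shift t (⊖ (t ⊗ (b ⊕ c ⊕ d))) (t ⊗ (b ⊗ c ⊕ b ⊗ d ⊕ c ⊗ d)) (⊖ (t ⊗ (b ⊗ c ⊗ d))) (prod (a , b , c , d))
      value : ∀ t q x → quartic (add t q) x ≡ quartic q x ⊕ ((x ⊝ b) ⊗ ((x ⊝ c) ⊗ (x ⊝ d))) ⊗ t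
      value t (c₃ , c₂ , c₁ , c₀) x = solveᶠ 9 (λ b c d c₃ c₂ c₁ c₀ t x →
        (((x :⊕ (c₃ :⊕ t)) :⊗ x :⊕ (c₂ :⊕ (:⊖ (t :⊗ (b :⊕ c :⊕ d))))) :⊗ x :⊕ (c₁ :⊕ t :⊗ (b :⊗ c :⊕ b :⊗ d :⊕ c :⊗ d))) :⊗ x :⊕ (c₀ :⊕ (:⊖ (t :⊗ (b :⊗ c :⊗ d))))
        :≡ (((x :⊕ c₃) :⊗ x :⊕ c₂) :⊗ x :⊕ c₁) :⊗ x :⊕ c₀ :⊕ ((x :⊝ b) :⊗ ((x :⊝ c) :⊗ (x :⊝ d))) :⊗ t) refl b c d c₃ c₂ c₁ c₀ t x
      unchanged : ∀ t q x → (x ⊝ b) ⊗ ((x ⊝ c) ⊗ (x ⊝ d)) ≡ 𝟘 → χ (quartic (add t q) x) ≡ χ (quartic q x)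
      unchanged t q x e = cong χ (trans (value t q x) (trans (cong (λ z → quartic q x ⊕ z ⊗ t) e) (trans (cong (quartic q x ⊕_) (⊗-zeroˡ t)) (⊕-identityʳ _))))
      moved : ∀ t q → prod (a , b , c , d) (add t q) ≡ χ (quartic q a ⊕ v ⊗ t) * rest q
      moved t q = cong₂ _*_ (cong χ (value t q a)) (cong₂ _*_ (unchanged t q b (trans (cong (_⊗ ((b ⊝ c) ⊗ (b ⊝ d))) (⊝-self b)) (⊗-zeroˡ _)))
        (cong₂ _*_ (unchanged t q c (trans (cong ((c ⊝ b) ⊗_) (trans (cong (_⊗ (c ⊝ d)) (⊝-self c)) (⊗-zeroˡ _))) (⊗-zeroʳ _)))
                   (unchanged t q d (trans (cong (λ z → (d ⊝ b) ⊗ ((d ⊝ c) ⊗ z)) (⊝-self d)) (trans (cong ((d ⊝ b) ⊗_) (⊗-zeroʳ _)) (⊗-zeroʳ _))))))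

    sq-*≤1 : ∀ {a b} → sq a ≤ 1ℚ → sq b ≤ 1ℚ → sq (a * b) ≤ 1ℚ
    sq-*≤1 {a} {b} p q = subst (_≤ 1ℚ) (shuffle a b) (*-mono (sq≥0 a) 0≤1 p q)
      where
      shuffle = solve 2 (λ a b → a :* a :* (b :* b) := a :* b :* (a :* b)) refl

    prod≤1 : ∀ x q → prod x q ≤ 1ℚ
    prod≤1 (a , b , c , d) q = sq-≤⇒≤ 0≤1 (sq-*≤1 {χ (quartic q a)} (χ-sq≤1 (quartic q a)) (sq-*≤1 {χ (quartic q b)} (χ-sq≤1 (quartic q b)) (sq-*≤1 {χ (quartic q c)} {χ (quartic q d)} (χ-sq≤1 (quartic q c)) (χ-sq≤1 (quartic q d)))))

    pair₁ pair₂ pair₃ pair : N⁴ n → ℚ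
    pair₁ (a , b , c , d) = δ a b * δ c d
    pair₂ (a , b , c , d) = δ a c * δ b d
    pair₃ (a , b , c , d) = δ a d * δ b c
    pair x = pair₁ x + pair₂ x + pair₃ x

    pair₁≥0 : ∀ x → 0ℚ ≤ pair₁ x
    pair₁≥0 (a , b , c , d) = *-≥0 (δ≥0 a b) (δ≥0 c d)
    pair₂≥0 : ∀ x → 0ℚ ≤ pair₂ x
    pair₂≥0 (a , b , c , d) = *-≥0 (δ≥0 a c) (δ≥0 b d)
    pair₃≥0 : ∀ x → 0ℚ ≤ pair₃ x
    pair₃≥0 (a , b , c , d) = *-≥0 (δ≥0 a d) (δ≥0 b c)

    M : ℚ
    M = N * (N * (N * (N * 1ℚ)))

    M≥0 : 0ℚ ≤ M
    M≥0 = *-≥0 N≥0 (*-≥0 N≥0 (*-≥0 N≥0 (*-≥0 N≥0 0≤1)))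

    paired : ∀ x → 1ℚ ≤ pair x → T x ≤ M * pair x
    paired x h = ≤-trans (L4.L-mono (prod≤1 x)) (≤-trans (≤-eq (∑⁴-const n 1ℚ)) (≤-trans (≤-eq (sym (*-identityʳ M))) (*-monoˡ M M≥0 h)))

    unpaired : ∀ x → T x ≡ 0ℚ → T x ≤ M * pair x
    unpaired x e = ≤-trans (≤-eq e) (*-≥0 M≥0 (+-≥0 (+-≥0 (pair₁≥0 x) (pair₂≥0 x)) (pair₃≥0 x)))

    -- If one point differs from the other three, `isolated` makes the sum vanish; otherwise the
    -- four points coincide in pairs and the trivial bound n⁴ applies. The three terms of `pair` are
    -- the three possible pairings.
    T≤ : ∀ x → T x ≤ M * pair x
    T≤ (a , b , c , d) = case a ≟ b of λ
      { (yes refl) → case c ≟ d of λ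
        { (yes refl) → paired (a , a , c , c) (≤-by (+-≥0 (pair₂≥0 (a , a , c , c)) (pair₃≥0 (a , a , c , c)))
            (trans (+-assoc (pair₁ (a , a , c , c)) _ _) (cong (_+ (pair₂ (a , a , c , c) + pair₃ (a , a , c , c))) (cong₂ _*_ (δ-refl a) (δ-refl c)))))
        ; (no c≢d) → case c ≟ a of λ
          { (yes refl) → unpaired (a , a , a , d) (trans (L4.L-cong λ q → to-d (f q a) (f q a) (f q a) (f q d)) (isolated d a a a (λ e → c≢d (sym e)) (λ e → c≢d (sym e)) (λ e → c≢d (sym e))))
          ; (no c≢a) → unpaired (a , a , c , d) (trans (L4.L-cong λ q → to-c (f q a) (f q a) (f q c) (f q d)) (isolated c a a d c≢a c≢a c≢d)) } }
      ; (no a≢b) → case a ≟ c of λ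
        { (yes refl) → case b ≟ d of λ
          { (yes refl) → paired (a , b , a , b) (≤-by (+-≥0 (pair₁≥0 (a , b , a , b)) (pair₃≥0 (a , b , a , b)))
              (trans (mid (pair₁ (a , b , a , b)) (pair₂ (a , b , a , b)) (pair₃ (a , b , a , b))) (cong (_+ (pair₁ (a , b , a , b) + pair₃ (a , b , a , b))) (cong₂ _*_ (δ-refl a) (δ-refl b)))))
          ; (no b≢d) → unpaired (a , b , a , d) (trans (L4.L-cong λ q → to-b (f q a) (f q b) (f q a) (f q d)) (isolated b a a d (λ e → a≢b (sym e)) (λ e → a≢b (sym e)) b≢d)) }
        ; (no a≢c) → case a ≟ d of λ
          { (yes refl) → case b ≟ c of λ
            { (yes refl) → paired (a , b , b , a) (≤-by (+-≥0 (pair₁≥0 (a , b , b , a)) (pair₂≥0 (a , b , b , a)))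
                (trans (last (pair₁ (a , b , b , a)) (pair₂ (a , b , b , a)) (pair₃ (a , b , b , a))) (cong (_+ (pair₁ (a , b , b , a) + pair₂ (a , b , b , a))) (cong₂ _*_ (δ-refl a) (δ-refl b)))))
            ; (no b≢c) → unpaired (a , b , c , a) (trans (L4.L-cong λ q → to-b (f q a) (f q b) (f q c) (f q a)) (isolated b a c a (λ e → a≢b (sym e)) b≢c (λ e → a≢b (sym e)))) }
          ; (no a≢d) → unpaired (a , b , c , d) (isolated a b c d a≢b a≢c a≢d) } } }
      where
      f : N⁴ n → Fin n → ℚ
      f q x = χ (quartic q x)
      to-b = solve 4 (λ a b c d → a :* (b :* (c :* d)) := b :* (a :* (c :* d))) refl
      to-c = solve 4 (λ a b c d → a :* (b :* (c :* d)) := c :* (a :* (b :* d))) refl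
      to-d = solve 4 (λ a b c d → a :* (b :* (c :* d)) := d :* (a :* (b :* c))) refl
      mid = solve 3 (λ a b c → a :+ b :+ c := b :+ (a :+ c)) refl
      last = solve 3 (λ a b c → a :+ b :+ c := c :+ (a :+ b)) refl

    ∑-pair : ∑⁴ pair ≡ # 3 * (N * N)
    ∑-pair = trans (L4.L-+ (λ x → pair₁ x + pair₂ x) pair₃) (trans (cong₂ _+_ (trans (L4.L-+ pair₁ pair₂) (cong₂ _+_ p₁ p₂)) p₃) (three (N * N)))
      where
      three = solve 1 (λ a → a :+ a :+ a := :# 3 :* a) refl
      NN : (∑ {n} λ _ → ∑ {n} λ _ → 1ℚ) ≡ N * N
      NN = trans (∑-cong λ _ → trans (∑-const n 1ℚ) (*-identityʳ N)) (∑-const n N)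
      p₁ : ∑⁴ pair₁ ≡ N * N
      p₁ = trans (∑-cong λ a → trans (∑-cong λ b → trans (∑-cong λ c → trans (∑-*ˡ (δ a b) (δ c)) (cong (δ a b *_) (∑-δ c))) (∑-const n (δ a b * 1ℚ))) (trans (∑-*ˡ N λ b → δ a b * 1ℚ) (trans (cong (N *_) (∑-δˡ a λ _ → 1ℚ)) (*-identityʳ N)))) (∑-const n N)
      p₂ : ∑⁴ pair₂ ≡ N * N
      p₂ = trans (∑-cong₂ λ a b → trans (∑-cong λ c → trans (∑-*ˡ (δ a c) (δ b)) (cong (δ a c *_) (∑-δ b))) (∑-δˡ a λ _ → 1ℚ)) NN
      p₃ : ∑⁴ pair₃ ≡ N * N
      p₃ = trans (∑-cong₂ λ a b → trans (∑-cong λ c → trans (∑-*ʳ (δ b c) (δ a)) (trans (cong (_* δ b c) (∑-δ a)) (*-comm 1ℚ (δ b c)))) (∑-δˡ b λ _ → 1ℚ)) NN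

  quartic-fourth-moment : ∑⁴ (λ c → pow4 (quarticSum c)) ≤ M * (# 3 * (N * N))
  quartic-fourth-moment = ≤-trans (≤-eq (trans (L4.L-cong λ c → sym (∑⁴-product (h c) (h c) (h c) (h c))) (L-∑⁴ ∑⁴-linear λ c x → prod x c)))
    (≤-trans (L4.L-mono T≤) (≤-eq (trans (L4.L-* M pair) (cong (M *_) ∑-pair))))
    where
    h : N⁴ n → Fin n → ℚ
    h c x = χ (quartic c x)

  -- The constant is 256 · 3. On average over root tuples, `rootSum` has at most the size √n of a
  -- random sum of signs.
  root-fourth-moment : ∑⁴ (λ τ → pow4 (rootSum τ)) ≤ # 768 * (N * N * N * N * N * N)
  root-fourth-moment = ≤-trans (≤-eq (L4.L-cong λ τ → cong pow4 (rootSum-fromRoots τ)))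
    (≤-trans (∑-fromRoots (λ c → pow4 (quarticSum c)) λ c → subst (0ℚ ≤_) (regroup (quarticSum c)) (sq≥0 (sq (quarticSum c))))
    (≤-trans (*-monoˡ (# 256) (#≥0 256) quartic-fourth-moment) (≤-eq (final N))))
    where
    regroup = solve 1 (λ a → (a :* a) :* (a :* a) := a :* (a :* (a :* a))) refl
    final = solve 1 (λ N → :# 256 :* (N :* (N :* (N :* (N :* con 1ℚ))) :* (:# 3 :* (N :* N))) := :# 768 :* (N :* N :* N :* N :* N :* N)) refl

-- The Paley matrix and the kernel on slopes

module PaleyMatrix {n : ℕ} (F : OddField n) (χ-⊖𝟙 : Field.χ F (OddField.⊖_ F (OddField.𝟙 F)) ≡ 1ℚ) where
  open Field F
  open FieldSolver F

  private
    N = # n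

  N≥0 : 0ℚ ≤ # n
  N≥0 = #≥0 n

  S : Fin n → Fin n → ℚ
  S i j = χ (i ⊝ j)

  χ-⊖ : ∀ x → χ (⊖ x) ≡ χ x
  χ-⊖ x = trans (cong χ (trans (solveᶠ 1 (λ x → :⊖ x :≡ (:⊖ :𝟙) :⊗ x) refl x) (cong (λ t → ⊖ t ⊗ x) fromℤ-1)))
    (trans (χ-⊗ (⊖ 𝟙) x) (trans (cong (_* χ x) χ-⊖𝟙) (*-identityˡ (χ x))))

  S-sym : ∀ i j → S i j ≡ S j i
  S-sym i j = trans (cong χ (solveᶠ 2 (λ i j → i :⊝ j :≡ :⊖ (j :⊝ i)) refl i j)) (χ-⊖ (j ⊝ i))

  S-diag : ∀ i → S i i ≡ 0ℚ
  S-diag i = trans (cong χ (⊝-self i)) χ-𝟘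

  χ-sq-δ : ∀ x → χ x * χ x ≡ 1ℚ - δ 𝟘 x
  χ-sq-δ x = case 𝟘 ≟ x of λ
    { (yes refl) → trans (cong₂ _*_ χ-𝟘 χ-𝟘) (sym (cong (λ t → 1ℚ - t) (δ-refl 𝟘)))
    ; (no ne) → trans (χ-sq (λ e → ne (sym e))) (sym (cong (λ t → 1ℚ - t) (δ-≢ ne))) }

  S-sq : ∀ i j → S i j * S i j ≡ 1ℚ - δ i j
  S-sq i j = trans (χ-sq-δ (i ⊝ j)) (cong (λ t → 1ℚ - t) (δ-⇔ (λ e → ⊝-≡𝟘 (sym e)) λ { refl → sym (⊝-self i) }))

  ∑-S : ∀ i → ∑ (S i) ≡ 0ℚ
  ∑-S i = trans (∑-reflect i χ) ∑-χ

  -- Off the diagonal this is a shifted correlation of χ, equal to -1 for every nonzero shift.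
  S-gram : ∀ i j → (∑[ k ] S i k * S j k) ≡ N * δ i j - 1ℚ
  S-gram i j = case i ≟ j of λ
    { (yes refl) → trans (∑-reflect i λ x → χ x * χ x) (trans (∑-cong χ-sq-δ) (trans (∑-minus (λ _ → 1ℚ) (δ 𝟘)) (cong₂ _-_ (trans (∑-const n 1ℚ) (cong (N *_) (sym (δ-refl i)))) (∑-δ 𝟘))))
    ; (no ne) → trans (∑-cong λ k → cong (λ t → S i k * χ t) (solveᶠ 3 (λ i j k → j :⊝ k :≡ (i :⊝ k) :⊕ (j :⊝ i)) refl i j k))
        (trans (∑-reflect i λ x → χ x * χ (x ⊕ (j ⊝ i))) (trans (χ-shift-correlation (j ⊝ i) (⊝-≢𝟘 λ e → ne (sym e))) (sym (trans (cong (λ t → N * t - 1ℚ) (δ-≢ ne)) (l N))))) }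
    where
    l = solve 1 (λ N → N :* con 0ℚ :- con 1ℚ := :- con 1ℚ) refl

  S-norm : ∀ x → (∑[ i ] sq (∑[ j ] S i j * x j)) ≡ N * ‖ x ‖² - sq (∑ x)
  S-norm x = trans (∑-sq S x) (trans (∑-cong λ j → trans (∑-cong λ k → trans (cong (x j * x k *_) (trans (∑-cong λ i → cong₂ _*_ (S-sym i j) (S-sym i k)) (S-gram j k))) (split (x j) (x k) N (δ j k)))
    (trans (∑-minus (λ k → δ j k * (N * (x j * x k))) (λ k → x j * x k)) (cong₂ _-_ (∑-δˡ j λ k → N * (x j * x k)) (∑-*ˡ (x j) x))))
    (trans (∑-minus (λ j → N * (x j * x j)) (λ j → x j * ∑ x)) (cong₂ _-_ (∑-*ˡ N λ j → x j * x j) (∑-*ʳ (∑ x) x))))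
    where
    split = solve 4 (λ a b N d → a :* b :* (N :* d :- con 1ℚ) := d :* (N :* (a :* b)) :- a :* b) refl

  S-norm≤ : ∀ x → (∑[ i ] sq (∑[ j ] S i j * x j)) ≤ N * ‖ x ‖²
  S-norm≤ x = ≤-by (sq≥0 (∑ x)) (trans (l (N * ‖ x ‖²) (sq (∑ x))) (cong (_+ sq (∑ x)) (sym (S-norm x))))
    where
    l = solve 2 (λ a b → a := a :- b :+ b) refl

  -- The matrix χ(z + a) is `S` with its columns permuted by z ↦ -z, so it obeys the same norm
  -- bound.
  χ-norm≤ : ∀ x → (∑[ a ] sq (∑[ z ] χ (z ⊕ a) * x z)) ≤ N * ‖ x ‖²
  χ-norm≤ x = ≤-trans (≤-eq (∑-cong λ a → cong sq (sym (trans (∑-cong λ z → cong (λ t → χ t * x (𝟘 ⊝ z)) (trans (solveᶠ 2 (λ a z → a :⊝ z :≡ (conᶠ (ℤ.+ 0) :⊝ z) :⊕ a) refl a z) (cong (λ t → (t ⊝ z) ⊕ a) fromℤ-0))) (∑-reflect 𝟘 λ z → χ (z ⊕ a) * x z)))))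
    (≤-trans (S-norm≤ λ z → x (𝟘 ⊝ z)) (≤-eq (cong (N *_) (∑-reflect 𝟘 λ z → sq (x z)))))

  ∑-sq≤ : (x : Fin n → ℚ) → sq (∑ x) ≤ N * ‖ x ‖²
  ∑-sq≤ x = subst₂ _≤_ (cong sq (∑-cong λ i → *-identityˡ (x i))) (cong (_* ‖ x ‖²) (trans (∑-const n (sq 1ℚ)) (*-identityʳ N))) (cauchy-schwarz (λ _ → 1ℚ) x)

  S-sq≤1 : ∀ i j → sq (S i j) ≤ 1ℚ
  S-sq≤1 i j = χ-sq≤1 (i ⊝ j)

  -- Four times the polynomial is (b + 2z)² - (b² - 4c), and z ↦ b + 2z is a bijection.
  quadratic-root-count : ∀ b c → (∑[ z ] δ (z ⊗ z ⊕ b ⊗ z ⊕ c) 𝟘) ≡ 1ℚ + χ (b ⊗ b ⊝ (𝟙 ⊕ 𝟙) ⊗ (𝟙 ⊕ 𝟙) ⊗ c)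
  quadratic-root-count b c = trans (∑-cong λ z → δ-⇔ (λ e → ⊝-≡𝟘 (trans (sym (complete z)) (trans (cong (4# ⊗_) e) (⊗-zeroʳ 4#))))
      (λ e → ⊗-cancelˡ 4# 4≢𝟘 (trans (complete z) (trans (cong (λ t → t ⊝ (b ⊗ b ⊝ 4# ⊗ c)) e) (trans (⊝-self _) (sym (⊗-zeroʳ 4#)))))))
    (trans (∑-affine (𝟙 ⊕ 𝟙) b 𝟙⊕𝟙≢𝟘 λ y → δ (y ⊗ y) (b ⊗ b ⊝ 4# ⊗ c)) (square-count (b ⊗ b ⊝ 4# ⊗ c)))
    where
    4# : Fin n
    4# = (𝟙 ⊕ 𝟙) ⊗ (𝟙 ⊕ 𝟙)
    4≢𝟘 : 4# ≢ 𝟘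
    4≢𝟘 = ⊗-≢𝟘 𝟙⊕𝟙≢𝟘 𝟙⊕𝟙≢𝟘
    complete : ∀ z → 4# ⊗ (z ⊗ z ⊕ b ⊗ z ⊕ c) ≡ (b ⊕ (𝟙 ⊕ 𝟙) ⊗ z) ⊗ (b ⊕ (𝟙 ⊕ 𝟙) ⊗ z) ⊝ (b ⊗ b ⊝ 4# ⊗ c)
    complete z = solveᶠ 4 (λ t b c z → t :⊗ t :⊗ (z :⊗ z :⊕ b :⊗ z :⊕ c) :≡ (t :⊗ t :⊗ (z :⊗ z) :⊕ t :⊗ t :⊗ (b :⊗ z)) :⊕ t :⊗ t :⊗ c) refl (𝟙 ⊕ 𝟙) b c z
      ∙ trans (cong (λ u → ((𝟙 ⊕ 𝟙) ⊗ (𝟙 ⊕ 𝟙) ⊗ (z ⊗ z) ⊕ u) ⊕ (𝟙 ⊕ 𝟙) ⊗ (𝟙 ⊕ 𝟙) ⊗ c) (trans (cong (λ u → (u ⊕ u) ⊗ (u ⊕ u) ⊗ (b ⊗ z)) (sym fromℤ-1)) (trans (solveᶠ 2 (λ b z → (:𝟙 :⊕ :𝟙) :⊗ (:𝟙 :⊕ :𝟙) :⊗ (b :⊗ z) :≡ (:𝟙 :⊕ :𝟙) :⊗ ((:𝟙 :⊕ :𝟙) :⊗ (b :⊗ z))) refl b z)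
          (trans (solveᶠ 2 (λ b z → (:𝟙 :⊕ :𝟙) :⊗ ((:𝟙 :⊕ :𝟙) :⊗ (b :⊗ z)) :≡ b :⊗ ((:𝟙 :⊕ :𝟙) :⊗ z) :⊕ b :⊗ ((:𝟙 :⊕ :𝟙) :⊗ z)) refl b z) (cong (λ u → b ⊗ ((u ⊕ u) ⊗ z) ⊕ b ⊗ ((u ⊕ u) ⊗ z)) fromℤ-1)))))
        (solveᶠ 4 (λ t b c z → (t :⊗ t :⊗ (z :⊗ z) :⊕ (b :⊗ (t :⊗ z) :⊕ b :⊗ (t :⊗ z))) :⊕ t :⊗ t :⊗ c :≡ (b :⊕ t :⊗ z) :⊗ (b :⊕ t :⊗ z) :⊝ (b :⊗ b :⊝ t :⊗ t :⊗ c)) refl (𝟙 ⊕ 𝟙) b c z)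
      where
      infixr 2 _∙_
      _∙_ : ∀ {x y z : Fin n} → x ≡ y → y ≡ z → x ≡ z
      _∙_ = trans

  -- Cross-ratio kernel of two edges of slopes m and m′, summed over their relative position w; it
  -- represents the form on functions of the slope.
  slopeKernel : Fin n → Fin n → ℚ
  slopeKernel m m′ = ∑[ w ] χ w * χ (w ⊝ m′) * (χ (w ⊕ m) * χ (w ⊕ m ⊝ m′))

  private
    2# : Fin n
    2# = 𝟙 ⊕ 𝟙

    two : ∀ x → 2# ⊗ x ≡ x ⊕ x
    two x = trans (cong (λ u → (u ⊕ u) ⊗ x) (sym fromℤ-1)) (solveᶠ 1 (λ x → (:𝟙 :⊕ :𝟙) :⊗ x :≡ x :⊕ x) refl x)

    disc : Fin n → Fin n → Fin n → Fin n
    disc a b W = (a ⊕ b ⊝ W ⊗ W) ⊗ (a ⊕ b ⊝ W ⊗ W) ⊝ 2# ⊗ 2# ⊗ (a ⊗ b)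

    -- With W = m - m′ + 2w the factors w, w - m′, w + m, w + m - m′ are the halves of W ± m ± m′,
    -- and the product of the latter four is (m² + m′² - W²)² - 4m²m′². Hence the kernel depends on
    -- m and m′ only through their squares.
    slopeKernel-disc : ∀ m m′ → slopeKernel m m′ ≡ (∑[ W ] χ (disc (m ⊗ m) (m′ ⊗ m′) W))
    slopeKernel-disc m m′ = trans (∑-cong λ w → sym (term w)) (∑-affine 2# (m ⊝ m′) 𝟙⊕𝟙≢𝟘 λ W → χ (disc (m ⊗ m) (m′ ⊗ m′) W))
      where
      4-sq : ∀ x → χ ((2# ⊗ 2#) ⊗ ((2# ⊗ 2#) ⊗ x)) ≡ χ x
      4-sq x = trans (χ-square-⊗ 4≢ (2# , refl) _) (χ-square-⊗ 4≢ (2# , refl) x)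
        where
        4≢ : 2# ⊗ 2# ≢ 𝟘
        4≢ = ⊗-≢𝟘 𝟙⊕𝟙≢𝟘 𝟙⊕𝟙≢𝟘
      four : ∀ x → (2# ⊗ 2#) ⊗ x ≡ (x ⊕ x) ⊕ (x ⊕ x)
      four x = trans (⊗-assoc 2# 2# x) (trans (cong (2# ⊗_) (two x)) (two (x ⊕ x)))
      fact : ∀ w → disc (m ⊗ m) (m′ ⊗ m′) (m ⊝ m′ ⊕ 2# ⊗ w) ≡ (2# ⊗ 2#) ⊗ ((2# ⊗ 2#) ⊗ ((w ⊗ (w ⊝ m′)) ⊗ ((w ⊕ m) ⊗ (w ⊕ m ⊝ m′))))
      fact w = trans (cong₂ (λ u v → (m ⊗ m ⊕ m′ ⊗ m′ ⊝ (m ⊝ m′ ⊕ u) ⊗ (m ⊝ m′ ⊕ u)) ⊗ (m ⊗ m ⊕ m′ ⊗ m′ ⊝ (m ⊝ m′ ⊕ u) ⊗ (m ⊝ m′ ⊕ u)) ⊝ v) (two w) (four (m ⊗ m ⊗ (m′ ⊗ m′))))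
        (trans (solveᶠ 3 (λ m m′ w → let W = m :⊝ m′ :⊕ (w :⊕ w); q = m :⊗ m :⊕ m′ :⊗ m′ :⊝ W :⊗ W; p = m :⊗ m :⊗ (m′ :⊗ m′); r = (w :⊗ (w :⊝ m′)) :⊗ ((w :⊕ m) :⊗ (w :⊕ m :⊝ m′)); s = (r :⊕ r) :⊕ (r :⊕ r) in
            q :⊗ q :⊝ ((p :⊕ p) :⊕ (p :⊕ p)) :≡ (s :⊕ s) :⊕ (s :⊕ s)) refl m m′ w)
        (sym (trans (four _) (cong (λ s → (s ⊕ s) ⊕ (s ⊕ s)) (four _)))))
      term : ∀ w → χ (disc (m ⊗ m) (m′ ⊗ m′) (m ⊝ m′ ⊕ 2# ⊗ w)) ≡ χ w * χ (w ⊝ m′) * (χ (w ⊕ m) * χ (w ⊕ m ⊝ m′))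
      term w = trans (cong χ (fact w)) (trans (4-sq _) (trans (χ-⊗ (w ⊗ (w ⊝ m′)) _) (cong₂ _*_ (χ-⊗ w (w ⊝ m′)) (χ-⊗ (w ⊕ m) (w ⊕ m ⊝ m′)))))

  -- Both sides count the solutions (W, z) of z² + (a + b - W²) z + ab = 0.
  ∑-disc : ∀ a b → a ≢ 𝟘 → b ≢ 𝟘 → (∑[ W ] χ (disc a b W)) ≡ (∑[ z ] χ z * (χ (z ⊕ a) * χ (z ⊕ b))) - 1ℚ
  ∑-disc a b a≢ b≢ = cancel (∑[ W ] χ (disc a b W)) _ N (trans (sym byW) (trans (∑-swap λ W z → δ (quad W z) 𝟘) byz))
    where
    cancel : ∀ x y N → N * 1ℚ + x ≡ (N * 1ℚ - 1ℚ) + y → x ≡ y - 1ℚ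
    cancel x y N e = trans (l x N) (trans (cong (λ t → t - N * 1ℚ) e) (l′ y N))
      where
      l = solve 2 (λ x N → x := N :* con 1ℚ :+ x :- N :* con 1ℚ) refl
      l′ = solve 2 (λ y N → N :* con 1ℚ :- con 1ℚ :+ y :- N :* con 1ℚ := y :- con 1ℚ) refl
    quad : Fin n → Fin n → Fin n
    quad W z = z ⊗ z ⊕ (a ⊕ b ⊝ W ⊗ W) ⊗ z ⊕ a ⊗ b
    byW : (∑[ W ] ∑[ z ] δ (quad W z) 𝟘) ≡ N * 1ℚ + (∑[ W ] χ (disc a b W))
    byW = trans (∑-cong λ W → quadratic-root-count (a ⊕ b ⊝ W ⊗ W) (a ⊗ b)) (trans (∑-+ (λ _ → 1ℚ) (λ W → χ (disc a b W))) (cong (_+ (∑[ W ] χ (disc a b W))) (∑-const n 1ℚ)))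
    cubic : Fin n → Fin n
    cubic z = z ⊗ ((z ⊕ a) ⊗ (z ⊕ b))
    -- For fixed z ≠ 0 the equation becomes (zW)² = z(z + a)(z + b), whose solutions W are counted
    -- by 1 + χ of the cubic.
    key : ∀ W z → z ⊗ quad W z ≡ cubic z ⊝ (z ⊗ W) ⊗ (z ⊗ W)
    key W z = solveᶠ 4 (λ a b W z → z :⊗ (z :⊗ z :⊕ (a :⊕ b :⊝ W :⊗ W) :⊗ z :⊕ a :⊗ b) :≡ z :⊗ ((z :⊕ a) :⊗ (z :⊕ b)) :⊝ (z :⊗ W) :⊗ (z :⊗ W)) refl a b W z
    fixed-z : ∀ z → (∑[ W ] δ (quad W z) 𝟘) ≡ (1ℚ - δ 𝟘 z) + χ (cubic z)
    fixed-z z = case 𝟘 ≟ z of λ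
      { (yes refl) → trans (∑-≡0 λ W → δ-≢ λ e → ⊗-≢𝟘 a≢ b≢ (trans (sym (at0 W)) e))
           (sym (cong₂ _+_ (cong (λ t → 1ℚ - t) (δ-refl 𝟘)) (trans (cong χ (⊗-zeroˡ _)) χ-𝟘)))
      ; (no ne) → let z≢ = λ e → ne (sym e) in trans (∑-cong λ W → δ-⇔ (λ e → sym (⊝-≡𝟘 (trans (sym (key W z)) (trans (cong (z ⊗_) e) (⊗-zeroʳ z)))))
            (λ e → ⊗-cancelˡ z z≢ (trans (key W z) (trans (cong (cubic z ⊝_) e) (trans (⊝-self _) (sym (⊗-zeroʳ z)))))))
          (trans (∑-scale z z≢ λ V → δ (V ⊗ V) (cubic z)) (trans (square-count (cubic z)) (cong (_+ χ (cubic z)) (sym (trans (cong (λ t → 1ℚ - t) (δ-≢ ne)) refl))))) }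
      where
      at0 : ∀ W → quad W 𝟘 ≡ a ⊗ b
      at0 W = trans (cong (_⊕ a ⊗ b) (trans (cong₂ _⊕_ (⊗-zeroˡ 𝟘) (⊗-zeroʳ (a ⊕ b ⊝ W ⊗ W))) (⊕-identityˡ 𝟘))) (⊕-identityˡ (a ⊗ b))
    byz : (∑[ z ] ∑[ W ] δ (quad W z) 𝟘) ≡ (N * 1ℚ - 1ℚ) + (∑[ z ] χ z * (χ (z ⊕ a) * χ (z ⊕ b)))
    byz = trans (∑-cong fixed-z) (trans (∑-+ (λ z → 1ℚ - δ 𝟘 z) (λ z → χ (cubic z)))
      (cong₂ _+_ (trans (∑-minus (λ _ → 1ℚ) (δ 𝟘)) (cong₂ _-_ (∑-const n 1ℚ) (∑-δ 𝟘))) (∑-cong λ z → trans (χ-⊗ z _) (cong (χ z *_) (χ-⊗ (z ⊕ a) (z ⊕ b))))))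

  slopeKernel-cubic : ∀ m m′ → m ≢ 𝟘 → m′ ≢ 𝟘 → slopeKernel m m′ ≡ (∑[ z ] χ z * (χ (z ⊕ m ⊗ m) * χ (z ⊕ m′ ⊗ m′))) - 1ℚ
  slopeKernel-cubic m m′ p q = trans (slopeKernel-disc m m′) (∑-disc (m ⊗ m) (m′ ⊗ m′) (⊗-≢𝟘 p p) (⊗-≢𝟘 q q))

  slopeKernel-sym : ∀ m m′ → slopeKernel m m′ ≡ slopeKernel m′ m
  slopeKernel-sym m m′ = trans (slopeKernel-disc m m′) (trans (∑-cong λ W → cong χ
    (trans (cong₂ (λ u v → (u ⊝ W ⊗ W) ⊗ (u ⊝ W ⊗ W) ⊝ 2# ⊗ 2# ⊗ v) (⊕-comm (m ⊗ m) (m′ ⊗ m′)) (⊗-comm (m ⊗ m) (m′ ⊗ m′))) refl)) (sym (slopeKernel-disc m′ m)))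

  -- Up to a rank-one term the slope kernel is a product of two matrices χ(z + m²).
  slopeKernel-norm : (s : Fin n → ℚ) → s 𝟘 ≡ 0ℚ → (∑[ m′ ] sq ((1ℚ - δ 𝟘 m′) * (∑[ m ] s m * slopeKernel m m′))) ≤ # 10 * (N * N * ‖ s ‖²)
  slopeKernel-norm s s0 = ≤-trans (∑-mono pointwise) (≤-trans (≤-eq (trans (∑-+ (λ _ → # 2 * sq E) (λ m′ → # 2 * sq (Y (m′ ⊗ m′)))) (cong₂ _+_ (∑-const n (# 2 * sq E)) (∑-*ˡ (# 2) λ m′ → sq (Y (m′ ⊗ m′))))))
    (≤-trans (+-mono-≤ (*-monoˡ N N≥0 (*-monoˡ (# 2) (#≥0 2) (∑-sq≤ s))) (*-monoˡ (# 2) (#≥0 2) ∑Y)) (≤-eq (final N ‖ s ‖²))))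
    where
    final = solve 2 (λ N s → N :* (:# 2 :* (N :* s)) :+ :# 2 :* (:# 2 :* (N :* (N :* (:# 2 :* s)))) := :# 10 :* (N :* N :* s)) refl
    E : ℚ
    E = ∑ s
    ζ : Fin n → ℚ
    ζ z = ∑[ m ] s m * χ (z ⊕ m ⊗ m)
    Y : Fin n → ℚ
    Y a = ∑[ z ] χ (z ⊕ a) * (χ z * ζ z)
    rewritten : ∀ m′ → m′ ≢ 𝟘 → (∑[ m ] s m * slopeKernel m m′) ≡ Y (m′ ⊗ m′) - E
    rewritten m′ m′≢ = trans (∑-cong λ m → term m) (trans (∑-minus (λ m → s m * (∑[ z ] χ z * (χ (z ⊕ m ⊗ m) * χ (z ⊕ m′ ⊗ m′)))) s) (cong (_- E)
      (trans (∑-cong λ m → sym (∑-*ˡ (s m) λ z → χ z * (χ (z ⊕ m ⊗ m) * χ (z ⊕ m′ ⊗ m′)))) (trans (∑-swap λ m z → s m * (χ z * (χ (z ⊕ m ⊗ m) * χ (z ⊕ m′ ⊗ m′))))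
      (∑-cong λ z → trans (∑-cong λ m → shuffle (s m) (χ z) (χ (z ⊕ m ⊗ m)) (χ (z ⊕ m′ ⊗ m′))) (trans (∑-*ˡ (χ (z ⊕ m′ ⊗ m′) * χ z) λ m → s m * χ (z ⊕ m ⊗ m)) (*-assoc (χ (z ⊕ m′ ⊗ m′)) (χ z) (ζ z))))))))
      where
      shuffle = solve 4 (λ s c d e → s :* (c :* (d :* e)) := e :* c :* (s :* d)) refl
      minus-one = solve 2 (λ s x → s :* (x :- con 1ℚ) := s :* x :- s) refl
      zero-term = solve 2 (λ x y → con 0ℚ :* x := con 0ℚ :* y :- con 0ℚ) refl
      term : ∀ m → s m * slopeKernel m m′ ≡ s m * (∑[ z ] χ z * (χ (z ⊕ m ⊗ m) * χ (z ⊕ m′ ⊗ m′))) - s m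
      term m = case m ≟ 𝟘 of λ
        { (yes refl) → trans (cong (_* slopeKernel 𝟘 m′) s0) (trans (zero-term (slopeKernel 𝟘 m′) (∑[ z ] χ z * (χ (z ⊕ 𝟘 ⊗ 𝟘) * χ (z ⊕ m′ ⊗ m′)))) (cong (λ t → t * (∑[ z ] χ z * (χ (z ⊕ 𝟘 ⊗ 𝟘) * χ (z ⊕ m′ ⊗ m′))) - t) (sym s0)))
        ; (no m≢) → trans (cong (s m *_) (slopeKernel-cubic m m′ m≢ m′≢)) (minus-one (s m) _) }
    pointwise : ∀ m′ → sq ((1ℚ - δ 𝟘 m′) * (∑[ m ] s m * slopeKernel m m′)) ≤ # 2 * sq E + # 2 * sq (Y (m′ ⊗ m′))
    pointwise m′ = case 𝟘 ≟ m′ of λ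
      { (yes refl) → ≤-trans (≤-eq (trans (cong (λ t → sq ((1ℚ - t) * K 𝟘)) (δ-refl 𝟘)) (z (K 𝟘)))) (+-≥0 (*-≥0 (#≥0 2) (sq≥0 E)) (*-≥0 (#≥0 2) (sq≥0 (Y (𝟘 ⊗ 𝟘)))))
      ; (no ne) → ≤-trans (≤-eq (trans (cong (λ t → sq ((1ℚ - t) * K m′)) (δ-≢ ne)) (trans (o (K m′)) (cong sq (rewritten m′ λ e → ne (sym e)))))) (≤-by (sq≥0 (Y (m′ ⊗ m′) + E)) (par (Y (m′ ⊗ m′)) E)) }
      where
      K : Fin n → ℚ
      K m′ = ∑[ m ] s m * slopeKernel m m′
      z = solve 1 (λ k → (con 1ℚ :- con 1ℚ) :* k :* ((con 1ℚ :- con 1ℚ) :* k) := con 0ℚ) refl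
      o = solve 1 (λ k → (con 1ℚ :- con 0ℚ) :* k :* ((con 1ℚ :- con 0ℚ) :* k) := k :* k) refl
      par = solve 2 (λ y e → :# 2 :* (e :* e) :+ :# 2 :* (y :* y) := (y :- e) :* (y :- e) :+ (y :+ e) :* (y :+ e)) refl
    1+χ≤2 : ∀ x → 1ℚ + χ x ≤ # 2
    1+χ≤2 x = +-monoʳ-≤ 1ℚ (χ≤1 x)
    -- Push-forward of s under squaring. Its fibres have at most two elements, so its squared norm
    -- is at most twice that of s; this passes from the columns χ(z + m²) to the full matrix χ(z +
    -- a).
    G : Fin n → ℚ
    G a = ∑[ m ] δ (m ⊗ m) a * s m
    ζ≡ : ∀ z → ζ z ≡ (∑[ a ] χ (a ⊕ z) * G a)
    ζ≡ z = trans (∑-cong λ m → sym (trans (∑-cong λ a → sw (χ (a ⊕ z)) (δ (m ⊗ m) a) (s m)) (trans (∑-δˡ (m ⊗ m) λ a → s m * χ (a ⊕ z)) (cong (λ t → s m * χ t) (⊕-comm (m ⊗ m) z)))))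
      (trans (∑-swap λ m a → χ (a ⊕ z) * (δ (m ⊗ m) a * s m)) (∑-cong λ a → ∑-*ˡ (χ (a ⊕ z)) λ m → δ (m ⊗ m) a * s m))
      where
      sw = solve 3 (λ a b c → a :* (b :* c) := b :* (c :* a)) refl
    ∑G : ‖ G ‖² ≤ # 2 * ‖ s ‖²
    ∑G = ≤-trans (∑-mono λ a → ≤-trans (≤-eq (cong sq (∑-cong λ m → trans (cong (_* s m) (sym (δ-idem (m ⊗ m) a))) (*-assoc (δ (m ⊗ m) a) (δ (m ⊗ m) a) (s m)))))
        (≤-trans (cauchy-schwarz (λ m → δ (m ⊗ m) a) (λ m → δ (m ⊗ m) a * s m)) (*-mono (‖‖²≥0 λ m → δ (m ⊗ m) a) (∑-≥0 λ m → *-≥0 (δ≥0 (m ⊗ m) a) (sq≥0 (s m)))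
          (≤-trans (≤-eq (trans (∑-cong λ m → δ-idem (m ⊗ m) a) (square-count a))) (1+χ≤2 a)) (≤-eq (∑-cong λ m → trans (sqr (δ (m ⊗ m) a) (s m)) (cong (_* sq (s m)) (δ-idem (m ⊗ m) a)))))))
      (≤-eq (trans (∑-*ˡ (# 2) λ a → ∑[ m ] δ (m ⊗ m) a * sq (s m)) (cong (# 2 *_) (trans (∑-swap λ a m → δ (m ⊗ m) a * sq (s m)) (∑-cong λ m → ∑-δˡ (m ⊗ m) λ _ → sq (s m))))))
      where
      sqr = solve 2 (λ d s → d :* s :* (d :* s) := d :* d :* (s :* s)) refl
    ∑ζ : ‖ ζ ‖² ≤ N * (# 2 * ‖ s ‖²)
    ∑ζ = ≤-trans (≤-eq (∑-cong λ z → cong sq (ζ≡ z))) (≤-trans (χ-norm≤ G) (*-monoˡ N N≥0 ∑G))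
    ∑Y : (∑[ m′ ] sq (Y (m′ ⊗ m′))) ≤ # 2 * (N * (N * (# 2 * ‖ s ‖²)))
    ∑Y = ≤-trans (≤-eq (∑-square λ a → sq (Y a))) (≤-trans (∑-mono λ a → *-mono (subst (_≤ 1ℚ + χ a) refl (+-monoʳ-≤ 1ℚ (-1≤χ a))) (sq≥0 (Y a)) (1+χ≤2 a) ≤-refl)
      (≤-trans (≤-eq (∑-*ˡ (# 2) λ a → sq (Y a))) (*-monoˡ (# 2) (#≥0 2) (≤-trans (χ-norm≤ λ z → χ z * ζ z) (*-monoˡ N N≥0 (≤-trans (∑-mono λ z → subst₂ _≤_ (swap-sq (χ z) (ζ z)) (*-identityˡ (sq (ζ z))) (*-mono (sq≥0 (χ z)) (sq≥0 (ζ z)) (χ-sq≤1 z) ≤-refl)) ∑ζ))))))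
      where
      swap-sq = solve 2 (λ a b → a :* a :* (b :* b) := a :* b :* (a :* b)) refl

-- Radon transform over the lines of the plane

module Lines {n : ℕ} (F : OddField n) where
  open Field F
  open FieldSolver F

  private
    N = # n

  -- A function of the lines y = c + m x is written φ c m.
  LineFun : Set
  LineFun = Fin n → Fin n → ℚ

  slopeSum : LineFun → Fin n → ℚ
  slopeSum φ m = ∑[ c ] φ c m

  total : LineFun → ℚ
  total φ = ∑ (slopeSum φ)

  -- Sum over the nonvertical lines through (x, y), the one of slope m having intercept y - mx.
  radon : LineFun → Fin n → Fin n → ℚ
  radon φ x y = ∑[ m ] φ (y ⊝ m ⊗ x) m

  ∑-radonʸ : ∀ φ x → ∑ (radon φ x) ≡ total φ
  ∑-radonʸ φ x = trans (∑-swap λ y m → φ (y ⊝ m ⊗ x) m) (∑-cong λ m → ∑-unshift (m ⊗ x) λ c → φ c m)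

  ∑-line : ∀ m y → m ≢ 𝟘 → (f : Fin n → ℚ) → (∑[ x ] f (y ⊝ m ⊗ x)) ≡ ∑ f
  ∑-line m y ne f = trans (∑-cong λ x → cong f (solveᶠ 3 (λ y m x → y :⊝ m :⊗ x :≡ y :⊕ (:⊖ m) :⊗ x) refl y m x)) (∑-affine (⊖ m) y (λ e → ne (⊖-≡𝟘 e)) f)

  -- A line of nonzero slope meets each horizontal line once. A horizontal line does not, whence the
  -- hypothesis that φ vanishes at slope zero.
  ∑-radonˣ : ∀ φ → (∀ c → φ c 𝟘 ≡ 0ℚ) → ∀ y → (∑[ x ] radon φ x y) ≡ total φ
  ∑-radonˣ φ φ0 y = trans (∑-swap λ x m → φ (y ⊝ m ⊗ x) m) (∑-cong λ m → case m ≟ 𝟘 of λ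
    { (yes refl) → trans (∑-≡0 λ x → φ0 (y ⊝ 𝟘 ⊗ x)) (sym (∑-≡0 φ0))
    ; (no ne) → ∑-line m y ne λ c → φ c m })

  -- Two distinct lines meet in one point, unless they are parallel.
  plancherel : ∀ φ η → (∑[ x ] ∑[ y ] radon φ x y * radon η x y) ≡
    (N * (∑[ m ] ∑[ c ] φ c m * η c m) - (∑[ m ] slopeSum φ m * slopeSum η m)) + total φ * total η
  plancherel φ η = trans (∑-cong₂ λ x y → ∑-* (λ m → φ (y ⊝ m ⊗ x) m) (λ m → η (y ⊝ m ⊗ x) m))
    (trans (trans (∑-cong λ x → ∑-swap λ y m → ∑[ m′ ] φ (y ⊝ m ⊗ x) m * η (y ⊝ m′ ⊗ x) m′) (∑-swap λ x m → ∑[ y ] ∑[ m′ ] φ (y ⊝ m ⊗ x) m * η (y ⊝ m′ ⊗ x) m′))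
    (trans (∑-cong λ m → trans (trans (∑-cong λ x → ∑-swap λ y m′ → φ (y ⊝ m ⊗ x) m * η (y ⊝ m′ ⊗ x) m′) (∑-swap λ x m′ → ∑[ y ] φ (y ⊝ m ⊗ x) m * η (y ⊝ m′ ⊗ x) m′))
      (trans (∑-cong λ m′ → block m m′) (trans (∑-+ (λ m′ → δ m m′ * diag m) (λ m′ → slopeSum φ m * slopeSum η m′)) (cong₂ _+_ (∑-δˡ m λ _ → diag m) (∑-*ˡ (slopeSum φ m) (slopeSum η))))))
    (trans (∑-+ diag λ m → slopeSum φ m * total η) (cong₂ _+_ (trans (∑-minus (λ m → N * (∑[ c ] φ c m * η c m)) (λ m → slopeSum φ m * slopeSum η m)) (cong (_- (∑[ m ] slopeSum φ m * slopeSum η m)) (∑-*ˡ N λ m → ∑[ c ] φ c m * η c m))) (∑-*ʳ (total η) (slopeSum φ))))))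
    where
    diag : Fin n → ℚ
    diag m = N * (∑[ c ] φ c m * η c m) - slopeSum φ m * slopeSum η m
    block : ∀ m m′ → (∑[ x ] ∑[ y ] φ (y ⊝ m ⊗ x) m * η (y ⊝ m′ ⊗ x) m′) ≡ δ m m′ * diag m + slopeSum φ m * slopeSum η m′
    block m m′ = case m ≟ m′ of λ
      { (yes refl) → trans (∑-cong λ x → ∑-unshift (m ⊗ x) λ c → φ c m * η c m) (trans (∑-const n _) (trans (same (N * (∑[ c ] φ c m * η c m)) (slopeSum φ m * slopeSum η m)) (cong (λ t → t * diag m + slopeSum φ m * slopeSum η m) (sym (δ-refl m)))))
      ; (no ne) → trans (∑-cong λ x → trans (sym (∑-shift (m ⊗ x) λ y → φ (y ⊝ m ⊗ x) m * η (y ⊝ m′ ⊗ x) m′)) (∑-cong λ z → cong₂ (λ u v → φ u m * η v m′)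
            (solveᶠ 3 (λ z m x → z :⊕ m :⊗ x :⊝ m :⊗ x :≡ z) refl z m x) (solveᶠ 4 (λ z m m′ x → z :⊕ m :⊗ x :⊝ m′ :⊗ x :≡ z :⊝ (m′ :⊝ m) :⊗ x) refl z m m′ x)))
          (trans (∑-swap λ x z → φ z m * η (z ⊝ (m′ ⊝ m) ⊗ x) m′) (trans (∑-cong λ z → trans (∑-*ˡ (φ z m) λ x → η (z ⊝ (m′ ⊝ m) ⊗ x) m′)
            (cong (φ z m *_) (∑-line (m′ ⊝ m) z (⊝-≢𝟘 λ e → ne (sym e)) λ c → η c m′))) (trans (∑-*ʳ (slopeSum η m′) λ z → φ z m) (trans (diff (diag m) (slopeSum φ m * slopeSum η m′)) (cong (λ t → t * diag m + slopeSum φ m * slopeSum η m′) (sym (δ-≢ ne))))))) }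
      where
      same = solve 2 (λ a b → a := con 1ℚ :* (a :- b) :+ b) refl
      diff = solve 2 (λ a b → b := con 0ℚ :* a :+ b) refl

  -- N times the centred transform, to avoid a division
  radon₀ : LineFun → Fin n → Fin n → ℚ
  radon₀ φ x y = N * radon φ x y - total φ

  ∑²-radon : ∀ φ → (∑[ x ] ∑[ y ] radon φ x y) ≡ N * total φ
  ∑²-radon φ = trans (∑-cong λ x → ∑-radonʸ φ x) (∑-const n (total φ))

  plancherel₀ : ∀ φ η → (∑[ x ] ∑[ y ] radon₀ φ x y * radon₀ η x y) ≡
    N * N * (N * (∑[ m ] ∑[ c ] φ c m * η c m) - (∑[ m ] slopeSum φ m * slopeSum η m))
  plancherel₀ φ η = trans (∑-cong₂ λ x y → expand N (radon φ x y) (radon η x y) (total φ) (total η))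
    (trans (L2.L-+ (λ (x , y) → N * N * (radon φ x y * radon η x y)) (λ (x , y) → (- (N * total η)) * radon φ x y + ((- (N * total φ)) * radon η x y + total φ * total η)))
    (trans (cong₂ _+_ (trans (L2.L-* (N * N) λ (x , y) → radon φ x y * radon η x y) (cong (N * N *_) (plancherel φ η)))
      (trans (L2.L-+ (λ (x , y) → (- (N * total η)) * radon φ x y) (λ (x , y) → (- (N * total φ)) * radon η x y + total φ * total η))
        (cong₂ _+_ (trans (L2.L-* (- (N * total η)) λ (x , y) → radon φ x y) (cong (- (N * total η) *_) (∑²-radon φ)))
          (trans (L2.L-+ (λ (x , y) → (- (N * total φ)) * radon η x y) (λ _ → total φ * total η))
            (cong₂ _+_ (trans (L2.L-* (- (N * total φ)) λ (x , y) → radon η x y) (cong (- (N * total φ) *_) (∑²-radon η))) (trans (∑-cong {n} λ _ → ∑-const n (total φ * total η)) (∑-const n _)))))))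
      (collect N (N * (∑[ m ] ∑[ c ] φ c m * η c m) - (∑[ m ] slopeSum φ m * slopeSum η m)) (total φ) (total η))))
    where
    module L2 = Linear (∑²-linear {n} {n})
    expand = solve 5 (λ N a b s t → (N :* a :- s) :* (N :* b :- t)
      := N :* N :* (a :* b) :+ ((:- (N :* t)) :* a :+ ((:- (N :* s)) :* b :+ s :* t))) refl
    collect = solve 4 (λ N X s t → N :* N :* (X :+ s :* t) :+ ((:- (N :* t)) :* (N :* s) :+ ((:- (N :* s)) :* (N :* t) :+ N :* (N :* (s :* t))))
      := N :* N :* X) refl

  lineNorm : LineFun → ℚ
  lineNorm φ = ∑[ m ] ∑[ c ] φ c m * φ c m

  radon₀-norm : ∀ φ → ‖ radon₀ φ ‖²₂ ≤ N * N * (N * lineNorm φ)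
  radon₀-norm φ = ≤-trans (≤-eq (plancherel₀ φ φ)) (*-monoˡ (N * N) (*-≥0 (#≥0 n) (#≥0 n)) (≤-by (∑-≥0 λ m → sq≥0 (slopeSum φ m)) (l (N * lineNorm φ) _)))
    where
    l = solve 2 (λ a b → a := a :- b :+ b) refl

  -- Convolution over the affine group is a p × p matrix product after the Radon transform. Since the
  -- nontrivial representation has dimension p - 1, this gains a factor p on the Hilbert–Schmidt bound.
  module Convolution (κ φ η : LineFun) (κ0 : ∀ c → κ c 𝟘 ≡ 0ℚ) (φ0 : ∀ c → φ c 𝟘 ≡ 0ℚ)
    (conv : ∀ c′ m′ → η c′ m′ ≡ (∑[ m ] ∑[ c ] φ c m * κ (inv m ⊗ (c′ ⊝ c)) (inv m ⊗ m′))) where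

    -- The line (c, m) stands for the affine map x ↦ c + mx, and the arguments of κ are the
    -- coordinates of g⁻¹g′ for g = (c, m) and g′ = (c′, m′). The substitutions m′ = mμ and c = y -
    -- mx turn the convolution into a matrix product.
    radon-conv : ∀ x′ y → radon η x′ y ≡ (∑[ x ] radon κ x′ x * radon φ x y)
    radon-conv x′ y = trans (∑-cong λ m′ → conv (y ⊝ m′ ⊗ x′) m′) (trans (∑-swap λ m′ m → ∑[ c ] φ c m * κ (inv m ⊗ ((y ⊝ m′ ⊗ x′) ⊝ c)) (inv m ⊗ m′))
      (trans (∑-cong slope) (trans (∑-swap λ m x → φ (y ⊝ m ⊗ x) m * radon κ x′ x) (∑-cong λ x → trans (∑-*ʳ (radon κ x′ x) λ m → φ (y ⊝ m ⊗ x) m) (*-comm (radon φ x y) (radon κ x′ x))))))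
      where
      slope : ∀ m → (∑[ m′ ] ∑[ c ] φ c m * κ (inv m ⊗ ((y ⊝ m′ ⊗ x′) ⊝ c)) (inv m ⊗ m′)) ≡ (∑[ x ] φ (y ⊝ m ⊗ x) m * radon κ x′ x)
      slope m = case m ≟ 𝟘 of λ
        { (yes refl) → trans (∑-≡0 λ m′ → ∑-≡0 λ c → trans (cong (_* κ (inv 𝟘 ⊗ ((y ⊝ m′ ⊗ x′) ⊝ c)) (inv 𝟘 ⊗ m′)) (φ0 c)) (*-zeroˡ (κ (inv 𝟘 ⊗ ((y ⊝ m′ ⊗ x′) ⊝ c)) (inv 𝟘 ⊗ m′)))) (sym (∑-≡0 λ x → trans (cong (_* radon κ x′ x) (φ0 (y ⊝ 𝟘 ⊗ x))) (*-zeroˡ (radon κ x′ x))))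
        ; (no ne) → trans (sym (∑-scale m ne λ m′ → ∑[ c ] φ c m * κ (inv m ⊗ ((y ⊝ m′ ⊗ x′) ⊝ c)) (inv m ⊗ m′)))
            (trans (∑-cong λ μ → trans (sym (∑-line m y ne λ c → φ c m * κ (inv m ⊗ ((y ⊝ m ⊗ μ ⊗ x′) ⊝ c)) (inv m ⊗ (m ⊗ μ))))
              (∑-cong λ x → cong₂ (λ u v → φ (y ⊝ m ⊗ x) m * κ u v)
                (trans (cong (inv m ⊗_) (solveᶠ 5 (λ y m μ x′ x → y :⊝ m :⊗ μ :⊗ x′ :⊝ (y :⊝ m :⊗ x) :≡ m :⊗ (x :⊝ μ :⊗ x′)) refl y m μ x′ x)) (⊗-cancelˡ-inv m _ ne)) (⊗-cancelˡ-inv m μ ne)))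
            (trans (∑-swap λ μ x → φ (y ⊝ m ⊗ x) m * κ (x ⊝ μ ⊗ x′) μ) (∑-cong λ x → ∑-*ˡ (φ (y ⊝ m ⊗ x) m) λ μ → κ (x ⊝ μ ⊗ x′) μ))) }

    total-conv : total η ≡ total κ * total φ
    total-conv = trans (sym (∑-radonʸ η 𝟘)) (trans (∑-cong λ y → radon-conv 𝟘 y) (trans (∑-swap λ y x → radon κ 𝟘 x * radon φ x y)
      (trans (∑-cong λ x → trans (∑-*ˡ (radon κ 𝟘 x) (radon φ x)) (cong (radon κ 𝟘 x *_) (∑-radonʸ φ x))) (trans (∑-*ʳ (total φ) (radon κ 𝟘)) (cong (_* total φ) (∑-radonʸ κ 𝟘))))))

    -- This removes the trivial representation from `radon-conv`: the subtracted constants match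
    -- because `total` is multiplicative, the rows of `radon κ` sum to `total κ`, and the columns of
    -- `radon φ` sum to `total φ`.
    radon₀-conv : ∀ x′ y → N * radon₀ η x′ y ≡ (∑[ x ] radon₀ κ x′ x * radon₀ φ x y)
    radon₀-conv x′ y = trans (trans (cong₂ (λ u v → N * (N * u - v)) (radon-conv x′ y) total-conv) (regroup N _ (total κ) (total φ)))
      (sym (trans (∑-cong λ x → expand N (radon κ x′ x) (radon φ x y) (total κ) (total φ)) (trans (∑-+ (λ x → N * N * (radon κ x′ x * radon φ x y)) (λ x → (- (N * total φ)) * radon κ x′ x + ((- (N * total κ)) * radon φ x y + total κ * total φ)))
        (cong₂ _+_ (∑-*ˡ (N * N) λ x → radon κ x′ x * radon φ x y) (trans (∑-+ (λ x → (- (N * total φ)) * radon κ x′ x) (λ x → (- (N * total κ)) * radon φ x y + total κ * total φ))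
          (cong₂ _+_ (trans (∑-*ˡ (- (N * total φ)) (radon κ x′)) (cong (- (N * total φ) *_) (∑-radonʸ κ x′))) (trans (∑-+ (λ x → (- (N * total κ)) * radon φ x y) (λ _ → total κ * total φ))
            (cong₂ _+_ (trans (∑-*ˡ (- (N * total κ)) λ x → radon φ x y) (cong (- (N * total κ) *_) (∑-radonˣ φ φ0 y))) (∑-const n (total κ * total φ))))))))))
      where
      expand = solve 5 (λ N a b s t → (N :* a :- s) :* (N :* b :- t)
        := N :* N :* (a :* b) :+ ((:- (N :* t)) :* a :+ ((:- (N :* s)) :* b :+ s :* t))) refl
      regroup = solve 4 (λ N X s t → N :* (N :* X :- s :* t) := N :* N :* X :+ ((:- (N :* t)) :* s :+ ((:- (N :* s)) :* t :+ N :* (s :* t)))) refl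

    -- n times the inner product of φ and η after both are made orthogonal to the functions of the
    -- slope alone; by `plancherel₀` this is the part seen by the centred transform.
    cross : ℚ
    cross = N * (∑[ m ] ∑[ c ] φ c m * η c m) - (∑[ m ] slopeSum φ m * slopeSum η m)

    -- The inner product is read as the pairing of `radon₀ κ` with the Gram matrix of `radon₀ φ`.
    -- Cauchy-Schwarz then asks only for the Hilbert-Schmidt norm of an n × n matrix, whose square,
    -- once the scaling by n is undone, is smaller by a factor n than for convolution acting on
    -- functions of lines.
    cross-sq : sq (N * N * N * cross) ≤ (N * N * (N * lineNorm κ)) * sq (N * N * (N * lineNorm φ))
    cross-sq = ≤-trans (≤-eq (cong sq as-trace)) (≤-trans (cauchy-schwarz₂ (radon₀ κ) gram)
      (*-mono (‖‖²₂≥0 (radon₀ κ)) (sq≥0 (N * N * (N * lineNorm φ))) (radon₀-norm κ) (≤-trans gram-norm (*-mono (‖‖²₂≥0 (radon₀ φ)) P≥0 (radon₀-norm φ) (radon₀-norm φ)))))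
      where
      P≥0 : 0ℚ ≤ N * N * (N * lineNorm φ)
      P≥0 = *-≥0 (*-≥0 (#≥0 n) (#≥0 n)) (*-≥0 (#≥0 n) (∑-≥0 λ m → ∑-≥0 λ c → sq≥0 (φ c m)))
      gram : Fin n → Fin n → ℚ
      gram x′ x = ∑[ y ] radon₀ φ x′ y * radon₀ φ x y
      gram-norm : ‖ gram ‖²₂ ≤ sq ‖ radon₀ φ ‖²₂
      gram-norm = ≤-trans (∑-mono λ x′ → ∑-mono λ x → cauchy-schwarz (radon₀ φ x′) (radon₀ φ x)) (≤-eq (sym (∑-* (λ x′ → ‖ radon₀ φ x′ ‖²) (λ x → ‖ radon₀ φ x ‖²))))
      as-trace : N * N * N * cross ≡ (∑[ x′ ] ∑[ x ] radon₀ κ x′ x * gram x′ x)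
      as-trace = trans (regroup N cross) (trans (cong (N *_) (sym (plancherel₀ φ η))) (trans (sym (trans (∑-cong λ x′ → ∑-*ˡ N λ y → radon₀ φ x′ y * radon₀ η x′ y) (∑-*ˡ N λ x′ → ∑[ y ] radon₀ φ x′ y * radon₀ η x′ y)))
        (∑-cong λ x′ → trans (∑-cong λ y → trans (pull N (radon₀ φ x′ y) (radon₀ η x′ y)) (trans (cong (radon₀ φ x′ y *_) (radon₀-conv x′ y)) (sym (∑-*ˡ (radon₀ φ x′ y) λ x → radon₀ κ x′ x * radon₀ φ x y))))
          (trans (∑-swap λ y x → radon₀ φ x′ y * (radon₀ κ x′ x * radon₀ φ x y)) (∑-cong λ x → trans (∑-cong λ y → pull (radon₀ φ x′ y) (radon₀ κ x′ x) (radon₀ φ x y)) (∑-*ˡ (radon₀ κ x′ x) λ y → radon₀ φ x′ y * radon₀ φ x y))))))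
        where
        regroup = solve 2 (λ N X → N :* N :* N :* X := N :* (N :* N :* X)) refl
        pull = solve 3 (λ a b c → a :* (b :* c) := b :* (a :* c)) refl

-- Norm bound for the cross-ratio form

module CrossRatioForm {n : ℕ} (F : OddField n) (χ-⊖𝟙 : Field.χ F (OddField.⊖_ F (OddField.𝟙 F)) ≡ 1ℚ) where
  open Field F
  open FieldSolver F
  open PaleyMatrix F χ-⊖𝟙
  open FourthMoment F using (0<N; rootSum; root-fourth-moment)
  open Lines F

  private
    N = # n

  -- The value of χ at the cross-ratio (k - i)(l - j) / ((l - i)(k - j)), since χ takes the same
  -- value at a product and at a quotient.
  R4 : Fin n → Fin n → Fin n → Fin n → ℚ
  R4 i j k l = S k i * S l i * (S k j * S l j)

  R4-sym : ∀ i j k l → R4 i j k l ≡ R4 k l i j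
  R4-sym i j k l = trans (cong₂ _*_ (cong₂ _*_ (S-sym k i) (S-sym l i)) (cong₂ _*_ (S-sym k j) (S-sym l j))) (sh (S i k) (S i l) (S j k) (S j l))
    where
    sh = solve 4 (λ a b c d → a :* b :* (c :* d) := a :* c :* (b :* d)) refl

  off : Fin n → ℚ
  off m = 1ℚ - δ 𝟘 m

  off-𝟘 : off 𝟘 ≡ 0ℚ
  off-𝟘 = cong (λ t → 1ℚ - t) (δ-refl 𝟘)

  off-≢ : ∀ {m} → m ≢ 𝟘 → off m ≡ 1ℚ
  off-≢ ne = cong (λ t → 1ℚ - t) (δ-≢ λ e → ne (sym e))

  off-* : ∀ m {a} → (m ≡ 𝟘 → a ≡ 0ℚ) → off m * a ≡ a
  off-* m {a} h = case m ≟ 𝟘 of λ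
    { (yes e) → trans (cong (off m *_) (h e)) (trans (*-zeroʳ (off m)) (sym (h e)))
    ; (no ne) → trans (cong (_* a) (off-≢ ne)) (*-identityˡ a) }

  off-idem : ∀ m a → off m * (off m * a) ≡ off m * a
  off-idem m a = off-* m λ { refl → trans (cong (_* a) off-𝟘) (*-zeroˡ a) }

  -- Ordered pairs (c, l) are reparametrized as lines of intercept c and slope l - c.
  ∑-lines : (G : Fin n → Fin n → ℚ) → (∑[ m ] ∑[ c ] G c (c ⊕ m)) ≡ (∑[ c ] ∑[ l ] G c l)
  ∑-lines G = trans (∑-swap λ m c → G c (c ⊕ m)) (∑-cong λ c → trans (∑-cong λ m → cong (G c) (⊕-comm c m)) (∑-shift c (G c)))

  -- The operator of the form, with the edge (c, c + m) written as the line of intercept c and slope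
  -- m. The factor `off` discards slope zero, which is a degenerate edge.
  R-op : LineFun → LineFun
  R-op φ c m = off m * (∑[ m₁ ] ∑[ c₁ ] φ c₁ m₁ * R4 c₁ (c₁ ⊕ m₁) c (c ⊕ m))

  -- The symmetry of `R4` moves the operator to the other side; the factor `off` disappears against
  -- φ, which vanishes at slope zero.
  R-op-adjoint : ∀ (φ ψ : LineFun) → (∀ c → φ c 𝟘 ≡ 0ℚ) → (∑[ m ] ∑[ c ] φ c m * R-op ψ c m) ≡
    (∑[ m ] ∑[ c ] ψ c m * (∑[ m₁ ] ∑[ c₁ ] φ c₁ m₁ * R4 c₁ (c₁ ⊕ m₁) c (c ⊕ m)))
  R-op-adjoint φ ψ φ0 = trans (∑-cong₂ λ m c → trans (pull (φ c m) (off m) _) (off-* m λ { refl → ≡0-* (∑[ m₁ ] ∑[ c₁ ] ψ c₁ m₁ * R4 c₁ (c₁ ⊕ m₁) c (c ⊕ 𝟘)) (φ0 c) }))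
    (trans (∑-cong₂ λ m c → trans (sym (∑-*ˡ (φ c m) λ m₁ → ∑[ c₁ ] ψ c₁ m₁ * R4 c₁ (c₁ ⊕ m₁) c (c ⊕ m))) (∑-cong λ m₁ → sym (∑-*ˡ (φ c m) λ c₁ → ψ c₁ m₁ * R4 c₁ (c₁ ⊕ m₁) c (c ⊕ m))))
    (trans (L-∑ (∑²-linear {n} {n}) λ (m , c) m₁ → ∑[ c₁ ] φ c m * (ψ c₁ m₁ * R4 c₁ (c₁ ⊕ m₁) c (c ⊕ m))) (∑-cong λ m₁ →
     trans (L-∑ (∑²-linear {n} {n}) λ (m , c) c₁ → φ c m * (ψ c₁ m₁ * R4 c₁ (c₁ ⊕ m₁) c (c ⊕ m))) (∑-cong λ c₁ →
     trans (∑-cong λ m → trans (∑-cong λ c → trans (pull (φ c m) (ψ c₁ m₁) (R4 c₁ (c₁ ⊕ m₁) c (c ⊕ m))) (cong (λ t → ψ c₁ m₁ * (φ c m * t)) (R4-sym c₁ (c₁ ⊕ m₁) c (c ⊕ m)))) (∑-*ˡ (ψ c₁ m₁) λ c → φ c m * R4 c (c ⊕ m) c₁ (c₁ ⊕ m₁)))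
       (∑-*ˡ (ψ c₁ m₁) λ m → ∑[ c ] φ c m * R4 c (c ⊕ m) c₁ (c₁ ⊕ m₁))))))
    where
    pull = solve 3 (λ a b c → a :* (b :* c) := b :* (a :* c)) refl

  -- By translation invariance the position c₁ drops out, so `R-op` acts on slope sums through
  -- `slopeKernel` alone.
  ∑-R4 : ∀ c₁ m₁ m → (∑[ c ] R4 c₁ (c₁ ⊕ m₁) c (c ⊕ m)) ≡ slopeKernel m m₁
  ∑-R4 c₁ m₁ m = trans (∑-cong λ c → trans (cong₂ (λ u v → S c c₁ * u * v) (cong χ (solveᶠ 3 (λ c m d → c :⊕ m :⊝ d :≡ c :⊝ d :⊕ m) refl c m c₁))
      (cong₂ (λ u v → χ u * χ v) (solveᶠ 3 (λ c d e → c :⊝ (d :⊕ e) :≡ c :⊝ d :⊝ e) refl c c₁ m₁) (solveᶠ 4 (λ c m d e → c :⊕ m :⊝ (d :⊕ e) :≡ c :⊝ d :⊕ m :⊝ e) refl c m c₁ m₁)))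
      (sh (S c c₁) (χ (c ⊝ c₁ ⊕ m)) (χ (c ⊝ c₁ ⊝ m₁)) (χ (c ⊝ c₁ ⊕ m ⊝ m₁))))
    (∑-unshift c₁ λ w → χ w * χ (w ⊝ m₁) * (χ (w ⊕ m) * χ (w ⊕ m ⊝ m₁)))
    where
    sh = solve 4 (λ a b c d → a :* b :* (c :* d) := a :* c :* (b :* d)) refl

  slope-R-op : ∀ φ m → slopeSum (R-op φ) m ≡ off m * (∑[ m₁ ] slopeSum φ m₁ * slopeKernel m₁ m)
  slope-R-op φ m = trans (∑-*ˡ (off m) λ c → ∑[ m₁ ] ∑[ c₁ ] φ c₁ m₁ * R4 c₁ (c₁ ⊕ m₁) c (c ⊕ m)) (cong (off m *_) (trans (∑-swap λ c m₁ → ∑[ c₁ ] φ c₁ m₁ * R4 c₁ (c₁ ⊕ m₁) c (c ⊕ m))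
    (∑-cong λ m₁ → trans (∑-swap λ c c₁ → φ c₁ m₁ * R4 c₁ (c₁ ⊕ m₁) c (c ⊕ m)) (trans (∑-cong λ c₁ → trans (∑-*ˡ (φ c₁ m₁) λ c → R4 c₁ (c₁ ⊕ m₁) c (c ⊕ m)) (cong (φ c₁ m₁ *_) (trans (∑-R4 c₁ m₁ m) (slopeKernel-sym m m₁))))
      (∑-*ʳ (slopeKernel m₁ m) λ c₁ → φ c₁ m₁)))))

  product : N⁴ n → Fin n → ℚ
  product (i , j , k , l) x = χ (x ⊝ i) * (χ (x ⊝ j) * (χ (x ⊝ k) * χ (x ⊝ l)))

  -- Sum of `product τ k * product τ l` over k ≠ l: an entry of the kernel of the squared operator.
  H : N⁴ n → ℚ
  H τ = sq (rootSum τ) - ‖ product τ ‖²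

  R4-square : ∀ i j i′ j′ → (∑[ k ] ∑[ l ] (1ℚ - δ k l) * (R4 i j k l * R4 i′ j′ k l)) ≡ H (i , j , i′ , j′)
  R4-square i j i′ j′ = trans (∑-cong λ k → trans (∑-cong λ l → trans (cong ((1ℚ - δ k l) *_) (sh (S k i) (S l i) (S k j) (S l j) (S k i′) (S l i′) (S k j′) (S l j′))) (dist (δ k l) (P k) (P l)))
      (trans (∑-minus (λ l → P k * P l) (λ l → δ k l * (P k * P l))) (cong₂ _-_ (∑-*ˡ (P k) P) (∑-δˡ k λ l → P k * P l))))
    (trans (∑-minus (λ k → P k * ∑ P) (λ k → P k * P k)) (cong (_- ‖ P ‖²) (∑-*ʳ (∑ P) P)))
    where
    P : Fin n → ℚ
    P = product (i , j , i′ , j′)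
    sh = solve 8 (λ a b c d e f g h → a :* b :* (c :* d) :* (e :* f :* (g :* h)) := a :* (c :* (e :* g)) :* (b :* (d :* (f :* h)))) refl
    dist = solve 3 (λ d p q → (con 1ℚ :- d) :* (p :* q) := p :* q :- d :* (p :* q)) refl

  product-affine : ∀ c m → m ≢ 𝟘 → ∀ i j k l x → product (c ⊕ m ⊗ i , c ⊕ m ⊗ j , c ⊕ m ⊗ k , c ⊕ m ⊗ l) (c ⊕ m ⊗ x) ≡ product (i , j , k , l) x
  product-affine c m ne i j k l x = trans (cong₂ _*_ (factor i) (cong₂ _*_ (factor j) (cong₂ _*_ (factor k) (factor l))))
    (trans (sh (χ m) (χ (x ⊝ i)) (χ (x ⊝ j)) (χ (x ⊝ k)) (χ (x ⊝ l))) (trans (cong (λ t → t * t * product (i , j , k , l) x) (χ-sq ne)) (*-identityˡ (product (i , j , k , l) x))))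
    where
    factor : ∀ i → χ ((c ⊕ m ⊗ x) ⊝ (c ⊕ m ⊗ i)) ≡ χ m * χ (x ⊝ i)
    factor i = trans (cong χ (solveᶠ 4 (λ c m x i → (c :⊕ m :⊗ x) :⊝ (c :⊕ m :⊗ i) :≡ m :⊗ (x :⊝ i)) refl c m x i)) (χ-⊗ m (x ⊝ i))
    sh = solve 5 (λ m a b c d → m :* a :* (m :* b :* (m :* c :* (m :* d))) := m :* m :* (m :* m) :* (a :* (b :* (c :* d)))) refl

  -- Each of the four factors picks up χ(m), and χ(m)⁴ = 1. This invariance is what makes the square
  -- of `R-op` a convolution over the affine group.
  H-affine : ∀ c m → m ≢ 𝟘 → ∀ i j k l → H (c ⊕ m ⊗ i , c ⊕ m ⊗ j , c ⊕ m ⊗ k , c ⊕ m ⊗ l) ≡ H (i , j , k , l)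
  H-affine c m ne i j k l = cong₂ (λ u v → u * u - v)
    (trans (sym (∑-affine m c ne (product τ))) (∑-cong (product-affine c m ne i j k l)))
    (trans (sym (∑-affine m c ne λ x → sq (product τ x))) (∑-cong λ x → cong sq (product-affine c m ne i j k l x)))
    where τ = (c ⊕ m ⊗ i , c ⊕ m ⊗ j , c ⊕ m ⊗ k , c ⊕ m ⊗ l)

  -- Values of `H` with the first edge normalized to (0, 1) by an affine map.
  κ : LineFun
  κ γ μ = off μ * H (𝟘 , 𝟙 , γ , γ ⊕ μ)

  κ-𝟘 : ∀ c → κ c 𝟘 ≡ 0ℚ
  κ-𝟘 c = trans (cong (_* H (𝟘 , 𝟙 , c , c ⊕ 𝟘)) off-𝟘) (*-zeroˡ (H (𝟘 , 𝟙 , c , c ⊕ 𝟘)))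

  affine-𝟘 : ∀ c m → c ⊕ m ⊗ 𝟘 ≡ c
  affine-𝟘 c m = trans (cong (c ⊕_) (⊗-zeroʳ m)) (⊕-identityʳ c)

  affine-𝟙 : ∀ c m → c ⊕ m ⊗ 𝟙 ≡ c ⊕ m
  affine-𝟙 c m = cong (c ⊕_) (⊗-identityʳ m)

  -- The middle edge is summed out by `R4-square`; then x ↦ (x - c)/m carries the edge (c, c + m) to
  -- (0, 1).
  R-op² : ∀ φ → (∀ c → φ c 𝟘 ≡ 0ℚ) → ∀ c′ m′ → R-op (R-op φ) c′ m′ ≡ (∑[ m ] ∑[ c ] φ c m * κ (inv m ⊗ (c′ ⊝ c)) (inv m ⊗ m′))
  R-op² φ φ0 c′ m′ = trans (cong (off m′ *_) (trans (∑-cong₂ λ m₂ c₂ → trans (reassoc (off m₂) _ (R4 c₂ (c₂ ⊕ m₂) c′ (c′ ⊕ m′)))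
        (trans (sym (∑-*ʳ (G m₂ c₂) λ m → ∑[ c ] φ c m * R4 c (c ⊕ m) c₂ (c₂ ⊕ m₂))) (∑-cong λ m → sym (∑-*ʳ (G m₂ c₂) λ c → φ c m * R4 c (c ⊕ m) c₂ (c₂ ⊕ m₂)))))
      (trans (L-∑ (∑²-linear {n} {n}) λ (m₂ , c₂) m → ∑[ c ] φ c m * R4 c (c ⊕ m) c₂ (c₂ ⊕ m₂) * G m₂ c₂) (∑-cong λ m →
       trans (L-∑ (∑²-linear {n} {n}) λ (m₂ , c₂) c → φ c m * R4 c (c ⊕ m) c₂ (c₂ ⊕ m₂) * G m₂ c₂) (∑-cong λ c → inner m c)))))
    (trans (sym (∑-*ˡ (off m′) λ m → ∑[ c ] φ c m * H (c , c ⊕ m , c′ , c′ ⊕ m′))) (∑-cong λ m → trans (sym (∑-*ˡ (off m′) λ c → φ c m * H (c , c ⊕ m , c′ , c′ ⊕ m′))) (∑-cong λ c → scaled m c)))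
    where
    G : Fin n → Fin n → ℚ
    G m₂ c₂ = off m₂ * R4 c₂ (c₂ ⊕ m₂) c′ (c′ ⊕ m′)
    reassoc = solve 3 (λ o x r → o :* x :* r := x :* (o :* r)) refl
    reassoc′ = solve 4 (λ p r o q → p :* r :* (o :* q) := p :* (o :* (r :* q))) refl
    pull = solve 3 (λ a b c → a :* (b :* c) := b :* (a :* c)) refl
    off-line : ∀ m₂ c₂ → off m₂ ≡ 1ℚ - δ c₂ (c₂ ⊕ m₂)
    off-line m₂ c₂ = cong (λ t → 1ℚ - t) (δ-⇔ (λ e → trans (sym (⊕-identityʳ c₂)) (cong (c₂ ⊕_) e))
      (λ e → trans (sym (⊝-self c₂)) (trans (cong (_⊝ c₂) e) (solveᶠ 2 (λ c m → c :⊕ m :⊝ c :≡ m) refl c₂ m₂))))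
    inner : ∀ m c → (∑[ m₂ ] ∑[ c₂ ] φ c m * R4 c (c ⊕ m) c₂ (c₂ ⊕ m₂) * G m₂ c₂) ≡ φ c m * H (c , c ⊕ m , c′ , c′ ⊕ m′)
    inner m c = trans (∑-cong λ m₂ → trans (∑-cong λ c₂ → trans (reassoc′ (φ c m) _ (off m₂) _) (cong (φ c m *_) (cong₂ _*_ (off-line m₂ c₂) (cong (R4 c (c ⊕ m) c₂ (c₂ ⊕ m₂) *_) (R4-sym c₂ (c₂ ⊕ m₂) c′ (c′ ⊕ m′))))))
        (∑-*ˡ (φ c m) λ c₂ → Q c₂ (c₂ ⊕ m₂)))
      (trans (∑-*ˡ (φ c m) λ m₂ → ∑[ c₂ ] Q c₂ (c₂ ⊕ m₂)) (cong (φ c m *_) (trans (∑-lines Q) (R4-square c (c ⊕ m) c′ (c′ ⊕ m′)))))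
      where
      Q : Fin n → Fin n → ℚ
      Q k l = (1ℚ - δ k l) * (R4 c (c ⊕ m) k l * R4 c′ (c′ ⊕ m′) k l)
    scaled : ∀ m c → off m′ * (φ c m * H (c , c ⊕ m , c′ , c′ ⊕ m′)) ≡ φ c m * κ (inv m ⊗ (c′ ⊝ c)) (inv m ⊗ m′)
    scaled m c = case m ≟ 𝟘 of λ
      { (yes refl) → trans (pull (off m′) (φ c 𝟘) _) (trans (cong₂ _*_ (φ0 c) refl) (trans (*-zeroˡ (off m′ * H (c , c ⊕ 𝟘 , c′ , c′ ⊕ m′))) (sym (trans (cong (_* κ (inv 𝟘 ⊗ (c′ ⊝ c)) (inv 𝟘 ⊗ m′)) (φ0 c)) (*-zeroˡ (κ (inv 𝟘 ⊗ (c′ ⊝ c)) (inv 𝟘 ⊗ m′)))))))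
      ; (no ne) → trans (pull (off m′) (φ c m) _) (cong (φ c m *_) (cong₂ _*_
          (cong (λ t → 1ℚ - t) (δ-⇔ (λ e → trans (sym (⊗-zeroʳ (inv m))) (cong (inv m ⊗_) e)) (λ e → ⊗-cancelˡ (inv m) (inv-≢𝟘 ne) (trans (⊗-zeroʳ (inv m)) e))))
          (sym (trans (sym (H-affine c m ne 𝟘 𝟙 (inv m ⊗ (c′ ⊝ c)) (inv m ⊗ (c′ ⊝ c) ⊕ inv m ⊗ m′)))
            (cong H (cong₂ _,_ (affine-𝟘 c m) (cong₂ _,_ (affine-𝟙 c m) (cong₂ _,_ (γ-eq c m ne) (δ-eq c m ne))))))))) }
      where
      γ-eq : ∀ c m → m ≢ 𝟘 → c ⊕ m ⊗ (inv m ⊗ (c′ ⊝ c)) ≡ c′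
      γ-eq c m ne = trans (cong (c ⊕_) (⊗-cancelˡ-inv′ m (c′ ⊝ c) ne)) (solveᶠ 2 (λ c d → c :⊕ (d :⊝ c) :≡ d) refl c c′)
      δ-eq : ∀ c m → m ≢ 𝟘 → c ⊕ m ⊗ (inv m ⊗ (c′ ⊝ c) ⊕ inv m ⊗ m′) ≡ c′ ⊕ m′
      δ-eq c m ne = trans (solveᶠ 4 (λ c m u v → c :⊕ m :⊗ (u :⊕ v) :≡ c :⊕ m :⊗ u :⊕ m :⊗ v) refl c m (inv m ⊗ (c′ ⊝ c)) (inv m ⊗ m′)) (cong₂ _⊕_ (γ-eq c m ne) (⊗-cancelˡ-inv′ m m′ ne))

  private
    product-sq≤1 : ∀ τ x → sq (product τ x) ≤ 1ℚ
    product-sq≤1 (i , j , k , l) x = sq-*≤1 (χ (x ⊝ i)) _ (χ-sq≤1 (x ⊝ i)) (sq-*≤1 (χ (x ⊝ j)) _ (χ-sq≤1 (x ⊝ j)) (sq-*≤1 (χ (x ⊝ k)) _ (χ-sq≤1 (x ⊝ k)) (χ-sq≤1 (x ⊝ l))))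
      where
      sh = solve 2 (λ a b → a :* a :* (b :* b) := a :* b :* (a :* b)) refl
      sq-*≤1 : ∀ a b → sq a ≤ 1ℚ → sq b ≤ 1ℚ → sq (a * b) ≤ 1ℚ
      sq-*≤1 a b p q = subst (_≤ 1ℚ) (sh a b) (*-mono (sq≥0 a) 0≤1 p q)

    -- For a, b ≥ 0 one has (a - b)² ≤ a² + b²; here b is a sum of n squares, each at most 1.
    H-sq : ∀ τ → sq (H τ) ≤ pow4 (rootSum τ) + N * N
    H-sq τ = ≤-trans (≤-by (*-≥0 (#≥0 2) (*-≥0 (sq≥0 (rootSum τ)) B≥0)) (l (rootSum τ) ‖ product τ ‖²)) (+-monoʳ-≤ (pow4 (rootSum τ)) (*-mono B≥0 N≥0 B≤N B≤N))
      where
      B≥0 = ‖‖²≥0 (product τ)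
      B≤N : ‖ product τ ‖² ≤ N
      B≤N = ≤-trans (∑-mono (product-sq≤1 τ)) (≤-eq (trans (∑-const n 1ℚ) (*-identityʳ N)))
      l = solve 2 (λ a b → a :* (a :* (a :* a)) :+ b :* b := (a :* a :- b) :* (a :* a :- b) :+ :# 2 :* (a :* a :* b)) refl

    ∑-H-sq : ∑⁴ (λ τ → sq (H τ)) ≤ # 769 * (N * N * N * N * N * N)
    ∑-H-sq = ≤-trans (L4.L-mono H-sq) (≤-trans (≤-eq (trans (L4.L-+ (λ τ → pow4 (rootSum τ)) (λ _ → N * N)) (cong (∑⁴ (λ τ → pow4 (rootSum τ)) +_) (∑⁴-const n (N * N)))))
      (≤-trans (+-monoˡ-≤ (N * (N * (N * (N * (N * N))))) root-fourth-moment) (≤-eq (l N))))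
      where
      module L4 = Linear (∑⁴-linear {n})
      l = solve 1 (λ N → :# 768 :* (N :* N :* N :* N :* N :* N) :+ N :* (N :* (N :* (N :* (N :* N)))) := :# 769 :* (N :* N :* N :* N :* N :* N)) refl

    -- By `H-affine` every nondegenerate first edge sees the same sum of squares, so the norm of κ
    -- can be averaged over all such edges and compared with a sum over all quadruples.
    κ-slice : ∀ m c → off m * lineNorm κ ≤ (∑[ k ] ∑[ l ] sq (H (c , c ⊕ m , k , l)))
    κ-slice m c = case m ≟ 𝟘 of λ
      { (yes refl) → ≤-trans (≤-eq (trans (cong (_* lineNorm κ) off-𝟘) (*-zeroˡ (lineNorm κ)))) (∑-≥0 λ k → ∑-≥0 λ l → sq≥0 (H (c , c ⊕ 𝟘 , k , l)))
      ; (no ne) → ≤-trans (≤-eq (trans (cong (_* lineNorm κ) (off-≢ ne)) (*-identityˡ (lineNorm κ)))) (≤-trans (∑-mono λ μ → ∑-mono λ γ → κ-sq γ μ) (≤-eq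
          (trans (∑-lines λ k l → sq (H (𝟘 , 𝟙 , k , l))) (trans (∑-cong₂ λ k l → cong sq (trans (sym (H-affine c m ne 𝟘 𝟙 k l)) (cong H (cong₂ _,_ (affine-𝟘 c m) (cong (_, (c ⊕ m ⊗ k , c ⊕ m ⊗ l)) (affine-𝟙 c m))))))
            (trans (∑-cong λ k → ∑-affine m c ne λ l → sq (H (c , c ⊕ m , c ⊕ m ⊗ k , l))) (∑-affine m c ne λ k → ∑[ l ] sq (H (c , c ⊕ m , k , l)))))))) }
      where
      κ-sq : ∀ γ μ → κ γ μ * κ γ μ ≤ sq (H (𝟘 , 𝟙 , γ , γ ⊕ μ))
      κ-sq γ μ = case μ ≟ 𝟘 of λ
        { (yes refl) → ≤-trans (≤-eq (trans (cong₂ _*_ (κ-𝟘 γ) (κ-𝟘 γ)) refl)) (sq≥0 (H (𝟘 , 𝟙 , γ , γ ⊕ 𝟘)))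
        ; (no ne) → ≤-eq (cong (λ t → t * t) (trans (cong (_* H (𝟘 , 𝟙 , γ , γ ⊕ μ)) (off-≢ ne)) (*-identityˡ (H (𝟘 , 𝟙 , γ , γ ⊕ μ))))) }

  -- There are n(n - 1) ≥ n²/2 nondegenerate edges, hence 1538 = 2 · 769.
  κ-norm : # 2 ≤ N → lineNorm κ ≤ # 1538 * (N * N * N * N)
  κ-norm 2≤N = cancel-≤ (N * N) (*->0 0<N 0<N) (≤-trans (≤-by (*-≥0 (*-≥0 N≥0 (diff≥0 2≤N)) K≥0) (l₁ N (lineNorm κ))) (≤-trans (*-monoˡ (# 2) (#≥0 2) weighted) (≤-eq (l₂ N))))
    where
    K≥0 : 0ℚ ≤ lineNorm κ
    K≥0 = ∑-≥0 λ m → ∑-≥0 λ c → sq≥0 (κ c m)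
    l₁ = solve 2 (λ N K → :# 2 :* ((N :* con 1ℚ :- con 1ℚ) :* (N :* K)) := N :* N :* K :+ N :* (N :- :# 2) :* K) refl
    l₂ = solve 1 (λ N → :# 2 :* (:# 769 :* (N :* N :* N :* N :* N :* N)) := N :* N :* (:# 1538 :* (N :* N :* N :* N))) refl
    ∑-off : ∑ off ≡ N * 1ℚ - 1ℚ
    ∑-off = trans (∑-minus (λ _ → 1ℚ) (δ 𝟘)) (cong₂ _-_ (∑-const n 1ℚ) (∑-δ 𝟘))
    weighted : (N * 1ℚ - 1ℚ) * (N * lineNorm κ) ≤ # 769 * (N * N * N * N * N * N)
    weighted = ≤-trans (≤-eq (sym (trans (∑-cong λ m → trans (∑-const n (off m * lineNorm κ)) (p N (off m) (lineNorm κ))) (trans (∑-*ʳ (N * lineNorm κ) off) (cong (_* (N * lineNorm κ)) ∑-off)))))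
      (≤-trans (∑-mono λ m → ∑-mono λ c → κ-slice m c) (≤-trans (≤-eq (∑-lines λ c j → ∑[ k ] ∑[ l ] sq (H (c , j , k , l)))) ∑-H-sq))
      where
      p = solve 3 (λ N o K → N :* (o :* K) := o :* (N :* K)) refl

  module _ (φ : LineFun) (φ0 : ∀ c → φ c 𝟘 ≡ 0ℚ) where
    private
      h : LineFun
      h = R-op φ
      s : Fin n → ℚ
      s = slopeSum φ
      s0 : s 𝟘 ≡ 0ℚ
      s0 = ∑-≡0 φ0
      X : LineFun
      X c m = ∑[ m₁ ] ∑[ c₁ ] φ c₁ m₁ * R4 c₁ (c₁ ⊕ m₁) c (c ⊕ m)
      K : Fin n → ℚ
      K m = ∑[ m₁ ] s m₁ * slopeKernel m₁ m
    open Convolution κ φ (R-op h) κ-𝟘 φ0 (R-op² φ φ0)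

    private
      off-sq : ∀ m x → off m * x * x ≡ off m * x * (off m * x)
      off-sq m x = trans (cong (_* x) (sym (off-idem m x))) (l (off m) x)
        where
        l = solve 2 (λ o x → o :* (o :* x) :* x := o :* x :* (o :* x)) refl

      energy : (∑[ m ] ∑[ c ] φ c m * R-op h c m) ≡ lineNorm h
      energy = trans (R-op-adjoint φ h φ0) (∑-cong₂ λ m c → off-sq m (X c m))

      -- `R-op` acts on slope sums by a symmetric kernel, so applying it twice and pairing with s
      -- gives a squared norm, which `slopeKernel-norm` controls.
      slopes : (∑[ m ] s m * slopeSum (R-op h) m) ≤ # 10 * (N * N * (N * lineNorm φ))
      slopes = ≤-trans (≤-eq e) (≤-trans (slopeKernel-norm s s0) (*-monoˡ (# 10) (#≥0 10) (*-monoˡ (N * N) (*-≥0 N≥0 N≥0) (≤-trans (∑-mono λ m → ∑-sq≤ λ c → φ c m) (≤-eq (∑-*ˡ N λ m → ‖ (λ c → φ c m) ‖²))))))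
        where
        pull = solve 3 (λ a b c → a :* (b :* c) := b :* (a :* c)) refl
        e : (∑[ m ] s m * slopeSum (R-op h) m) ≡ (∑[ m ] sq (off m * K m))
        e = trans (∑-cong λ m → trans (cong (s m *_) (slope-R-op h m)) (trans (pull (s m) (off m) (∑[ m₁ ] slopeSum h m₁ * slopeKernel m₁ m)) (off-* m λ { refl → ≡0-* (∑[ m₁ ] slopeSum h m₁ * slopeKernel m₁ 𝟘) s0 })))
          (trans (∑-cong λ m → sym (∑-*ˡ (s m) λ m₁ → slopeSum h m₁ * slopeKernel m₁ m)) (trans (∑-swap λ m m₁ → s m * (slopeSum h m₁ * slopeKernel m₁ m))
          (∑-cong λ m₁ → trans (∑-cong λ m → trans (pull (s m) (slopeSum h m₁) _) (cong (λ t → slopeSum h m₁ * (s m * t)) (slopeKernel-sym m₁ m))) (trans (∑-*ˡ (slopeSum h m₁) λ m → s m * slopeKernel m m₁)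
            (trans (cong (_* K m₁) (slope-R-op φ m₁)) (off-sq m₁ (K m₁)))))))

    -- `energy` identifies ‖Rφ‖² with ⟨φ, R²φ⟩, and n times this is `cross` plus the slope term. By
    -- `κ-norm` and `cross-sq` the first is at most n y ‖φ‖² whenever y² ≥ 1538 n⁵, so the operator
    -- norm is of order n^(5/4).
    R-op-norm : # 2 ≤ N → ∀ y → 0ℚ ≤ y → # 1538 * (N * N * N * N * N) ≤ sq y → lineNorm (R-op φ) ≤ (y + # 10 * (N * N)) * lineNorm φ
    R-op-norm 2≤N y 0≤y hy = cancel-≤ N 0<N (≤-trans (≤-eq (trans (cong (N *_) (sym energy)) (l₁ _ (∑[ m ] s m * slopeSum (R-op h) m)))) (≤-trans (+-mono-≤ cross≤ slopes) (≤-eq (l₂ N y Φ))))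
      where
      Φ : ℚ
      Φ = lineNorm φ
      Φ≥0 : 0ℚ ≤ Φ
      Φ≥0 = ∑-≥0 λ m → ∑-≥0 λ c → sq≥0 (φ c m)
      l₁ = solve 2 (λ a b → a := a :- b :+ b) refl
      l₂ = solve 3 (λ N y Φ → N :* y :* Φ :+ :# 10 :* (N :* N :* (N :* Φ)) := N :* ((y :+ :# 10 :* (N :* N)) :* Φ)) refl
      N³ : ℚ
      N³ = N * N * N
      0<N³ : 0ℚ < N³
      0<N³ = *->0 (*->0 0<N 0<N) 0<N
      cross≤ : cross ≤ N * y * Φ
      cross≤ = cancel-≤ N³ 0<N³ (sq-≤⇒≤ (*-≥0 (<⇒≤ 0<N³) (*-≥0 (*-≥0 N≥0 0≤y) Φ≥0)) (≤-trans cross-sq (≤-trans (*-mono (*-≥0 (*-≥0 N≥0 N≥0) (*-≥0 N≥0 (∑-≥0 λ m → ∑-≥0 λ c → sq≥0 (κ c m)))) (sq≥0 (N * N * (N * Φ)))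
          (*-monoˡ (N * N) (*-≥0 N≥0 N≥0) (*-monoˡ N N≥0 (κ-norm 2≤N))) ≤-refl)
        (≤-trans (≤-eq (l₃ N Φ)) (≤-trans (*-monoˡ (N * N * sq (N * N * (N * Φ))) (*-≥0 (*-≥0 N≥0 N≥0) (sq≥0 (N * N * (N * Φ)))) hy) (≤-eq (l₄ N y Φ)))))))
        where
        l₃ = solve 2 (λ N Φ → N :* N :* (N :* (:# 1538 :* (N :* N :* N :* N))) :* (N :* N :* (N :* Φ) :* (N :* N :* (N :* Φ)))
          := N :* N :* (N :* N :* (N :* Φ) :* (N :* N :* (N :* Φ))) :* (:# 1538 :* (N :* N :* N :* N :* N))) refl
        l₄ = solve 3 (λ N y Φ → N :* N :* (N :* N :* (N :* Φ) :* (N :* N :* (N :* Φ))) :* (y :* y)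
          := N :* N :* N :* (N :* y :* Φ) :* (N :* N :* N :* (N :* y :* Φ))) refl

  R-form : (Fin n → Fin n → ℚ) → ℚ
  R-form f = ∑[ k ] ∑[ l ] f k l * (∑[ i ] ∑[ j ] f i j * R4 i j k l)

  -- Cauchy-Schwarz between f and its image; the vanishing diagonal puts f on the lines of nonzero
  -- slope, where `R-op-norm` applies.
  R-form-bound : # 2 ≤ N → ∀ y → 0ℚ ≤ y → # 1538 * (N * N * N * N * N) ≤ sq y → ∀ f → (∀ i → f i i ≡ 0ℚ) →
    sq (R-form f) ≤ (y + # 10 * (N * N)) * sq ‖ f ‖²₂
  R-form-bound 2≤N y 0≤y hy f f0 = ≤-trans (≤-eq (cong sq e)) (≤-trans (L-cauchy-schwarz (∑²-linear {n} {n}) (λ (m , c) → φ c m) (λ (m , c) → R-op φ c m))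
    (≤-trans (*-monoˡ (lineNorm φ) (∑-≥0 λ m → ∑-≥0 λ c → sq≥0 (φ c m)) (R-op-norm φ φ0 2≤N y 0≤y hy)) (≤-eq (trans (l (lineNorm φ) (y + # 10 * (N * N))) (cong (λ t → (y + # 10 * (N * N)) * (t * t)) norm)))))
    where
    φ : LineFun
    φ c m = f c (c ⊕ m)
    φ0 : ∀ c → φ c 𝟘 ≡ 0ℚ
    φ0 c = trans (cong (f c) (⊕-identityʳ c)) (f0 c)
    norm : lineNorm φ ≡ ‖ f ‖²₂
    norm = ∑-lines λ c l → sq (f c l)
    l = solve 2 (λ a b → a :* (b :* a) := b :* (a :* a)) refl
    pull = solve 3 (λ a b c → a :* (b :* c) := b :* (a :* c)) refl
    e : R-form f ≡ (∑[ m ] ∑[ c ] φ c m * R-op φ c m)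
    e = trans (sym (∑-lines λ k l → f k l * (∑[ i ] ∑[ j ] f i j * R4 i j k l))) (∑-cong₂ λ m c → trans (cong (φ c m *_) (sym (∑-lines λ i j → f i j * R4 i j c (c ⊕ m))))
      (sym (trans (pull (φ c m) (off m) _) (off-* m λ { refl → ≡0-* (∑[ m₁ ] ∑[ c₁ ] φ c₁ m₁ * R4 c₁ (c₁ ⊕ m₁) c (c ⊕ 𝟘)) (φ0 c) }))))

-- Sums over pairs of edges with symmetric weights

module SymmetricForm {n : ℕ} (e : Fin n → Fin n → ℚ) (e-sym : ∀ i j → e i j ≡ e j i) where

  F4 : Set
  F4 = Fin n → Fin n → Fin n → Fin n → ℚ

  Λ : F4 → ℚ
  Λ g = ∑[ i ] ∑[ j ] ∑[ k ] ∑[ l ] e i j * e k l * g i j k l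

  module L4 = Linear (∑⁴-linear {n})

  Λ-+ : ∀ g h → Λ (λ i j k l → g i j k l + h i j k l) ≡ Λ g + Λ h
  Λ-+ g h = trans (∑-cong₂ λ i j → ∑-cong₂ λ k l → *-distribˡ-+ (e i j * e k l) (g i j k l) (h i j k l)) (L4.L-+ (λ (i , j , k , l) → e i j * e k l * g i j k l) (λ (i , j , k , l) → e i j * e k l * h i j k l))

  Λ-* : ∀ c g → Λ (λ i j k l → c * g i j k l) ≡ c * Λ g
  Λ-* c g = trans (∑-cong₂ λ i j → ∑-cong₂ λ k l → sh (e i j * e k l) c (g i j k l)) (L4.L-* c (λ (i , j , k , l) → e i j * e k l * g i j k l))
    where
    sh = solve 3 (λ e c g → e :* (c :* g) := c :* (e :* g)) refl

  Λ-cong : ∀ {g h : F4} → (∀ i j k l → g i j k l ≡ h i j k l) → Λ g ≡ Λ h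
  Λ-cong p = ∑-cong₂ λ i j → ∑-cong₂ λ k l → cong (e i j * e k l *_) (p i j k l)

  swap₁ : ∀ g → Λ (λ i j k l → g j i k l) ≡ Λ g
  swap₁ g = trans (∑-swap λ i j → ∑[ k ] ∑[ l ] e i j * e k l * g j i k l) (∑-cong₂ λ j i → ∑-cong₂ λ k l → cong (λ t → t * e k l * g j i k l) (e-sym i j))

  swap₂ : ∀ g → Λ (λ i j k l → g i j l k) ≡ Λ g
  swap₂ g = ∑-cong₂ λ i j → trans (∑-swap λ k l → e i j * e k l * g i j l k) (∑-cong₂ λ l k → cong (λ t → e i j * t * g i j l k) (e-sym k l))

  exchange : ∀ g → Λ (λ i j k l → g k l i j) ≡ Λ g
  exchange g = trans (L-∑ (∑²-linear {n} {n}) λ (i , j) k → ∑[ l ] e i j * e k l * g k l i j) (∑-cong λ k → trans (L-∑ (∑²-linear {n} {n}) λ (i , j) l → e i j * e k l * g k l i j)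
    (∑-cong λ l → ∑-cong₂ λ i j → cong (_* g k l i j) (*-comm (e i j) (e k l))))

  Λ-δδ : Λ (λ i j k l → δ i k * δ j l) ≡ ‖ e ‖²₂
  Λ-δδ = ∑-cong₂ λ i j → trans (∑-cong λ k → trans (∑-cong λ l → sh (e i j) (e k l) (δ i k) (δ j l)) (trans (∑-δˡ j λ l → δ i k * (e i j * e k l)) refl)) (∑-δˡ i λ k → e i j * e k j)
    where
    sh = solve 4 (λ a b c d → a :* b :* (c :* d) := d :* (c :* (a :* b))) refl

  -- Orbit sum under exchanging the ends of either edge; as e is symmetric, all four terms have the
  -- same `Λ`.
  lump : F4 → F4
  lump g i j k l = (g i j k l + g j i k l) + (g i j l k + g j i l k)

  Λ-lump : ∀ g → Λ (lump g) ≡ # 4 * Λ g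
  Λ-lump g = trans (Λ-+ (λ i j k l → g i j k l + g j i k l) (λ i j k l → g i j l k + g j i l k)) (trans (cong₂ _+_ half (trans (swap₂ λ i j k l → g i j k l + g j i k l) half)) (four (Λ g)))
    where
    half : Λ (λ i j k l → g i j k l + g j i k l) ≡ Λ g + Λ g
    half = trans (Λ-+ g λ i j k l → g j i k l) (cong (Λ g +_) (swap₁ g))
    four = solve 1 (λ a → a :+ a :+ (a :+ a) := :# 4 :* a) refl

  Λ-δ-edge : ∀ (g : Fin n → Fin n → ℚ) → Λ (λ i j k l → δ i k * g j l) ≡ (∑[ i ] ∑[ j ] ∑[ l ] e i j * e i l * g j l)
  Λ-δ-edge g = ∑-cong₂ λ i j → trans (∑-cong λ k → trans (∑-cong λ l → sh (e i j * e k l) (δ i k) (g j l)) (∑-*ˡ (δ i k) λ l → e i j * e k l * g j l)) (∑-δˡ i λ k → ∑[ l ] e i j * e k l * g j l)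
    where
    sh = solve 3 (λ a d s → a :* (d :* s) := d :* (a :* s)) refl

-- Edge functions: expansions in S and spectral bounds

module Edges {n : ℕ} (F : OddField n) (χ-⊖𝟙 : Field.χ F (OddField.⊖_ F (OddField.𝟙 F)) ≡ 1ℚ) where
  open PaleyMatrix F χ-⊖𝟙 public
  open CrossRatioForm F χ-⊖𝟙 public using (R-form; R4; R-form-bound)

  private
    N = # n

  -- Twice the adjacency matrix
  A₂ : Fin n → Fin n → ℚ
  A₂ i j = 1ℚ - δ i j + S i j

  A₂-sym : ∀ i j → A₂ i j ≡ A₂ j i
  A₂-sym i j = cong₂ (λ u v → 1ℚ - u + v) (δ-sym i j) (S-sym i j)

  A₂-diag : ∀ i → A₂ i i ≡ 0ℚ
  A₂-diag i = cong₂ (λ u v → 1ℚ - u + v) (δ-refl i) (S-diag i)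

  module _ (e : Fin n → Fin n → ℚ) where

    degree : Fin n → ℚ
    degree i = ∑[ j ] e i j

    -- The part of the e-weighted sum over edges in the link of i that is quadratic in `S`.
    wedge : Fin n → ℚ
    wedge i = ∑[ j ] ∑[ k ] e j k * (S i j * S i k)

    V-form : ℚ
    V-form = ∑[ i ] ∑[ j ] e i j * (∑[ k ] S j k * e i k)

    Se eS : Fin n → Fin n → ℚ
    Se k j = ∑[ i ] S k i * e i j
    eS k j = ∑[ l ] S j l * e k l

    -- Two edges ij and kl coupled through `S` along the disjoint pairs ik, jl for `Q-form`, and
    -- along the path ik, kj, jl for `P-form`; coupling along all four pairs is `R-form`.
    Q-form P-form : ℚ
    Q-form = ∑[ k ] ∑[ j ] Se k j * eS k j
    P-form = ∑[ k ] ∑[ j ] S k j * Se k j * eS k j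

    degree-norm : ‖ degree ‖² ≤ N * ‖ e ‖²₂
    degree-norm = ≤-trans (∑-mono λ i → ∑-sq≤ (e i)) (≤-eq (∑-*ˡ N λ i → ‖ e i ‖²))

    eS-norm : ‖ eS ‖²₂ ≤ N * ‖ e ‖²₂
    eS-norm = ≤-trans (∑-mono λ k → S-norm≤ (e k)) (≤-eq (∑-*ˡ N λ k → ‖ e k ‖²))

    Se-norm : ‖ Se ‖²₂ ≤ N * ‖ e ‖²₂
    Se-norm = ≤-trans (≤-eq (∑-swap λ k j → sq (Se k j))) (≤-trans (∑-mono λ j → S-norm≤ λ i → e i j) (≤-eq (trans (∑-*ˡ N λ j → ∑[ i ] sq (e i j)) (cong (N *_) (∑-swap λ j i → sq (e i j))))))

    private
      ε : ℚ
      ε = ‖ e ‖²₂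
      ε≥0 : 0ℚ ≤ ε
      ε≥0 = ‖‖²₂≥0 e
      Nε≥0 : 0ℚ ≤ N * ε
      Nε≥0 = *-≥0 N≥0 ε≥0

    S-contract : ∀ i j x → sq (S i j * x) ≤ sq x
    S-contract i j x = subst₂ _≤_ (sh (S i j) x) (*-identityˡ (sq x)) (*-mono (sq≥0 (S i j)) (sq≥0 x) (S-sq≤1 i j) ≤-refl)
      where
      sh = solve 2 (λ a b → a :* a :* (b :* b) := a :* b :* (a :* b)) refl

    Q-bound : sq Q-form ≤ sq (N * ‖ e ‖²₂)
    Q-bound = ≤-trans (cauchy-schwarz₂ Se eS) (*-mono (‖‖²₂≥0 Se) Nε≥0 Se-norm eS-norm)

    P-bound : sq P-form ≤ sq (N * ‖ e ‖²₂)
    P-bound = ≤-trans (cauchy-schwarz₂ (λ k j → S k j * Se k j) eS) (*-mono (‖‖²₂≥0 λ k j → S k j * Se k j) Nε≥0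
      (≤-trans (∑-mono λ k → ∑-mono λ j → S-contract k j (Se k j)) Se-norm) eS-norm)

    V-bound : sq V-form ≤ N * sq ‖ e ‖²₂
    V-bound = ≤-trans (cauchy-schwarz₂ e eS) (≤-trans (*-monoˡ ε ε≥0 eS-norm) (≤-eq (l ε N)))
      where
      l = solve 2 (λ e N → e :* (N :* e) := N :* (e :* e)) refl

    -- W(i) is the sum over j of `S i j * eS j i`. Cauchy-Schwarz in j costs a factor n, and
    -- `eS-norm` another.
    wedge-norm : ‖ wedge ‖² ≤ N * N * ‖ e ‖²₂
    wedge-norm = ≤-trans (∑-mono row) (≤-trans (≤-eq (trans (∑-*ˡ N λ i → ∑[ j ] sq (eS j i)) (cong (N *_) (∑-swap λ i j → sq (eS j i)))))
      (≤-trans (*-monoˡ N N≥0 eS-norm) (≤-eq (sym (*-assoc N N ε)))))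
      where
      sh = solve 3 (λ e a b → e :* (a :* b) := a :* (b :* e)) refl
      row : ∀ i → sq (wedge i) ≤ N * (∑[ j ] sq (eS j i))
      row i = ≤-trans (≤-eq (cong sq (∑-cong λ j → trans (∑-cong λ k → sh (e j k) (S i j) (S i k)) (∑-*ˡ (S i j) λ k → S i k * e j k))))
        (≤-trans (∑-sq≤ λ j → S i j * eS j i) (*-monoˡ N N≥0 (∑-mono λ j → S-contract i j (eS j i))))

  bilinear-bound : ∀ (x : Fin n → ℚ) → sq (∑[ i ] x i * (∑[ j ] S i j * x j)) ≤ N * sq ‖ x ‖²
  bilinear-bound x = ≤-trans (cauchy-schwarz x λ i → ∑[ j ] S i j * x j) (≤-trans (*-monoˡ ‖ x ‖² (‖‖²≥0 x) (S-norm≤ x)) (≤-eq (l ‖ x ‖² N)))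
    where
    l = solve 2 (λ e N → e :* (N :* e) := N :* (e :* e)) refl

  record IsEdgeFun (e : Fin n → Fin n → ℚ) : Set where
    field
      e-sym : ∀ i j → e i j ≡ e j i
      e-supp : ∀ i j → S i j ≡ 1ℚ ⊎ e i j ≡ 0ℚ

  module EdgeFun {e : Fin n → Fin n → ℚ} (isEdgeFun : IsEdgeFun e) where
    open IsEdgeFun isEdgeFun

    e-diag : ∀ i → e i i ≡ 0ℚ
    e-diag i with e-supp i i
    ... | inj₂ p = p
    ... | inj₁ p = contradiction (trans (sym (S-diag i)) p) λ ()

    S-e : ∀ i j → S i j * e i j ≡ e i j
    S-e i j with e-supp i j
    ... | inj₁ p = trans (cong (_* e i j) p) (*-identityˡ (e i j))
    ... | inj₂ p = trans (cong (S i j *_) p) (trans (*-zeroʳ (S i j)) (sym p))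

    private
      r W : Fin n → ℚ
      r = degree e
      W = wedge e
      E ε V : ℚ
      E = ∑ r
      ε = ‖ e ‖²₂
      V = V-form e
      module L2 = Linear (∑²-linear {n} {n})

    -- A₂ = 1 - δ + S is expanded in both factors; since e lives where S = 1, every diagonal
    -- correction collapses to a multiple of the degree.
    ∑-edges-in-link : ∀ i → (∑[ j ] ∑[ k ] A₂ i j * A₂ i k * e j k) ≡ E - # 4 * r i + # 2 * (∑[ j ] S i j * r j) + W i
    ∑-edges-in-link i = trans (∑-cong₂ λ j k → expand (S i j) (S i k) (δ i j) (δ i k) (e j k))
      (trans (L2.L-+ (λ (j , k) → e j k + S i j * e j k + S i k * e j k + e j k * (S i j * S i k)) (λ (j , k) → δ i j * (δ i k * e j k - (1ℚ + S i k) * e j k) - δ i k * ((1ℚ + S i j) * e j k)))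
      (trans (cong₂ _+_ plain corr) (collect E (∑[ j ] S i j * r j) (W i) (r i))))
      where
      expand = solve 5 (λ a b d c e → (con 1ℚ :- d :+ a) :* (con 1ℚ :- c :+ b) :* e
        := e :+ a :* e :+ b :* e :+ e :* (a :* b) :+ (d :* (c :* e :- (con 1ℚ :+ b) :* e) :- c :* ((con 1ℚ :+ a) :* e))) refl
      collect = solve 4 (λ E s W r → E :+ s :+ s :+ W :+ (con 0ℚ :- (r :+ r) :- (r :+ r)) := E :- :# 4 :* r :+ :# 2 :* s :+ W) refl
      s : ℚ
      s = ∑[ j ] S i j * r j
      plain : (∑[ j ] ∑[ k ] (e j k + S i j * e j k + S i k * e j k + e j k * (S i j * S i k))) ≡ E + s + s + W i
      plain = trans (L2.L-+ (λ (j , k) → e j k + S i j * e j k + S i k * e j k) (λ (j , k) → e j k * (S i j * S i k))) (cong (_+ W i)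
        (trans (L2.L-+ (λ (j , k) → e j k + S i j * e j k) (λ (j , k) → S i k * e j k)) (cong₂ _+_
          (trans (L2.L-+ (λ (j , k) → e j k) (λ (j , k) → S i j * e j k)) (cong (E +_) (∑-cong λ j → ∑-*ˡ (S i j) (e j))))
          (trans (∑-swap λ j k → S i k * e j k) (∑-cong λ k → trans (∑-*ˡ (S i k) λ j → e j k) (cong (S i k *_) (∑-cong λ j → e-sym j k)))))))
      deg2 : (∑[ k ] (1ℚ + S i k) * e i k) ≡ r i + r i
      deg2 = trans (∑-cong λ k → trans (l (S i k) (e i k)) (cong (e i k +_) (S-e i k))) (∑-+ (e i) (e i))
        where
        l = solve 2 (λ s e → (con 1ℚ :+ s) :* e := e :+ s :* e) refl
      corr : (∑[ j ] ∑[ k ] (δ i j * (δ i k * e j k - (1ℚ + S i k) * e j k) - δ i k * ((1ℚ + S i j) * e j k))) ≡ 0ℚ - (r i + r i) - (r i + r i)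
      corr = trans (L2.L-minus (λ (j , k) → δ i j * (δ i k * e j k - (1ℚ + S i k) * e j k)) (λ (j , k) → δ i k * ((1ℚ + S i j) * e j k))) (cong₂ _-_
        (trans (∑-cong λ j → ∑-*ˡ (δ i j) λ k → δ i k * e j k - (1ℚ + S i k) * e j k) (trans (∑-δˡ i λ j → ∑[ k ] (δ i k * e j k - (1ℚ + S i k) * e j k))
          (trans (∑-minus (λ k → δ i k * e i k) (λ k → (1ℚ + S i k) * e i k)) (cong₂ _-_ (trans (∑-δˡ i (e i)) (e-diag i)) deg2))))
        (trans (∑-cong λ j → ∑-δˡ i λ k → (1ℚ + S i j) * e j k) (trans (∑-cong λ j → cong ((1ℚ + S i j) *_) (e-sym j i)) deg2)))

    ∑-cherries : (∑[ i ] ∑[ j ] ∑[ k ] e i j * e i k * A₂ j k) ≡ ‖ r ‖² - ε + V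
    ∑-cherries = trans (∑-cong λ i → trans (∑-cong λ j → trans (∑-cong λ k → expand (e i j) (e i k) (δ j k) (S j k))
        (trans (∑-+ (λ k → e i j * e i k - δ j k * (e i j * e i k)) (λ k → e i j * (S j k * e i k))) (cong₂ _+_ (trans (∑-minus (λ k → e i j * e i k) (λ k → δ j k * (e i j * e i k))) (cong₂ _-_ (∑-*ˡ (e i j) (e i)) (∑-δˡ j λ k → e i j * e i k))) (∑-*ˡ (e i j) λ k → S j k * e i k))))
      (trans (∑-+ (λ j → e i j * r i - e i j * e i j) (λ j → e i j * (∑[ k ] S j k * e i k))) (cong (_+ (∑[ j ] e i j * (∑[ k ] S j k * e i k))) (trans (∑-minus (λ j → e i j * r i) (λ j → e i j * e i j)) (cong (_- ‖ e i ‖²) (∑-*ʳ (r i) (e i)))))))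
      (trans (∑-+ (λ i → r i * r i - ‖ e i ‖²) (λ i → ∑[ j ] e i j * (∑[ k ] S j k * e i k))) (cong (_+ V) (∑-minus (λ i → r i * r i) (λ i → ‖ e i ‖²))))
      where
      expand = solve 4 (λ a b d s → a :* b :* (con 1ℚ :- d :+ s) := a :* b :- d :* (a :* b) :+ a :* (s :* b)) refl

    private
      open SymmetricForm e e-sym

      rSr rW : ℚ
      rSr = ∑[ i ] r i * (∑[ k ] S i k * r k)
      rW = ∑[ i ] r i * W i

      Λ-1 : Λ (λ _ _ _ _ → 1ℚ) ≡ E * E
      Λ-1 = trans (∑-cong₂ λ i j → trans (∑-cong₂ λ k l → *-identityʳ (e i j * e k l)) (trans (∑-cong λ k → ∑-*ˡ (e i j) (e k)) (∑-*ˡ (e i j) r))) (trans (∑-cong λ i → ∑-*ʳ E (e i)) (∑-*ʳ E r))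

      Λ-S : Λ (λ i j k l → S i k) ≡ rSr
      Λ-S = ∑-cong λ i → trans (∑-cong λ j → trans (∑-cong λ k → trans (∑-cong λ l → sh (e i j) (e k l) (S i k)) (trans (∑-*ˡ (e i j) λ l → S i k * e k l) (cong (e i j *_) (∑-*ˡ (S i k) (e k))))) (∑-*ˡ (e i j) λ k → S i k * r k)) (∑-*ʳ (∑[ k ] S i k * r k) (e i))
        where
        sh = solve 3 (λ e c g → e :* c :* g := e :* (g :* c)) refl

      Λ-SS : Λ (λ i j k l → S i k * S i l) ≡ rW
      Λ-SS = ∑-cong λ i → trans (∑-cong λ j → trans (∑-cong λ k → trans (∑-cong λ l → *-assoc (e i j) (e k l) (S i k * S i l)) (∑-*ˡ (e i j) λ l → e k l * (S i k * S i l))) (∑-*ˡ (e i j) λ k → ∑[ l ] e k l * (S i k * S i l))) (∑-*ʳ (W i) (e i))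

      -- reorder (i, j, k, l) so that k and j, the free indices of Se and eS, come first
      reorder : ∀ (g : F4) → (∑[ i ] ∑[ j ] ∑[ k ] ∑[ l ] g i j k l) ≡ (∑[ k ] ∑[ j ] ∑[ i ] ∑[ l ] g i j k l)
      reorder g = trans (L-∑ (∑²-linear {n} {n}) λ (i , j) k → ∑[ l ] g i j k l) (∑-cong λ k → ∑-swap λ i j → ∑[ l ] g i j k l)

      Λ-Q : Λ (λ i j k l → S i k * S j l) ≡ Q-form e
      Λ-Q = trans (reorder λ i j k l → e i j * e k l * (S i k * S j l)) (∑-cong₂ λ k j → trans (∑-cong₂ λ i l → trans (cong (λ t → e i j * e k l * (t * S j l)) (S-sym i k)) (sh (e i j) (e k l) (S k i) (S j l))) (sym (∑-* (λ i → S k i * e i j) (λ l → S j l * e k l))))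
        where
        sh = solve 4 (λ a b c d → a :* b :* (c :* d) := c :* a :* (d :* b)) refl

      Λ-P : Λ (λ i j k l → S i k * S j l * S j k) ≡ P-form e
      Λ-P = trans (reorder λ i j k l → e i j * e k l * (S i k * S j l * S j k)) (∑-cong₂ λ k j → trans (∑-cong₂ λ i l → trans (cong₂ (λ t u → e i j * e k l * (t * S j l * u)) (S-sym i k) (S-sym j k)) (sh (e i j) (e k l) (S k i) (S j l) (S k j)))
          (trans (∑-cong λ i → ∑-*ˡ (S k j) λ l → S k i * e i j * (S j l * e k l)) (trans (∑-*ˡ (S k j) λ i → ∑[ l ] S k i * e i j * (S j l * e k l)) (trans (cong (S k j *_) (sym (∑-* (λ i → S k i * e i j) (λ l → S j l * e k l)))) (sym (*-assoc (S k j) (Se e k j) (eS e k j)))))))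
        where
        sh = solve 5 (λ a b c d f → a :* b :* (c :* d :* f) := f :* (c :* a :* (d :* b))) refl

      Λ-R : Λ (λ i j k l → S i k * S i l * (S j k * S j l)) ≡ R-form e
      Λ-R = trans (sym (exchange λ i j k l → S i k * S i l * (S j k * S j l))) (∑-cong₂ λ i j → sym (trans (sym (∑-*ˡ (e i j) λ k → ∑[ l ] e k l * R4 k l i j)) (∑-cong λ k → trans (sym (∑-*ˡ (e i j) λ l → e k l * R4 k l i j)) (∑-cong λ l →
          trans (sym (*-assoc (e i j) (e k l) (R4 k l i j))) (cong (e i j * e k l *_) (cong₂ _*_ (cong₂ _*_ (S-sym i k) (S-sym j k)) (cong₂ _*_ (S-sym i l) (S-sym j l))))))))

      Λ-δ : Λ (λ i j k l → δ i k * (1ℚ + S j l)) ≡ ‖ r ‖² + V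
      Λ-δ = trans (∑-cong λ i → trans (∑-cong λ j → trans (∑-cong λ k → trans (∑-cong λ l → sh (e i j) (e k l) (δ i k) (S j l)) (∑-*ˡ (δ i k) λ l → e i j * e k l + e i j * (S j l * e k l)))
          (trans (∑-δˡ i λ k → ∑[ l ] (e i j * e k l + e i j * (S j l * e k l))) (trans (∑-+ (λ l → e i j * e i l) (λ l → e i j * (S j l * e i l))) (cong₂ _+_ (∑-*ˡ (e i j) (e i)) (∑-*ˡ (e i j) λ l → S j l * e i l)))))
        (trans (∑-+ (λ j → e i j * r i) (λ j → e i j * (∑[ l ] S j l * e i l))) (cong (_+ (∑[ j ] e i j * (∑[ l ] S j l * e i l))) (∑-*ʳ (r i) (e i)))))
        (∑-+ (λ i → r i * r i) (λ i → ∑[ j ] e i j * (∑[ l ] S j l * e i l)))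
        where
        sh = solve 4 (λ a b d s → a :* b :* (d :* (con 1ℚ :+ s)) := d :* (a :* b :+ a :* (s :* b))) refl

      -- The four factors A₂ of two distinct edges, with the overlapping pairs subtracted
      overlaps : F4
      overlaps i j k l = lump (λ i j k l → δ i k * (1ℚ + S j l)) i j k l

      -- On the support of the weights S is 1 on both edges. A shared endpoint therefore leaves 4(1
      -- + S) of the opposite pair in the unrestricted product, which is subtracted; two shared
      -- endpoints are subtracted twice and added back once.
      pointwise : ∀ i j k l → e i j * e k l * (A₂ i k * A₂ i l * (A₂ j k * A₂ j l)) ≡
        e i j * e k l * ((1ℚ + S i k) * (1ℚ + S i l) * ((1ℚ + S j k) * (1ℚ + S j l)) + (- # 4) * overlaps i j k l + # 4 * (δ i k * δ j l + δ i l * δ j k))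
      pointwise i j k l with e-supp i j | e-supp k l
      ... | inj₂ p | _ = trans (≡0-* _ (≡0-* (e k l) p)) (sym (≡0-* _ (≡0-* (e k l) p)))
      ... | inj₁ _ | inj₂ p = trans (≡0-* _ (trans (cong (e i j *_) p) (*-zeroʳ (e i j)))) (sym (≡0-* _ (trans (cong (e i j *_) p) (*-zeroʳ (e i j)))))
      ... | inj₁ p | inj₁ q = cong (e i j * e k l *_) (cases i j k l p q)
        where
        S-≢ : ∀ {i j} → S i j ≡ 1ℚ → δ i j ≡ 0ℚ
        S-≢ {i} {j} p = δ-≢ {i = i} {j = j} λ { refl → contradiction (trans (sym (S-diag i)) p) λ () }
        -- x, y, z, w are the values of S, and a, b, c, d those of δ, on ik, il, jk, jl
        form : (x y z w a b c d : ℚ) → ℚ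
        form x y z w a b c d = (1ℚ + x) * (1ℚ + y) * ((1ℚ + z) * (1ℚ + w)) + (- # 4) * ((a * (1ℚ + w) + c * (1ℚ + y)) + (b * (1ℚ + z) + d * (1ℚ + x))) + # 4 * (a * d + b * c)
        lhs : (x y z w a b c d : ℚ) → ℚ
        lhs x y z w a b c d = (1ℚ - a + x) * (1ℚ - b + y) * ((1ℚ - c + z) * (1ℚ - d + w))
        eq-form : ∀ {x x′ y y′ z z′ w w′ a a′ b b′ c c′ d d′ : ℚ} → x ≡ x′ → y ≡ y′ → z ≡ z′ → w ≡ w′ → a ≡ a′ → b ≡ b′ → c ≡ c′ → d ≡ d′ → lhs x′ y′ z′ w′ a′ b′ c′ d′ ≡ form x′ y′ z′ w′ a′ b′ c′ d′ → lhs x y z w a b c d ≡ form x y z w a b c d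
        eq-form refl refl refl refl refl refl refl refl h = h
        cases : ∀ i j k l → S i j ≡ 1ℚ → S k l ≡ 1ℚ → lhs (S i k) (S i l) (S j k) (S j l) (δ i k) (δ i l) (δ j k) (δ j l) ≡ form (S i k) (S i l) (S j k) (S j l) (δ i k) (δ i l) (δ j k) (δ j l)
        cases i j k l p q = case i ≟ k of λ
          { (yes refl) → case j ≟ l of λ
            { (yes refl) → eq-form (S-diag i) p (trans (S-sym j i) p) (S-diag j) (δ-refl i) (S-≢ p) (trans (δ-sym j i) (S-≢ p)) (δ-refl j) refl
            ; (no j≢l) → eq-form {w = S j l} (S-diag i) q (trans (S-sym j i) p) refl (δ-refl i) (S-≢ q) (trans (δ-sym j i) (S-≢ p)) (δ-≢ j≢l) (f₁ (S j l)) }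
          ; (no i≢k) → case i ≟ l of λ
            { (yes refl) → case j ≟ k of λ
              { (yes refl) → eq-form p (S-diag i) (S-diag j) (trans (S-sym j i) p) (S-≢ p) (δ-refl i) (δ-refl j) (trans (δ-sym j i) (S-≢ p)) refl
              ; (no j≢k) → eq-form {z = S j k} (trans (S-sym i k) q) (S-diag i) refl (trans (S-sym j i) p) (δ-≢ i≢k) (δ-refl i) (δ-≢ j≢k) (trans (δ-sym j i) (S-≢ p)) (f₂ (S j k)) }
            ; (no i≢l) → case j ≟ k of λ
              { (yes refl) → eq-form {y = S i l} p refl (S-diag j) q (δ-≢ i≢k) (δ-≢ i≢l) (δ-refl j) (S-≢ q) (f₃ (S i l))
              ; (no j≢k) → case j ≟ l of λ
                { (yes refl) → eq-form {x = S i k} refl p (trans (S-sym j k) q) (S-diag j) (δ-≢ i≢k) (δ-≢ i≢l) (δ-≢ j≢k) (δ-refl j) (f₄ (S i k))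
                ; (no j≢l) → eq-form {x = S i k} {y = S i l} {z = S j k} {w = S j l} refl refl refl refl (δ-≢ i≢k) (δ-≢ i≢l) (δ-≢ j≢k) (δ-≢ j≢l) (f₀ (S i k) (S i l) (S j k) (S j l)) } } } }
          where
          f₀ = solve 4 (λ x y z w → (con 1ℚ :- con 0ℚ :+ x) :* (con 1ℚ :- con 0ℚ :+ y) :* ((con 1ℚ :- con 0ℚ :+ z) :* (con 1ℚ :- con 0ℚ :+ w))
            := (con 1ℚ :+ x) :* (con 1ℚ :+ y) :* ((con 1ℚ :+ z) :* (con 1ℚ :+ w)) :+ (:- :# 4) :* ((con 0ℚ :* (con 1ℚ :+ w) :+ con 0ℚ
              :* (con 1ℚ :+ y)) :+ (con 0ℚ :* (con 1ℚ :+ z) :+ con 0ℚ :* (con 1ℚ :+ x))) :+ :# 4 :* (con 0ℚ :* con 0ℚ :+ con 0ℚ :* con 0ℚ)) refl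
          f₁ = solve 1 (λ w → (con 1ℚ :- con 1ℚ :+ con 0ℚ) :* (con 1ℚ :- con 0ℚ :+ con 1ℚ) :* ((con 1ℚ :- con 0ℚ :+ con 1ℚ) :* (con 1ℚ
              :- con 0ℚ :+ w))
            := (con 1ℚ :+ con 0ℚ) :* (con 1ℚ :+ con 1ℚ) :* ((con 1ℚ :+ con 1ℚ) :* (con 1ℚ :+ w)) :+ (:- :# 4) :* ((con 1ℚ :* (con 1ℚ
              :+ w) :+ con 0ℚ :* (con 1ℚ :+ con 1ℚ)) :+ (con 0ℚ :* (con 1ℚ :+ con 1ℚ) :+ con 0ℚ :* (con 1ℚ :+ con 0ℚ))) :+ :# 4 :* (con 1ℚ
              :* con 0ℚ :+ con 0ℚ :* con 0ℚ)) refl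
          f₂ = solve 1 (λ z → (con 1ℚ :- con 0ℚ :+ con 1ℚ) :* (con 1ℚ :- con 1ℚ :+ con 0ℚ) :* ((con 1ℚ :- con 0ℚ :+ z) :* (con 1ℚ
              :- con 0ℚ :+ con 1ℚ))
            := (con 1ℚ :+ con 1ℚ) :* (con 1ℚ :+ con 0ℚ) :* ((con 1ℚ :+ z) :* (con 1ℚ :+ con 1ℚ)) :+ (:- :# 4) :* ((con 0ℚ :* (con 1ℚ
              :+ con 1ℚ) :+ con 0ℚ :* (con 1ℚ :+ con 0ℚ)) :+ (con 1ℚ :* (con 1ℚ :+ z) :+ con 0ℚ :* (con 1ℚ :+ con 1ℚ))) :+ :# 4 :* (con 0ℚ
              :* con 0ℚ :+ con 1ℚ :* con 0ℚ)) refl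
          f₃ = solve 1 (λ y → (con 1ℚ :- con 0ℚ :+ con 1ℚ) :* (con 1ℚ :- con 0ℚ :+ y) :* ((con 1ℚ :- con 1ℚ :+ con 0ℚ) :* (con 1ℚ
              :- con 0ℚ :+ con 1ℚ))
            := (con 1ℚ :+ con 1ℚ) :* (con 1ℚ :+ y) :* ((con 1ℚ :+ con 0ℚ) :* (con 1ℚ :+ con 1ℚ)) :+ (:- :# 4) :* ((con 0ℚ :* (con 1ℚ
              :+ con 1ℚ) :+ con 1ℚ :* (con 1ℚ :+ y)) :+ (con 0ℚ :* (con 1ℚ :+ con 0ℚ) :+ con 0ℚ :* (con 1ℚ :+ con 1ℚ))) :+ :# 4 :* (con 0ℚ
              :* con 0ℚ :+ con 0ℚ :* con 1ℚ)) refl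
          f₄ = solve 1 (λ x → (con 1ℚ :- con 0ℚ :+ x) :* (con 1ℚ :- con 0ℚ :+ con 1ℚ) :* ((con 1ℚ :- con 0ℚ :+ con 1ℚ) :* (con 1ℚ
              :- con 1ℚ :+ con 0ℚ))
            := (con 1ℚ :+ x) :* (con 1ℚ :+ con 1ℚ) :* ((con 1ℚ :+ con 1ℚ) :* (con 1ℚ :+ con 0ℚ)) :+ (:- :# 4) :* ((con 0ℚ :* (con 1ℚ
              :+ con 0ℚ) :+ con 0ℚ :* (con 1ℚ :+ con 1ℚ)) :+ (con 0ℚ :* (con 1ℚ :+ con 1ℚ) :+ con 1ℚ :* (con 1ℚ :+ x))) :+ :# 4 :* (con 0ℚ
              :* con 1ℚ :+ con 0ℚ :* con 0ℚ)) refl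

      g₁ g₂ g₃ g₄ g₅ g₆ : F4
      g₁ i j k l = S i k
      g₂ i j k l = S i k * S i l
      g₃ i j k l = S i k * S j k
      g₄ i j k l = S i k * S j l
      g₅ i j k l = S i k * S j l * S j k
      g₆ i j k l = S i k * S i l * (S j k * S j l)

      Λ-g₃ : Λ g₃ ≡ rW
      Λ-g₃ = trans (sym (exchange g₃)) (trans (Λ-cong λ i j k l → cong₂ _*_ (S-sym k i) (S-sym l i)) Λ-SS)

      -- Monomials with a symmetry under exchange of ends occur twice in their `lump`, hence the
      -- halves.
      expand-product = solve 4 (λ x y z w → (con 1ℚ :+ x) :* (con 1ℚ :+ y) :* ((con 1ℚ :+ z) :* (con 1ℚ :+ w))
        := con 1ℚ :+ ((x :+ z) :+ (y :+ w)) :+ con ½ :* ((x :* y :+ z :* w) :+ (y :* x :+ w :* z)) :+ con ½ :* ((x :* z :+ z :* x)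
          :+ (y :* w :+ w :* y)) :+ con ½ :* ((x :* w :+ z :* y) :+ (y :* z :+ w :* x)) :+ ((x :* w :* z :+ z :* y :* x) :+ (y :* z
          :* w :+ w :* x :* y)) :+ x :* y :* (z :* w)) refl

      ½-lump : ∀ g → Λ (λ i j k l → ½ * lump g i j k l) ≡ # 2 * Λ g
      ½-lump g = trans (Λ-* ½ (lump g)) (trans (cong (½ *_) (Λ-lump g)) (l (Λ g)))
        where
        l = solve 1 (λ a → con ½ :* (:# 4 :* a) := :# 2 :* a) refl

      Λ-product : Λ (λ i j k l → (1ℚ + S i k) * (1ℚ + S i l) * ((1ℚ + S j k) * (1ℚ + S j l))) ≡
        E * E + # 4 * rSr + # 2 * rW + # 2 * rW + # 2 * Q-form e + # 4 * P-form e + R-form e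
      Λ-product = trans (Λ-cong λ i j k l → expand-product (S i k) (S i l) (S j k) (S j l))
        (trans (Λ-+ _ g₆) (cong₂ _+_ (trans (Λ-+ _ (lump g₅)) (cong₂ _+_ (trans (Λ-+ _ (λ i j k l → ½ * lump g₄ i j k l)) (cong₂ _+_ (trans (Λ-+ _ (λ i j k l → ½ * lump g₃ i j k l)) (cong₂ _+_ (trans (Λ-+ _ (λ i j k l → ½ * lump g₂ i j k l)) (cong₂ _+_
          (trans (Λ-+ (λ _ _ _ _ → 1ℚ) (lump g₁)) (cong₂ _+_ Λ-1 (trans (Λ-lump g₁) (cong (# 4 *_) Λ-S))))
          (trans (½-lump g₂) (cong (# 2 *_) Λ-SS)))) (trans (½-lump g₃) (cong (# 2 *_) Λ-g₃)))) (trans (½-lump g₄) (cong (# 2 *_) Λ-Q)))) (trans (Λ-lump g₅) (cong (# 4 *_) Λ-P)))) Λ-R))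

    ∑-edge-pairs : (∑[ i ] ∑[ j ] ∑[ k ] ∑[ l ] e i j * e k l * (A₂ i k * A₂ i l * (A₂ j k * A₂ j l))) ≡
      E * E + # 4 * (∑[ i ] r i * (∑[ k ] S i k * r k)) + # 4 * (∑[ i ] r i * W i) + # 2 * Q-form e + # 4 * P-form e + R-form e
      - # 16 * ‖ r ‖² - # 16 * V + # 8 * ε
    ∑-edge-pairs = trans (∑-cong₂ λ i j → ∑-cong₂ λ k l → pointwise i j k l)
      (trans (Λ-+ _ (λ i j k l → # 4 * (δ i k * δ j l + δ i l * δ j k))) (trans (cong₂ _+_ (trans (Λ-+ _ (λ i j k l → (- # 4) * overlaps i j k l)) (cong₂ _+_ Λ-product (trans (Λ-* (- # 4) overlaps) (cong ((- # 4) *_) (trans (Λ-lump λ i j k l → δ i k * (1ℚ + S j l)) (cong (# 4 *_) Λ-δ))))))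
        (trans (Λ-* (# 4) λ i j k l → δ i k * δ j l + δ i l * δ j k) (cong (# 4 *_) (trans (Λ-+ (λ i j k l → δ i k * δ j l) (λ i j k l → δ i l * δ j k)) (cong₂ _+_ Λ-δδ (trans (swap₂ λ i j k l → δ i k * δ j l) Λ-δδ))))))
      (collect (E * E) rSr rW (Q-form e) (P-form e) (R-form e) ‖ r ‖² V ε)))
      where
      collect = solve 9 (λ EE s w Q P R r V ε → EE :+ :# 4 :* s :+ :# 2 :* w :+ :# 2 :* w :+ :# 2 :* Q :+ :# 4 :* P :+ R :+ (:- :# 4)
          :* (:# 4 :* (r :+ V)) :+ :# 4 :* (ε :+ ε)
        := EE :+ :# 4 :* s :+ :# 4 :* w :+ :# 2 :* Q :+ :# 4 :* P :+ R :- :# 16 :* r :- :# 16 :* V :+ :# 8 :* ε) refl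

-- Pseudomoments of monomials of degree at most four

≡ᵇ-refl : ∀ k → (k ℕ.≡ᵇ k) ≡ true
≡ᵇ-refl zero = refl
≡ᵇ-refl (suc k) = ≡ᵇ-refl k

≡ᵇ-≢ : ∀ {n} {i j : Fin n} → i ≢ j → (toℕ i ℕ.≡ᵇ toℕ j) ≡ false
≡ᵇ-≢ {i = i} {j} ne with toℕ i ℕ.≡ᵇ toℕ j in eq
... | false = refl
... | true = ⊥-elim (ne (toℕ-injective (ℕ.≡ᵇ⇒≡ (toℕ i) (toℕ j) (subst 𝔹.T (sym eq) _))))

does-refl : ∀ {n} (i : Fin n) → does (i ≟ i) ≡ true
does-refl i = dec-true (i ≟ i) refl

does-≢ : ∀ {n} {i j : Fin n} → i ≢ j → does (i ≟ j) ≡ false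
does-≢ {i = i} {j} ne = dec-false (i ≟ j) ne

module PseudoMoments {n : ℕ} (G : Graph n) (G-sym : ∀ i j → G i j ≡ G j i) (α : FKParams) where

  a₁ a₂ a₃ a₄ : ℚ
  a₁ = αAt α 1
  a₂ = αAt α 2
  a₃ = αAt α 3
  a₄ = αAt α 4

  ind : Bool → ℚ
  ind b = if b then 1ℚ else 0ℚ

  A : Fin n → Fin n → ℚ
  A i j = if does (i ≟ j) then 0ℚ else ind (G i j)

  A-diag : ∀ i → A i i ≡ 0ℚ
  A-diag i rewrite does-refl i = refl

  A-≢ : ∀ {i j} → i ≢ j → A i j ≡ ind (G i j)
  A-≢ ne rewrite does-≢ ne = refl

  A-sym : ∀ i j → A i j ≡ A j i
  A-sym i j = case i ≟ j of λ
    { (yes refl) → refl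
    ; (no ne) → trans (A-≢ ne) (trans (cong ind (G-sym i j)) (sym (A-≢ λ e → ne (sym e)))) }

  private
    eval : List (Fin n) → ℚ
    eval T = if isClique G T then αAt α (length T) else 0ℚ

    eval₁ : ∀ i → eval (i ∷ []) ≡ a₁
    eval₁ i rewrite ≡ᵇ-refl (toℕ i) = refl

    z0 = solve 1 (λ x → con 0ℚ := con 0ℚ :* x) refl
    z1 = solve 1 (λ x → con 0ℚ := con 1ℚ :* (con 0ℚ :* x)) refl
    z2 = solve 1 (λ x → con 0ℚ := con 1ℚ :* (con 1ℚ :* (con 0ℚ :* x))) refl
    z3 = solve 1 (λ x → con 0ℚ := con 1ℚ :* (con 1ℚ :* (con 1ℚ :* (con 0ℚ :* x)))) refl
    z4 = solve 1 (λ x → con 0ℚ := con 1ℚ :* (con 1ℚ :* (con 1ℚ :* (con 1ℚ :* (con 0ℚ :* x))))) refl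
    z5 = solve 1 (λ x → con 0ℚ := con 1ℚ :* (con 1ℚ :* (con 1ℚ :* (con 1ℚ :* (con 1ℚ :* (con 0ℚ :* x)))))) refl
    o1 = solve 1 (λ x → x := con 1ℚ :* x) refl
    o3 = solve 1 (λ x → x := con 1ℚ :* (con 1ℚ :* (con 1ℚ :* x))) refl
    o6 = solve 1 (λ x → x := con 1ℚ :* (con 1ℚ :* (con 1ℚ :* (con 1ℚ :* (con 1ℚ :* (con 1ℚ :* x)))))) refl

    nest₂ : ∀ bij a → (if (bij 𝔹.∧ true) 𝔹.∧ (bij 𝔹.∧ true) 𝔹.∧ true then a else 0ℚ) ≡ ind bij * a
    nest₂ false a = z0 (a)
    nest₂ true a = o1 a

    nest₃ : ∀ bij bik bjk a → (if (bij 𝔹.∧ bik 𝔹.∧ true) 𝔹.∧ (bij 𝔹.∧ bjk 𝔹.∧ true) 𝔹.∧ (bik 𝔹.∧ bjk 𝔹.∧ true) 𝔹.∧ true then a else 0ℚ) ≡ ind bij * (ind bik * (ind bjk * a))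
    nest₃ false bik bjk a = z0 (ind bik * (ind bjk * a))
    nest₃ true false bjk a = z1 (ind bjk * a)
    nest₃ true true false a = z2 (a)
    nest₃ true true true a = o3 a

    nest₄ : ∀ bij bik bil bjk bjl bkl a → (if (bij 𝔹.∧ bik 𝔹.∧ bil 𝔹.∧ true) 𝔹.∧ (bij 𝔹.∧ bjk 𝔹.∧ bjl 𝔹.∧ true) 𝔹.∧ (bik 𝔹.∧ bjk 𝔹.∧ bkl 𝔹.∧ true) 𝔹.∧ (bil 𝔹.∧ bjl 𝔹.∧ bkl 𝔹.∧ true) 𝔹.∧ true then a else 0ℚ) ≡ ind bij * (ind bik * (ind bil * (ind bjk * (ind bjl * (ind bkl * a)))))
    nest₄ false bik bil bjk bjl bkl a = z0 (ind bik * (ind bil * (ind bjk * (ind bjl * (ind bkl * a)))))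
    nest₄ true false bil bjk bjl bkl a = z1 (ind bil * (ind bjk * (ind bjl * (ind bkl * a))))
    nest₄ true true false bjk bjl bkl a = z2 (ind bjk * (ind bjl * (ind bkl * a)))
    nest₄ true true true false bjl bkl a = z3 (ind bjl * (ind bkl * a))
    nest₄ true true true true false bkl a = z4 (ind bkl * a)
    nest₄ true true true true true false a = z5 (a)
    nest₄ true true true true true true a = o6 a

    eval₂ : ∀ {i j} → i ≢ j → eval (i ∷ j ∷ []) ≡ A i j * a₂
    eval₂ {i} {j} ij rewrite ≡ᵇ-refl (toℕ i) | ≡ᵇ-refl (toℕ j) | ≡ᵇ-≢ ij | ≡ᵇ-≢ (λ e → ij (sym e)) | does-≢ ij | G-sym j i = nest₂ (G i j) a₂

    eval₃ : ∀ {i j k} → i ≢ j → i ≢ k → j ≢ k → eval (i ∷ j ∷ k ∷ []) ≡ A i j * (A i k * (A j k * a₃))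
    eval₃ {i} {j} {k} ij ik jk rewrite ≡ᵇ-refl (toℕ i) | ≡ᵇ-refl (toℕ j) | ≡ᵇ-refl (toℕ k) | ≡ᵇ-≢ ij | ≡ᵇ-≢ (λ e → ij (sym e)) | ≡ᵇ-≢ ik | ≡ᵇ-≢ (λ e → ik (sym e)) | ≡ᵇ-≢ jk | ≡ᵇ-≢ (λ e → jk (sym e))
      | does-≢ ij | does-≢ ik | does-≢ jk | G-sym j i | G-sym k i | G-sym k j = nest₃ (G i j) (G i k) (G j k) a₃

    eval₄ : ∀ {i j k l} → i ≢ j → i ≢ k → i ≢ l → j ≢ k → j ≢ l → k ≢ l → eval (i ∷ j ∷ k ∷ l ∷ []) ≡ A i j * (A i k * (A i l * (A j k * (A j l * (A k l * a₄)))))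
    eval₄ {i} {j} {k} {l} ij ik il jk jl kl rewrite ≡ᵇ-refl (toℕ i) | ≡ᵇ-refl (toℕ j) | ≡ᵇ-refl (toℕ k) | ≡ᵇ-refl (toℕ l) | ≡ᵇ-≢ ij | ≡ᵇ-≢ (λ e → ij (sym e)) | ≡ᵇ-≢ ik | ≡ᵇ-≢ (λ e → ik (sym e)) | ≡ᵇ-≢ jk | ≡ᵇ-≢ (λ e → jk (sym e))
      | ≡ᵇ-≢ il | ≡ᵇ-≢ (λ e → il (sym e)) | ≡ᵇ-≢ jl | ≡ᵇ-≢ (λ e → jl (sym e)) | ≡ᵇ-≢ kl | ≡ᵇ-≢ (λ e → kl (sym e))
      | does-≢ ij | does-≢ ik | does-≢ jk | does-≢ il | does-≢ jl | does-≢ kl | G-sym j i | G-sym k i | G-sym k j | G-sym l i | G-sym l j | G-sym l k =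
      nest₄ (G i j) (G i k) (G i l) (G j k) (G j l) (G k l) a₄

    support-double : ∀ i (m : List (Fin n)) → support (i ∷ i ∷ m) ≡ support (i ∷ m)
    support-double i m rewrite does-refl i = cong (i ∷_) (filter-idem (λ j → ¬? (i ≟ j)) (support m))

    support-tail : ∀ i (m m′ : List (Fin n)) → support m ≡ support m′ → support (i ∷ m) ≡ support (i ∷ m′)
    support-tail i m m′ e = cong (λ T → i ∷ filter (λ j → ¬? (i ≟ j)) T) e

    Ẽ-eval : ∀ (m T : List (Fin n)) → support m ≡ T → Ẽ G α m ≡ eval T
    Ẽ-eval m T e = cong eval e

    Ẽ-same : ∀ (m m′ : List (Fin n)) → support m ≡ support m′ → Ẽ G α m ≡ Ẽ G α m′
    Ẽ-same m m′ e = cong eval e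

    infixr 2 _∙_
    _∙_ : ∀ {x y z : ℚ} → x ≡ y → y ≡ z → x ≡ z
    _∙_ = trans

  -- `M₂`, `M₃` and `M₄` express the pseudomoments as polynomials in δ and `A`, so that sums over
  -- all index tuples can be expanded without case distinctions. For an edge ij, `Y i j k` is the
  -- value of x_i x_j x_k, and for a further edge kl, `X i j k l` that of x_i x_j x_k x_l.
  M₂ : Fin n → Fin n → ℚ
  M₂ i j = δ i j * a₁ + A i j * a₂

  Y : Fin n → Fin n → Fin n → ℚ
  Y i j k = a₂ * (δ i k + δ j k) + a₃ * (A k i * A k j)

  M₃ : Fin n → Fin n → Fin n → ℚ
  M₃ i j k = δ i j * M₂ i k + A i j * Y i j k

  X : Fin n → Fin n → Fin n → Fin n → ℚ
  X i j k l = a₂ * (δ i k * δ j l + δ i l * δ j k) + a₃ * (δ i k * A j l + δ i l * A j k + (δ j k * A i l + δ j l * A i k)) + a₄ * (A i k * A i l * (A j k * A j l))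

  M₄ : Fin n → Fin n → Fin n → Fin n → ℚ
  M₄ i j k l = δ i j * M₃ k l i + A i j * (δ k l * Y i j k + A k l * X i j k l)

  A-idem : ∀ i j x → A i j * (A i j * x) ≡ A i j * x
  A-idem i j x = case i ≟ j of λ
    { (yes refl) → ≡0-* (A i i * x) (A-diag i) ∙ sym (≡0-* x (A-diag i))
    ; (no ne) → cong (λ t → t * (t * x)) (A-≢ ne) ∙ bool (G i j) ∙ sym (cong (_* x) (A-≢ ne)) }
    where
    bool : ∀ b → ind b * (ind b * x) ≡ ind b * x
    bool true = *-identityˡ (1ℚ * x)
    bool false = ≡0-* (0ℚ * x) refl ∙ sym (≡0-* x refl)

  Ẽ₁ : ∀ i → Ẽ G α (i ∷ []) ≡ a₁
  Ẽ₁ = eval₁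

  Ẽ₂ : ∀ i j → Ẽ G α (i ∷ j ∷ []) ≡ M₂ i j
  Ẽ₂ i j = case i ≟ j of λ
    { (yes refl) → Ẽ-same (i ∷ i ∷ []) (i ∷ []) (support-double i []) ∙ Ẽ₁ i ∙ sym (cong₂ (λ d a → d * a₁ + a * a₂) (δ-refl i) (A-diag i) ∙ l a₁ a₂)
    ; (no ij) → Ẽ-eval (i ∷ j ∷ []) (i ∷ j ∷ []) (s₂ ij) ∙ eval₂ ij ∙ sym (cong (λ d → d * a₁ + A i j * a₂) (δ-≢ ij) ∙ l′ a₁ (A i j * a₂)) }
    where
    l = solve 2 (λ x y → con 1ℚ :* x :+ con 0ℚ :* y := x) refl
    l′ = solve 2 (λ x y → con 0ℚ :* x :+ y := y) refl
    s₂ : ∀ {i j : Fin n} → i ≢ j → support (i ∷ j ∷ []) ≡ i ∷ j ∷ []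
    s₂ ij rewrite does-≢ ij = refl

  private
    M₃-diag : ∀ i k → M₃ i i k ≡ M₂ i k
    M₃-diag i k = cong₂ (λ d a → d * M₂ i k + a * Y i i k) (δ-refl i) (A-diag i) ∙ l (M₂ i k) (Y i i k)
      where
      l = solve 2 (λ x y → con 1ℚ :* x :+ con 0ℚ :* y := x) refl

    M₃-off : ∀ {i j} → i ≢ j → ∀ k → M₃ i j k ≡ A i j * Y i j k
    M₃-off {i} {j} ij k = cong (λ d → d * M₂ i k + A i j * Y i j k) (δ-≢ ij) ∙ l (M₂ i k) (A i j * Y i j k)
      where
      l = solve 2 (λ x y → con 0ℚ :* x :+ y := y) refl

    Y-left : ∀ {i j} → i ≢ j → Y i j i ≡ a₂
    Y-left {i} {j} ij = cong₂ (λ d a → a₂ * (d + δ j i) + a₃ * (a * A i j)) (δ-refl i) (A-diag i) ∙ cong (λ d → a₂ * (1ℚ + d) + a₃ * (0ℚ * A i j)) (δ-≢ λ e → ij (sym e)) ∙ l a₂ a₃ (A i j)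
      where
      l = solve 3 (λ a b x → a :* (con 1ℚ :+ con 0ℚ) :+ b :* (con 0ℚ :* x) := a) refl

    Y-right : ∀ {i j} → i ≢ j → Y i j j ≡ a₂
    Y-right {i} {j} ij = cong₂ (λ d a → a₂ * (δ i j + d) + a₃ * (A j i * a)) (δ-refl j) (A-diag j) ∙ cong (λ d → a₂ * (d + 1ℚ) + a₃ * (A j i * 0ℚ)) (δ-≢ ij) ∙ l a₂ a₃ (A j i)
      where
      l = solve 3 (λ a b x → a :* (con 0ℚ :+ con 1ℚ) :+ b :* (x :* con 0ℚ) := a) refl

    Y-off : ∀ {i j k} → i ≢ k → j ≢ k → Y i j k ≡ a₃ * (A k i * A k j)
    Y-off {i} {j} {k} ik jk = cong₂ (λ d d′ → a₂ * (d + d′) + a₃ * (A k i * A k j)) (δ-≢ ik) (δ-≢ jk) ∙ l a₂ (a₃ * (A k i * A k j))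
      where
      l = solve 2 (λ a x → a :* (con 0ℚ :+ con 0ℚ) :+ x := x) refl

    sh₃ = solve 4 (λ a b c d → a :* (b :* (c :* d)) := a :* (d :* (b :* c))) refl

    sh₃′ = solve 4 (λ a b c d → a :* (b :* (c :* d)) := c :* (d :* (a :* b))) refl

  Ẽ₃ : ∀ i j k → Ẽ G α (i ∷ j ∷ k ∷ []) ≡ M₃ i j k
  Ẽ₃ i j k = case i ≟ j of λ
    { (yes refl) → Ẽ-same (i ∷ i ∷ k ∷ []) (i ∷ k ∷ []) (support-double i (k ∷ [])) ∙ Ẽ₂ i k ∙ sym (M₃-diag i k)
    ; (no ij) → off ij ∙ sym (M₃-off ij k) }
    where
    s₁ : ∀ {i j : Fin n} → i ≢ j → support (i ∷ j ∷ i ∷ []) ≡ i ∷ j ∷ []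
    s₁ {i} {j} ij rewrite does-≢ (λ e → ij (sym e)) | does-≢ ij | does-refl i = refl
    s₂ : ∀ {i j : Fin n} → i ≢ j → support (i ∷ j ∷ j ∷ []) ≡ i ∷ j ∷ []
    s₂ {i} {j} ij rewrite does-refl j | does-≢ ij = refl
    s₃ : ∀ {i j k : Fin n} → i ≢ j → i ≢ k → j ≢ k → support (i ∷ j ∷ k ∷ []) ≡ i ∷ j ∷ k ∷ []
    s₃ ij ik jk rewrite does-≢ jk | does-≢ ij | does-≢ ik = refl
    off : i ≢ j → Ẽ G α (i ∷ j ∷ k ∷ []) ≡ A i j * Y i j k
    off ij = case i ≟ k of λ
      { (yes refl) → Ẽ-eval (i ∷ j ∷ i ∷ []) (i ∷ j ∷ []) (s₁ ij) ∙ eval₂ ij ∙ cong (A i j *_) (sym (Y-left ij))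
      ; (no ik) → case j ≟ k of λ
        { (yes refl) → Ẽ-eval (i ∷ j ∷ j ∷ []) (i ∷ j ∷ []) (s₂ ij) ∙ eval₂ ij ∙ cong (A i j *_) (sym (Y-right ij))
        ; (no jk) → Ẽ-eval (i ∷ j ∷ k ∷ []) (i ∷ j ∷ k ∷ []) (s₃ ij ik jk) ∙ eval₃ ij ik jk
            ∙ cong₂ (λ x y → A i j * (x * (y * a₃))) (A-sym i k) (A-sym j k) ∙ sh₃ (A i j) (A k i) (A k j) a₃ ∙ cong (A i j *_) (sym (Y-off ik jk)) } }

  -- `support` keeps the order of the variables, so a linear term times a quadratic one, with the
  -- single variable in front, needs its own evaluation.
  Ẽ₃′ : ∀ k i j → Ẽ G α (k ∷ i ∷ j ∷ []) ≡ M₃ i j k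
  Ẽ₃′ k i j = case i ≟ j of λ
    { (yes refl) → Ẽ-same (k ∷ i ∷ i ∷ []) (k ∷ i ∷ []) (support-tail k (i ∷ i ∷ []) (i ∷ []) (support-double i [])) ∙ Ẽ₂ k i ∙ cong₂ (λ d a → d * a₁ + a * a₂) (δ-sym k i) (A-sym k i) ∙ sym (M₃-diag i k)
    ; (no ij) → off ij ∙ sym (M₃-off ij k) }
    where
    s₀ : ∀ {i j : Fin n} → i ≢ j → support (i ∷ j ∷ []) ≡ i ∷ j ∷ []
    s₀ ij rewrite does-≢ ij = refl
    s₂ : ∀ {i j : Fin n} → i ≢ j → support (j ∷ i ∷ j ∷ []) ≡ j ∷ i ∷ []
    s₂ {i} {j} ij rewrite does-≢ ij | does-≢ (λ e → ij (sym e)) | does-refl j = refl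
    s₃ : ∀ {i j k : Fin n} → i ≢ j → i ≢ k → j ≢ k → support (k ∷ i ∷ j ∷ []) ≡ k ∷ i ∷ j ∷ []
    s₃ ij ik jk rewrite does-≢ ij | does-≢ (λ e → ik (sym e)) | does-≢ (λ e → jk (sym e)) = refl
    off : i ≢ j → Ẽ G α (k ∷ i ∷ j ∷ []) ≡ A i j * Y i j k
    off ij = case i ≟ k of λ
      { (yes refl) → Ẽ-same (i ∷ i ∷ j ∷ []) (i ∷ j ∷ []) (support-double i (j ∷ [])) ∙ Ẽ-eval (i ∷ j ∷ []) (i ∷ j ∷ []) (s₀ ij) ∙ eval₂ ij ∙ cong (A i j *_) (sym (Y-left ij))
      ; (no ik) → case j ≟ k of λ
        { (yes refl) → Ẽ-eval (j ∷ i ∷ j ∷ []) (j ∷ i ∷ []) (s₂ ij) ∙ eval₂ (λ e → ij (sym e)) ∙ cong₂ _*_ (A-sym j i) (sym (Y-right ij))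
        ; (no jk) → Ẽ-eval (k ∷ i ∷ j ∷ []) (k ∷ i ∷ j ∷ []) (s₃ ij ik jk) ∙ eval₃ (λ e → ik (sym e)) (λ e → jk (sym e)) ij
            ∙ sh₃′ (A k i) (A k j) (A i j) a₃ ∙ cong (A i j *_) (sym (Y-off ik jk)) } }

  private
    X-value : ∀ i j k l {d₁ d₂ d₃ d₄ b₁ b₂ b₃ b₄ : ℚ} → δ i k ≡ d₁ → δ i l ≡ d₂ → δ j k ≡ d₃ → δ j l ≡ d₄ → A i k ≡ b₁ → A i l ≡ b₂ → A j k ≡ b₃ → A j l ≡ b₄ →
      X i j k l ≡ a₂ * (d₁ * d₄ + d₂ * d₃) + a₃ * (d₁ * b₄ + d₂ * b₃ + (d₃ * b₂ + d₄ * b₁)) + a₄ * (b₁ * b₂ * (b₃ * b₄))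
    X-value i j k l refl refl refl refl refl refl refl refl = refl

    -- the two edges (i, j) and (k, l) are opposite, adjacent at one end, or disjoint
    X-off : ∀ i j k l → i ≢ j → k ≢ l → Ẽ G α (i ∷ j ∷ k ∷ l ∷ []) ≡ A i j * (A k l * X i j k l)
    X-off i j k l ij kl = case i ≟ k of λ
      { (yes refl) → case j ≟ l of λ
        { (yes refl) → Ẽ-eval (i ∷ j ∷ i ∷ j ∷ []) (i ∷ j ∷ []) (s₁ ij) ∙ eval₂ ij ∙ sym (cong (λ t → A i j * (A i j * t)) (X-value i j i j (δ-refl i) (δ-≢ ij) (δ-≢ λ e → ij (sym e)) (δ-refl j) (A-diag i) refl refl (A-diag j) ∙ x₁ a₂ a₃ a₄ (A i j) (A j i)) ∙ A-idem i j a₂)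
        ; (no jl) → Ẽ-eval (i ∷ j ∷ i ∷ l ∷ []) (i ∷ j ∷ l ∷ []) (s₂ ij kl jl) ∙ eval₃ ij kl jl ∙ cong (λ t → A i j * (A i l * t)) (*-comm (A j l) a₃ ∙ sym (X-value i j i l (δ-refl i) (δ-≢ kl) (δ-≢ λ e → ij (sym e)) (δ-≢ jl) (A-diag i) refl refl refl ∙ x₂ a₂ a₃ a₄ (A i l) (A j i) (A j l))) }
      ; (no ik) → case i ≟ l of λ
        { (yes refl) → case j ≟ k of λ
          { (yes refl) → Ẽ-eval (i ∷ j ∷ j ∷ i ∷ []) (i ∷ j ∷ []) (s₃ ij) ∙ eval₂ ij ∙ sym (cong₂ (λ s t → A i j * (s * t)) (A-sym j i) (X-value i j j i (δ-≢ ij) (δ-refl i) (δ-refl j) (δ-≢ λ e → ij (sym e)) refl (A-diag i) (A-diag j) refl ∙ x₃ a₂ a₃ a₄ (A i j) (A j i)) ∙ A-idem i j a₂)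
          ; (no jk) → Ẽ-eval (i ∷ j ∷ k ∷ i ∷ []) (i ∷ j ∷ k ∷ []) (s₄ ij ik jk) ∙ eval₃ ij ik jk ∙ cong₂ (λ s t → A i j * (s * t)) (A-sym i k) (*-comm (A j k) a₃ ∙ sym (X-value i j k i (δ-≢ ik) (δ-refl i) (δ-≢ jk) (δ-≢ λ e → ij (sym e)) refl (A-diag i) refl refl ∙ x₄ a₂ a₃ a₄ (A i k) (A j k) (A j i))) }
        ; (no il) → case j ≟ k of λ
          { (yes refl) → Ẽ-eval (i ∷ j ∷ j ∷ l ∷ []) (i ∷ j ∷ l ∷ []) (s₅ ij il kl) ∙ eval₃ ij il kl ∙ sw (A i j) (A i l) (A j l) a₃ ∙ cong (λ t → A i j * (A j l * t)) (sym (X-value i j j l (δ-≢ ik) (δ-≢ il) (δ-refl j) (δ-≢ kl) refl refl (A-diag j) refl ∙ x₅ a₂ a₃ a₄ (A i j) (A i l) (A j l)))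
          ; (no jk) → case j ≟ l of λ
            { (yes refl) → Ẽ-eval (i ∷ j ∷ k ∷ j ∷ []) (i ∷ j ∷ k ∷ []) (s₆ ij ik jk) ∙ eval₃ ij ik jk ∙ sw (A i j) (A i k) (A j k) a₃ ∙ cong₂ (λ s t → A i j * (s * t)) (A-sym j k) (sym (X-value i j k j (δ-≢ ik) (δ-≢ il) (δ-≢ jk) (δ-refl j) refl refl refl (A-diag j) ∙ x₆ a₂ a₃ a₄ (A i k) (A i j) (A j k)))
            ; (no jl) → Ẽ-eval (i ∷ j ∷ k ∷ l ∷ []) (i ∷ j ∷ k ∷ l ∷ []) (s₇ ij ik il jk jl kl) ∙ eval₄ ij ik il jk jl kl ∙ sw₄ (A i j) (A i k) (A i l) (A j k) (A j l) (A k l) a₄ ∙ cong (λ t → A i j * (A k l * t)) (sym (X-value i j k l (δ-≢ ik) (δ-≢ il) (δ-≢ jk) (δ-≢ jl) refl refl refl refl ∙ x₇ a₂ a₃ a₄ (A i k) (A i l) (A j k) (A j l))) } } } }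
      where
      sw = solve 4 (λ a b c d → a :* (b :* (c :* d)) := a :* (c :* (d :* b))) refl
      sw₄ = solve 7 (λ a b c d e f x → a :* (b :* (c :* (d :* (e :* (f :* x))))) := a :* (f :* (x :* (b :* c :* (d :* e))))) refl
      x₁ = solve 5 (λ a b c x y → a :* (con 1ℚ :* con 1ℚ :+ con 0ℚ :* con 0ℚ) :+ b :* (con 1ℚ :* con 0ℚ :+ con 0ℚ :* y :+ (con 0ℚ
          :* x :+ con 1ℚ :* con 0ℚ)) :+ c :* (con 0ℚ :* x :* (y :* con 0ℚ))
        := a) refl
      x₂ = solve 6 (λ a b c x y z → a :* (con 1ℚ :* con 0ℚ :+ con 0ℚ :* con 0ℚ) :+ b :* (con 1ℚ :* z :+ con 0ℚ :* y :+ (con 0ℚ :* x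
          :+ con 0ℚ :* con 0ℚ)) :+ c :* (con 0ℚ :* x :* (y :* z))
        := b :* z) refl
      x₃ = solve 5 (λ a b c x y → a :* (con 0ℚ :* con 0ℚ :+ con 1ℚ :* con 1ℚ) :+ b :* (con 0ℚ :* y :+ con 1ℚ :* con 0ℚ :+ (con 1ℚ
          :* con 0ℚ :+ con 0ℚ :* x)) :+ c :* (x :* con 0ℚ :* (con 0ℚ :* y))
        := a) refl
      x₄ = solve 6 (λ a b c x y z → a :* (con 0ℚ :* con 0ℚ :+ con 1ℚ :* con 0ℚ) :+ b :* (con 0ℚ :* z :+ con 1ℚ :* y :+ (con 0ℚ :* con 0ℚ
          :+ con 0ℚ :* x)) :+ c :* (x :* con 0ℚ :* (y :* z))
        := b :* y) refl
      x₅ = solve 6 (λ a b c x y z → a :* (con 0ℚ :* con 0ℚ :+ con 0ℚ :* con 1ℚ) :+ b :* (con 0ℚ :* z :+ con 0ℚ :* con 0ℚ :+ (con 1ℚ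
          :* y :+ con 0ℚ :* x)) :+ c :* (x :* y :* (con 0ℚ :* z))
        := b :* y) refl
      x₆ = solve 6 (λ a b c x y z → a :* (con 0ℚ :* con 1ℚ :+ con 0ℚ :* con 0ℚ) :+ b :* (con 0ℚ :* con 0ℚ :+ con 0ℚ :* z :+ (con 0ℚ
          :* y :+ con 1ℚ :* x)) :+ c :* (x :* y :* (z :* con 0ℚ))
        := b :* x) refl
      x₇ = solve 7 (λ a b c x y z w → a :* (con 0ℚ :* con 0ℚ :+ con 0ℚ :* con 0ℚ) :+ b :* (con 0ℚ :* w :+ con 0ℚ :* z :+ (con 0ℚ
          :* y :+ con 0ℚ :* x)) :+ c :* (x :* y :* (z :* w))
        := c :* (x :* y :* (z :* w))) refl
      s₁ : ∀ {i j : Fin n} → i ≢ j → support (i ∷ j ∷ i ∷ j ∷ []) ≡ i ∷ j ∷ []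
      s₁ {i} {j} ij rewrite does-≢ ij | does-≢ (λ e → ij (sym e)) | does-refl i | does-refl j = refl
      s₂ : ∀ {i j l : Fin n} → i ≢ j → i ≢ l → j ≢ l → support (i ∷ j ∷ i ∷ l ∷ []) ≡ i ∷ j ∷ l ∷ []
      s₂ {i} {j} {l} ij il jl rewrite does-≢ il | does-≢ (λ e → ij (sym e)) | does-≢ jl | does-≢ ij | does-refl i | does-≢ il = refl
      s₃ : ∀ {i j : Fin n} → i ≢ j → support (i ∷ j ∷ j ∷ i ∷ []) ≡ i ∷ j ∷ []
      s₃ {i} {j} ij rewrite does-≢ (λ e → ij (sym e)) | does-refl j | does-≢ (λ e → ij (sym e)) | does-≢ ij | does-refl i = refl
      s₄ : ∀ {i j k : Fin n} → i ≢ j → i ≢ k → j ≢ k → support (i ∷ j ∷ k ∷ i ∷ []) ≡ i ∷ j ∷ k ∷ []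
      s₄ {i} {j} {k} ij ik jk rewrite does-≢ (λ e → ik (sym e)) | does-≢ jk | does-≢ (λ e → ij (sym e)) | does-≢ ij | does-≢ ik | does-refl i = refl
      s₅ : ∀ {i j l : Fin n} → i ≢ j → i ≢ l → j ≢ l → support (i ∷ j ∷ j ∷ l ∷ []) ≡ i ∷ j ∷ l ∷ []
      s₅ {i} {j} {l} ij il jl rewrite does-≢ jl | does-refl j | does-≢ jl | does-≢ ij | does-≢ il = refl
      s₆ : ∀ {i j k : Fin n} → i ≢ j → i ≢ k → j ≢ k → support (i ∷ j ∷ k ∷ j ∷ []) ≡ i ∷ j ∷ k ∷ []
      s₆ {i} {j} {k} ij ik jk rewrite does-≢ (λ e → jk (sym e)) | does-≢ jk | does-refl j | does-≢ ij | does-≢ ik = refl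
      s₇ : ∀ {i j k l : Fin n} → i ≢ j → i ≢ k → i ≢ l → j ≢ k → j ≢ l → k ≢ l → support (i ∷ j ∷ k ∷ l ∷ []) ≡ i ∷ j ∷ k ∷ l ∷ []
      s₇ ij ik il jk jl kl rewrite does-≢ kl | does-≢ jk | does-≢ jl | does-≢ ij | does-≢ ik | does-≢ il = refl

  Ẽ₄ : ∀ i j k l → Ẽ G α (i ∷ j ∷ k ∷ l ∷ []) ≡ M₄ i j k l
  Ẽ₄ i j k l = case i ≟ j of λ
    { (yes refl) → Ẽ-same (i ∷ i ∷ k ∷ l ∷ []) (i ∷ k ∷ l ∷ []) (support-double i (k ∷ l ∷ [])) ∙ Ẽ₃′ i k l ∙ sym (cong₂ (λ d a → d * M₃ k l i + a * Z) (δ-refl i) (A-diag i) ∙ l₁ (M₃ k l i) Z)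
    ; (no ij) → case k ≟ l of λ
      { (yes refl) → Ẽ-same (i ∷ j ∷ k ∷ k ∷ []) (i ∷ j ∷ k ∷ []) (support-tail i (j ∷ k ∷ k ∷ []) (j ∷ k ∷ []) (support-tail j (k ∷ k ∷ []) (k ∷ []) (support-double k []))) ∙ Ẽ₃ i j k ∙ M₃-off ij k
          ∙ sym (cong (λ d → d * M₃ k k i + A i j * (δ k k * Y i j k + A k k * X i j k k)) (δ-≢ ij) ∙ cong₂ (λ d a → 0ℚ * M₃ k k i + A i j * (d * Y i j k + a * X i j k k)) (δ-refl k) (A-diag k) ∙ l₂ (M₃ k k i) (A i j) (Y i j k) (X i j k k))
      ; (no kl) → X-off i j k l ij kl ∙ sym (cong₂ (λ d d′ → d * M₃ k l i + A i j * (d′ * Y i j k + A k l * X i j k l)) (δ-≢ ij) (δ-≢ kl) ∙ l₃ (M₃ k l i) (A i j) (Y i j k) (A k l * X i j k l)) } }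
    where
    Z : ℚ
    Z = δ k l * Y i j k + A k l * X i j k l
    l₁ = solve 2 (λ x y → con 1ℚ :* x :+ con 0ℚ :* y := x) refl
    l₂ = solve 4 (λ m a y x → con 0ℚ :* m :+ a :* (con 1ℚ :* y :+ con 0ℚ :* x) := a :* y) refl
    l₃ = solve 4 (λ m a y x → con 0ℚ :* m :+ a :* (con 0ℚ :* y :+ x) := a :* x) refl

-- The pseudoexpectation of a square as a quadratic form in the coefficients

sumℚ-++ : ∀ xs ys → sumℚ (xs ++ ys) ≡ sumℚ xs + sumℚ ys
sumℚ-++ [] ys = sym (+-identityˡ (sumℚ ys))
sumℚ-++ (x ∷ xs) ys = trans (cong (x +_) (sumℚ-++ xs ys)) (sym (+-assoc x (sumℚ xs) (sumℚ ys)))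

sumℚ-concatMap : ∀ {X Y : Set} (h : Y → ℚ) (f : X → List Y) xs → sumℚ (map h (concatMap f xs)) ≡ sumℚ (map (λ x → sumℚ (map h (f x))) xs)
sumℚ-concatMap h f [] = refl
sumℚ-concatMap h f (x ∷ xs) = trans (cong sumℚ (map-++ h (f x) (concatMap f xs))) (trans (sumℚ-++ (map h (f x)) (map h (concatMap f xs))) (cong (sumℚ (map h (f x)) +_) (sumℚ-concatMap h f xs)))

sumℚ-concat : ∀ {X : Set} (f : X → List ℚ) xs → sumℚ (concatMap f xs) ≡ sumℚ (map (λ x → sumℚ (f x)) xs)
sumℚ-concat f [] = refl
sumℚ-concat f (x ∷ xs) = trans (sumℚ-++ (f x) (concatMap f xs)) (cong (sumℚ (f x) +_) (sumℚ-concat f xs))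

sumℚ-tabulate : ∀ {n} (f : Fin n → ℚ) → sumℚ (tabulate f) ≡ ∑ f
sumℚ-tabulate {zero} f = sym (∑-zero f)
sumℚ-tabulate {suc n} f = trans (cong (f zero +_) (sumℚ-tabulate λ x → f (suc x))) (sym (∑-suc f))

sumℚ-allFin : ∀ {n} (f : Fin n → ℚ) → sumℚ (map f (allFin n)) ≡ ∑ f
sumℚ-allFin {n} f = trans (cong sumℚ (map-tabulate (λ x → x) f)) (sumℚ-tabulate f)

sumℚ-terms : ∀ {n} (q : Poly≤2 n) (h : ℚ × Monomial n → ℚ) → let open Poly≤2 q in
  sumℚ (map h (terms q)) ≡ h (c₀ , []) + ((∑[ i ] h (c₁ i , i ∷ [])) + (∑[ i ] ∑[ j ] h (c₂ i j , i ∷ j ∷ [])))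
sumℚ-terms {n} (poly c₀ c₁ c₂) h = cong (h (c₀ , []) +_) (trans (cong sumℚ (map-++ h singles pairs)) (trans (sumℚ-++ (map h singles) (map h pairs)) (cong₂ _+_
  (trans (cong sumℚ (sym (map-∘ (allFin n)))) (sumℚ-allFin λ i → h (c₁ i , i ∷ [])))
  (trans (sumℚ-concatMap h row (allFin n)) (trans (sumℚ-allFin λ i → sumℚ (map h (row i))) (∑-cong λ i → trans (cong sumℚ (sym (map-∘ (allFin n)))) (sumℚ-allFin λ j → h (c₂ i j , i ∷ j ∷ []))))))))
  where
  row : Fin n → List (ℚ × Monomial n)
  row i = map (λ j → c₂ i j , i ∷ j ∷ []) (allFin n)
  singles pairs : List (ℚ × Monomial n)
  singles = map (λ i → c₁ i , i ∷ []) (allFin n)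
  pairs = concatMap row (allFin n)

module QuadraticForm {n : ℕ} (G : Graph n) (G-sym : ∀ i j → G i j ≡ G j i) (α : FKParams) where
  open PseudoMoments G G-sym α public

  -- Pseudoexpectation of the square of c + Σ b_i x_i + Σ e_ij x_i x_j for symmetric e supported on
  -- edges.
  Form : ℚ → (Fin n → ℚ) → (Fin n → Fin n → ℚ) → ℚ
  Form c b e = c * c + # 2 * c * (a₁ * ∑ b + a₂ * (∑[ i ] ∑[ j ] e i j)) + (a₁ * ‖ b ‖² + a₂ * (∑[ i ] ∑[ k ] A i k * (b i * b k)))
    + # 2 * (∑[ k ] b k * (# 2 * a₂ * (∑[ i ] e k i) + a₃ * (∑[ i ] ∑[ j ] A k i * A k j * e i j)))
    + (# 2 * a₂ * ‖ e ‖²₂ + # 4 * a₃ * (∑[ i ] ∑[ j ] ∑[ k ] e i j * e i k * A j k) + a₄ * (∑[ i ] ∑[ j ] ∑[ k ] ∑[ l ] e i j * e k l * (A i k * A i l * (A j k * A j l))))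

  M₂-sym : ∀ i j → M₂ i j ≡ M₂ j i
  M₂-sym i j = cong₂ (λ d a → d * a₁ + a * a₂) (δ-sym i j) (A-sym i j)

  private
    module L2 = Linear (∑²-linear {n} {n})

    pair-split : ∀ (c : Fin n → Fin n → ℚ) (u : Fin n → ℚ) (v : Fin n → Fin n → ℚ) → (∑[ i ] ∑[ j ] c i j * (δ i j * u i + A i j * v i j)) ≡ (∑[ i ] c i i * u i) + (∑[ i ] ∑[ j ] c i j * A i j * v i j)
    pair-split c u v = trans (∑-cong₂ λ i j → l (c i j) (δ i j) (u i) (A i j) (v i j)) (trans (L2.L-+ (λ (i , j) → δ i j * (c i j * u i)) (λ (i , j) → c i j * A i j * v i j))
      (cong (_+ (∑[ i ] ∑[ j ] c i j * A i j * v i j)) (∑-cong λ i → ∑-δˡ i λ j → c i j * u i)))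
      where
      l = solve 5 (λ c d u a v → c :* (d :* u :+ a :* v) := d :* (c :* u) :+ c :* a :* v) refl

  module Expand (c : ℚ) (b : Fin n → ℚ) (c₂ : Fin n → Fin n → ℚ) where
    d : Fin n → ℚ
    d i = c₂ i i
    w : Fin n → Fin n → ℚ
    w i j = c₂ i j * A i j

    -- values of the functional on x_k times the quadratic part, and on x_i x_j times it
    R : Fin n → ℚ
    R k = ∑[ i ] ∑[ j ] w i j * Y i j k
    XX : ℚ
    XX = ∑[ i ] ∑[ j ] w i j * (∑[ k ] ∑[ l ] w k l * X i j k l)
    D : Fin n → ℚ
    D k = ∑[ i ] d i * M₂ i k

    level : (ℚ → Monomial n → ℚ) → ℚ
    level h = h c [] + ((∑[ i ] h (b i) (i ∷ [])) + (∑[ i ] ∑[ j ] h (c₂ i j) (i ∷ j ∷ [])))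

    ẼSq-levels : ẼSq G α (poly c b c₂) ≡ level λ v m → level λ v′ m′ → (v * v′) * Ẽ G α (m ++ m′)
    ẼSq-levels = trans (sumℚ-concat outer (terms (poly c b c₂))) (trans (sumℚ-terms (poly c b c₂) λ t → sumℚ (outer t))
        (cong₂ _+_ (inner (c , [])) (cong₂ _+_ (∑-cong λ i → inner (b i , i ∷ [])) (∑-cong₂ λ i j → inner (c₂ i j , i ∷ j ∷ [])))))
      where
      outer : ℚ × Monomial n → List ℚ
      outer t = map (λ s → (proj₁ t * proj₁ s) * Ẽ G α (proj₂ t ++ proj₂ s)) (terms (poly c b c₂))
      inner : ∀ t → sumℚ (outer t) ≡ level (λ v′ m′ → (proj₁ t * v′) * Ẽ G α (proj₂ t ++ m′))
      inner t = sumℚ-terms (poly c b c₂) λ s → (proj₁ t * proj₁ s) * Ẽ G α (proj₂ t ++ proj₂ s)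

    private
      q-sum : ∀ v (m : Fin n → Fin n → ℚ) → (∑[ i ] ∑[ j ] v * c₂ i j * m i j) ≡ v * (∑[ i ] ∑[ j ] c₂ i j * m i j)
      q-sum v m = trans (∑-cong₂ λ i j → *-assoc v (c₂ i j) (m i j)) (L2.L-* v (λ (i , j) → c₂ i j * m i j))
      b-sum : ∀ v (m : Fin n → ℚ) → (∑[ i ] v * b i * m i) ≡ v * (∑[ i ] b i * m i)
      b-sum v m = trans (∑-cong λ i → *-assoc v (b i) (m i)) (∑-*ˡ v λ i → b i * m i)

      sd sw sb : ℚ
      sd = ∑ d
      sw = ∑[ i ] ∑[ j ] w i j
      sb = ∑ b

      quad-1 : (∑[ i ] ∑[ j ] c₂ i j * M₂ i j) ≡ sd * a₁ + sw * a₂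
      quad-1 = trans (pair-split c₂ (λ _ → a₁) (λ _ _ → a₂)) (cong₂ _+_ (∑-*ʳ a₁ d) (trans (∑-cong λ i → ∑-*ʳ a₂ (w i)) (∑-*ʳ a₂ λ i → ∑ (w i))))

      quad-x : ∀ k → (∑[ i ] ∑[ j ] c₂ i j * M₃ i j k) ≡ D k + R k
      quad-x k = pair-split c₂ (λ i → M₂ i k) (λ i j → Y i j k)

      quad-xx : ∀ i j → (∑[ k ] ∑[ l ] c₂ k l * M₄ i j k l) ≡ δ i j * (D i + R i) + A i j * ((∑[ k ] d k * Y i j k) + (∑[ k ] ∑[ l ] w k l * X i j k l))
      quad-xx i j = trans (∑-cong₂ λ k l → s (c₂ k l) (δ i j) (M₃ k l i) (A i j) (δ k l * Y i j k + A k l * X i j k l)) (trans (L2.L-+ (λ (k , l) → δ i j * (c₂ k l * M₃ k l i)) (λ (k , l) → A i j * (c₂ k l * (δ k l * Y i j k + A k l * X i j k l))))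
        (cong₂ _+_ (trans (L2.L-* (δ i j) λ (k , l) → c₂ k l * M₃ k l i) (cong (δ i j *_) (quad-x i))) (trans (L2.L-* (A i j) λ (k , l) → c₂ k l * (δ k l * Y i j k + A k l * X i j k l)) (cong (A i j *_) (pair-split c₂ (λ k → Y i j k) (λ k l → X i j k l))))))
        where
        s = solve 5 (λ c d m a x → c :* (d :* m :+ a :* x) := d :* (c :* m) :+ a :* (c :* x)) refl

      bM bD bR dD dR : ℚ
      bM = ∑[ i ] b i * (∑[ k ] b k * M₂ i k)
      bD = ∑[ i ] b i * D i
      bR = ∑[ i ] b i * R i
      dD = ∑[ i ] d i * D i
      dR = ∑[ i ] d i * R i

      D+R : ∀ (f : Fin n → ℚ) → (∑[ i ] f i * (D i + R i)) ≡ (∑[ i ] f i * D i) + (∑[ i ] f i * R i)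
      D+R f = trans (∑-cong λ i → *-distribˡ-+ (f i) (D i) (R i)) (∑-+ (λ i → f i * D i) (λ i → f i * R i))

      lvl₀ : level (λ v′ m′ → (c * v′) * Ẽ G α m′) ≡ c * c * 1ℚ + (c * (sb * a₁) + c * (sd * a₁ + sw * a₂))
      lvl₀ = cong (c * c * 1ℚ +_) (cong₂ _+_ (trans (∑-cong λ i → cong (c * b i *_) (Ẽ₁ i)) (trans (b-sum c λ _ → a₁) (cong (c *_) (∑-*ʳ a₁ b))))
        (trans (∑-cong₂ λ i j → cong (c * c₂ i j *_) (Ẽ₂ i j)) (trans (q-sum c M₂) (cong (c *_) quad-1))))

      lvl₁ : ∀ v i → level (λ v′ m′ → (v * v′) * Ẽ G α (i ∷ m′)) ≡ v * (c * a₁ + ((∑[ k ] b k * M₂ i k) + (D i + R i)))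
      lvl₁ v i = trans (cong₂ _+_ (trans (cong (v * c *_) (Ẽ₁ i)) (*-assoc v c a₁)) (cong₂ _+_ (trans (∑-cong λ k → cong (v * b k *_) (Ẽ₂ i k)) (b-sum v (M₂ i)))
        (trans (∑-cong₂ λ k l → cong (v * c₂ k l *_) (Ẽ₃′ i k l)) (trans (q-sum v λ k l → M₃ k l i) (cong (v *_) (quad-x i)))))) (s v (c * a₁) (∑[ k ] b k * M₂ i k) (D i + R i))
        where
        s = solve 4 (λ v x y z → v :* x :+ (v :* y :+ v :* z) := v :* (x :+ (y :+ z))) refl

      lvl₂ : ∀ v i j → level (λ v′ m′ → (v * v′) * Ẽ G α (i ∷ j ∷ m′)) ≡ v * (δ i j * (c * a₁ + (∑[ k ] b k * M₂ i k) + (D i + R i)) + A i j * (c * a₂ + (∑[ k ] b k * Y i j k) + ((∑[ k ] d k * Y i j k) + (∑[ k ] ∑[ l ] w k l * X i j k l))))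
      lvl₂ v i j = trans (cong₂ _+_ (trans (cong (v * c *_) (Ẽ₂ i j)) (*-assoc v c (M₂ i j))) (cong₂ _+_ (trans (∑-cong λ k → cong (v * b k *_) (Ẽ₃ i j k)) (trans (b-sum v (M₃ i j)) (cong (v *_) bM₃)))
        (trans (∑-cong₂ λ k l → cong (v * c₂ k l *_) (Ẽ₄ i j k l)) (trans (q-sum v (M₄ i j)) (cong (v *_) (quad-xx i j))))))
        (s v c (δ i j) (A i j) a₁ a₂ (∑[ k ] b k * M₂ i k) (∑[ k ] b k * Y i j k) (D i + R i) _)
        where
        bM₃ : (∑[ k ] b k * M₃ i j k) ≡ δ i j * (∑[ k ] b k * M₂ i k) + A i j * (∑[ k ] b k * Y i j k)
        bM₃ = trans (∑-cong λ k → t (b k) (δ i j) (M₂ i k) (A i j) (Y i j k)) (trans (∑-+ (λ k → δ i j * (b k * M₂ i k)) (λ k → A i j * (b k * Y i j k))) (cong₂ _+_ (∑-*ˡ (δ i j) λ k → b k * M₂ i k) (∑-*ˡ (A i j) λ k → b k * Y i j k)))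
          where
          t = solve 5 (λ b d m a y → b :* (d :* m :+ a :* y) := d :* (b :* m) :+ a :* (b :* y)) refl
        s = solve 10 (λ v c d a a₁ a₂ x y z u → v :* (c :* (d :* a₁ :+ a :* a₂)) :+ (v :* (d :* x :+ a :* y) :+ v :* (d :* z :+ a :* u))
          := v :* (d :* (c :* a₁ :+ x :+ z) :+ a :* (c :* a₂ :+ y :+ u))) refl

      yb : ∀ (f : Fin n → ℚ) → (∑[ i ] ∑[ j ] w i j * (∑[ k ] f k * Y i j k)) ≡ (∑[ k ] f k * R k)
      yb f = trans (∑-cong₂ λ i j → sym (∑-*ˡ (w i j) λ k → f k * Y i j k)) (trans (L-∑ (∑²-linear {n} {n}) λ (i , j) k → w i j * (f k * Y i j k))
        (∑-cong λ k → trans (∑-cong₂ λ i j → p (w i j) (f k) (Y i j k)) (L2.L-* (f k) λ (i , j) → w i j * Y i j k)))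
        where
        p = solve 3 (λ a b c → a :* (b :* c) := b :* (a :* c)) refl

      db : (∑[ i ] d i * (∑[ k ] b k * M₂ i k)) ≡ bD
      db = trans (∑-cong λ i → sym (∑-*ˡ (d i) λ k → b k * M₂ i k)) (trans (∑-swap λ i k → d i * (b k * M₂ i k)) (∑-cong λ k → trans (∑-cong λ i → p (d i) (b k) (M₂ i k)) (∑-*ˡ (b k) λ i → d i * M₂ i k)))
        where
        p = solve 3 (λ a b c → a :* (b :* c) := b :* (a :* c)) refl

      sum₁ : (∑[ i ] b i * (c * a₁ + ((∑[ k ] b k * M₂ i k) + (D i + R i)))) ≡ sb * (c * a₁) + (bM + (bD + bR))
      sum₁ = trans (∑-cong λ i → t (b i) (c * a₁) (∑[ k ] b k * M₂ i k) (D i + R i)) (trans (∑-+ (λ i → b i * (c * a₁)) (λ i → b i * (∑[ k ] b k * M₂ i k) + b i * (D i + R i)))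
        (cong₂ _+_ (∑-*ʳ (c * a₁) b) (trans (∑-+ (λ i → b i * (∑[ k ] b k * M₂ i k)) (λ i → b i * (D i + R i))) (cong (bM +_) (D+R b)))))
        where
        t = solve 4 (λ b x y z → b :* (x :+ (y :+ z)) := b :* x :+ (b :* y :+ b :* z)) refl

      sum₂ : (∑[ i ] ∑[ j ] c₂ i j * (δ i j * (c * a₁ + (∑[ k ] b k * M₂ i k) + (D i + R i)) + A i j * (c * a₂ + (∑[ k ] b k * Y i j k) + ((∑[ k ] d k * Y i j k) + (∑[ k ] ∑[ l ] w k l * X i j k l)))))
        ≡ (sd * (c * a₁) + bD + (dD + dR)) + (sw * (c * a₂) + bR + (dR + XX))
      sum₂ = trans (pair-split c₂ (λ i → c * a₁ + (∑[ k ] b k * M₂ i k) + (D i + R i)) (λ i j → c * a₂ + (∑[ k ] b k * Y i j k) + ((∑[ k ] d k * Y i j k) + (∑[ k ] ∑[ l ] w k l * X i j k l))))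
        (cong₂ _+_
          (trans (∑-cong λ i → t (d i) (c * a₁) (∑[ k ] b k * M₂ i k) (D i + R i)) (trans (∑-+ (λ i → d i * (c * a₁) + d i * (∑[ k ] b k * M₂ i k)) (λ i → d i * (D i + R i))) (cong₂ _+_ (trans (∑-+ (λ i → d i * (c * a₁)) (λ i → d i * (∑[ k ] b k * M₂ i k))) (cong₂ _+_ (∑-*ʳ (c * a₁) d) db)) (D+R d))))
          (trans (∑-cong₂ λ i j → u (w i j) (c * a₂) (∑[ k ] b k * Y i j k) (∑[ k ] d k * Y i j k) (∑[ k ] ∑[ l ] w k l * X i j k l))
            (trans (L2.L-+ (λ (i , j) → w i j * (c * a₂) + w i j * (∑[ k ] b k * Y i j k)) (λ (i , j) → w i j * (∑[ k ] d k * Y i j k) + w i j * (∑[ k ] ∑[ l ] w k l * X i j k l)))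
              (cong₂ _+_ (trans (L2.L-+ (λ (i , j) → w i j * (c * a₂)) (λ (i , j) → w i j * (∑[ k ] b k * Y i j k))) (cong₂ _+_ (trans (∑-cong λ i → ∑-*ʳ (c * a₂) (w i)) (∑-*ʳ (c * a₂) λ i → ∑ (w i))) (yb b)))
                (trans (L2.L-+ (λ (i , j) → w i j * (∑[ k ] d k * Y i j k)) (λ (i , j) → w i j * (∑[ k ] ∑[ l ] w k l * X i j k l))) (cong (_+ XX) (yb d)))))))
        where
        t = solve 4 (λ b x y z → b :* (x :+ y :+ z) := b :* x :+ b :* y :+ b :* z) refl
        u = solve 5 (λ b x y z v → b :* (x :+ y :+ (z :+ v)) := b :* x :+ b :* y :+ (b :* z :+ b :* v)) refl

    -- Diagonal coefficients join the linear ones, because replacing x_i² by x_i does not change a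
    -- pseudomoment.
    β : Fin n → ℚ
    β i = b i + d i

    ẼSq-weights : ẼSq G α (poly c b c₂) ≡ c * c + # 2 * c * (a₁ * ∑ β + a₂ * (∑[ i ] ∑[ j ] w i j)) + (∑[ i ] β i * (∑[ k ] β k * M₂ i k)) + # 2 * (∑[ k ] β k * R k) + XX
    ẼSq-weights = trans ẼSq-levels (trans (cong₂ _+_ lvl₀ (cong₂ _+_ (trans (∑-cong λ i → lvl₁ (b i) i) sum₁) (trans (∑-cong₂ λ i j → lvl₂ (c₂ i j) i j) sum₂)))
      (trans (final c a₁ a₂ sb sd sw bM bD bR dD dR XX) (cong₂ (λ x y → x + y + XX) (cong₂ (λ x y → c * c + # 2 * c * (a₁ * x + a₂ * sw) + y) (sym (∑-+ b d)) (sym ββ)) (cong (# 2 *_) (sym βR)))))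
      where
      βR : (∑[ k ] β k * R k) ≡ bR + dR
      βR = trans (∑-cong λ k → *-distribʳ-+ (R k) (b k) (d k)) (∑-+ (λ k → b k * R k) (λ k → d k * R k))
      ββ : (∑[ i ] β i * (∑[ k ] β k * M₂ i k)) ≡ bM + # 2 * bD + dD
      ββ = trans (∑-cong λ i → trans (cong (β i *_) (trans (∑-cong λ k → *-distribʳ-+ (M₂ i k) (b k) (d k)) (trans (∑-+ (λ k → b k * M₂ i k) (λ k → d k * M₂ i k)) (cong ((∑[ k ] b k * M₂ i k) +_) (∑-cong λ k → cong (d k *_) (M₂-sym i k))))))
          (t (b i) (d i) (∑[ k ] b k * M₂ i k) (D i)))
        (trans (∑-+ (λ i → b i * (∑[ k ] b k * M₂ i k) + b i * D i) (λ i → d i * (∑[ k ] b k * M₂ i k) + d i * D i)) (trans (cong₂ _+_ (∑-+ (λ i → b i * (∑[ k ] b k * M₂ i k)) (λ i → b i * D i)) (trans (∑-+ (λ i → d i * (∑[ k ] b k * M₂ i k)) (λ i → d i * D i)) (cong (_+ dD) db))) (s bM bD dD)))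
        where
        t = solve 4 (λ b d x y → (b :+ d) :* (x :+ y) := b :* x :+ b :* y :+ (d :* x :+ d :* y)) refl
        s = solve 3 (λ x y z → x :+ y :+ (y :+ z) := x :+ :# 2 :* y :+ z) refl
      final = solve 12 (λ c a₁ a₂ sb sd sw bM bD bR dD dR XX → c :* c :* con 1ℚ :+ (c :* (sb :* a₁) :+ c :* (sd :* a₁ :+ sw :* a₂))
          :+ (sb :* (c :* a₁) :+ (bM :+ (bD :+ bR)) :+ (sd :* (c :* a₁) :+ bD :+ (dD :+ dR) :+ (sw :* (c :* a₂) :+ bR :+ (dR :+ XX))))
        := c :* c :+ :# 2 :* c :* (a₁ :* (sb :+ sd) :+ a₂ :* sw) :+ (bM :+ :# 2 :* bD :+ dD) :+ :# 2 :* (bR :+ dR) :+ XX) refl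

    -- Normal form of the quadratic part: coefficients at non-edges multiply monomials of value
    -- zero, and x_i x_j commute, so the symmetric part on edges determines the form.
    e : Fin n → Fin n → ℚ
    e i j = ½ * (w i j + w j i)

    e-sym : ∀ i j → e i j ≡ e j i
    e-sym i j = cong (½ *_) (+-comm (w i j) (w j i))

    private
      symmetrize : ∀ (v : Fin n → Fin n → ℚ) → (∀ i j → v i j ≡ v j i) → (∑[ i ] ∑[ j ] w i j * v i j) ≡ (∑[ i ] ∑[ j ] e i j * v i j)
      symmetrize v v-sym = sym (trans (∑-cong₂ λ i j → s (w i j) (w j i) (v i j)) (trans (L2.L-* ½ λ (i , j) → w i j * v i j + w j i * v i j) (trans (cong (½ *_) (trans (L2.L-+ (λ (i , j) → w i j * v i j) (λ (i , j) → w j i * v i j))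
        (cong ((∑[ i ] ∑[ j ] w i j * v i j) +_) (trans (∑-swap λ i j → w j i * v i j) (∑-cong₂ λ j i → cong (w j i *_) (v-sym i j)))))) (h (∑[ i ] ∑[ j ] w i j * v i j)))))
        where
        s = solve 3 (λ x y v → con ½ :* (x :+ y) :* v := con ½ :* (x :* v :+ y :* v)) refl
        h = solve 1 (λ x → con ½ :* (x :+ x) := x) refl

      Y-sym : ∀ i j k → Y i j k ≡ Y j i k
      Y-sym i j k = s a₂ a₃ (δ i k) (δ j k) (A k i) (A k j)
        where
        s = solve 6 (λ a b x y z w → a :* (x :+ y) :+ b :* (z :* w) := a :* (y :+ x) :+ b :* (w :* z)) refl

      X-sym₁ : ∀ i j k l → X i j k l ≡ X j i k l
      X-sym₁ i j k l = s a₂ a₃ a₄ (δ i k) (δ j l) (δ i l) (δ j k) (A j l) (A j k) (A i l) (A i k)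
        where
        s = solve 11 (λ a b c x y z w p q r t → a :* (x :* y :+ z :* w) :+ b :* (x :* p :+ z :* q :+ (w :* r :+ y :* t)) :+ c :* (t :* r :* (q :* p))
          := a :* (w :* z :+ y :* x) :+ b :* (w :* r :+ y :* t :+ (x :* p :+ z :* q)) :+ c :* (q :* p :* (t :* r))) refl

      X-sym₂ : ∀ i j k l → X i j k l ≡ X i j l k
      X-sym₂ i j k l = s a₂ a₃ a₄ (δ i k) (δ j l) (δ i l) (δ j k) (A j l) (A j k) (A i l) (A i k)
        where
        s = solve 11 (λ a b c x y z w p q r t → a :* (x :* y :+ z :* w) :+ b :* (x :* p :+ z :* q :+ (w :* r :+ y :* t)) :+ c :* (t :* r :* (q :* p))
          := a :* (z :* w :+ x :* y) :+ b :* (z :* q :+ x :* p :+ (y :* t :+ w :* r)) :+ c :* (r :* t :* (p :* q))) refl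

      open SymmetricForm e e-sym

      sum-M₂ : ∀ (f : Fin n → ℚ) → (∑[ i ] f i * (∑[ k ] f k * M₂ i k)) ≡ a₁ * ‖ f ‖² + a₂ * (∑[ i ] ∑[ k ] A i k * (f i * f k))
      sum-M₂ f = trans (∑-cong λ i → trans (sym (∑-*ˡ (f i) λ k → f k * M₂ i k)) (trans (∑-cong λ k → s (f i) (f k) (δ i k) (A i k) a₁ a₂) (trans (∑-+ (λ k → δ i k * (a₁ * (f i * f k))) (λ k → a₂ * (A i k * (f i * f k))))
          (cong₂ _+_ (∑-δˡ i λ k → a₁ * (f i * f k)) (∑-*ˡ a₂ λ k → A i k * (f i * f k))))))
        (trans (∑-+ (λ i → a₁ * (f i * f i)) (λ i → a₂ * (∑[ k ] A i k * (f i * f k)))) (cong₂ _+_ (∑-*ˡ a₁ λ i → f i * f i) (∑-*ˡ a₂ λ i → ∑[ k ] A i k * (f i * f k))))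
        where
        s = solve 6 (λ x y d a p q → x :* (y :* (d :* p :+ a :* q)) := d :* (p :* (x :* y)) :+ q :* (a :* (x :* y))) refl

      sum-Y : ∀ k → R k ≡ # 2 * a₂ * (∑[ i ] e k i) + a₃ * (∑[ i ] ∑[ j ] A k i * A k j * e i j)
      sum-Y k = trans (symmetrize (λ i j → Y i j k) λ i j → Y-sym i j k) (trans (∑-cong₂ λ i j → s (e i j) a₂ a₃ (δ i k) (δ j k) (A k i) (A k j))
        (trans (L2.L-+ (λ (i , j) → δ i k * (a₂ * e i j) + δ j k * (a₂ * e i j)) (λ (i , j) → a₃ * (A k i * A k j * e i j))) (cong₂ _+_
          (trans (L2.L-+ (λ (i , j) → δ i k * (a₂ * e i j)) (λ (i , j) → δ j k * (a₂ * e i j))) (trans (cong₂ _+_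
            (trans (∑-cong λ i → trans (∑-*ˡ (δ i k) λ j → a₂ * e i j) (cong (δ i k *_) (∑-*ˡ a₂ (e i)))) (∑-δʳ k λ i → a₂ * ∑ (e i)))
            (trans (∑-cong λ i → ∑-δʳ k λ j → a₂ * e i j) (trans (∑-*ˡ a₂ λ i → e i k) (cong (a₂ *_) (∑-cong λ i → e-sym i k))))) (t a₂ (∑ (e k)))))
          (L2.L-* a₃ λ (i , j) → A k i * A k j * e i j))))
        where
        s = solve 7 (λ e a b x y z w → e :* (a :* (x :+ y) :+ b :* (z :* w)) := x :* (a :* e) :+ y :* (a :* e) :+ b :* (z :* w :* e)) refl
        t = solve 2 (λ a x → a :* x :+ a :* x := :# 2 :* a :* x) refl

      sum-X : XX ≡ # 2 * a₂ * ‖ e ‖²₂ + # 4 * a₃ * (∑[ i ] ∑[ j ] ∑[ k ] e i j * e i k * A j k) + a₄ * (∑[ i ] ∑[ j ] ∑[ k ] ∑[ l ] e i j * e k l * (A i k * A i l * (A j k * A j l)))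
      sum-X = trans (trans (symmetrize (λ i j → ∑[ k ] ∑[ l ] w k l * X i j k l) λ i j → ∑-cong₂ λ k l → cong (w k l *_) (X-sym₁ i j k l)) (∑-cong₂ λ i j → trans (cong (e i j *_) (symmetrize (X i j) (X-sym₂ i j)))
          (trans (sym (∑-*ˡ (e i j) λ k → ∑[ l ] e k l * X i j k l)) (∑-cong λ k → trans (sym (∑-*ˡ (e i j) λ l → e k l * X i j k l)) (∑-cong λ l → sym (*-assoc (e i j) (e k l) (X i j k l)))))))
        (trans (Λ-cong {X} {λ i j k l → a₂ * (δ i k * δ j l + δ i l * δ j k) + a₃ * lump (λ i j k l → δ i k * A j l) i j k l + a₄ * (A i k * A i l * (A j k * A j l))} λ i j k l → cong (λ t → a₂ * (δ i k * δ j l + δ i l * δ j k) + a₃ * t + a₄ * (A i k * A i l * (A j k * A j l))) (re (δ i k * A j l) (δ i l * A j k) (δ j k * A i l) (δ j l * A i k)))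
        (trans (Λ-+ (λ i j k l → a₂ * (δ i k * δ j l + δ i l * δ j k) + a₃ * lump (λ i j k l → δ i k * A j l) i j k l) (λ i j k l → a₄ * (A i k * A i l * (A j k * A j l))))
          (cong₂ _+_ (trans (Λ-+ (λ i j k l → a₂ * (δ i k * δ j l + δ i l * δ j k)) (λ i j k l → a₃ * lump (λ i j k l → δ i k * A j l) i j k l)) (cong₂ _+_
             (trans (Λ-* a₂ λ i j k l → δ i k * δ j l + δ i l * δ j k) (trans (cong (a₂ *_) (trans (Λ-+ (λ i j k l → δ i k * δ j l) (λ i j k l → δ i l * δ j k)) (cong₂ _+_ Λ-δδ (trans (swap₂ λ i j k l → δ i k * δ j l) Λ-δδ)))) (t a₂ ‖ e ‖²₂)))
             (trans (Λ-* a₃ (lump λ i j k l → δ i k * A j l)) (trans (cong (a₃ *_) (trans (Λ-lump λ i j k l → δ i k * A j l) (cong (# 4 *_) (Λ-δ-edge A)))) (u a₃ _)))))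
            (Λ-* a₄ λ i j k l → A i k * A i l * (A j k * A j l)))))
        where
        re = solve 4 (λ a b c d → a :+ b :+ (c :+ d) := (a :+ c) :+ (b :+ d)) refl
        t = solve 2 (λ a x → a :* (x :+ x) := :# 2 :* a :* x) refl
        u = solve 2 (λ a x → a :* (:# 4 :* x) := :# 4 :* a :* x) refl

    ẼSq-Form : ẼSq G α (poly c b c₂) ≡ Form c β e
    ẼSq-Form = trans ẼSq-weights (cong₂ _+_ (cong₂ _+_ (cong₂ _+_ (cong (λ t → c * c + # 2 * c * (a₁ * ∑ β + a₂ * t)) sw-e) (sum-M₂ β)) (cong (# 2 *_) (∑-cong λ k → cong (β k *_) (sum-Y k)))) sum-X)
      where
      sw-e : (∑[ i ] ∑[ j ] w i j) ≡ (∑[ i ] ∑[ j ] e i j)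
      sw-e = trans (∑-cong₂ λ i j → sym (*-identityʳ (w i j))) (trans (symmetrize (λ _ _ → 1ℚ) λ _ _ → refl) (∑-cong₂ λ i j → *-identityʳ (e i j)))

  Form-cong : ∀ c {b b′ : Fin n → ℚ} {e e′ : Fin n → Fin n → ℚ} → (∀ i → b i ≡ b′ i) → (∀ i j → e i j ≡ e′ i j) → Form c b e ≡ Form c b′ e′
  Form-cong c {b} {b′} {e} {e′} hb he = cong₂ _+_ (cong₂ _+_ (cong₂ _+_ (cong₂ (λ x y → c * c + # 2 * c * (a₁ * x + a₂ * y)) (∑-cong hb) (∑-cong₂ he))
      (cong₂ (λ x y → a₁ * x + a₂ * y) (∑-cong λ i → cong sq (hb i)) (∑-cong₂ λ i k → cong₂ (λ x y → A i k * (x * y)) (hb i) (hb k))))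
      (cong (# 2 *_) (∑-cong λ k → cong₂ _*_ (hb k) (cong₂ (λ x y → # 2 * a₂ * x + a₃ * y) (∑-cong (he k)) (∑-cong₂ λ i j → cong (A k i * A k j *_) (he i j))))))
    (cong₂ _+_ (cong₂ (λ x y → # 2 * a₂ * x + # 4 * a₃ * y) (∑-cong₂ λ i j → cong sq (he i j)) (∑-cong₂ λ i j → ∑-cong λ k → cong₂ (λ x y → x * y * A j k) (he i j) (he i k)))
      (cong (a₄ *_) (∑-cong₂ λ i j → ∑-cong₂ λ k l → cong₂ (λ x y → x * y * (A i k * A i l * (A j k * A j l))) (he i j) (he k l))))

  -- Quadratic coefficients that are symmetric and supported on edges are already in normal form.
  feasible-Form : FKFeasible G α → ∀ c b (e : Fin n → Fin n → ℚ) → (∀ i j → e i j ≡ e j i) → (∀ i j → e i j * A i j ≡ e i j) → 0ℚ ≤ Form c b e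
  feasible-Form feas c b e e-sym e-A = subst (0ℚ ≤_) (trans (Expand.ẼSq-Form c b e) (Form-cong c (λ i → trans (cong (b i +_) (e-diag i)) (+-identityʳ (b i)))
      (λ i j → trans (cong₂ (λ x y → ½ * (x + y)) (e-A i j) (trans (e-A j i) (e-sym j i))) (h (e i j))))) (feas (poly c b e))
    where
    h = solve 1 (λ x → con ½ :* (x :+ x) := x) refl
    e-diag : ∀ i → e i i ≡ 0ℚ
    e-diag i = trans (sym (e-A i i)) (trans (cong (e i i *_) (A-diag i)) (*-zeroʳ (e i i)))

  FKValue-∑ : FKValue G α ≡ # n * a₁
  FKValue-∑ = trans (sumℚ-allFin λ i → Ẽ G α (i ∷ [])) (trans (∑-cong Ẽ₁) (∑-const n a₁))

-- The quadratic form of a Paley graph in terms of S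

module PaleyQuadraticForm {n : ℕ} (F : OddField n) (χ-⊖𝟙 : Field.χ F (OddField.⊖_ F (OddField.𝟙 F)) ≡ 1ℚ)
  (G : Graph n) (G-sym : ∀ i j → G i j ≡ G j i)
  (G-paley : ∀ i j → (if does (i ≟ j) then 0ℚ else (if G i j then 1ℚ else 0ℚ)) ≡ ½ * Edges.A₂ F χ-⊖𝟙 i j) (α : FKParams) where
  open Edges F χ-⊖𝟙 public
  open QuadraticForm G G-sym α public hiding (module Expand)

  private
    ¼ ⅟16 : ℚ
    ¼ = ½ * ½
    ⅟16 = ¼ * ¼

  A-A₂ : ∀ i j → A i j ≡ ½ * A₂ i j
  A-A₂ = G-paley

  ∑-A-quadratic : ∀ (b : Fin n → ℚ) → (∑[ i ] ∑[ k ] A i k * (b i * b k)) ≡ ½ * (sq (∑ b) - ‖ b ‖² + (∑[ i ] b i * (∑[ k ] S i k * b k)))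
  ∑-A-quadratic b = trans (∑-cong λ i → trans (∑-cong λ k → trans (cong (_* (b i * b k)) (A-A₂ i k)) (l (δ i k) (S i k) (b i) (b k)))
      (trans (∑-*ˡ ½ λ k → b i * b k - δ i k * (b i * b k) + b i * (S i k * b k)) (cong (½ *_) (trans (∑-+ (λ k → b i * b k - δ i k * (b i * b k)) (λ k → b i * (S i k * b k)))
        (cong₂ _+_ (trans (∑-minus (λ k → b i * b k) (λ k → δ i k * (b i * b k))) (cong₂ _-_ (∑-*ˡ (b i) b) (∑-δˡ i λ k → b i * b k))) (∑-*ˡ (b i) λ k → S i k * b k))))))
    (trans (∑-*ˡ ½ λ i → b i * ∑ b - b i * b i + b i * (∑[ k ] S i k * b k)) (cong (½ *_) (trans (∑-+ (λ i → b i * ∑ b - b i * b i) (λ i → b i * (∑[ k ] S i k * b k)))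
      (cong (_+ (∑[ i ] b i * (∑[ k ] S i k * b k))) (trans (∑-minus (λ i → b i * ∑ b) (λ i → b i * b i)) (cong (_- ‖ b ‖²) (∑-*ʳ (∑ b) b)))))))
    where
    l = solve 4 (λ d s x y → con ½ :* (con 1ℚ :- d :+ s) :* (x :* y) := con ½ :* (x :* y :- d :* (x :* y) :+ x :* (s :* y))) refl

  module _ {e : Fin n → Fin n → ℚ} (isEdgeFun : IsEdgeFun e) where
    open EdgeFun isEdgeFun
    private
      r W : Fin n → ℚ
      r = degree e
      W = wedge e

    ∑-A-link : ∀ k → (∑[ i ] ∑[ j ] A k i * A k j * e i j) ≡ ¼ * (∑ r - # 4 * r k + # 2 * (∑[ j ] S k j * r j) + W k)
    ∑-A-link k = trans (∑-cong₂ λ i j → trans (cong₂ (λ x y → x * y * e i j) (A-A₂ k i) (A-A₂ k j)) (l (A₂ k i) (A₂ k j) (e i j)))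
      (trans (trans (∑-cong λ i → ∑-*ˡ ¼ λ j → A₂ k i * A₂ k j * e i j) (∑-*ˡ ¼ λ i → ∑[ j ] A₂ k i * A₂ k j * e i j)) (cong (¼ *_) (∑-edges-in-link k)))
      where
      l = solve 3 (λ x y e → con ½ :* x :* (con ½ :* y) :* e := con ½ :* con ½ :* (x :* y :* e)) refl

    ∑-A-cherries : (∑[ i ] ∑[ j ] ∑[ k ] e i j * e i k * A j k) ≡ ½ * (‖ r ‖² - ‖ e ‖²₂ + V-form e)
    ∑-A-cherries = trans (∑-cong₂ λ i j → trans (∑-cong λ k → trans (cong (e i j * e i k *_) (A-A₂ j k)) (l (e i j * e i k) (A₂ j k))) (∑-*ˡ ½ λ k → e i j * e i k * A₂ j k))
      (trans (trans (∑-cong λ i → ∑-*ˡ ½ λ j → ∑[ k ] e i j * e i k * A₂ j k) (∑-*ˡ ½ λ i → ∑[ j ] ∑[ k ] e i j * e i k * A₂ j k)) (cong (½ *_) ∑-cherries))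
      where
      l = solve 2 (λ e a → e :* (con ½ :* a) := con ½ :* (e :* a)) refl

    pairs : ℚ
    pairs = ∑ r * ∑ r + # 4 * (∑[ i ] r i * (∑[ k ] S i k * r k)) + # 4 * (∑[ i ] r i * W i) + # 2 * Q-form e + # 4 * P-form e + R-form e
      - # 16 * ‖ r ‖² - # 16 * V-form e + # 8 * ‖ e ‖²₂

    ∑-A-pairs : (∑[ i ] ∑[ j ] ∑[ k ] ∑[ l ] e i j * e k l * (A i k * A i l * (A j k * A j l))) ≡ ⅟16 * pairs
    ∑-A-pairs = trans (∑-cong₂ λ i j → ∑-cong₂ λ k l → trans (cong₂ (λ x y → e i j * e k l * (x * y)) (cong₂ _*_ (A-A₂ i k) (A-A₂ i l)) (cong₂ _*_ (A-A₂ j k) (A-A₂ j l))) (s (e i j * e k l) (A₂ i k) (A₂ i l) (A₂ j k) (A₂ j l)))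
      (trans (L4.L-* ⅟16 (λ (i , j , k , l) → e i j * e k l * (A₂ i k * A₂ i l * (A₂ j k * A₂ j l)))) (cong (⅟16 *_) ∑-edge-pairs))
      where
      module L4 = Linear (∑⁴-linear {n})
      s = solve 5 (λ e x y z w → e :* (con ½ :* x :* (con ½ :* y) :* (con ½ :* z :* (con ½ :* w)))
        := con ½ :* con ½ :* (con ½ :* con ½) :* (e :* (x :* y :* (z :* w)))) refl

    Form-S : ∀ c (b : Fin n → ℚ) → Form c b e ≡
      c * c + # 2 * c * (a₁ * ∑ b + a₂ * ∑ r) + (a₁ * ‖ b ‖² + a₂ * (½ * (sq (∑ b) - ‖ b ‖² + (∑[ i ] b i * (∑[ k ] S i k * b k)))))
      + # 2 * (# 2 * a₂ * (∑[ k ] b k * r k) + a₃ * (¼ * (∑ b * ∑ r - # 4 * (∑[ k ] b k * r k) + # 2 * (∑[ k ] b k * (∑[ j ] S k j * r j)) + (∑[ k ] b k * W k))))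
      + (# 2 * a₂ * ‖ e ‖²₂ + # 4 * a₃ * (½ * (‖ r ‖² - ‖ e ‖²₂ + V-form e)) + a₄ * (⅟16 * pairs))
    Form-S c b = cong₂ _+_ (cong₂ _+_ (cong (λ t → c * c + # 2 * c * (a₁ * ∑ b + a₂ * ∑ r) + (a₁ * ‖ b ‖² + a₂ * t)) (∑-A-quadratic b)) (cong (# 2 *_) mixed))
      (cong₂ (λ x y → # 2 * a₂ * ‖ e ‖²₂ + # 4 * a₃ * x + a₄ * y) ∑-A-cherries ∑-A-pairs)
      where
      s = solve 7 (λ b a₂ a₃ E r s w → b :* (:# 2 :* a₂ :* r :+ a₃ :* (con ½ :* con ½ :* (E :- :# 4 :* r :+ :# 2 :* s :+ w)))
        := :# 2 :* a₂ :* (b :* r) :+ a₃ :* (con ½ :* con ½) :* (b :* E :+ ((:- :# 4) :* (b :* r) :+ (:# 2 :* (b :* s) :+ b :* w)))) refl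
      t = solve 6 (λ a₂ a₃ br BE bs bw → :# 2 :* a₂ :* br :+ a₃ :* (con ½ :* con ½) :* (BE :+ ((:- :# 4) :* br :+ (:# 2 :* bs :+ bw)))
        := :# 2 :* a₂ :* br :+ a₃ :* (con ½ :* con ½ :* (BE :- :# 4 :* br :+ :# 2 :* bs :+ bw))) refl
      Sr : Fin n → ℚ
      Sr k = ∑[ j ] S k j * r j
      mixed : (∑[ k ] b k * (# 2 * a₂ * r k + a₃ * (∑[ i ] ∑[ j ] A k i * A k j * e i j))) ≡ # 2 * a₂ * (∑[ k ] b k * r k) + a₃ * (¼ * (∑ b * ∑ r - # 4 * (∑[ k ] b k * r k) + # 2 * (∑[ k ] b k * Sr k) + (∑[ k ] b k * W k)))
      mixed = trans (∑-cong λ k → trans (cong (λ x → b k * (# 2 * a₂ * r k + a₃ * x)) (∑-A-link k)) (s (b k) a₂ a₃ (∑ r) (r k) (Sr k) (W k)))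
        (trans (trans (∑-+ (λ k → # 2 * a₂ * (b k * r k)) (λ k → a₃ * (½ * ½) * (b k * ∑ r + ((- # 4) * (b k * r k) + (# 2 * (b k * Sr k) + b k * W k)))))
          (cong₂ _+_ (∑-*ˡ (# 2 * a₂) λ k → b k * r k) (trans (∑-*ˡ (a₃ * (½ * ½)) λ k → b k * ∑ r + ((- # 4) * (b k * r k) + (# 2 * (b k * Sr k) + b k * W k))) (cong (a₃ * (½ * ½) *_)
            (trans (∑-+ (λ k → b k * ∑ r) (λ k → (- # 4) * (b k * r k) + (# 2 * (b k * Sr k) + b k * W k))) (cong₂ _+_ (∑-*ʳ (∑ r) b) (trans (∑-+ (λ k → (- # 4) * (b k * r k)) (λ k → # 2 * (b k * Sr k) + b k * W k)) (cong₂ _+_ (∑-*ˡ (- # 4) λ k → b k * r k)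
              (trans (∑-+ (λ k → # 2 * (b k * Sr k)) (λ k → b k * W k)) (cong (_+ (∑[ k ] b k * W k)) (∑-*ˡ (# 2) λ k → b k * Sr k)))))))))))
          (t a₂ a₃ (∑[ k ] b k * r k) (∑ b * ∑ r) (∑[ k ] b k * Sr k) (∑[ k ] b k * W k)))

  S-selfadjoint : ∀ (x y : Fin n → ℚ) → (∑[ i ] x i * (∑[ k ] S i k * y k)) ≡ (∑[ i ] y i * (∑[ k ] S i k * x k))
  S-selfadjoint x y = trans (∑-cong λ i → sym (∑-*ˡ (x i) λ k → S i k * y k)) (trans (∑-swap λ i k → x i * (S i k * y k)) (∑-cong λ k → trans (∑-cong λ i → trans (cong (λ t → x i * (t * y k)) (S-sym i k)) (s (x i) (S k i) (y k))) (∑-*ˡ (y k) λ i → S k i * x i)))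
    where
    s = solve 3 (λ x s y → x :* (s :* y) := y :* (s :* x)) refl

  A-supported : ∀ i j → S i j ≡ 1ℚ ⊎ A i j ≡ 0ℚ
  A-supported i j = case i ≟ j of λ
    { (yes refl) → inj₂ (A-diag i)
    ; (no ne) → case Field.χ-values F (OddField._⊝_ F i j) (Field.⊝-≢𝟘 F ne) of λ
      { (inj₁ p) → inj₁ p
      ; (inj₂ p) → inj₂ (trans (A-A₂ i j) (cong₂ (λ d s → ½ * (1ℚ - d + s)) (δ-≢ ne) p)) } }

  A-S : ∀ i j → S i j * A i j ≡ A i j
  A-S i j = case A-supported i j of λ
    { (inj₁ p) → trans (cong (_* A i j) p) (*-identityˡ (A i j))
    ; (inj₂ p) → trans (cong (S i j *_) p) (trans (*-zeroʳ (S i j)) (sym p)) }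

  A-idem₁ : ∀ i j → A i j * A i j ≡ A i j
  A-idem₁ i j = trans (cong (A i j *_) (sym (*-identityʳ (A i j)))) (trans (A-idem i j 1ℚ) (*-identityʳ (A i j)))

-- Feasibility of the moments (τ, 2τ², 8τ³, 64τ⁴)

module LowerBound {n : ℕ} (F : OddField n) (χ-⊖𝟙 : Field.χ F (OddField.⊖_ F (OddField.𝟙 F)) ≡ 1ℚ)
  (G : Graph n) (G-sym : ∀ i j → G i j ≡ G j i)
  (G-paley : ∀ i j → (if does (i ≟ j) then 0ℚ else (if G i j then 1ℚ else 0ℚ)) ≡ ½ * Edges.A₂ F χ-⊖𝟙 i j)
  (τ κ ρ : ℚ) (0≤τ : 0ℚ ≤ τ) (0≤κ : 0ℚ ≤ κ) (0≤ρ : 0ℚ ≤ ρ) (N≤κ² : # n ≤ sq κ)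
  (R-bound : ∀ f → (∀ i → f i i ≡ 0ℚ) → sq (Edges.R-form F χ-⊖𝟙 f) ≤ sq (ρ * ‖ f ‖²₂))
  (h₁ : τ ≤ ℤ.+ 1 / 100) (h₂ : τ * κ ≤ ℤ.+ 3 / 100) (h₃ : τ * τ * # n ≤ ℤ.+ 8 / 10000)
  (h₄ : τ * τ * ρ ≤ ℤ.+ 88 / 10000) (h₅ : τ * τ * τ * (# n * # n) ≤ ℤ.+ 64 / 1000000) where

  -- The moments of a uniformly random set of density τ conditioned on being a clique
  moments : FKParams
  moments = τ , # 2 * (τ * τ) , # 8 * (τ * τ * τ) , # 64 * (τ * τ * (τ * τ))

  open PaleyQuadraticForm F χ-⊖𝟙 G G-sym G-paley moments

  private
    N = # n

  -- The positivity certificate as one identity: the square of Ẽ[q], then τ times the sum of squares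
  -- in `Z≥0`, then terms that pair a form with its bound in κ, n or ρ, or carry a slack of `h₁` to
  -- `h₅`. The coefficient of τD splits as 1 = 1/4 + 2/100 + 3/100 + 7/10; of the coefficient 4 of
  -- τ²ε the slacks consume 0.721024.
  certificate = solve 21 (λ τ κ ρ N c B E nb br nr bSb bSr rSr bW rW WW ε V Q P R → c :* c :+ :# 2 :* c :* (τ :* B :+ :# 2 :* (τ
      :* τ) :* E) :+ (τ :* nb :+ :# 2 :* (τ :* τ) :* (con ½ :* (B :* B :- nb :+ bSb))) :+ :# 2 :* (:# 2 :* (:# 2 :* (τ :* τ)) :* br
      :+ :# 8 :* (τ :* τ :* τ) :* (con ½ :* con ½ :* (B :* E :- :# 4 :* br :+ :# 2 :* bSr :+ bW))) :+ (:# 2 :* (:# 2 :* (τ :* τ))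
      :* ε :+ :# 4 :* (:# 8 :* (τ :* τ :* τ)) :* (con ½ :* (nr :- ε :+ V)) :+ :# 64 :* (τ :* τ :* (τ :* τ)) :* (con ½ :* con ½ :* (con ½
      :* con ½) :* (E :* E :+ :# 4 :* rSr :+ :# 4 :* rW :+ :# 2 :* Q :+ :# 4 :* P :+ R :- :# 16 :* nr :- :# 16 :* V :+ :# 8 :* ε)))
    := (c :+ τ :* B :+ :# 2 :* (τ :* τ) :* E) :* (c :+ τ :* B :+ :# 2 :* (τ :* τ) :* E) :+ τ :* (con ½ :* con ½ :* (nb :+ :# 8 :* τ
      :* br :+ :# 16 :* (τ :* τ) :* nr) :+ :# 4 :* (τ :* τ) :* (bW :+ :# 4 :* τ :* rW) :+ :# 16 :* (τ :* τ :* (τ :* τ)) :* WW) :+ τ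
      :* τ :* nb :+ (τ :* τ :* ((bSb :+ :# 8 :* τ :* bSr :+ :# 16 :* (τ :* τ) :* rSr) :+ κ :* (nb :+ :# 8 :* τ :* br :+ :# 16 :* (τ
      :* τ) :* nr)) :+ τ :* (nb :+ :# 8 :* τ :* br :+ :# 16 :* (τ :* τ) :* nr) :* (:# 2 :* (con (ℤ.+ 1 / 100) :- τ) :+ (con (ℤ.+ 3 / 100)
      :- τ :* κ) :+ con (ℤ.+ 7 / 10))) :+ (:# 16 :* (τ :* τ :* τ) :* (:# 4 :* (con (ℤ.+ 1 / 100) :- τ) :+ con (ℤ.+ 96 / 100)) :* (V
      :+ κ :* ε) :+ :# 4 :* (τ :* τ :* (τ :* τ)) :* (:# 2 :* (Q :+ N :* ε) :+ :# 4 :* (P :+ N :* ε) :+ (R :+ ρ :* ε)) :+ :# 16 :* (τ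
      :* τ :* (τ :* τ) :* τ) :* (N :* N :* ε :- WW) :+ :# 32 :* (τ :* τ :* (τ :* τ)) :* (N :* ε :- nr) :+ ε :* (τ :* τ) :* (:# 16
      :* (con (ℤ.+ 1 / 100) :- τ) :+ :# 16 :* (con (ℤ.+ 3 / 100) :- τ :* κ) :+ :# 56 :* (con (ℤ.+ 8 / 10000) :- τ :* τ :* N) :+ :# 4
      :* (con (ℤ.+ 88 / 10000) :- τ :* τ :* ρ) :+ :# 16 :* (con (ℤ.+ 64 / 1000000) :- τ :* τ :* τ :* (N :* N)) :+ :# 32 :* (τ :* τ)
      :+ :# 64 :* (τ :* τ :* κ) :+ (:# 4 :- con (ℤ.+ 720 / 1000) :- con (ℤ.+ 1024 / 1000000))))) refl

  Form≥0 : ∀ c (b : Fin n → ℚ) {e : Fin n → Fin n → ℚ} → IsEdgeFun e → 0ℚ ≤ Form c b e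
  Form≥0 c b {e} isEdgeFun = subst (0ℚ ≤_) (sym (trans (Form-S isEdgeFun c b) (certificate τ κ ρ N c (∑ b) (∑ r) ‖ b ‖² br ‖ r ‖² bSb bSr rSr bW rW ‖ W ‖² ε V (Q-form e) (P-form e) (R-form e))))
    (+-≥0 (+-≥0 (+-≥0 (+-≥0 (sq≥0 (c + τ * ∑ b + # 2 * (τ * τ) * ∑ r)) (*-≥0 0≤τ Z≥0)) (*-≥0 ττ≥0 (‖‖²≥0 b))) d-part) e-part)
    where
    open EdgeFun isEdgeFun
    r W d : Fin n → ℚ
    r = degree e
    W = wedge e
    -- `τ * d i` is the part of Ẽ[x_i q] coming from the monomials of q that contain x_i: every edge
    -- at i occurs in both orders and has value 2τ².
    d i = b i + # 4 * τ * r i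
    br bSb bSr rSr bW rW ε V D : ℚ
    br = ∑[ k ] b k * r k
    bSb = ∑[ i ] b i * (∑[ k ] S i k * b k)
    bSr = ∑[ k ] b k * (∑[ j ] S k j * r j)
    rSr = ∑[ k ] r k * (∑[ j ] S k j * r j)
    bW = ∑[ k ] b k * W k
    rW = ∑[ k ] r k * W k
    ε = ‖ e ‖²₂
    V = V-form e
    D = ‖ b ‖² + # 8 * τ * br + # 16 * (τ * τ) * ‖ r ‖²
    ττ≥0 : 0ℚ ≤ τ * τ
    ττ≥0 = *-≥0 0≤τ 0≤τ
    ε≥0 : 0ℚ ≤ ε
    ε≥0 = ‖‖²₂≥0 e
    D≡ : ‖ d ‖² ≡ D
    D≡ = trans (∑-cong λ i → s (b i) τ (r i)) (trans (∑-+ (λ i → b i * b i + # 8 * τ * (b i * r i)) (λ i → # 16 * (τ * τ) * (r i * r i))) (cong₂ _+_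
        (trans (∑-+ (λ i → b i * b i) (λ i → # 8 * τ * (b i * r i))) (cong (‖ b ‖² +_) (∑-*ˡ (# 8 * τ) λ i → b i * r i))) (∑-*ˡ (# 16 * (τ * τ)) λ i → r i * r i)))
      where
      s = solve 3 (λ b t r → (b :+ :# 4 :* t :* r) :* (b :+ :# 4 :* t :* r) := b :* b :+ :# 8 :* t :* (b :* r) :+ :# 16 :* (t :* t) :* (r :* r)) refl
    D≥0 : 0ℚ ≤ D
    D≥0 = subst (0ℚ ≤_) D≡ (‖‖²≥0 d)
    dSd≡ : (∑[ i ] d i * (∑[ k ] S i k * d k)) ≡ bSb + # 8 * τ * bSr + # 16 * (τ * τ) * rSr
    dSd≡ = trans (∑-cong λ i → trans (cong (d i *_) (trans (∑-cong λ k → s₁ (S i k) (b k) τ (r k)) (trans (∑-+ (λ k → S i k * b k) (λ k → # 4 * τ * (S i k * r k))) (cong ((∑[ k ] S i k * b k) +_) (∑-*ˡ (# 4 * τ) λ k → S i k * r k)))))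
          (s₂ (b i) τ (r i) (∑[ k ] S i k * b k) (∑[ k ] S i k * r k)))
      (trans (∑-+ (λ i → b i * (∑[ k ] S i k * b k) + # 4 * τ * (b i * (∑[ k ] S i k * r k))) (λ i → # 4 * τ * (r i * (∑[ k ] S i k * b k)) + # 16 * (τ * τ) * (r i * (∑[ k ] S i k * r k))))
        (trans (cong₂ _+_ (trans (∑-+ (λ i → b i * (∑[ k ] S i k * b k)) (λ i → # 4 * τ * (b i * (∑[ k ] S i k * r k)))) (cong (bSb +_) (∑-*ˡ (# 4 * τ) λ i → b i * (∑[ k ] S i k * r k))))
          (trans (∑-+ (λ i → # 4 * τ * (r i * (∑[ k ] S i k * b k))) (λ i → # 16 * (τ * τ) * (r i * (∑[ k ] S i k * r k)))) (cong₂ _+_ (trans (∑-*ˡ (# 4 * τ) λ i → r i * (∑[ k ] S i k * b k)) (cong (# 4 * τ *_) (S-selfadjoint r b))) (∑-*ˡ (# 16 * (τ * τ)) λ i → r i * (∑[ k ] S i k * r k)))))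
          (s₃ bSb τ bSr rSr)))
      where
      s₁ = solve 4 (λ s b t r → s :* (b :+ :# 4 :* t :* r) := s :* b :+ :# 4 :* t :* (s :* r)) refl
      s₂ = solve 5 (λ b t r x y → (b :+ :# 4 :* t :* r) :* (x :+ :# 4 :* t :* y)
        := b :* x :+ :# 4 :* t :* (b :* y) :+ (:# 4 :* t :* (r :* x) :+ :# 16 :* (t :* t) :* (r :* y))) refl
      s₃ = solve 4 (λ x t y z → x :+ :# 4 :* t :* y :+ (:# 4 :* t :* y :+ :# 16 :* (t :* t) :* z)
        := x :+ :# 8 :* t :* y :+ :# 16 :* (t :* t) :* z) refl
    dSd-bound : 0ℚ ≤ (bSb + # 8 * τ * bSr + # 16 * (τ * τ) * rSr) + κ * D
    dSd-bound = subst₂ (λ x y → 0ℚ ≤ x + κ * y) dSd≡ D≡ (abs-bound {∑[ i ] d i * (∑[ k ] S i k * d k)} (*-≥0 0≤κ (‖‖²≥0 d)) (≤-trans (bilinear-bound d) (≤-trans (*-mono N≥0 (sq≥0 ‖ d ‖²) N≤κ² ≤-refl) (≤-eq (s κ ‖ d ‖²)))))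
      where
      s = solve 2 (λ k d → k :* k :* (d :* d) := k :* d :* (k :* d)) refl
    -- A quarter of the vertex diagonal D pays for the cross terms with the wedge vector W. The
    -- square of W introduced here is paid for by the edge diagonal, through `wedge-norm` and `h₅`.
    Z≥0 : 0ℚ ≤ ½ * ½ * D + # 4 * (τ * τ) * (bW + # 4 * τ * rW) + # 16 * (τ * τ * (τ * τ)) * ‖ W ‖²
    Z≥0 = subst (0ℚ ≤_) (trans (∑-cong λ i → s (b i) τ (r i) (W i)) (trans (∑-+ (λ i → ½ * ½ * (d i * d i) + # 4 * (τ * τ) * (b i * W i + # 4 * τ * (r i * W i))) (λ i → # 16 * (τ * τ * (τ * τ)) * (W i * W i)))
        (cong₂ _+_ (trans (∑-+ (λ i → ½ * ½ * (d i * d i)) (λ i → # 4 * (τ * τ) * (b i * W i + # 4 * τ * (r i * W i)))) (cong₂ _+_ (trans (∑-*ˡ (½ * ½) λ i → d i * d i) (cong (½ * ½ *_) D≡))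
          (trans (∑-*ˡ (# 4 * (τ * τ)) λ i → b i * W i + # 4 * τ * (r i * W i)) (cong (# 4 * (τ * τ) *_) (trans (∑-+ (λ i → b i * W i) (λ i → # 4 * τ * (r i * W i))) (cong (bW +_) (∑-*ˡ (# 4 * τ) λ i → r i * W i)))))))
          (∑-*ˡ (# 16 * (τ * τ * (τ * τ))) λ i → W i * W i)))) (∑-≥0 λ i → sq≥0 (½ * d i + # 4 * (τ * τ) * W i))
      where
      s = solve 4 (λ b t r w → (con ½ :* (b :+ :# 4 :* t :* r) :+ :# 4 :* (t :* t) :* w) :* (con ½ :* (b :+ :# 4 :* t :* r) :+ :# 4 :* (t :* t) :* w)
        := con ½ :* con ½ :* ((b :+ :# 4 :* t :* r) :* (b :+ :# 4 :* t :* r)) :+ :# 4 :* (t :* t) :* (b :* w :+ :# 4 :* t :* (r :* w))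
          :+ :# 16 :* (t :* t :* (t :* t)) :* (w :* w)) refl
    q≥0 : ∀ k m .{{_ : ℕ.NonZero m}} → 0ℚ ≤ ℤ.+ k / m
    q≥0 k m = nonNegative⁻¹ (ℤ.+ k / m) {{normalize-nonNeg k m}}
    d-part : 0ℚ ≤ τ * τ * ((bSb + # 8 * τ * bSr + # 16 * (τ * τ) * rSr) + κ * D) + τ * D * (# 2 * (ℤ.+ 1 / 100 - τ) + (ℤ.+ 3 / 100 - τ * κ) + ℤ.+ 7 / 10)
    d-part = +-≥0 (*-≥0 ττ≥0 dSd-bound) (*-≥0 (*-≥0 0≤τ D≥0) (+-≥0 (+-≥0 (*-≥0 (#≥0 2) (diff≥0 h₁)) (diff≥0 h₂)) (q≥0 7 10)))
    V-bound′ : 0ℚ ≤ V + κ * ε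
    V-bound′ = abs-bound {V} (*-≥0 0≤κ ε≥0) (≤-trans (V-bound e) (≤-trans (*-mono N≥0 (sq≥0 ε) N≤κ² ≤-refl) (≤-eq (s κ ε))))
      where
      s = solve 2 (λ k d → k :* k :* (d :* d) := k :* d :* (k :* d)) refl
    τ³≥0 : 0ℚ ≤ τ * τ * τ
    τ³≥0 = *-≥0 ττ≥0 0≤τ
    τ⁴≥0 : 0ℚ ≤ τ * τ * (τ * τ)
    τ⁴≥0 = *-≥0 ττ≥0 ττ≥0
    Nε≥0 : 0ℚ ≤ N * ε
    Nε≥0 = *-≥0 N≥0 ε≥0
    e-part = +-≥0 (+-≥0 (+-≥0 (+-≥0
      (*-≥0 (*-≥0 (*-≥0 (#≥0 16) τ³≥0) (+-≥0 (*-≥0 (#≥0 4) (diff≥0 h₁)) (q≥0 96 100))) V-bound′)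
      (*-≥0 (*-≥0 (#≥0 4) τ⁴≥0) (+-≥0 (+-≥0 (*-≥0 (#≥0 2) (abs-bound {Q-form e} Nε≥0 (Q-bound e))) (*-≥0 (#≥0 4) (abs-bound {P-form e} Nε≥0 (P-bound e)))) (abs-bound {R-form e} (*-≥0 0≤ρ ε≥0) (R-bound e e-diag)))))
      (*-≥0 (*-≥0 (#≥0 16) (*-≥0 τ⁴≥0 0≤τ)) (diff≥0 (wedge-norm e))))
      (*-≥0 (*-≥0 (#≥0 32) τ⁴≥0) (diff≥0 (degree-norm e))))
      (*-≥0 (*-≥0 ε≥0 ττ≥0) (+-≥0 (+-≥0 (+-≥0 (+-≥0 (+-≥0 (+-≥0 (+-≥0 (*-≥0 (#≥0 16) (diff≥0 h₁)) (*-≥0 (#≥0 16) (diff≥0 h₂))) (*-≥0 (#≥0 56) (diff≥0 h₃))) (*-≥0 (#≥0 4) (diff≥0 h₄))) (*-≥0 (#≥0 16) (diff≥0 h₅)))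
        (*-≥0 (#≥0 32) ττ≥0)) (*-≥0 (#≥0 64) (*-≥0 ττ≥0 0≤κ))) (q≥0 3278976 1000000)))

  feasible : FKFeasible G moments
  feasible (poly c b c₂) = subst (0ℚ ≤_) (sym ẼSq-Form) (Form≥0 c β (record { e-sym = e-sym ; e-supp = supp }))
    where
    open QuadraticForm.Expand G G-sym moments c b c₂
    supp : ∀ i j → S i j ≡ 1ℚ ⊎ e i j ≡ 0ℚ
    supp i j = case A-supported i j of λ
      { (inj₁ p) → inj₁ p
      ; (inj₂ p) → inj₂ (cong₂ (λ x y → ½ * (x + y)) (trans (cong (c₂ i j *_) p) (*-zeroʳ (c₂ i j))) (trans (cong (c₂ j i *_) (trans (A-sym j i) p)) (*-zeroʳ (c₂ j i)))) }

-- Test polynomials for the upper bound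

module UpperForm {n : ℕ} (F : OddField n) (χ-⊖𝟙 : Field.χ F (OddField.⊖_ F (OddField.𝟙 F)) ≡ 1ℚ)
  (G : Graph n) (G-sym : ∀ i j → G i j ≡ G j i)
  (G-paley : ∀ i j → (if does (i ≟ j) then 0ℚ else (if G i j then 1ℚ else 0ℚ)) ≡ ½ * Edges.A₂ F χ-⊖𝟙 i j)
  (α : FKParams) (feasible : FKFeasible G α) (o : Fin n) where

  open PaleyQuadraticForm F χ-⊖𝟙 G G-sym G-paley α public

  private
    N = # n
    module L2 = Linear (∑²-linear {n} {n})
    module L3 = Linear (∑-linear {n} ⊛ ∑²-linear {n} {n})
    module L4 = Linear (∑⁴-linear {n})

  D : ℚ
  D = ½ * (N * 1ℚ - 1ℚ)

  ∑-A : ∀ i → ∑ (A i) ≡ D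
  ∑-A i = trans (∑-cong (A-A₂ i)) (trans (∑-*ˡ ½ (A₂ i)) (cong (½ *_) (trans (∑-+ (λ j → 1ℚ - δ i j) (S i)) (trans (cong₂ _+_ (trans (∑-minus (λ _ → 1ℚ) (δ i)) (cong₂ _-_ (∑-const n 1ℚ) (∑-δ i))) (∑-S i)) (+-identityʳ (N * 1ℚ - 1ℚ))))))

  -- The value test: q = ω - Σ_i x_i.
  value-bound : sq (N * a₁) ≤ N * a₁ + a₂ * (N * D)
  value-bound = diff≥0⇒≤ (subst (0ℚ ≤_) eq (feasible-Form feasible (- (N * a₁)) (λ _ → 1ℚ) (λ _ _ → 0ℚ) (λ _ _ → refl) (λ i j → *-zeroˡ (A i j))))
    where
    zero₃ : (∑[ i ] ∑[ j ] ∑[ k ] 0ℚ * 0ℚ * A j k) ≡ 0ℚ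
    zero₃ = ∑-≡0 {n} λ _ → ∑-≡0 λ j → ∑-≡0 λ k → ≡0-* (A j k) refl
    zero₄ : (∑[ i ] ∑[ j ] ∑[ k ] ∑[ l ] 0ℚ * 0ℚ * (A i k * A i l * (A j k * A j l))) ≡ 0ℚ
    zero₄ = ∑-≡0 λ i → ∑-≡0 λ j → ∑-≡0 λ k → ∑-≡0 λ l → ≡0-* (A i k * A i l * (A j k * A j l)) refl
    zero₂ : ∀ k → (∑[ i ] ∑[ j ] A k i * A k j * 0ℚ) ≡ 0ℚ
    zero₂ k = ∑-≡0 λ i → ∑-≡0 λ j → *-zeroʳ (A k i * A k j)
    AA : (∑[ i ] ∑[ k ] A i k * (1ℚ * 1ℚ)) ≡ N * D
    AA = trans (∑-cong λ i → trans (∑-cong λ k → *-identityʳ (A i k)) (∑-A i)) (∑-const n D)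
    mid : (∑[ k ] 1ℚ * (# 2 * a₂ * (∑ {n} λ _ → 0ℚ) + a₃ * (∑[ i ] ∑[ j ] A k i * A k j * 0ℚ))) ≡ 0ℚ
    mid = ∑-≡0 λ k → trans (cong₂ (λ x y → 1ℚ * (# 2 * a₂ * x + a₃ * y)) (∑-0 n) (zero₂ k)) (l a₂ a₃)
      where
      l = solve 2 (λ a b → con 1ℚ :* (:# 2 :* a :* con 0ℚ :+ b :* con 0ℚ) := con 0ℚ) refl
    one : (∑ {n} λ _ → 1ℚ) ≡ N
    one = trans (∑-const n 1ℚ) (*-identityʳ N)
    eq : Form (- (N * a₁)) (λ _ → 1ℚ) (λ _ _ → 0ℚ) ≡ N * a₁ + a₂ * (N * D) - N * a₁ * (N * a₁)
    eq = trans (cong₂ _+_ (cong₂ _+_ (cong₂ _+_ (cong₂ (λ x y → - (N * a₁) * - (N * a₁) + # 2 * - (N * a₁) * (a₁ * x + a₂ * y)) one (∑-≡0 {n} λ _ → ∑-0 n))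
          (cong₂ (λ x y → a₁ * x + a₂ * y) one AA)) (cong (# 2 *_) mid))
        (cong₂ _+_ (cong₂ (λ x y → # 2 * a₂ * x + # 4 * a₃ * y) (∑-≡0 {n} λ _ → ∑-0 n) zero₃) (cong (a₄ *_) zero₄)))
      (l N a₁ a₂ a₃ a₄ D)
      where
      l = solve 6 (λ N a b c d D → :- (N :* a) :* :- (N :* a) :+ :# 2 :* :- (N :* a) :* (a :* N :+ b :* con 0ℚ) :+ (a :* N :+ b :* (N
          :* D)) :+ :# 2 :* con 0ℚ :+ (:# 2 :* b :* con 0ℚ :+ :# 4 :* c :* con 0ℚ :+ d :* con 0ℚ)
        := N :* a :+ b :* (N :* D) :- N :* a :* (N :* a)) refl

  u : Fin n → ℚ
  u = A o

  u-o : u o ≡ 0ℚ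
  u-o = A-diag o

  δ-u : ∀ j → δ o j * u j ≡ 0ℚ
  δ-u j = trans (δ-* o j λ { refl → u-o }) (*-zeroʳ (δ o j))

  S-u : ∀ j → (∑[ k ] S j k * u k) ≡ ½ * (0ℚ - S j o + (N * δ j o - 1ℚ))
  S-u j = trans (∑-cong λ k → trans (cong (S j k *_) (A-A₂ o k)) (l (S j k) (δ o k) (S o k))) (trans (∑-*ˡ ½ λ k → S j k - δ o k * S j k + S j k * S o k) (cong (½ *_)
      (trans (∑-+ (λ k → S j k - δ o k * S j k) (λ k → S j k * S o k)) (cong₂ _+_ (trans (∑-minus (S j) (λ k → δ o k * S j k)) (cong₂ _-_ (∑-S j) (∑-δˡ o (S j)))) (S-gram j o)))))
    where
    l = solve 3 (λ s d t → s :* (con ½ :* (con 1ℚ :- d :+ t)) := con ½ :* (s :- d :* s :+ s :* t)) refl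

  -- Strong regularity: a neighbour of o has (n - 5)/4 = (D - 2)/2 common neighbours with o.
  link-degree : ∀ j → u j * (∑[ k ] A j k * u k) ≡ u j * (½ * (D - # 2))
  link-degree j = trans (cong (u j *_) (trans (∑-cong λ k → trans (cong (_* u k) (A-A₂ j k)) (l (δ j k) (S j k) (u k))) (trans (∑-*ˡ ½ λ k → u k - δ j k * u k + S j k * u k) (cong (½ *_)
      (trans (∑-+ (λ k → u k - δ j k * u k) (λ k → S j k * u k)) (cong₂ _+_ (trans (∑-minus u (λ k → δ j k * u k)) (cong₂ _-_ (∑-A o) (∑-δˡ j u))) (S-u j)))))))
    (trans (expand (u j) D (S j o) N (δ j o)) (trans (cong₃ (λ x y z → ½ * (D * u j - x + ½ * (0ℚ - y + (N * z - u j)))) (A-idem₁ o j) (trans (*-comm (u j) (S j o)) (trans (cong (_* u j) (S-sym j o)) (A-S o j))) (trans (*-comm (u j) (δ j o)) (trans (cong (_* u j) (δ-sym j o)) (δ-u j))))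
      (collect (u j) D N)))
    where
    cong₃ : ∀ (f : ℚ → ℚ → ℚ → ℚ) {x x′ y y′ z z′} → x ≡ x′ → y ≡ y′ → z ≡ z′ → f x y z ≡ f x′ y′ z′
    cong₃ f refl refl refl = refl
    l = solve 3 (λ d s u → con ½ :* (con 1ℚ :- d :+ s) :* u := con ½ :* (u :- d :* u :+ s :* u)) refl
    expand = solve 5 (λ u D s N d → u :* (con ½ :* (D :- u :+ con ½ :* (con 0ℚ :- s :+ (N :* d :- con 1ℚ))))
      := con ½ :* (D :* u :- u :* u :+ con ½ :* (con 0ℚ :- u :* s :+ (N :* (u :* d) :- u)))) refl
    collect = solve 3 (λ u D N → con ½ :* (D :* u :- u :+ con ½ :* (con 0ℚ :- u :+ (N :* con 0ℚ :- u))) := u :* (con ½ :* (D :- :# 2))) refl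

  -- Ordered adjacent pairs, and ordered triangles, in the link of o
  edges₀ triangles₀ : ℚ
  edges₀ = ∑[ j ] u j * (∑[ k ] A j k * u k)
  triangles₀ = ∑[ j ] u j * (∑[ k ] ∑[ l ] A k l * (u k * u l * (A j k * A j l)))

  edges₀-value : edges₀ ≡ D * (½ * (D - # 2))
  edges₀-value = trans (∑-cong link-degree) (trans (∑-*ʳ (½ * (D - # 2)) u) (cong (_* (½ * (D - # 2))) (∑-A o)))

  A≥0 : ∀ i j → 0ℚ ≤ A i j
  A≥0 i j = subst (0ℚ ≤_) (A-idem₁ i j) (sq≥0 (A i j))

  -- For a neighbour j of o let v be the indicator of the σ common neighbours. The ordered adjacent
  -- pairs among them number ½(σ² - σ + ⟨v, Sv⟩), and the spectral bound makes the last term at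
  -- least -κσ.
  triangles₀-bound : ∀ κ → 0ℚ ≤ κ → N ≤ sq κ → ½ * (D * (½ * (D - # 2) * (½ * (D - # 2) - 1ℚ - κ))) ≤ triangles₀
  triangles₀-bound κ 0≤κ hκ = ≤-trans (≤-eq (sym total)) (∑-mono pointwise)
    where
    σ₀ : ℚ
    σ₀ = ½ * (D - # 2)
    total : (∑[ j ] u j * (½ * (σ₀ * (σ₀ - 1ℚ - κ)))) ≡ ½ * (D * (σ₀ * (σ₀ - 1ℚ - κ)))
    total = trans (∑-*ʳ (½ * (σ₀ * (σ₀ - 1ℚ - κ))) u) (trans (cong (_* (½ * (σ₀ * (σ₀ - 1ℚ - κ)))) (∑-A o)) (l D (σ₀ * (σ₀ - 1ℚ - κ))))
      where
      l = solve 2 (λ d x → d :* (con ½ :* x) := con ½ :* (d :* x)) refl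
    pointwise : ∀ j → u j * (½ * (σ₀ * (σ₀ - 1ℚ - κ))) ≤ u j * (∑[ k ] ∑[ l ] A k l * (u k * u l * (A j k * A j l)))
    pointwise j = ≤-trans (≤-eq step₁) (≤-trans (*-monoˡ (u j) (A≥0 o j) inner) (≤-eq (cong (u j *_) (sym step₂))))
      where
      v : Fin n → ℚ
      v k = A j k * u k
      σ : ℚ
      σ = ∑ v
      v-idem : ∀ k → v k * v k ≡ v k
      v-idem k = trans (l (A j k) (u k)) (cong₂ _*_ (A-idem₁ j k) (A-idem₁ o k))
        where
        l = solve 2 (λ a b → a :* b :* (a :* b) := a :* a :* (b :* b)) refl
      v-norm : ‖ v ‖² ≡ σ
      v-norm = ∑-cong v-idem
      vSv : ℚ
      vSv = ∑[ i ] v i * (∑[ k ] S i k * v k)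
      step₂ : (∑[ k ] ∑[ l ] A k l * (u k * u l * (A j k * A j l))) ≡ ½ * (sq σ - σ + vSv)
      step₂ = trans (∑-cong₂ λ k l → s (A k l) (u k) (u l) (A j k) (A j l)) (trans (∑-A-quadratic v) (cong (λ t → ½ * (sq σ - t + vSv)) v-norm))
        where
        s = solve 5 (λ a x y b c → a :* (x :* y :* (b :* c)) := a :* (b :* x :* (c :* y))) refl
      step₁ : u j * (½ * (σ₀ * (σ₀ - 1ℚ - κ))) ≡ u j * (½ * (sq σ - σ - κ * σ))
      step₁ = trans (l₁ (u j) σ₀ κ) (trans (cong₂ (λ x y → ½ * (x * σ₀ - (1ℚ + κ) * y)) (sym (link-degree j)) (sym (link-degree j))) (trans (l₂ (u j) σ σ₀ κ) (trans (cong (λ x → ½ * (σ * x - (1ℚ + κ) * (u j * σ))) (sym (link-degree j))) (l₃ (u j) σ κ))))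
        where
        l₁ = solve 3 (λ u s k → u :* (con ½ :* (s :* (s :- con 1ℚ :- k))) := con ½ :* (u :* s :* s :- (con 1ℚ :+ k) :* (u :* s))) refl
        l₂ = solve 4 (λ u t s k → con ½ :* (u :* t :* s :- (con 1ℚ :+ k) :* (u :* t)) := con ½ :* (t :* (u :* s) :- (con 1ℚ :+ k) :* (u :* t))) refl
        l₃ = solve 3 (λ u t k → con ½ :* (t :* (u :* t) :- (con 1ℚ :+ k) :* (u :* t)) := u :* (con ½ :* (t :* t :- t :- k :* t))) refl
      inner : ½ * (sq σ - σ - κ * σ) ≤ ½ * (sq σ - σ + vSv)
      inner = ≤-by (*-≥0 0≤½ (abs-bound {vSv} (*-≥0 0≤κ (∑-≥0 λ k → *-≥0 (A≥0 j k) (A≥0 o k))) (≤-trans (bilinear-bound v) (≤-trans (*-mono N≥0 (sq≥0 ‖ v ‖²) hκ ≤-refl) (≤-eq (trans (cong (λ t → κ * κ * (t * t)) v-norm) (l₁ κ σ))))))) (l₂ (sq σ) σ κ vSv)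
        where
        l₁ = solve 2 (λ k s → k :* k :* (s :* s) := k :* s :* (k :* s)) refl
        0≤½ : 0ℚ ≤ ½
        0≤½ = *≤* (ℤ.+≤+ ℕ.z≤n)
        l₂ = solve 4 (λ q s k v → con ½ :* (q :- s :+ v) := con ½ :* (q :- s :- k :* s) :+ con ½ :* (v :+ k :* s)) refl

  -- Coefficients of x_o Σ_j A_oj x_j and of the Kelner polynomial (Σ_j S_oj x_j)²
  ℓ w : Fin n → Fin n → ℚ
  ℓ i j = ½ * (δ o i * u j + δ o j * u i)
  w i j = A i j * (S o i * S o j)

  w-sym : ∀ i j → w i j ≡ w j i
  w-sym i j = cong₂ _*_ (A-sym i j) (*-comm (S o i) (S o j))

  w-A : ∀ i j → w i j * A i j ≡ w i j
  w-A i j = trans (l (A i j) (S o i * S o j)) (cong (_* (S o i * S o j)) (A-idem₁ i j))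
    where
    l = solve 2 (λ a s → a :* s :* a := a :* a :* s) refl

  ℓ-sym : ∀ i j → ℓ i j ≡ ℓ j i
  ℓ-sym i j = cong (½ *_) (+-comm (δ o i * u j) (δ o j * u i))

  ℓ-A : ∀ i j → ℓ i j * A i j ≡ ℓ i j
  ℓ-A i j = trans (l (δ o i) (u j) (δ o j) (u i) (A i j)) (cong₂ (λ x y → ½ * (x + y)) (δ-* o i λ { refl → A-idem₁ o j }) (δ-* o j λ { refl → trans (cong (u i *_) (A-sym i o)) (A-idem₁ o i) }))
    where
    l = solve 5 (λ a x b y c → con ½ :* (a :* x :+ b :* y) :* c := con ½ :* (a :* (x :* c) :+ b :* (y :* c))) refl

  private
    cherryB pairB : (e e′ : Fin n → Fin n → ℚ) → ℚ
    cherryB e e′ = ∑[ i ] ∑[ j ] ∑[ k ] e i j * e′ i k * A j k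
    pairB e e′ = ∑[ i ] ∑[ j ] ∑[ k ] ∑[ l ] e i j * e′ k l * (A i k * A i l * (A j k * A j l))

    ∑-ℓ : ∀ (K : Fin n → Fin n → ℚ) → (∑[ i ] ∑[ j ] ℓ i j * K i j) ≡ ½ * ((∑[ j ] u j * K o j) + (∑[ i ] u i * K i o))
    ∑-ℓ K = trans (∑-cong₂ λ i j → l (δ o i) (u j) (δ o j) (u i) (K i j)) (trans (L2.L-* ½ λ (i , j) → δ o i * (u j * K i j) + δ o j * (u i * K i j)) (cong (½ *_) (trans (L2.L-+ (λ (i , j) → δ o i * (u j * K i j)) (λ (i , j) → δ o j * (u i * K i j)))
      (cong₂ _+_ (trans (∑-cong λ i → ∑-*ˡ (δ o i) λ j → u j * K i j) (∑-δˡ o λ i → ∑[ j ] u j * K i j)) (∑-cong λ i → ∑-δˡ o λ j → u i * K i j)))))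
      where
      l = solve 5 (λ a x b y k → con ½ :* (a :* x :+ b :* y) :* k := con ½ :* (a :* (x :* k) :+ b :* (y :* k))) refl

    ℓ-o : ∀ j → ℓ o j ≡ ½ * u j
    ℓ-o j = cong (½ *_) (trans (cong₂ (λ x y → x * u j + δ o j * y) (δ-refl o) u-o) (l (u j) (δ o j)))
      where
      l = solve 2 (λ x y → con 1ℚ :* x :+ y :* con 0ℚ := x) refl

    ℓ-o′ : ∀ i → ℓ i o ≡ ½ * u i
    ℓ-o′ i = trans (ℓ-sym i o) (ℓ-o i)

    w-o : ∀ j → w o j ≡ 0ℚ
    w-o j = trans (cong (λ t → A o j * (t * S o j)) (S-diag o)) (l (A o j) (S o j))
      where
      l = solve 2 (λ a s → a :* (con 0ℚ :* s) := con 0ℚ) refl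

    w-o′ : ∀ i → w i o ≡ 0ℚ
    w-o′ i = trans (w-sym i o) (w-o i)

    -- ℓ lives on edges at o, and o is not in its own link.
    uuℓ : ∀ i j → u i * u j * ℓ i j ≡ 0ℚ
    uuℓ i j = trans (l (u i) (u j) (δ o i) (δ o j)) (trans (cong₂ (λ x y → ½ * (x * (u j * u j) + y * (u i * u i))) (δ-u i) (δ-u j)) (z (u j * u j) (u i * u i)))
      where
      l = solve 4 (λ x y a b → x :* y :* (con ½ :* (a :* y :+ b :* x)) := con ½ :* (a :* x :* (y :* y) :+ b :* y :* (x :* x))) refl
      z = solve 2 (λ x y → con ½ :* (con 0ℚ :* x :+ con 0ℚ :* y) := con 0ℚ) refl

    -- On the link of o both signs S_oi and S_oj are 1, so the Kelner coefficients reduce to the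
    -- adjacency there. This is the source of the correlation with edges and triangles of the link.
    uuw : ∀ i j → u i * u j * w i j ≡ u i * u j * A i j
    uuw i j = trans (l (u i) (u j) (A i j) (S o i) (S o j)) (cong₂ (λ x y → x * y * A i j) (A-S o i) (A-S o j))
      where
      l = solve 5 (λ x y a s t → x :* y :* (a :* (s :* t)) := s :* x :* (t :* y) :* a) refl

    ∑u² : (∑[ j ] u j * u j) ≡ D
    ∑u² = trans (∑-cong (A-idem₁ o)) (∑-A o)

    half-half = solve 1 (λ x → con ½ :* (con ½ :* x :+ con ½ :* x) := con ½ :* x) refl

    ℓℓ : ‖ ℓ ‖²₂ ≡ ½ * D
    ℓℓ = trans (∑-ℓ ℓ) (trans (cong₂ (λ x y → ½ * (x + y)) (half ℓ-o) (half ℓ-o′)) (half-half D))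
      where
      half : ∀ {f : Fin n → ℚ} → (∀ j → f j ≡ ½ * u j) → (∑[ j ] u j * f j) ≡ ½ * D
      half h = trans (∑-cong λ j → trans (cong (u j *_) (h j)) (l (u j))) (trans (∑-*ˡ ½ λ j → u j * u j) (cong (½ *_) ∑u²))
        where
        l = solve 1 (λ x → x :* (con ½ :* x) := con ½ :* (x :* x)) refl

    ℓw : (∑[ i ] ∑[ j ] ℓ i j * w i j) ≡ 0ℚ
    ℓw = trans (∑-ℓ w) (trans (cong₂ (λ x y → ½ * (x + y)) (∑-≡0 λ j → trans (cong (u j *_) (w-o j)) (*-zeroʳ (u j))) (∑-≡0 λ j → trans (cong (u j *_) (w-o′ j)) (*-zeroʳ (u j)))) refl)

    uu-edges : (∑[ i ] ∑[ k ] u i * u k * A i k) ≡ edges₀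
    uu-edges = ∑-cong λ i → trans (∑-cong λ k → l (u i) (u k) (A i k)) (∑-*ˡ (u i) λ k → A i k * u k)
      where
      l = solve 3 (λ x y a → x :* y :* a := x :* (a :* y)) refl

    cherry-ℓ : ∀ (e : Fin n → Fin n → ℚ) → cherryB ℓ e ≡ ½ * ((∑[ j ] u j * (∑[ k ] e o k * A j k)) + (∑[ i ] ∑[ k ] u i * u k * e i k))
    cherry-ℓ e = trans (∑-cong₂ λ i j → trans (∑-cong λ k → *-assoc (ℓ i j) (e i k) (A j k)) (∑-*ˡ (ℓ i j) λ k → e i k * A j k)) (trans (∑-ℓ λ i j → ∑[ k ] e i k * A j k)
      (cong (λ t → ½ * ((∑[ j ] u j * (∑[ k ] e o k * A j k)) + t)) (∑-cong λ i → trans (sym (∑-*ˡ (u i) λ k → e i k * A o k)) (∑-cong λ k → l (u i) (e i k) (u k)))))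
      where
      l = solve 3 (λ x e y → x :* (e :* y) := x :* y :* e) refl

    cherry-ℓℓ : cherryB ℓ ℓ ≡ ½ * (½ * edges₀)
    cherry-ℓℓ = trans (cherry-ℓ ℓ) (trans (cong₂ (λ x y → ½ * (x + y)) first (∑-≡0 λ i → ∑-≡0 λ k → uuℓ i k)) (cong (½ *_) (+-identityʳ (½ * edges₀))))
      where
      first : (∑[ j ] u j * (∑[ k ] ℓ o k * A j k)) ≡ ½ * edges₀
      first = trans (∑-cong λ j → trans (cong (u j *_) (trans (∑-cong λ k → trans (cong (_* A j k) (ℓ-o k)) (l (u k) (A j k))) (∑-*ˡ ½ λ k → A j k * u k))) (l′ (u j) _)) (∑-*ˡ ½ λ j → u j * (∑[ k ] A j k * u k))
        where
        l = solve 2 (λ x a → con ½ :* x :* a := con ½ :* (a :* x)) refl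
        l′ = solve 2 (λ x a → x :* (con ½ :* a) := con ½ :* (x :* a)) refl

    cherry-ℓw : cherryB ℓ w ≡ ½ * edges₀
    cherry-ℓw = trans (cherry-ℓ w) (cong (½ *_) (trans (cong₂ _+_ (∑-≡0 λ j → trans (cong (u j *_) (∑-≡0 λ k → ≡0-* (A j k) (w-o k))) (*-zeroʳ (u j))) (trans (∑-cong₂ uuw) uu-edges)) (+-identityˡ edges₀)))

    cherry-sym : ∀ (e e′ : Fin n → Fin n → ℚ) → cherryB e e′ ≡ cherryB e′ e
    cherry-sym e e′ = ∑-cong λ i → trans (∑-swap λ j k → e i j * e′ i k * A j k) (∑-cong₂ λ k j → cong₂ _*_ (*-comm (e i j) (e′ i k)) (A-sym j k))

    pair-sym : ∀ (e e′ : Fin n → Fin n → ℚ) → pairB e e′ ≡ pairB e′ e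
    pair-sym e e′ = trans (L-∑ (∑²-linear {n} {n}) λ (i , j) k → ∑[ l ] e i j * e′ k l * (A i k * A i l * (A j k * A j l))) (∑-cong λ k → trans (L-∑ (∑²-linear {n} {n}) λ (i , j) l → e i j * e′ k l * (A i k * A i l * (A j k * A j l)))
      (∑-cong λ l → ∑-cong₂ λ i j → cong₂ _*_ (*-comm (e i j) (e′ k l)) (trans (cong₂ _*_ (cong₂ _*_ (A-sym i k) (A-sym i l)) (cong₂ _*_ (A-sym j k) (A-sym j l))) (s (A k i) (A l i) (A k j) (A l j)))))
      where
      s = solve 4 (λ a b c d → a :* b :* (c :* d) := a :* c :* (b :* d)) refl

    pair-ℓ : ∀ (e : Fin n → Fin n → ℚ) → pairB ℓ e ≡ (∑[ j ] u j * (∑[ k ] ∑[ l ] u k * u l * e k l * (A j k * A j l)))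
    pair-ℓ e = trans (∑-cong₂ λ i j → trans (∑-cong λ k → trans (∑-cong λ l → *-assoc (ℓ i j) (e k l) _) (∑-*ˡ (ℓ i j) λ l → e k l * (A i k * A i l * (A j k * A j l)))) (∑-*ˡ (ℓ i j) λ k → ∑[ l ] e k l * (A i k * A i l * (A j k * A j l))))
      (trans (∑-ℓ λ i j → ∑[ k ] ∑[ l ] e k l * (A i k * A i l * (A j k * A j l))) (trans (cong₂ (λ x y → ½ * (x + y))
        (∑-cong λ j → cong (u j *_) (∑-cong₂ λ k l → s (e k l) (u k) (u l) (A j k * A j l)))
        (∑-cong λ i → cong (u i *_) (∑-cong₂ λ k l → s′ (e k l) (u k) (u l) (A i k * A i l)))) (h _)))
      where
      s = solve 4 (λ e x y a → e :* (x :* y :* a) := x :* y :* e :* a) refl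
      s′ = solve 4 (λ e x y a → e :* (a :* (x :* y)) := x :* y :* e :* a) refl
      h = solve 1 (λ x → con ½ :* (x :+ x) := x) refl

    pair-ℓℓ : pairB ℓ ℓ ≡ 0ℚ
    pair-ℓℓ = trans (pair-ℓ ℓ) (∑-≡0 λ j → trans (cong (u j *_) (∑-≡0 λ k → ∑-≡0 λ l → ≡0-* (A j k * A j l) (uuℓ k l))) (*-zeroʳ (u j)))

    pair-ℓw : pairB ℓ w ≡ triangles₀
    pair-ℓw = trans (pair-ℓ w) (∑-cong λ j → cong (u j *_) (∑-cong₂ λ k l → trans (cong (_* (A j k * A j l)) (uuw k l)) (s (u k * u l) (A k l) (A j k * A j l))))
      where
      s = solve 3 (λ x a b → x :* a :* b := a :* (x :* b)) refl

  -- Pseudoexpectation of the square of Σ w_ij x_i x_j, the off-diagonal part of the Kelner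
  -- polynomial modulo non-edges.
  gram : ℚ
  gram = # 2 * a₂ * ‖ w ‖²₂ + # 4 * a₃ * (∑[ i ] ∑[ j ] ∑[ k ] w i j * w i k * A j k) + a₄ * (∑[ i ] ∑[ j ] ∑[ k ] ∑[ l ] w i j * w k l * (A i k * A i l * (A j k * A j l)))

  private
    combo : ℚ → ℚ → Fin n → Fin n → ℚ
    combo s t i j = s * ℓ i j + t * w i j

    -- Pseudoexpectation of the square of β x_o + s x_o Σ_j A_oj x_j + t Σ w_ij x_i x_j. Each of the
    -- three tests comes from setting one variable to zero.
    quadratic : ∀ β s t → Form 0ℚ (λ i → β * δ o i) (combo s t) ≡
      a₁ * (β * β) + # 2 * (β * (s * (a₂ * D) + t * (a₃ * edges₀))) + (a₂ * D + a₃ * edges₀) * (s * s) + # 2 * (s * t) * (# 2 * a₃ * edges₀ + a₄ * triangles₀) + gram * (t * t)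
    quadratic β s t = trans (cong₂ _+_ (cong₂ _+_ (cong₂ _+_ (z (a₁ * (∑[ i ] β * δ o i) + a₂ * (∑[ i ] ∑[ j ] combo s t i j))) (cong₂ (λ x y → a₁ * x + a₂ * y) bb bAb)) (cong (# 2 *_) be))
        (cong₂ _+_ (cong₂ (λ x y → # 2 * a₂ * x + # 4 * a₃ * y) ee cc) (cong (a₄ *_) pp)))
      (final a₁ a₂ a₃ a₄ β s t D edges₀ triangles₀ ‖ w ‖²₂ (cherryB w w) (pairB w w))
      where
      z = solve 1 (λ x → con 0ℚ :* con 0ℚ :+ :# 2 :* con 0ℚ :* x := con 0ℚ) refl
      final = solve 13 (λ a b c d β s t D τ T ε C P → con 0ℚ :+ (a :* (β :* β) :+ b :* con 0ℚ) :+ :# 2 :* (β :* (:# 2 :* b :* (s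
          :* (con ½ :* D)) :+ c :* (t :* τ))) :+ (:# 2 :* b :* (s :* s :* (con ½ :* D) :+ (:# 2 :* (s :* t) :* con 0ℚ :+ t :* t :* ε))
          :+ :# 4 :* c :* (s :* s :* (con ½ :* (con ½ :* τ)) :+ (:# 2 :* (s :* t) :* (con ½ :* τ) :+ t :* t :* C)) :+ d :* (s :* s
          :* con 0ℚ :+ (:# 2 :* (s :* t) :* T :+ t :* t :* P)))
        := a :* (β :* β) :+ :# 2 :* (β :* (s :* (b :* D) :+ t :* (c :* τ))) :+ (b :* D :+ c :* τ) :* (s :* s) :+ :# 2 :* (s :* t)
          :* (:# 2 :* c :* τ :+ d :* T) :+ (:# 2 :* b :* ε :+ :# 4 :* c :* C :+ d :* P) :* (t :* t)) refl
      bb : (∑[ i ] (β * δ o i) * (β * δ o i)) ≡ β * β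
      bb = trans (∑-cong λ i → trans (l β (δ o i)) (cong (_* (β * β)) (δ-idem o i))) (∑-δˡ o λ _ → β * β)
        where
        l = solve 2 (λ b d → b :* d :* (b :* d) := d :* d :* (b :* b)) refl
      bAb : (∑[ i ] ∑[ k ] A i k * (β * δ o i * (β * δ o k))) ≡ 0ℚ
      bAb = trans (∑-cong λ i → trans (∑-cong λ k → l (A i k) β (δ o i) (δ o k)) (trans (∑-δˡ o λ k → δ o i * (β * β * A i k)) refl)) (trans (∑-δˡ o λ i → β * β * A i o) (trans (cong (β * β *_) u-o) (*-zeroʳ (β * β))))
        where
        l = solve 4 (λ a b x y → a :* (b :* x :* (b :* y)) := y :* (x :* (b :* b :* a))) refl
      deg : ∑ (combo s t o) ≡ s * (½ * D)
      deg = trans (∑-cong λ j → trans (cong₂ (λ x y → s * x + t * y) (ℓ-o j) (w-o j)) (l s t (u j))) (trans (∑-*ˡ (s * ½) u) (trans (cong (s * ½ *_) (∑-A o)) (*-assoc s ½ D)))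
        where
        l = solve 3 (λ s t x → s :* (con ½ :* x) :+ t :* con 0ℚ := s :* con ½ :* x) refl
      linkT : (∑[ i ] ∑[ j ] A o i * A o j * combo s t i j) ≡ t * edges₀
      linkT = trans (∑-cong₂ λ i j → trans (l (u i * u j) s (ℓ i j) t (w i j)) (trans (cong₂ (λ x y → s * x + t * y) (uuℓ i j) (uuw i j)) (l′ s t (u i * u j * A i j)))) (trans (L2.L-* t λ (i , j) → u i * u j * A i j) (cong (t *_) uu-edges))
        where
        l = solve 5 (λ x s a t b → x :* (s :* a :+ t :* b) := s :* (x :* a) :+ t :* (x :* b)) refl
        l′ = solve 3 (λ s t x → s :* con 0ℚ :+ t :* x := t :* x) refl
      be : (∑[ k ] β * δ o k * (# 2 * a₂ * ∑ (combo s t k) + a₃ * (∑[ i ] ∑[ j ] A k i * A k j * combo s t i j))) ≡ β * (# 2 * a₂ * (s * (½ * D)) + a₃ * (t * edges₀))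
      be = trans (∑-cong λ k → l β (δ o k) (# 2 * a₂ * ∑ (combo s t k) + a₃ * (∑[ i ] ∑[ j ] A k i * A k j * combo s t i j))) (trans (∑-δˡ o λ k → β * (# 2 * a₂ * ∑ (combo s t k) + a₃ * (∑[ i ] ∑[ j ] A k i * A k j * combo s t i j)))
          (cong₂ (λ x y → β * (# 2 * a₂ * x + a₃ * y)) deg linkT))
        where
        l = solve 3 (λ b d x → b :* d :* x := d :* (b :* x)) refl
      ee : ‖ combo s t ‖²₂ ≡ s * s * (½ * D) + (# 2 * (s * t) * 0ℚ + t * t * ‖ w ‖²₂)
      ee = trans (∑-cong₂ λ i j → l s t (ℓ i j) (w i j)) (trans (L2.L-+ (λ (i , j) → s * s * (ℓ i j * ℓ i j)) (λ (i , j) → # 2 * (s * t) * (ℓ i j * w i j) + t * t * (w i j * w i j)))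
          (cong₂ _+_ (trans (L2.L-* (s * s) λ (i , j) → ℓ i j * ℓ i j) (cong (s * s *_) ℓℓ)) (trans (L2.L-+ (λ (i , j) → # 2 * (s * t) * (ℓ i j * w i j)) (λ (i , j) → t * t * (w i j * w i j)))
            (cong₂ _+_ (trans (L2.L-* (# 2 * (s * t)) λ (i , j) → ℓ i j * w i j) (cong (# 2 * (s * t) *_) ℓw)) (L2.L-* (t * t) λ (i , j) → w i j * w i j)))))
        where
        l = solve 4 (λ s t x y → (s :* x :+ t :* y) :* (s :* x :+ t :* y)
          := s :* s :* (x :* x) :+ (:# 2 :* (s :* t) :* (x :* y) :+ t :* t :* (y :* y))) refl
      spread = solve 7 (λ s t x y x′ y′ a → (s :* x :+ t :* y) :* (s :* x′ :+ t :* y′) :* a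
        := s :* s :* (x :* x′ :* a) :+ (s :* t :* (x :* y′ :* a :+ y :* x′ :* a) :+ t :* t :* (y :* y′ :* a))) refl
      double = solve 3 (λ s t x → s :* t :* (x :+ x) := :# 2 :* (s :* t) :* x) refl
      cc : cherryB (combo s t) (combo s t) ≡ s * s * (½ * (½ * edges₀)) + (# 2 * (s * t) * (½ * edges₀) + t * t * cherryB w w)
      cc = trans (∑-cong₂ λ i j → ∑-cong λ k → spread s t (ℓ i j) (w i j) (ℓ i k) (w i k) (A j k)) (trans (L3.L-+ (λ (i , j , k) → s * s * (ℓ i j * ℓ i k * A j k)) (λ (i , j , k) → s * t * (ℓ i j * w i k * A j k + w i j * ℓ i k * A j k) + t * t * (w i j * w i k * A j k)))
          (cong₂ _+_ (trans (L3.L-* (s * s) λ (i , j , k) → ℓ i j * ℓ i k * A j k) (cong (s * s *_) cherry-ℓℓ)) (trans (L3.L-+ (λ (i , j , k) → s * t * (ℓ i j * w i k * A j k + w i j * ℓ i k * A j k)) (λ (i , j , k) → t * t * (w i j * w i k * A j k)))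
            (cong₂ _+_ (trans (L3.L-* (s * t) λ (i , j , k) → ℓ i j * w i k * A j k + w i j * ℓ i k * A j k) (trans (cong (s * t *_) (trans (L3.L-+ (λ (i , j , k) → ℓ i j * w i k * A j k) (λ (i , j , k) → w i j * ℓ i k * A j k)) (cong₂ _+_ cherry-ℓw (trans (cherry-sym w ℓ) cherry-ℓw)))) (double s t (½ * edges₀))))
              (L3.L-* (t * t) λ (i , j , k) → w i j * w i k * A j k)))))
      pp : pairB (combo s t) (combo s t) ≡ s * s * 0ℚ + (# 2 * (s * t) * triangles₀ + t * t * pairB w w)
      pp = trans (∑-cong₂ λ i j → ∑-cong₂ λ k l → spread s t (ℓ i j) (w i j) (ℓ k l) (w k l) (A i k * A i l * (A j k * A j l))) (trans (L4.L-+ (λ (i , j , k , l) → s * s * (ℓ i j * ℓ k l * (A i k * A i l * (A j k * A j l)))) (λ (i , j , k , l) → s * t * (ℓ i j * w k l * (A i k * A i l * (A j k * A j l)) + w i j * ℓ k l * (A i k * A i l * (A j k * A j l))) + t * t * (w i j * w k l * (A i k * A i l * (A j k * A j l)))))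
          (cong₂ _+_ (trans (L4.L-* (s * s) λ (i , j , k , l) → ℓ i j * ℓ k l * (A i k * A i l * (A j k * A j l))) (cong (s * s *_) pair-ℓℓ)) (trans (L4.L-+ (λ (i , j , k , l) → s * t * (ℓ i j * w k l * (A i k * A i l * (A j k * A j l)) + w i j * ℓ k l * (A i k * A i l * (A j k * A j l)))) (λ (i , j , k , l) → t * t * (w i j * w k l * (A i k * A i l * (A j k * A j l)))))
            (cong₂ _+_ (trans (L4.L-* (s * t) λ (i , j , k , l) → ℓ i j * w k l * (A i k * A i l * (A j k * A j l)) + w i j * ℓ k l * (A i k * A i l * (A j k * A j l))) (trans (cong (s * t *_) (trans (L4.L-+ (λ (i , j , k , l) → ℓ i j * w k l * (A i k * A i l * (A j k * A j l))) (λ (i , j , k , l) → w i j * ℓ k l * (A i k * A i l * (A j k * A j l)))) (cong₂ _+_ pair-ℓw (trans (pair-sym w ℓ) pair-ℓw)))) (double s t triangles₀)))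
              (L4.L-* (t * t) λ (i , j , k , l) → w i j * w k l * (A i k * A i l * (A j k * A j l))))))) 

    quadratic≥0 : ∀ β s t → 0ℚ ≤ a₁ * (β * β) + # 2 * (β * (s * (a₂ * D) + t * (a₃ * edges₀))) + (a₂ * D + a₃ * edges₀) * (s * s) + # 2 * (s * t) * (# 2 * a₃ * edges₀ + a₄ * triangles₀) + gram * (t * t)
    quadratic≥0 β s t = subst (0ℚ ≤_) (quadratic β s t) (feasible-Form feasible 0ℚ (λ i → β * δ o i) (combo s t) (λ i j → cong₂ (λ x y → s * x + t * y) (ℓ-sym i j) (w-sym i j))
      (λ i j → trans (l s t (ℓ i j) (w i j) (A i j)) (cong₂ (λ x y → s * x + t * y) (ℓ-A i j) (w-A i j))))
      where
      l = solve 5 (λ s t x y a → (s :* x :+ t :* y) :* a := s :* (x :* a) :+ t :* (y :* a)) refl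

  -- Correlation of x_o with x_o Σ_j A_oj x_j: it forces a₃ to be large once a₂ is.
  link-test : sq (a₂ * D) ≤ a₁ * (a₂ * D + a₃ * edges₀)
  link-test = discriminant a₁ (a₂ * D) _ λ β s → subst (0ℚ ≤_) (l a₁ (a₂ * D) (a₃ * edges₀) (# 2 * a₃ * edges₀ + a₄ * triangles₀) gram β s) (quadratic≥0 β s 0ℚ)
    where
    l = solve 7 (λ a x y z g β s → a :* (β :* β) :+ :# 2 :* (β :* (s :* x :+ con 0ℚ :* y)) :+ (x :+ y) :* (s :* s) :+ :# 2 :* (s
        :* con 0ℚ) :* z :+ g :* (con 0ℚ :* con 0ℚ)
      := a :* (β :* β) :+ (x :+ x) :* (β :* s) :+ (x :+ y) :* (s :* s)) refl

  -- Correlation of x_o with the Kelner polynomial: it bounds a₃ from above in terms of `gram`.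
  kelner-test : sq (a₃ * edges₀) ≤ a₁ * gram
  kelner-test = discriminant a₁ (a₃ * edges₀) gram λ β t → subst (0ℚ ≤_) (l a₁ (a₂ * D) (a₃ * edges₀) (# 2 * a₃ * edges₀ + a₄ * triangles₀) gram β t) (quadratic≥0 β 0ℚ t)
    where
    l = solve 7 (λ a x y z g β t → a :* (β :* β) :+ :# 2 :* (β :* (con 0ℚ :* x :+ t :* y)) :+ (x :+ y) :* (con 0ℚ :* con 0ℚ) :+ :# 2
        :* (con 0ℚ :* t) :* z :+ g :* (t :* t)
      := a :* (β :* β) :+ (y :+ y) :* (β :* t) :+ g :* (t :* t)) refl

  -- The triangles of the link bring in a₄, so this test controls |a₄| in terms of a₃.
  kelner-link-test : sq (# 2 * a₃ * edges₀ + a₄ * triangles₀) ≤ (a₂ * D + a₃ * edges₀) * gram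
  kelner-link-test = discriminant (a₂ * D + a₃ * edges₀) (# 2 * a₃ * edges₀ + a₄ * triangles₀) gram λ s t → subst (0ℚ ≤_) (l a₁ (a₂ * D) (a₃ * edges₀) (# 2 * a₃ * edges₀ + a₄ * triangles₀) gram s t) (quadratic≥0 0ℚ s t)
    where
    l = solve 7 (λ a x y z g s t → a :* (con 0ℚ :* con 0ℚ) :+ :# 2 :* (con 0ℚ :* (s :* x :+ t :* y)) :+ (x :+ y) :* (s :* s) :+ :# 2
        :* (s :* t) :* z :+ g :* (t :* t)
      := (x :+ y) :* (s :* s) :+ (z :+ z) :* (s :* t) :+ g :* (t :* t)) refl

-- Size of the square of the Kelner polynomial

module GramBound {n : ℕ} (F : OddField n) (χ-⊖𝟙 : Field.χ F (OddField.⊖_ F (OddField.𝟙 F)) ≡ 1ℚ)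
  (G : Graph n) (G-sym : ∀ i j → G i j ≡ G j i)
  (G-paley : ∀ i j → (if does (i ≟ j) then 0ℚ else (if G i j then 1ℚ else 0ℚ)) ≡ ½ * Edges.A₂ F χ-⊖𝟙 i j)
  (α : FKParams) (feasible : FKFeasible G α) (o : Fin n)
  (κ ρ y : ℚ) (0≤κ : 0ℚ ≤ κ) (0≤ρ : 0ℚ ≤ ρ) (0≤y : 0ℚ ≤ y) (N≤κ² : # n ≤ sq κ)
  (R-bound : ∀ f → (∀ i → f i i ≡ 0ℚ) → sq (Edges.R-form F χ-⊖𝟙 f) ≤ sq (ρ * ‖ f ‖²₂)) where

  open UpperForm F χ-⊖𝟙 G G-sym G-paley α feasible o

  private
    N = # n

  w-isEdgeFun : IsEdgeFun w
  w-isEdgeFun = record { e-sym = w-sym ; e-supp = λ i j → [ inj₁ , (λ p → inj₂ (≡0-* (S o i * S o j) p)) ]′ (A-supported i j) }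

  open EdgeFun w-isEdgeFun using (e-diag)

  private
    r W : Fin n → ℚ
    r = degree w
    W = wedge w
    ω V : ℚ
    ω = ‖ w ‖²₂
    V = V-form w

  -- The row sums of `S` vanish and S² = nI - J, so the signs in row j of w cancel almost
  -- completely. This keeps the total weight at -D instead of order n² and is the reason why the
  -- Kelner polynomial has a small square.
  degree-w : ∀ j → r j ≡ - u j
  degree-w j = trans (∑-cong λ k → trans (cong (_* (S o j * S o k)) (A-A₂ j k)) (l (δ j k) (S j k) (S o j) (S o k)))
    (trans (∑-*ˡ (½ * S o j) λ k → S o k - δ j k * S o k + S j k * S o k) (trans (cong (½ * S o j *_) (trans (∑-+ (λ k → S o k - δ j k * S o k) (λ k → S j k * S o k)) (cong₂ _+_ (trans (∑-minus (S o) (λ k → δ j k * S o k)) (cong₂ _-_ (∑-S o) (∑-δˡ j (S o)))) (S-gram j o))))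
    (trans (expand (S o j) N (δ j o)) (trans (cong₂ (λ x z → ½ * (0ℚ - x + (N * z - S o j))) (S-sq o j) (trans (cong (_* S o j) (δ-sym j o)) (trans (δ-* o j λ { refl → S-diag o }) (*-zeroʳ (δ o j)))))
      (trans (collect N (δ o j) (S o j)) (cong -_ (sym (A-A₂ o j))))))))
    where
    l = solve 4 (λ d s a b → con ½ :* (con 1ℚ :- d :+ s) :* (a :* b) := con ½ :* a :* (b :- d :* b :+ s :* b)) refl
    expand = solve 3 (λ s N d → con ½ :* s :* (con 0ℚ :- s :+ (N :* d :- con 1ℚ)) := con ½ :* (con 0ℚ :- s :* s :+ (N :* (d :* s) :- s))) refl
    collect = solve 3 (λ N d s → con ½ :* (con 0ℚ :- (con 1ℚ :- d) :+ (N :* con 0ℚ :- s)) := :- (con ½ :* (con 1ℚ :- d :+ s))) refl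

  D≥0 : 0ℚ ≤ D
  D≥0 = subst (0ℚ ≤_) (∑-A o) (∑-≥0 λ j → A≥0 o j)

  r-norm : ‖ r ‖² ≡ D
  r-norm = trans (∑-cong λ j → trans (cong sq (degree-w j)) (trans (l (u j)) (A-idem₁ o j))) (∑-A o)
    where
    l = solve 1 (λ a → (:- a) :* (:- a) := a :* a) refl

  ∑-r : ∑ r ≡ - D
  ∑-r = trans (∑-cong degree-w) (trans (∑-neg u) (cong -_ (∑-A o)))

  private
    NN≥0 : 0ℚ ≤ N * N
    NN≥0 = *-≥0 N≥0 N≥0
    ω≥0 : 0ℚ ≤ ω
    ω≥0 = ‖‖²₂≥0 w

  ω≤ : ω ≤ N * N
  ω≤ = ≤-trans (∑-mono λ i → ∑-mono λ j → term i j) (≤-eq (trans (∑-cong λ _ → trans (∑-const n 1ℚ) (*-identityʳ N)) (∑-const n N)))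
    where
    A≤1 : ∀ i j → sq (A i j) ≤ 1ℚ
    A≤1 i j with does (i ≟ j)
    ... | true = *≤* (ℤ.+≤+ ℕ.z≤n)
    ... | false with G i j
    ... | true = ≤-refl
    ... | false = *≤* (ℤ.+≤+ ℕ.z≤n)
    l = solve 3 (λ a b c → a :* (b :* c) :* (a :* (b :* c)) := a :* a :* (b :* b :* (c :* c))) refl
    term : ∀ i j → sq (w i j) ≤ 1ℚ
    term i j = ≤-trans (≤-eq (l (A i j) (S o i) (S o j))) (*-mono {b = 1ℚ} {d = 1ℚ} (sq≥0 (A i j)) 0≤1 (A≤1 i j) (*-mono {b = 1ℚ} {d = 1ℚ} (sq≥0 (S o i)) 0≤1 (S-sq≤1 o i) (S-sq≤1 o j)))

  private
    V± : V ∈± κ * (N * N)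
    V± = ±-widen (*-monoˡ κ 0≤κ ω≤) (sq-≤⇒∈± {V} (*-≥0 0≤κ ω≥0) (≤-trans (V-bound w) (≤-trans (*-mono N≥0 (sq≥0 ω) N≤κ² ≤-refl) (≤-eq (l κ ω)))))
      where
      l = solve 2 (λ k x → k :* k :* (x :* x) := k :* x :* (k :* x)) refl
    Q± : Q-form w ∈± N * (N * N)
    Q± = ±-widen (*-monoˡ N N≥0 ω≤) (sq-≤⇒∈± {Q-form w} (*-≥0 N≥0 ω≥0) (Q-bound w))
    P± : P-form w ∈± N * (N * N)
    P± = ±-widen (*-monoˡ N N≥0 ω≤) (sq-≤⇒∈± {P-form w} (*-≥0 N≥0 ω≥0) (P-bound w))
    R± : R-form w ∈± ρ * (N * N)
    R± = ±-widen (*-monoˡ ρ 0≤ρ ω≤) (sq-≤⇒∈± {R-form w} (*-≥0 0≤ρ ω≥0) (R-bound w e-diag))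
    rSr rW : ℚ
    rSr = ∑[ i ] r i * (∑[ k ] S i k * r k)
    rW = ∑[ i ] r i * W i
    rSr± : rSr ∈± κ * D
    rSr± = sq-≤⇒∈± {rSr} (*-≥0 0≤κ D≥0) (≤-trans (bilinear-bound r) (≤-trans (*-mono N≥0 (sq≥0 ‖ r ‖²) N≤κ² ≤-refl) (≤-eq (trans (cong (λ t → κ * κ * (t * t)) r-norm) (l κ D)))))
      where
      l = solve 2 (λ k x → k :* k :* (x :* x) := k :* x :* (k :* x)) refl
    rW± : D * (N * N * (N * N)) ≤ sq y → rW ∈± y
    rW± hy = sq-≤⇒∈± {rW} 0≤y (≤-trans (cauchy-schwarz r W) (≤-trans (*-mono (‖‖²≥0 r) (*-≥0 NN≥0 NN≥0) (≤-eq r-norm) (≤-trans (wedge-norm w) (*-monoˡ (N * N) NN≥0 ω≤))) hy))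

  -- Triangle inequality over the terms of `pairs`. With the values chosen later for κ, ρ and y, the
  -- term ρn² has the highest power of m.
  pairsBound : ℚ
  pairsBound = D * D + # 4 * (κ * D) + # 4 * y + # 2 * (N * (N * N)) + # 4 * (N * (N * N)) + ρ * (N * N) + # 16 * D + # 16 * (κ * (N * N)) + # 8 * (N * N)

  pairs± : D * (N * N * (N * N)) ≤ sq y → pairs w-isEdgeFun ∈± pairsBound
  pairs± hy = plus₈ (plus₇ (plus₆ (plus₅ (plus₄ (plus₃ (plus₂ (±-+ EE± (±-*ˡ {rSr} {κ * D} (# 4) (#≥0 4) rSr±))))))))
    where
    EE± : ∑ r * ∑ r ∈± D * D
    EE± = subst (_∈± D * D) (sym (trans (cong (λ t → t * t) ∑-r) (l D))) (±-≥0 (*-≥0 D≥0 D≥0))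
      where
      l = solve 1 (λ d → (:- d) :* (:- d) := d :* d) refl
    plus₂ : ∀ {t s} → t ∈± s → t + # 4 * rW ∈± s + # 4 * y
    plus₂ {t} {s} h = ±-+ {t} {s} h (±-*ˡ {rW} {y} (# 4) (#≥0 4) (rW± hy))
    plus₃ : ∀ {t s} → t ∈± s → t + # 2 * Q-form w ∈± s + # 2 * (N * (N * N))
    plus₃ {t} {s} h = ±-+ {t} {s} h (±-*ˡ {Q-form w} {N * (N * N)} (# 2) (#≥0 2) Q±)
    plus₄ : ∀ {t s} → t ∈± s → t + # 4 * P-form w ∈± s + # 4 * (N * (N * N))
    plus₄ {t} {s} h = ±-+ {t} {s} h (±-*ˡ {P-form w} {N * (N * N)} (# 4) (#≥0 4) P±)
    plus₅ : ∀ {t s} → t ∈± s → t + R-form w ∈± s + ρ * (N * N)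
    plus₅ {t} {s} h = ±-+ {t} {s} h R±
    plus₆ : ∀ {t s} → t ∈± s → t - # 16 * ‖ r ‖² ∈± s + # 16 * D
    plus₆ {t} {s} h = ±-+ {t} {s} h (±-neg {# 16 * ‖ r ‖²} {# 16 * D} (±-*ˡ {‖ r ‖²} {D} (# 16) (#≥0 16) (subst (_∈± D) (sym r-norm) (±-≥0 D≥0))))
    plus₇ : ∀ {t s} → t ∈± s → t - # 16 * V ∈± s + # 16 * (κ * (N * N))
    plus₇ {t} {s} h = ±-+ {t} {s} h (±-neg {# 16 * V} {# 16 * (κ * (N * N))} (±-*ˡ {V} {κ * (N * N)} (# 16) (#≥0 16) V±))
    plus₈ : ∀ {t s} → t ∈± s → t + # 8 * ω ∈± s + # 8 * (N * N)
    plus₈ {t} {s} h = ±-+ {t} {s} h (±-*ˡ {ω} {N * N} (# 8) (#≥0 8) (±-widen ω≤ (±-≥0 ω≥0)))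

  pairsBound≥0 : 0ℚ ≤ pairsBound
  pairsBound≥0 = +-≥0 (+-≥0 (+-≥0 (+-≥0 (+-≥0 (+-≥0 (+-≥0 (+-≥0 (*-≥0 D≥0 D≥0) (*-≥0 (#≥0 4) (*-≥0 0≤κ D≥0))) (*-≥0 (#≥0 4) 0≤y)) (*-≥0 (#≥0 2) N³≥0)) (*-≥0 (#≥0 4) N³≥0)) (*-≥0 0≤ρ NN≥0)) (*-≥0 (#≥0 16) D≥0)) (*-≥0 (#≥0 16) (*-≥0 0≤κ NN≥0))) (*-≥0 (#≥0 8) NN≥0)
    where
    N³≥0 : 0ℚ ≤ N * (N * N)
    N³≥0 = *-≥0 N≥0 NN≥0

  -- The sign of a₄ is unknown, so its term is estimated in absolute value, while the a₂ and a₃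
  -- terms, with nonnegative coefficients, need only upper bounds.
  gram-bound : D * (N * N * (N * N)) ≤ sq y → ∀ v → 0ℚ ≤ v → a₄ ∈± v → 0ℚ ≤ a₂ → 0ℚ ≤ a₃ →
    gram ≤ # 2 * a₂ * (N * N) + # 2 * a₃ * (D + κ * (N * N)) + v * (½ * ½ * (½ * ½) * pairsBound)
  gram-bound hy v 0≤v a₄± 0≤a₂ 0≤a₃ = +-mono-≤ (+-mono-≤ (*-monoˡ (# 2 * a₂) (*-≥0 (#≥0 2) 0≤a₂) ω≤)
      (≤-trans (≤-eq (trans (cong (# 4 * a₃ *_) (∑-A-cherries w-isEdgeFun)) (l a₃ ‖ r ‖² ω V))) (*-monoˡ (# 2 * a₃) (*-≥0 (#≥0 2) 0≤a₃) (+-mono-≤ (≤-by {a = ‖ r ‖² - ω} ω≥0 (trans (sym r-norm) (l′ ‖ r ‖² ω))) (proj₁ V±)))))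
    (≤-trans (≤-eq (cong (a₄ *_) (∑-A-pairs w-isEdgeFun))) (proj₁ (±-* {a₄} {v} {½ * ½ * (½ * ½) * pairs w-isEdgeFun} {½ * ½ * (½ * ½) * pairsBound} 0≤v (*-≥0 0≤⅟16 pairsBound≥0) a₄± (±-*ˡ {pairs w-isEdgeFun} {pairsBound} (½ * ½ * (½ * ½)) 0≤⅟16 (pairs± hy)))))
    where
    0≤⅟16 : 0ℚ ≤ ½ * ½ * (½ * ½)
    0≤⅟16 = *≤* (ℤ.+≤+ ℕ.z≤n)
    l = solve 4 (λ a r w v → :# 4 :* a :* (con ½ :* (r :- w :+ v)) := :# 2 :* a :* (r :- w :+ v)) refl
    l′ = solve 2 (λ r w → r := r :- w :+ w) refl

-- Estimates in powers of the scale m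

module Powers (m : ℚ) (1≤m : 1ℚ ≤ m) where
  pow : ℕ → ℚ
  pow zero = 1ℚ
  pow (suc k) = m * pow k

  m≥0 : 0ℚ ≤ m
  m≥0 = ≤-trans 0≤1 1≤m

  pow≥0 : ∀ k → 0ℚ ≤ pow k
  pow≥0 zero = 0≤1
  pow≥0 (suc k) = *-≥0 m≥0 (pow≥0 k)

  pow-suc : ∀ k → pow k ≤ pow (suc k)
  pow-suc k = subst (_≤ m * pow k) (*-identityˡ (pow k)) (*-monoʳ-≤-nonNeg (pow k) {{nonNegative (pow≥0 k)}} 1≤m)

  pow-mono : ∀ {j k} → j ℕ.≤′ k → pow j ≤ pow k
  pow-mono ℕ.≤′-refl = ≤-refl
  pow-mono (ℕ.≤′-step {n} h) = ≤-trans (pow-mono h) (pow-suc n)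

-- With n of order m³, the quantities √n, n^(5/4) and √(Dn⁴) behind κ, ρ and y are of order m^(3/2),
-- m^(15/4) and m^(15/2). They are rounded up to m², m⁴ and m⁸, which the argument can afford.
module Arithmetic (m N κ ρ y : ℚ) (128≤m : # 128 ≤ m) (m³≤N : m * m * m ≤ N) (N≤8m³ : N ≤ # 8 * (m * m * m))
  (κ≡ : κ ≡ # 3 * (m * m)) (ρ≡ : ρ ≡ # 88 * (m * m * (m * m))) (y≡ : y ≡ # 128 * (m * m * (m * m) * (m * m * (m * m)))) where

  1≤m : 1ℚ ≤ m
  1≤m = ≤-trans (#-mono {1} {128} (ℕ.s≤s ℕ.z≤n)) 128≤m
  open Powers m 1≤m public

  D : ℚ
  D = ½ * (N * 1ℚ - 1ℚ)

  0<m : 0ℚ < m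
  0<m = <-≤-trans 0<1 1≤m

  m³ : ℚ
  m³ = m * m * m

  m≤m³ : m ≤ m³
  m≤m³ = ≤-trans (≤-eq (l₁ m)) (≤-trans (pow-mono {1} {3} (ℕ.≤⇒≤′ (ℕ.s≤s ℕ.z≤n))) (≤-eq (l₃ m)))
    where
    l₁ = solve 1 (λ m → m := m :* con 1ℚ) refl
    l₃ = solve 1 (λ m → m :* (m :* (m :* con 1ℚ)) := m :* m :* m) refl

  m³≥0 : 0ℚ ≤ m³
  m³≥0 = ≤-trans m≥0 m≤m³

  private
    q≥0 : ∀ k d .{{_ : ℕ.NonZero d}} → 0ℚ ≤ ℤ.+ k / d
    q≥0 k d = nonNegative⁻¹ (ℤ.+ k / d) {{normalize-nonNeg k d}}

  128≤m³ : # 128 ≤ m³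
  128≤m³ = ≤-trans 128≤m m≤m³

  D≥ : ℤ.+ 1 / 4 * m³ ≤ D
  D≥ = ≤-by (+-≥0 (*-≥0 (q≥0 1 2) (diff≥0 m³≤N)) (+-≥0 (*-≥0 (q≥0 1 4) (diff≥0 128≤m³)) (q≥0 63 2))) (l N m³)
    where
    l = solve 2 (λ N t → con ½ :* (N :* con 1ℚ :- con 1ℚ)
      := con (ℤ.+ 1 / 4) :* t :+ (con (ℤ.+ 1 / 2) :* (N :- t) :+ (con (ℤ.+ 1 / 4) :* (t :- :# 128) :+ con (ℤ.+ 63 / 2)))) refl

  D≤ : D ≤ # 4 * m³
  D≤ = ≤-by (+-≥0 (*-≥0 (q≥0 1 2) (diff≥0 N≤8m³)) (q≥0 1 2)) (l N m³)
    where
    l = solve 2 (λ N t → :# 4 :* t := con ½ :* (N :* con 1ℚ :- con 1ℚ) :+ (con (ℤ.+ 1 / 2) :* (:# 8 :* t :- N) :+ con (ℤ.+ 1 / 2))) refl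

  D-2≥ : ℤ.+ 1 / 8 * m³ ≤ D - # 2
  D-2≥ = ≤-by (+-≥0 (diff≥0 D≥) (+-≥0 (*-≥0 (q≥0 1 8) (diff≥0 128≤m³)) (q≥0 14 1))) (l D m³)
    where
    l = solve 2 (λ D t → D :- :# 2
      := con (ℤ.+ 1 / 8) :* t :+ (D :- con (ℤ.+ 1 / 4) :* t :+ (con (ℤ.+ 1 / 8) :* (t :- :# 128) :+ con (ℤ.+ 14 / 1)))) refl

  D-2≥0 : 0ℚ ≤ D - # 2
  D-2≥0 = ≤-trans (*-≥0 (q≥0 1 8) m³≥0) D-2≥

  D≥0 : 0ℚ ≤ D
  D≥0 = ≤-trans (*-≥0 (q≥0 1 4) m³≥0) D≥

  0<D : 0ℚ < D
  0<D = <-≤-trans (0<# 1) (≤-by {a = # 2} D-2≥0 (l D))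
    where
    l = solve 1 (λ D → D := :# 2 :+ (D :- :# 2)) refl

  mm≤D : m * m ≤ D
  mm≤D = ≤-trans (≤-by (*-≥0 (*-≥0 (q≥0 1 4) (*-≥0 m≥0 m≥0)) (≤-trans (q≥0 124 1) (≤-by {c = m - # 128} (diff≥0 128≤m) (l₂ m)))) (l m)) D≥
    where
    l = solve 1 (λ m → con (ℤ.+ 1 / 4) :* (m :* m :* m) := m :* m :+ con (ℤ.+ 1 / 4) :* (m :* m) :* (m :- :# 4)) refl
    l₂ = solve 1 (λ m → m :- :# 4 := con (ℤ.+ 124 / 1) :+ (m :- :# 128)) refl

  N² : N * N ≤ # 64 * pow 6
  N² = ≤-trans (*-mono N≥0 (*-≥0 (#≥0 8) m³≥0) N≤8m³ N≤8m³) (≤-eq (l m))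
    where
    N≥0 : 0ℚ ≤ N
    N≥0 = ≤-trans m³≥0 m³≤N
    l = solve 1 (λ m → :# 8 :* (m :* m :* m) :* (:# 8 :* (m :* m :* m)) := :# 64 :* (m :* (m :* (m :* (m :* (m :* (m :* con 1ℚ))))))) refl

  N≥0 : 0ℚ ≤ N
  N≥0 = ≤-trans m³≥0 m³≤N

  NN≥0 : 0ℚ ≤ N * N
  NN≥0 = *-≥0 N≥0 N≥0

  D≤pow : D ≤ # 4 * pow 3
  D≤pow = ≤-trans D≤ (≤-eq (l m))
    where
    l = solve 1 (λ m → :# 4 :* (m :* m :* m) := :# 4 :* (m :* (m :* (m :* con 1ℚ)))) refl

  κ≥0 : 0ℚ ≤ κ
  κ≥0 = subst (0ℚ ≤_) (sym κ≡) (*-≥0 (#≥0 3) (*-≥0 m≥0 m≥0))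

  mm≥0 : 0ℚ ≤ m * m
  mm≥0 = *-≥0 m≥0 m≥0

  ρ≥0 : 0ℚ ≤ ρ
  ρ≥0 = subst (0ℚ ≤_) (sym ρ≡) (*-≥0 (#≥0 88) (*-≥0 mm≥0 mm≥0))

  y≥0 : 0ℚ ≤ y
  y≥0 = subst (0ℚ ≤_) (sym y≡) (*-≥0 (#≥0 128) (*-≥0 (*-≥0 mm≥0 mm≥0) (*-≥0 mm≥0 mm≥0)))

  -- y has to bound the pairing of the degree and wedge vectors of w, whose squared norms are D and
  -- at most n⁴.
  hy : D * (N * N * (N * N)) ≤ sq y
  hy = ≤-trans (*-mono D≥0 (*-≥0 (*-≥0 (#≥0 64) (pow≥0 6)) (*-≥0 (#≥0 64) (pow≥0 6))) D≤pow (*-mono NN≥0 (*-≥0 (#≥0 64) (pow≥0 6)) N² N²))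
    (≤-trans (≤-eq (l₁ m)) (≤-trans (*-monoˡ (# 16384) (#≥0 16384) (pow-suc 15)) (≤-eq (trans (l₂ m) (cong sq (sym y≡))))))
    where
    l₁ = solve 1 (λ m → :# 4 :* (m :* (m :* (m :* con 1ℚ))) :* (:# 64 :* (m :* (m :* (m :* (m :* (m :* (m :* con 1ℚ)))))) :* (:# 64
        :* (m :* (m :* (m :* (m :* (m :* (m :* con 1ℚ))))))))
      := :# 16384 :* (m :* (m :* (m :* (m :* (m :* (m :* (m :* (m :* (m :* (m :* (m :* (m :* (m :* (m :* (m :* con 1ℚ)))))))))))))))) refl
    l₂ = solve 1 (λ m → :# 16384 :* (m :* (m :* (m :* (m :* (m :* (m :* (m :* (m :* (m :* (m :* (m :* (m :* (m :* (m :* (m :* (m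
        :* con 1ℚ))))))))))))))))
      := :# 128 :* (m :* m :* (m :* m) :* (m :* m :* (m :* m))) :* (:# 128 :* (m :* m :* (m :* m) :* (m :* m :* (m :* m))))) refl

  private
    raise : ∀ j {t c} → {j≤10 : j ℕ.≤ 10} → 0ℚ ≤ c → t ≤ c * pow j → t ≤ c * pow 10
    raise j {t} {c} {j≤10} 0≤c h = ≤-trans h (*-monoˡ c 0≤c (pow-mono (ℕ.≤⇒≤′ j≤10)))

    times : ∀ j {t} c d → 0ℚ ≤ c → t ≤ d * pow j → c * t ≤ c * d * pow j
    times j c d 0≤c h = ≤-trans (*-monoˡ c 0≤c h) (≤-eq (sym (*-assoc c d (pow j))))

    ≤10 : ∀ {j} {h : Relation.Nullary.True (j ℕ.≤? 10)} → j ℕ.≤ 10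
    ≤10 {j} {h} = Relation.Nullary.toWitness h

    64≥0 = *-≥0 (#≥0 64) (pow≥0 6)

    N³ : N * (N * N) ≤ # 512 * pow 9
    N³ = ≤-trans (*-mono N≥0 64≥0 N≤8m³ N²) (≤-eq (l m))
      where
      l = solve 1 (λ m → :# 8 :* (m :* m :* m) :* (:# 64 :* (m :* (m :* (m :* (m :* (m :* (m :* con 1ℚ)))))))
        := :# 512 :* (m :* (m :* (m :* (m :* (m :* (m :* (m :* (m :* (m :* con 1ℚ)))))))))) refl

    κNN : κ * (N * N) ≤ # 192 * pow 8
    κNN = ≤-trans (*-monoˡ κ κ≥0 N²) (≤-eq (trans (cong (_* (# 64 * pow 6)) κ≡) (l m)))
      where
      l = solve 1 (λ m → :# 3 :* (m :* m) :* (:# 64 :* (m :* (m :* (m :* (m :* (m :* (m :* con 1ℚ)))))))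
        := :# 192 :* (m :* (m :* (m :* (m :* (m :* (m :* (m :* (m :* con 1ℚ))))))))) refl

    κD : κ * D ≤ # 12 * pow 5
    κD = ≤-trans (*-monoˡ κ κ≥0 D≤pow) (≤-eq (trans (cong (_* (# 4 * pow 3)) κ≡) (l m)))
      where
      l = solve 1 (λ m → :# 3 :* (m :* m) :* (:# 4 :* (m :* (m :* (m :* con 1ℚ)))) := :# 12 :* (m :* (m :* (m :* (m :* (m :* con 1ℚ)))))) refl

    DD : D * D ≤ # 16 * pow 6
    DD = ≤-trans (*-mono D≥0 (*-≥0 (#≥0 4) (pow≥0 3)) D≤pow D≤pow) (≤-eq (l m))
      where
      l = solve 1 (λ m → :# 4 :* (m :* (m :* (m :* con 1ℚ))) :* (:# 4 :* (m :* (m :* (m :* con 1ℚ))))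
        := :# 16 :* (m :* (m :* (m :* (m :* (m :* (m :* con 1ℚ))))))) refl

    ρNN : ρ * (N * N) ≤ # 5632 * pow 10
    ρNN = ≤-trans (*-monoˡ ρ ρ≥0 N²) (≤-eq (trans (cong (_* (# 64 * pow 6)) ρ≡) (l m)))
      where
      l = solve 1 (λ m → :# 88 :* (m :* m :* (m :* m)) :* (:# 64 :* (m :* (m :* (m :* (m :* (m :* (m :* con 1ℚ)))))))
        := :# 5632 :* (m :* (m :* (m :* (m :* (m :* (m :* (m :* (m :* (m :* (m :* con 1ℚ))))))))))) refl

    y≤ : y ≤ # 128 * pow 8
    y≤ = ≤-eq (trans y≡ (l m))
      where
      l = solve 1 (λ m → :# 128 :* (m :* m :* (m :* m) :* (m :* m :* (m :* m)))
        := :# 128 :* (m :* (m :* (m :* (m :* (m :* (m :* (m :* (m :* con 1ℚ))))))))) refl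

  pairs-size : D * D + # 4 * (κ * D) + # 4 * y + # 2 * (N * (N * N)) + # 4 * (N * (N * N)) + ρ * (N * N) + # 16 * D + # 16 * (κ * (N * N)) + # 8 * (N * N) ≤ # 12928 * pow 10
  pairs-size = ≤-trans (+-mono-≤ (+-mono-≤ (+-mono-≤ (+-mono-≤ (+-mono-≤ (+-mono-≤ (+-mono-≤ (+-mono-≤
      (raise 6 {j≤10 = ≤10} (#≥0 16) DD)
      (raise 5 {j≤10 = ≤10} (#≥0 48) (times 5 (# 4) (# 12) (#≥0 4) κD)))
      (raise 8 {j≤10 = ≤10} (#≥0 512) (times 8 (# 4) (# 128) (#≥0 4) y≤)))
      (raise 9 {j≤10 = ≤10} (#≥0 1024) (times 9 (# 2) (# 512) (#≥0 2) N³)))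
      (raise 9 {j≤10 = ≤10} (#≥0 2048) (times 9 (# 4) (# 512) (#≥0 4) N³)))
      ρNN)
      (raise 3 {j≤10 = ≤10} (#≥0 64) (times 3 (# 16) (# 4) (#≥0 16) D≤pow)))
      (raise 8 {j≤10 = ≤10} (#≥0 3072) (times 8 (# 16) (# 192) (#≥0 16) κNN)))
      (raise 6 {j≤10 = ≤10} (#≥0 512) (times 6 (# 8) (# 64) (#≥0 8) N²)))
    (≤-eq (l (pow 10)))
    where
    l = solve 1 (λ p → :# 16 :* p :+ :# 48 :* p :+ :# 512 :* p :+ :# 1024 :* p :+ :# 2048 :* p :+ :# 5632 :* p :+ :# 64 :* p :+ :# 3072
        :* p :+ :# 512 :* p
      := :# 12928 :* p) refl

  -- Every term of the bound is at most a constant times m² times a rescaled moment. Extracting m²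
  -- is what lets it combine with a₁ into x in the test against x_o.
  gram-size : ∀ {g a₂ a₃ v B} → 0ℚ ≤ a₂ → 0ℚ ≤ a₃ → 0ℚ ≤ v → B ≤ # 12928 * pow 10 →
    g ≤ # 2 * a₂ * (N * N) + # 2 * a₃ * (D + κ * (N * N)) + v * (½ * ½ * (½ * ½) * B) →
    g ≤ # 1000 * (m * m) * (a₂ * (m * m * (m * m)) + a₃ * (m * m * (m * m) * (m * m)) + v * (m * m * (m * m) * (m * m * (m * m))))
  gram-size {g} {a₂} {a₃} {v} {B} 0≤a₂ 0≤a₃ 0≤v hB h = ≤-trans h (≤-trans (+-mono-≤ (+-mono-≤ (*-monoˡ (# 2 * a₂) (*-≥0 (#≥0 2) 0≤a₂) N²)
        (*-monoˡ (# 2 * a₃) (*-≥0 (#≥0 2) 0≤a₃) (+-mono-≤ (≤-trans D≤pow (*-monoˡ (# 4) (#≥0 4) (pow-mono {3} {8} (ℕ.≤⇒≤′ (ℕ.s≤s (ℕ.s≤s (ℕ.s≤s ℕ.z≤n))))))) κNN)))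
        (*-monoˡ v 0≤v (*-monoˡ (½ * ½ * (½ * ½)) (*≤* (ℤ.+≤+ ℕ.z≤n)) hB)))
      (≤-by (+-≥0 (+-≥0 (*-≥0 (*-≥0 (#≥0 872) 0≤a₂) (pow≥0 6)) (*-≥0 (*-≥0 (#≥0 608) 0≤a₃) (pow≥0 8))) (*-≥0 (*-≥0 (#≥0 192) 0≤v) (pow≥0 10))) (l a₂ a₃ v m)))
    where
    l = solve 4 (λ a b v m → :# 1000 :* (m :* m) :* (a :* (m :* m :* (m :* m)) :+ b :* (m :* m :* (m :* m) :* (m :* m)) :+ v :* (m
        :* m :* (m :* m) :* (m :* m :* (m :* m))))
      := :# 2 :* a :* (:# 64 :* (m :* (m :* (m :* (m :* (m :* (m :* con 1ℚ))))))) :+ :# 2 :* b :* (:# 4 :* (m :* (m :* (m :* (m :* (m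
        :* (m :* (m :* (m :* con 1ℚ)))))))) :+ :# 192 :* (m :* (m :* (m :* (m :* (m :* (m :* (m :* (m :* con 1ℚ))))))))) :+ v :* (con ½
        :* con ½ :* (con ½ :* con ½) :* (:# 12928 :* (m :* (m :* (m :* (m :* (m :* (m :* (m :* (m :* (m :* (m :* con 1ℚ))))))))))))
        :+ (:# 872 :* a :* (m :* (m :* (m :* (m :* (m :* (m :* con 1ℚ)))))) :+ :# 608 :* b :* (m :* (m :* (m :* (m :* (m :* (m :* (m
        :* (m :* con 1ℚ)))))))) :+ :# 192 :* v :* (m :* (m :* (m :* (m :* (m :* (m :* (m :* (m :* (m :* (m :* con 1ℚ)))))))))))) refl

  -- x, Y, Z and w are the pseudomoments rescaled so that all of them have order 1 at the threshold.
  module Threshold (a₁ a₂ a₃ a₄ g T : ℚ) where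
    x Y Z edges : ℚ
    x = a₁ * (m * m)
    Y = a₂ * (m * m * (m * m))
    Z = a₃ * (m * m * (m * m) * (m * m))
    edges = D * (½ * (D - # 2))

    0<mm : 0ℚ < m * m
    0<mm = *->0 0<m 0<m

    unscale : ∀ {a} t → 0ℚ < t → 0ℚ ≤ a * t → 0ℚ ≤ a
    unscale {a} t 0<t h = cancel-≤ t 0<t (subst₂ _≤_ (sym (*-zeroʳ t)) (*-comm a t) h)

    0<N : 0ℚ < N
    0<N = <-≤-trans (0<# 127) (≤-trans 128≤m³ m³≤N)

    module _ (2≤x : # 2 ≤ x) (value : sq (N * a₁) ≤ N * a₁ + a₂ * (N * D)) where
      x≥0 : 0ℚ ≤ x
      x≥0 = ≤-trans (#≥0 2) 2≤x

      -- The value test rescaled: the competing term na₁ is at most half of (na₁)² because x ≥ 2.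
      YD : ½ * (N * sq x) ≤ Y * D
      YD = cancel-≤ N 0<N (≤-by (+-≥0 (*-≥0 (*-≥0 (*-≥0 mm≥0 mm≥0) 0≤1) (diff≥0 value)) (*-≥0 (*-≥0 N≥0 x≥0) slack)) (l N a₁ a₂ D m))
        where
        mm≤N : m * m ≤ N
        mm≤N = ≤-trans mm≤D (≤-trans (≤-by (+-≥0 (*-≥0 (q≥0 1 2) N≥0) (q≥0 1 2)) (l′ N)) ≤-refl)
          where
          l′ = solve 1 (λ N → N := con ½ :* (N :* con 1ℚ :- con 1ℚ) :+ (con (ℤ.+ 1 / 2) :* N :+ con (ℤ.+ 1 / 2))) refl
        slack : 0ℚ ≤ ½ * (N * x) - m * m
        slack = diff≥0 (≤-trans mm≤N (≤-by (*-≥0 (q≥0 1 2) (*-≥0 N≥0 (diff≥0 2≤x))) (l′ N x)))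
          where
          l′ = solve 2 (λ N x → con ½ :* (N :* x) := N :+ con (ℤ.+ 1 / 2) :* (N :* (x :- :# 2))) refl
        l = solve 5 (λ N a b D m → N :* (b :* (m :* m :* (m :* m)) :* D)
          := N :* (con ½ :* (N :* (a :* (m :* m) :* (a :* (m :* m))))) :+ (m :* m :* (m :* m) :* con 1ℚ :* (N :* a :+ b :* (N :* D)
            :- N :* a :* (N :* a)) :+ N :* (a :* (m :* m)) :* (con ½ :* (N :* (a :* (m :* m))) :- m :* m))) refl

      Y≥0 : 0ℚ ≤ Y
      Y≥0 = cancel-≤ D 0<D (subst₂ _≤_ (sym (*-zeroʳ D)) (*-comm Y D) (≤-trans (*-≥0 (q≥0 1 2) (*-≥0 N≥0 (sq≥0 x))) YD))

      x²≤Y : sq x ≤ Y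
      x²≤Y = cancel-≤ N 0<N (≤-by (+-≥0 (*-≥0 (#≥0 2) (diff≥0 YD)) Y≥0) (l N x Y))
        where
        l = solve 3 (λ N x Y → N :* Y := N :* (x :* x) :+ (:# 2 :* (Y :* (con ½ :* (N :* con 1ℚ :- con 1ℚ)) :- con ½ :* (N :* (x :* x))) :+ Y)) refl

      a₂≥0 : 0ℚ ≤ a₂
      a₂≥0 = unscale (m * m * (m * m)) (*->0 0<mm 0<mm) Y≥0

      2x≤Y : # 2 * x ≤ Y
      2x≤Y = ≤-trans (*-mono (#≥0 2) x≥0 2≤x ≤-refl) x²≤Y

      module _ (link : sq (a₂ * D) ≤ a₁ * (a₂ * D + a₃ * edges)) where
        -- The link test rescaled: the competing term a₁a₂D is at most half of (a₂D)² because 2x ≤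
        -- Y.
        Y²D : ½ * (sq Y * D) ≤ x * Z * (½ * (D - # 2))
        Y²D = cancel-≤ D 0<D (≤-by (+-≥0 (*-≥0 (*-≥0 (*-≥0 mm≥0 mm≥0) (*-≥0 mm≥0 mm≥0)) (diff≥0 link)) (*-≥0 (*-≥0 D≥0 Y≥0) slack)) (l a₁ a₂ a₃ D m))
          where
          slack : 0ℚ ≤ ½ * (Y * D) - x * (m * m)
          slack = diff≥0 (≤-trans (*-monoˡ x x≥0 mm≤D) (≤-by (*-≥0 (*-≥0 (q≥0 1 2) D≥0) (diff≥0 2x≤Y)) (l′ x D Y)))
            where
            l′ = solve 3 (λ x D Y → con ½ :* (Y :* D) := x :* D :+ con (ℤ.+ 1 / 2) :* D :* (Y :- :# 2 :* x)) refl
          l = solve 5 (λ a b c D m → D :* (a :* (m :* m) :* (c :* (m :* m :* (m :* m) :* (m :* m))) :* (con ½ :* (D :- :# 2)))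
            := D :* (con ½ :* (b :* (m :* m :* (m :* m)) :* (b :* (m :* m :* (m :* m))) :* D)) :+ (m :* m :* (m :* m) :* (m :* m
              :* (m :* m)) :* (a :* (b :* D :+ c :* (D :* (con ½ :* (D :- :# 2)))) :- b :* D :* (b :* D)) :+ D :* (b :* (m :* m :* (m
              :* m))) :* (con ½ :* (b :* (m :* m :* (m :* m)) :* D) :- a :* (m :* m) :* (m :* m)))) refl

        0<x : 0ℚ < x
        0<x = <-≤-trans (0<# 1) 2≤x

        0<D-2 : 0ℚ < D - # 2
        0<D-2 = <-≤-trans (*->0 {ℤ.+ 1 / 8} (*<* (ℤ.+<+ (ℕ.s≤s ℕ.z≤n))) (<-≤-trans (0<# 127) 128≤m³)) D-2≥

        Z≥0 : 0ℚ ≤ Z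
        Z≥0 = unscale (x * (D - # 2)) (*->0 0<x 0<D-2) (≤-trans (*-≥0 (sq≥0 Y) D≥0) (≤-by (*-≥0 (#≥0 2) (diff≥0 Y²D)) (l x Z D (sq Y))))
          where
          l = solve 4 (λ x Z D y → Z :* (x :* (D :- :# 2)) := y :* D :+ :# 2 :* (x :* Z :* (con ½ :* (D :- :# 2)) :- con ½ :* (y :* D))) refl

        Y²≤xZ : sq Y ≤ x * Z
        Y²≤xZ = cancel-≤ D 0<D (≤-by (+-≥0 (*-≥0 (#≥0 2) (diff≥0 Y²D)) (*-≥0 (#≥0 2) (*-≥0 x≥0 Z≥0))) (l x Z D (sq Y)))
          where
          l = solve 4 (λ x Z D y → D :* (x :* Z)
            := D :* y :+ (:# 2 :* (x :* Z :* (con ½ :* (D :- :# 2)) :- con ½ :* (y :* D)) :+ :# 2 :* (x :* Z))) refl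

        xY≤Z : x * Y ≤ Z
        xY≤Z = cancel-≤ x 0<x (≤-trans (≤-eq (sym (*-assoc x x Y))) (≤-trans (*-mono (sq≥0 x) Y≥0 x²≤Y ≤-refl) Y²≤xZ))

        Y≤Z : Y ≤ Z
        Y≤Z = ≤-trans (≤-by (*-≥0 (diff≥0 (≤-trans (#-mono {1} {2} (ℕ.s≤s ℕ.z≤n)) 2≤x)) Y≥0) (l x Y)) xY≤Z
          where
          l = solve 2 (λ x Y → x :* Y := Y :+ (x :- con 1ℚ) :* Y) refl

        x³≤Z : x * sq x ≤ Z
        x³≤Z = ≤-trans (*-monoˡ x x≥0 x²≤Y) xY≤Z

        0<Z : 0ℚ < Z
        0<Z = <-≤-trans (*->0 0<x (*->0 0<x 0<x)) x³≤Z

        a₃≥0 : 0ℚ ≤ a₃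
        a₃≥0 = unscale (m * m * (m * m) * (m * m)) (*->0 (*->0 0<mm 0<mm) 0<mm) Z≥0

        edges≥ : ℤ.+ 1 / 64 * (m³ * m³) ≤ edges
        edges≥ = ≤-trans (≤-eq (l m³)) (*-mono (*-≥0 (q≥0 1 4) m³≥0) (*-≥0 (q≥0 1 2) D-2≥0) D≥ (*-monoˡ (ℤ.+ 1 / 2) (q≥0 1 2) D-2≥))
          where
          l = solve 1 (λ t → con (ℤ.+ 1 / 64) :* (t :* t) := con (ℤ.+ 1 / 4) :* t :* (con (ℤ.+ 1 / 2) :* (con (ℤ.+ 1 / 8) :* t))) refl

        edges≤ : edges ≤ # 8 * (m³ * m³)
        edges≤ = ≤-trans (≤-by D≥0 (l D)) (≤-trans (*-monoˡ ½ (q≥0 1 2) (*-mono D≥0 (*-≥0 (#≥0 4) m³≥0) D≤ D≤)) (≤-eq (l′ m³)))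
          where
          l = solve 1 (λ D → con ½ :* (D :* D) := D :* (con ½ :* (D :- :# 2)) :+ D) refl
          l′ = solve 1 (λ t → con ½ :* (:# 4 :* t :* (:# 4 :* t)) := :# 8 :* (t :* t)) refl

        a₃edges≤ : a₃ * edges ≤ # 8 * Z
        a₃edges≤ = ≤-trans (*-monoˡ a₃ a₃≥0 edges≤) (≤-eq (l a₃ m))
          where
          l = solve 2 (λ a m → a :* (:# 8 :* (m :* m :* m :* (m :* m :* m))) := :# 8 :* (a :* (m :* m :* (m :* m) :* (m :* m)))) refl

        a₃edges≥ : ℤ.+ 1 / 64 * Z ≤ a₃ * edges
        a₃edges≥ = ≤-trans (≤-eq (l a₃ m)) (*-monoˡ a₃ a₃≥0 edges≥)
          where
          l = solve 2 (λ a m → con (ℤ.+ 1 / 64) :* (a :* (m :* m :* (m :* m) :* (m :* m)))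
            := a :* (con (ℤ.+ 1 / 64) :* (m :* m :* m :* (m :* m :* m)))) refl

        link≤ : a₂ * D + a₃ * edges ≤ # 12 * Z
        link≤ = ≤-trans (+-mono-≤ (≤-trans (*-monoˡ a₂ a₂≥0 D≤) (≤-trans (≤-by (*-≥0 (#≥0 4) (*-≥0 (*-≥0 a₂≥0 m³≥0) (diff≥0 1≤m))) (l a₂ m)) (*-monoˡ (# 4) (#≥0 4) Y≤Z))) a₃edges≤) (≤-eq (l′ Z))
          where
          l = solve 2 (λ a m → :# 4 :* (a :* (m :* m :* (m :* m)))
            := a :* (:# 4 :* (m :* m :* m)) :+ :# 4 :* (a :* (m :* m :* m) :* (m :- con 1ℚ))) refl
          l′ = solve 1 (λ Z → :# 4 :* Z :+ :# 8 :* Z := :# 12 :* Z) refl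

        -- Any value of at least 36000 · 8192² serves, since `absurd` derives w ≤ 36000 · 8192² · Z
        -- from LZ < w.
        L : ℚ
        L = # 10000000000000

        module _ (triangles : ½ * (D * (½ * (D - # 2) * (½ * (D - # 2) - 1ℚ - κ))) ≤ T)
          (kelner : sq (a₃ * edges) ≤ a₁ * g) (kelner-link : sq (# 2 * a₃ * edges + a₄ * T) ≤ (a₂ * D + a₃ * edges) * g)
          (v : ℚ) (0≤v : 0ℚ ≤ v) (a₄-v : a₄ ≡ v ⊎ a₄ ≡ - v)
          (g≤ : g ≤ # 1000 * (m * m) * (Y + Z + v * (m * m * (m * m) * (m * m * (m * m))))) where

          w : ℚ
          w = v * (m * m * (m * m) * (m * m * (m * m)))

          w≥0 : 0ℚ ≤ w
          w≥0 = *-≥0 0≤v (*-≥0 (*-≥0 mm≥0 mm≥0) (*-≥0 mm≥0 mm≥0))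

          g≤′ : g ≤ # 1000 * (m * m) * (# 2 * Z + w)
          g≤′ = ≤-trans g≤ (*-monoˡ (# 1000 * (m * m)) (*-≥0 (#≥0 1000) mm≥0) (+-monoˡ-≤ w (≤-trans (+-monoˡ-≤ Z Y≤Z) (≤-eq (l Z)))))
            where
            l = solve 1 (λ Z → Z :+ Z := :# 2 :* Z) refl

          T≥ : ℤ.+ 1 / 4096 * (m³ * m³ * m³) ≤ T
          T≥ = ≤-trans (≤-eq (l m³)) (≤-trans (*-monoˡ ½ (q≥0 1 2) (*-mono (*-≥0 (q≥0 1 4) m³≥0) (*-≥0 σ≥0 (≤-trans (*-≥0 (q≥0 1 32) m³≥0) σ-≥)) D≥ (*-mono (*-≥0 (q≥0 1 16) m³≥0) (≤-trans (*-≥0 (q≥0 1 32) m³≥0) σ-≥) σ≥ σ-≥))) triangles)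
            where
            l = solve 1 (λ t → con (ℤ.+ 1 / 4096) :* (t :* t :* t)
              := con ½ :* (con (ℤ.+ 1 / 4) :* t :* (con (ℤ.+ 1 / 16) :* t :* (con (ℤ.+ 1 / 32) :* t)))) refl
            σ≥ : ℤ.+ 1 / 16 * m³ ≤ ½ * (D - # 2)
            σ≥ = ≤-trans (≤-eq (l′ m³)) (*-monoˡ (ℤ.+ 1 / 2) (q≥0 1 2) D-2≥)
              where
              l′ = solve 1 (λ t → con (ℤ.+ 1 / 16) :* t := con (ℤ.+ 1 / 2) :* (con (ℤ.+ 1 / 8) :* t)) refl
            σ≥0 : 0ℚ ≤ ½ * (D - # 2)
            σ≥0 = *-≥0 (q≥0 1 2) D-2≥0
            -- Here m ≥ 128 is used in full: m³/32 ≥ 4m² leaves room for 1 + κ = 1 + 3m².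
            σ-≥ : ℤ.+ 1 / 32 * m³ ≤ ½ * (D - # 2) - 1ℚ - κ
            σ-≥ = ≤-by (+-≥0 (diff≥0 σ≥) (+-≥0 (*-≥0 (*-≥0 (q≥0 1 32) mm≥0) (diff≥0 128≤m)) (mm-1))) (trans (cong (λ k → ½ * (D - # 2) - 1ℚ - k) κ≡) (l′ D m))
              where
              mm-1 : 0ℚ ≤ m * m - 1ℚ
              mm-1 = diff≥0 (≤-trans 1≤m (≤-by (*-≥0 m≥0 (diff≥0 1≤m)) (l″ m)))
                where
                l″ = solve 1 (λ m → m :* m := m :+ m :* (m :- con 1ℚ)) refl
              l′ = solve 2 (λ D m → con ½ :* (D :- :# 2) :- con 1ℚ :- :# 3 :* (m :* m)
                := con (ℤ.+ 1 / 32) :* (m :* m :* m) :+ (con ½ :* (D :- :# 2) :- con (ℤ.+ 1 / 16) :* (m :* m :* m) :+ (con (ℤ.+ 1 / 32)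
                  :* (m :* m) :* (m :- :# 128) :+ (m :* m :- con 1ℚ)))) refl

          -- T is of order m⁹ while w carries m⁸, so a factor m is gained. Its square cancels the m²
          -- in the bound for `gram`, and the test of the link against the Kelner polynomial
          -- compares w² with Z(Z + w) up to constants.
          vT≥ : ℤ.+ 1 / 4096 * (w * m) ≤ v * T
          vT≥ = ≤-trans (≤-eq (l v m)) (*-monoˡ v 0≤v T≥)
            where
            l = solve 2 (λ v m → con (ℤ.+ 1 / 4096) :* (v :* (m :* m :* (m :* m) :* (m :* m :* (m :* m))) :* m)
              := v :* (con (ℤ.+ 1 / 4096) :* (m :* m :* m :* (m :* m :* m) :* (m :* m :* m)))) refl

          -- otherwise the test of x_o Σ_j A_oj x_j against the Kelner polynomial fails
          w≤LZ : w ≤ L * Z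
          w≤LZ = case ≤-split w (L * Z) of λ
            { (inj₁ p) → p
            ; (inj₂ p) → ⊥-elim (absurd p) }
            where
            absurd : L * Z < w → ⊥
            absurd LZ<w = <-irrefl refl (<-≤-trans LZ<w (≤-trans (cancel-≤ (m * m * w) (*->0 0<mm 0<w) w²≤) (*-monoʳ-≤-nonNeg Z {{nonNegative Z≥0}} (#-mono {36000 ℕ.* 67108864} {10000000000000} (ℕ.≤ᵇ⇒≤ (36000 ℕ.* 67108864) 10000000000000 _)))))
              where
              0<w : 0ℚ < w
              0<w = ≤-<-trans (*-≥0 (#≥0 10000000000000) Z≥0) LZ<w
              Z≤w : Z ≤ w
              Z≤w = ≤-trans (≤-by (*-≥0 (#≥0 9999999999999) Z≥0) (l Z)) (<⇒≤ LZ<w)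
                where
                l = solve 1 (λ Z → :# 10000000000000 :* Z := Z :+ :# 9999999999999 :* Z) refl
              s : ℚ
              s = ℤ.+ 1 / 8192 * (w * m)
              s≥0 : 0ℚ ≤ s
              s≥0 = *-≥0 (q≥0 1 8192) (*-≥0 w≥0 m≥0)
              -- For negative a₄ the triangle term must outweigh 2a₃ · `edges` ≤ 16Z; because w >
              -- LZ, half of its lower bound survives.
              s≤ : s ≤ ℤ.+ 1 / 4096 * (w * m) - # 16 * Z
              s≤ = ≤-by (+-≥0 (*-≥0 (*-≥0 (q≥0 1 8192) w≥0) (diff≥0 1≤m)) (+-≥0 (*-≥0 (q≥0 1 8192) (diff≥0 (<⇒≤ LZ<w))) (*-≥0 (q≥0 1220703109 1) Z≥0))) (l w m Z)
                where
                l = solve 3 (λ w m Z → con (ℤ.+ 1 / 4096) :* (w :* m) :- :# 16 :* Z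
                  := con (ℤ.+ 1 / 8192) :* (w :* m) :+ (con (ℤ.+ 1 / 8192) :* w :* (m :- con 1ℚ) :+ (con (ℤ.+ 1 / 8192) :* (w :- :# 10000000000000
                    :* Z) :+ (con (ℤ.+ 10000000000000 / 8192) :- :# 16) :* Z))) refl
              s² : sq s ≤ sq (# 2 * a₃ * edges + a₄ * T)
              s² = [ positive-case , negative-case ]′ a₄-v
                where
                edges≥0 : 0ℚ ≤ edges
                edges≥0 = ≤-trans (*-≥0 (q≥0 1 64) (*-≥0 m³≥0 m³≥0)) edges≥
                K : ℚ → ℚ
                K a = # 2 * a₃ * edges + a * T
                neg-≤ : ∀ {t} → 0ℚ ≤ t → - t ≤ s
                neg-≤ h = ≤-trans (neg-antimono-≤ h) s≥0
                neg-sq′ = solve 1 (λ a → (:- a) :* (:- a) := a :* a) refl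
                l₁ = solve 7 (λ a e v T w m Z → :# 2 :* a :* e :+ v :* T
                  := con (ℤ.+ 1 / 4096) :* (w :* m) :- :# 16 :* Z :+ (v :* T :- con (ℤ.+ 1 / 4096) :* (w :* m) :+ :# 2 :* (a :* e)
                    :+ :# 16 :* Z)) refl
                l₂ = solve 6 (λ a e v T w m → :# 2 :* a :* e :+ v :* T
                  := con 0ℚ :+ (v :* T :- con (ℤ.+ 1 / 4096) :* (w :* m) :+ :# 2 :* (a :* e) :+ con (ℤ.+ 1 / 4096) :* (w :* m))) refl
                l₃ = solve 7 (λ a e v T w m Z → :- (:# 2 :* a :* e :+ :- v :* T)
                  := con (ℤ.+ 1 / 4096) :* (w :* m) :- :# 16 :* Z :+ (v :* T :- con (ℤ.+ 1 / 4096) :* (w :* m) :+ :# 2 :* (:# 8 :* Z :- a :* e))) refl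
                positive-case : a₄ ≡ v → sq s ≤ sq (K a₄)
                positive-case e = ±-sq {s} {K a₄}
                  ( ≤-trans s≤ (≤-by (+-≥0 (+-≥0 (diff≥0 vT≥) (*-≥0 (#≥0 2) (*-≥0 a₃≥0 edges≥0))) (*-≥0 (#≥0 16) Z≥0)) (trans (cong K e) (l₁ a₃ edges v T w m Z)))
                  , neg-≤ (≤-by (+-≥0 (+-≥0 (diff≥0 vT≥) (*-≥0 (#≥0 2) (*-≥0 a₃≥0 edges≥0))) (*-≥0 (q≥0 1 4096) (*-≥0 w≥0 m≥0))) (trans (cong K e) (l₂ a₃ edges v T w m))))
                negative-case : a₄ ≡ - v → sq s ≤ sq (K a₄)
                negative-case e = subst (sq s ≤_) (trans (neg-sq′ (K (- v))) (cong (λ t → sq (K t)) (sym e))) (±-sq {s} { - K (- v)}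
                  ( ≤-trans s≤ below , neg-≤ (≤-trans (≤-trans s≥0 s≤) below)))
                  where
                  below : ℤ.+ 1 / 4096 * (w * m) - # 16 * Z ≤ - K (- v)
                  below = ≤-by (+-≥0 (diff≥0 vT≥) (*-≥0 (#≥0 2) (diff≥0 a₃edges≤))) (l₃ a₃ edges v T w m Z)
              w²≤ : m * m * w * w ≤ m * m * w * (# 2415919104000 * Z)
              w²≤ = ≤-trans (≤-eq (l₁ m w)) (≤-trans (*-monoˡ (# 67108864) (#≥0 67108864) (≤-trans s² (≤-trans kelner-link (≤-trans (*-monoˡ (a₂ * D + a₃ * edges) link≥0 g≤′) (*-mono link≥0 (*-≥0 (*-≥0 (#≥0 1000) mm≥0) (*-≥0 (#≥0 3) w≥0)) link≤ (*-monoˡ (# 1000 * (m * m)) (*-≥0 (#≥0 1000) mm≥0) (≤-trans (+-monoˡ-≤ w (*-monoˡ (# 2) (#≥0 2) Z≤w)) (≤-eq (l₂ w)))))))))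
                  (≤-eq (l₃ m w Z)))
                where
                link≥0 : 0ℚ ≤ a₂ * D + a₃ * edges
                link≥0 = +-≥0 (*-≥0 a₂≥0 D≥0) (*-≥0 a₃≥0 (≤-trans (*-≥0 (q≥0 1 64) (*-≥0 m³≥0 m³≥0)) edges≥))
                l₁ = solve 2 (λ m w → m :* m :* w :* w := :# 67108864 :* (con (ℤ.+ 1 / 8192) :* (w :* m) :* (con (ℤ.+ 1 / 8192) :* (w :* m)))) refl
                l₂ = solve 1 (λ w → :# 2 :* w :+ w := :# 3 :* w) refl
                l₃ = solve 3 (λ m w Z → :# 67108864 :* (:# 12 :* Z :* (:# 1000 :* (m :* m) :* (:# 3 :* w)))
                  := m :* m :* w :* (:# 2415919104000 :* Z)) refl

          -- The Kelner test with w ≤ LZ gives Z² ≤ CxZ, and x³ ≤ Z turns this into a bound on x².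
          -- The constant C = 4096 · 1000 · (10¹³ + 2) is rounded up to the square 10²⁰.
          x²≤ : sq x ≤ # 100000000000000000000
          x²≤ = ≤-trans (cancel-≤ x 0<x (≤-trans x³≤Z (cancel-≤ Z 0<Z (≤-trans Z²≤ (≤-by (*-≥0 (#≥0 59039999999991808000) (*-≥0 x≥0 Z≥0)) (l₀ x Z)))))) ≤-refl
            where
            l₀ = solve 2 (λ x Z → Z :* (x :* :# 100000000000000000000)
              := :# 40960000000008192000 :* (x :* Z) :+ :# 59039999999991808000 :* (x :* Z)) refl
            Z²≤ : Z * Z ≤ # 40960000000008192000 * (x * Z)
            Z²≤ = ≤-trans (≤-eq (l₁ Z)) (≤-trans (*-monoˡ (# 4096) (#≥0 4096) (≤-trans (*-mono (*-≥0 (q≥0 1 64) Z≥0) (≤-trans (*-≥0 (q≥0 1 64) Z≥0) a₃edges≥) a₃edges≥ a₃edges≥) (≤-trans kelner (≤-trans (*-monoˡ a₁ a₁≥0 (≤-trans g≤′ (*-monoˡ (# 1000 * (m * m)) (*-≥0 (#≥0 1000) mm≥0) (+-monoʳ-≤ (# 2 * Z) w≤LZ)))) (≤-eq (l₂ a₁ m Z))))))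
              (≤-by (*-≥0 (#≥0 0) (*-≥0 x≥0 Z≥0)) (l₃ x Z)))
              where
              a₁≥0 : 0ℚ ≤ a₁
              a₁≥0 = unscale (m * m) 0<mm x≥0
              l₁ = solve 1 (λ Z → Z :* Z := :# 4096 :* (con (ℤ.+ 1 / 64) :* Z :* (con (ℤ.+ 1 / 64) :* Z))) refl
              l₂ = solve 3 (λ a m Z → a :* (:# 1000 :* (m :* m) :* (:# 2 :* Z :+ :# 10000000000000 :* Z))
                := :# 10000000000002000 :* (a :* (m :* m) :* Z)) refl
              l₃ = solve 2 (λ x Z → :# 40960000000008192000 :* (x :* Z) := :# 4096 :* (:# 10000000000002000 :* (x :* Z)) :+ :# 0 :* (x :* Z)) refl

          x≤ : x ≤ # 10000000000
          x≤ = sq-≤⇒≤ (#≥0 10000000000) (≤-trans x²≤ (≤-eq refl))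

-- The prime field and the Paley graph

module Modular (q : ℕ) where
  p : ℕ
  p = suc q

  infix 4 _~_
  infixr 4 _,~_
  -- Congruence modulo p with an explicit quotient, so that each compatibility law is a polynomial
  -- identity over ℤ.
  record _~_ (a b : ℤ) : Set where
    constructor _,~_
    field
      factor : ℤ
      equation : a ≡ b ℤ.+ factor ℤ.* ℤ.+ p

  lift : Fin p → ℤ
  lift x = ℤ.+ toℕ x

  red : ℤ → Fin p
  red a = Fin.fromℕ< (n%ℕd<d a p)

  lift-red : ∀ a → a ~ lift (red a)
  lift-red a = a /ℕ p ,~ trans (a≡a%ℕn+[a/ℕn]*n a p) (cong (λ t → ℤ.+ t ℤ.+ (a /ℕ p) ℤ.* ℤ.+ p) (sym (toℕ-fromℕ< (n%ℕd<d a p))))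

  ~-sym : ∀ {a b} → a ~ b → b ~ a
  ~-sym {a} {b} (k ,~ e) = ℤ.- k ,~ trans (l b k (ℤ.+ p)) (cong (λ t → t ℤ.+ (ℤ.- k) ℤ.* ℤ.+ p) (sym e))
    where
    l : ∀ b k p → b ≡ b ℤ.+ k ℤ.* p ℤ.+ (ℤ.- k) ℤ.* p
    l = ℤSolver.solve-∀

  ~-trans : ∀ {a b c} → a ~ b → b ~ c → a ~ c
  ~-trans {c = c} (k ,~ refl) (l ,~ refl) = l ℤ.+ k ,~ eq c l k (ℤ.+ p)
    where
    eq : ∀ c l k p → c ℤ.+ l ℤ.* p ℤ.+ k ℤ.* p ≡ c ℤ.+ (l ℤ.+ k) ℤ.* p
    eq = ℤSolver.solve-∀

  ~-+ : ∀ {a b c d} → a ~ b → c ~ d → a ℤ.+ c ~ b ℤ.+ d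
  ~-+ {b = b} {d = d} (k ,~ refl) (l ,~ refl) = k ℤ.+ l ,~ eq b d k l (ℤ.+ p)
    where
    eq : ∀ b d k l p → b ℤ.+ k ℤ.* p ℤ.+ (d ℤ.+ l ℤ.* p) ≡ b ℤ.+ d ℤ.+ (k ℤ.+ l) ℤ.* p
    eq = ℤSolver.solve-∀

  ~-* : ∀ {a b c d} → a ~ b → c ~ d → a ℤ.* c ~ b ℤ.* d
  ~-* {b = b} {d = d} (k ,~ refl) (l ,~ refl) = b ℤ.* l ℤ.+ k ℤ.* d ℤ.+ k ℤ.* l ℤ.* ℤ.+ p ,~ eq b d k l (ℤ.+ p)
    where
    eq : ∀ b d k l p → (b ℤ.+ k ℤ.* p) ℤ.* (d ℤ.+ l ℤ.* p) ≡ b ℤ.* d ℤ.+ (b ℤ.* l ℤ.+ k ℤ.* d ℤ.+ k ℤ.* l ℤ.* p) ℤ.* p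
    eq = ℤSolver.solve-∀

  ~-neg : ∀ {a b} → a ~ b → ℤ.- a ~ ℤ.- b
  ~-neg {b = b} (k ,~ refl) = ℤ.- k ,~ eq b k (ℤ.+ p)
    where
    eq : ∀ b k p → ℤ.- (b ℤ.+ k ℤ.* p) ≡ ℤ.- b ℤ.+ (ℤ.- k) ℤ.* p
    eq = ℤSolver.solve-∀

  private
    small : ∀ a b k → a ℕ.< p → ℤ.+ a ≡ ℤ.+ b ℤ.+ ℤ.+ suc k ℤ.* ℤ.+ p → ⊥
    small a b k a<p e = ℕ.<-irrefl refl (ℕ.<-≤-trans a<p (ℕ.≤-trans (ℕ.m≤m+n p (k ℕ.* p)) (ℕ.≤-trans (ℕ.m≤n+m (suc k ℕ.* p) b)
      (ℕ.≤-reflexive (sym (ℤ.+-injective (trans e (trans (cong (λ t → ℤ.+ b ℤ.+ t) (sym (ℤ.pos-* (suc k) p))) (sym (ℤ.pos-+ b (suc k ℕ.* p)))))))))))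

  lift-injective : ∀ {x y} → lift x ~ lift y → x ≡ y
  lift-injective {x} {y} (ℤ.+ zero ,~ e) = toℕ-injective (ℤ.+-injective (trans e (ℤ.+-identityʳ (lift y))))
  lift-injective {x} {y} (ℤ.+ suc k ,~ e) = ⊥-elim (small (toℕ x) (toℕ y) k (toℕ<n x) e)
  lift-injective {x} {y} (ℤ.-[1+ k ] ,~ e) = ⊥-elim (small (toℕ y) (toℕ x) k (toℕ<n y) (_~_.equation (~-sym {lift x} {lift y} (ℤ.-[1+ k ] ,~ e))))

  red-cong : ∀ {a b} → a ~ b → red a ≡ red b
  red-cong {a} {b} h = lift-injective (~-trans (~-sym (lift-red a)) (~-trans h (lift-red b)))

  red-~ : ∀ {a b} → red a ≡ red b → a ~ b
  red-~ {a} {b} h = ~-trans (lift-red a) (~-trans (0ℤ-refl (cong lift h)) (~-sym (lift-red b)))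
    where
    0ℤ-refl : ∀ {a b} → a ≡ b → a ~ b
    0ℤ-refl {a} refl = ℤ.+ 0 ,~ sym (ℤ.+-identityʳ a)

  red-lift : ∀ x → red (lift x) ≡ x
  red-lift x = lift-injective (~-sym (lift-red (lift x)))

  infixl 6 _⊕_
  infixl 7 _⊗_
  infix 8 ⊖_
  abstract
    _⊕_ _⊗_ : Fin p → Fin p → Fin p
    x ⊕ y = red (lift x ℤ.+ lift y)
    x ⊗ y = red (lift x ℤ.* lift y)
    ⊖_ : Fin p → Fin p
    ⊖ x = red (ℤ.- lift x)

    red-+ : ∀ a b → red (a ℤ.+ b) ≡ red a ⊕ red b
    red-+ a b = red-cong (~-+ (lift-red a) (lift-red b))
    red-* : ∀ a b → red (a ℤ.* b) ≡ red a ⊗ red b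
    red-* a b = red-cong (~-* (lift-red a) (lift-red b))
    red-neg : ∀ a → red (ℤ.- a) ≡ ⊖ red a
    red-neg a = red-cong (~-neg (lift-red a))

  𝟘 𝟙 : Fin p
  𝟘 = red (ℤ.+ 0)
  𝟙 = red (ℤ.+ 1)

  private
    view : ∀ x → ∃ λ a → x ≡ red a
    view x = lift x , sym (red-lift x)

    ⊕-assoc : ∀ x y z → (x ⊕ y) ⊕ z ≡ x ⊕ (y ⊕ z)
    ⊕-assoc x y z with view x | view y | view z
    ... | a , refl | b , refl | c , refl = trans (cong (_⊕ red c) (sym (red-+ a b))) (trans (sym (red-+ (a ℤ.+ b) c)) (trans (cong red (ℤ.+-assoc a b c)) (trans (red-+ a (b ℤ.+ c)) (cong (red a ⊕_) (red-+ b c)))))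
    ⊗-assoc : ∀ x y z → (x ⊗ y) ⊗ z ≡ x ⊗ (y ⊗ z)
    ⊗-assoc x y z with view x | view y | view z
    ... | a , refl | b , refl | c , refl = trans (cong (_⊗ red c) (sym (red-* a b))) (trans (sym (red-* (a ℤ.* b) c)) (trans (cong red (ℤ.*-assoc a b c)) (trans (red-* a (b ℤ.* c)) (cong (red a ⊗_) (red-* b c)))))
    ⊕-comm : ∀ x y → x ⊕ y ≡ y ⊕ x
    ⊕-comm x y with view x | view y
    ... | a , refl | b , refl = trans (sym (red-+ a b)) (trans (cong red (ℤ.+-comm a b)) (red-+ b a))
    ⊗-comm : ∀ x y → x ⊗ y ≡ y ⊗ x
    ⊗-comm x y with view x | view y
    ... | a , refl | b , refl = trans (sym (red-* a b)) (trans (cong red (ℤ.*-comm a b)) (red-* b a))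
    ⊕-identityˡ : ∀ x → 𝟘 ⊕ x ≡ x
    ⊕-identityˡ x with view x
    ... | a , refl = trans (sym (red-+ (ℤ.+ 0) a)) (cong red (ℤ.+-identityˡ a))
    ⊗-identityˡ : ∀ x → 𝟙 ⊗ x ≡ x
    ⊗-identityˡ x with view x
    ... | a , refl = trans (sym (red-* (ℤ.+ 1) a)) (cong red (ℤ.*-identityˡ a))
    ⊕-inverseʳ : ∀ x → x ⊕ ⊖ x ≡ 𝟘
    ⊕-inverseʳ x with view x
    ... | a , refl = trans (cong (red a ⊕_) (sym (red-neg a))) (trans (sym (red-+ a (ℤ.- a))) (cong red (ℤ.+-inverseʳ a)))
    distribˡ : ∀ x y z → x ⊗ (y ⊕ z) ≡ x ⊗ y ⊕ x ⊗ z
    distribˡ x y z with view x | view y | view z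
    ... | a , refl | b , refl | c , refl = trans (cong (red a ⊗_) (sym (red-+ b c))) (trans (sym (red-* a (b ℤ.+ c))) (trans (cong red (ℤ.*-distribˡ-+ a b c)) (trans (red-+ (a ℤ.* b) (a ℤ.* c)) (cong₂ _⊕_ (red-* a b) (red-* a c)))))

  isCommutativeRing : IsCommutativeRing _≡_ _⊕_ _⊗_ ⊖_ 𝟘 𝟙
  isCommutativeRing = record
    { isRing = record
      { +-isAbelianGroup = record
        { isGroup = record
          { isMonoid = record
            { isSemigroup = record { isMagma = record { isEquivalence = isEquivalence ; ∙-cong = cong₂ _⊕_ } ; assoc = ⊕-assoc }
            ; identity = ⊕-identityˡ , λ x → trans (⊕-comm x 𝟘) (⊕-identityˡ x) }
          ; inverse = (λ x → trans (⊕-comm (⊖ x) x) (⊕-inverseʳ x)) , ⊕-inverseʳ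
          ; ⁻¹-cong = cong ⊖_ }
        ; comm = ⊕-comm }
      ; *-cong = cong₂ _⊗_
      ; *-assoc = ⊗-assoc
      ; *-identity = ⊗-identityˡ , λ x → trans (⊗-comm x 𝟙) (⊗-identityˡ x)
      ; distrib = distribˡ , λ x y z → trans (⊗-comm (y ⊕ z) x) (trans (distribˡ x y z) (cong₂ _⊕_ (⊗-comm x y) (⊗-comm x z))) }
    ; *-comm = ⊗-comm }

module PrimeField (q : ℕ) (isPrime : Prime (suc q)) (2<p : 2 ℕ.< suc q) where
  open Modular q

  private
    red-≢ : ∀ k → 0 ℕ.< k → k ℕ.< p → red (ℤ.+ k) ≢ 𝟘
    red-≢ k 0<k k<p e with red-~ {ℤ.+ k} {ℤ.+ 0} e
    ... | ℤ.+ zero ,~ h = ℕ.<-irrefl (sym (ℤ.+-injective h)) 0<k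
    ... | ℤ.+ suc j ,~ h = ℕ.<-irrefl refl (ℕ.<-≤-trans k<p (ℕ.≤-trans (ℕ.m≤m+n p (j ℕ.* p)) (ℕ.≤-reflexive (sym (ℤ.+-injective (trans h (trans (ℤ.+-identityˡ _) (sym (ℤ.pos-* (suc j) p)))))))))
    ... | ℤ.-[1+ j ] ,~ h = ℤ-neg k j h
      where
      ℤ-neg : ∀ k j → ℤ.+ k ≡ ℤ.+ 0 ℤ.+ ℤ.-[1+ j ] ℤ.* ℤ.+ p → ⊥
      ℤ-neg k j h = case trans h (ℤ.+-identityˡ (ℤ.-[1+ j ] ℤ.* ℤ.+ p)) of λ ()

    𝟙≢𝟘 : 𝟙 ≢ 𝟘
    𝟙≢𝟘 = red-≢ 1 (ℕ.s≤s ℕ.z≤n) (ℕ.<-trans (ℕ.s≤s (ℕ.s≤s ℕ.z≤n)) 2<p)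

    -- The inverse is a Bézout coefficient of the residue and p; the two shapes of the identity over
    -- ℕ differ in sign, whence the negated coefficient in one of them.
    inverse : ∀ x → x ≢ 𝟘 → ∃ λ y → x ⊗ y ≡ 𝟙
    inverse x x≢ with toℕ x in eq
    ... | zero = ⊥-elim (x≢ (trans (sym (red-lift x)) (cong (λ t → red (ℤ.+ t)) eq)))
    ... | suc m with coprime-Bézout (prime⇒coprime isPrime (subst (ℕ._< p) eq (toℕ<n x)))
    ... | Bézout.+- a b h = red (ℤ.- ℤ.+ b) , trans (cong (_⊗ red (ℤ.- ℤ.+ b)) (sym (red-lift x))) (trans (sym (red-* (lift x) (ℤ.- ℤ.+ b))) (red-cong {b = ℤ.+ 1} (ℤ.- ℤ.+ a ,~ eqℤ)))
      where
      hℤ : ℤ.+ 1 ℤ.+ ℤ.+ b ℤ.* ℤ.+ suc m ≡ ℤ.+ a ℤ.* ℤ.+ p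
      hℤ = trans (cong (λ t → ℤ.+ 1 ℤ.+ t) (sym (ℤ.pos-* b (suc m)))) (trans (cong ℤ.+_ h) (ℤ.pos-* a p))
      l : ∀ m b ap → ℤ.+ 1 ℤ.+ b ℤ.* m ≡ ap → m ℤ.* (ℤ.- b) ≡ ℤ.+ 1 ℤ.+ (ℤ.- ap)
      l m b .(ℤ.+ 1 ℤ.+ b ℤ.* m) refl = s m b
        where
        s : ∀ m b → m ℤ.* (ℤ.- b) ≡ ℤ.+ 1 ℤ.+ (ℤ.- (ℤ.+ 1 ℤ.+ b ℤ.* m))
        s = ℤSolver.solve-∀
      eqℤ : lift x ℤ.* (ℤ.- ℤ.+ b) ≡ ℤ.+ 1 ℤ.+ (ℤ.- ℤ.+ a) ℤ.* ℤ.+ p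
      eqℤ = trans (cong (λ t → ℤ.+ t ℤ.* (ℤ.- ℤ.+ b)) eq) (trans (l (ℤ.+ suc m) (ℤ.+ b) (ℤ.+ a ℤ.* ℤ.+ p) hℤ) (cong (λ t → ℤ.+ 1 ℤ.+ t) (ℤ.neg-distribˡ-* (ℤ.+ a) (ℤ.+ p))))
    ... | Bézout.-+ a b h = red (ℤ.+ b) , trans (cong (_⊗ red (ℤ.+ b)) (sym (red-lift x))) (trans (sym (red-* (lift x) (ℤ.+ b))) (red-cong {b = ℤ.+ 1} (ℤ.+ a ,~ eqℤ)))
      where
      eqℤ : lift x ℤ.* ℤ.+ b ≡ ℤ.+ 1 ℤ.+ ℤ.+ a ℤ.* ℤ.+ p
      eqℤ = trans (cong (λ t → ℤ.+ t ℤ.* ℤ.+ b) eq) (trans (ℤ.*-comm (ℤ.+ suc m) (ℤ.+ b)) (trans (sym (ℤ.pos-* b (suc m))) (trans (cong ℤ.+_ (sym h)) (cong (λ t → ℤ.+ 1 ℤ.+ t) (ℤ.pos-* a p)))))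

    inv : Fin p → Fin p
    inv x with x ≟ 𝟘
    ... | yes _ = 𝟘
    ... | no x≢ = proj₁ (inverse x x≢)

    inv-𝟘 : inv 𝟘 ≡ 𝟘
    inv-𝟘 with 𝟘 ≟ 𝟘
    ... | yes _ = refl
    ... | no ne = ⊥-elim (ne refl)

    ⊗-inv : ∀ x → x ≢ 𝟘 → x ⊗ inv x ≡ 𝟙
    ⊗-inv x x≢ with x ≟ 𝟘
    ... | yes e = ⊥-elim (x≢ e)
    ... | no ne = proj₂ (inverse x ne)

  field′ : OddField p
  field′ = record
    { _⊕_ = _⊕_ ; _⊗_ = _⊗_ ; ⊖_ = ⊖_ ; inv = inv ; 𝟘 = 𝟘 ; 𝟙 = 𝟙 ; isCommutativeRing = isCommutativeRing
    ; fromℤ = red ; fromℤ-+ = red-+ ; fromℤ-* = red-* ; fromℤ-neg = red-neg ; fromℤ-0 = refl ; fromℤ-1 = refl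
    ; inv-𝟘 = inv-𝟘 ; ⊗-inv = ⊗-inv ; 𝟙≢𝟘 = 𝟙≢𝟘
    ; 𝟙⊕𝟙≢𝟘 = λ e → red-≢ 2 (ℕ.s≤s ℕ.z≤n) 2<p (trans (red-+ (ℤ.+ 1) (ℤ.+ 1)) e) }

  open Field field′ using (IsSquare; χ; χ-square; χ-nonsquare; isSquare?; ⊝-≢𝟘; _⊝_)

  private
    any-allFin : ∀ {n} (f : Fin n → Bool) x → f x ≡ true → any f (allFin n) ≡ true
    any-allFin f x = go f (λ y → y) x
      where
      go : ∀ {m n} (f : Fin m → Bool) (g : Fin n → Fin m) x → f (g x) ≡ true → any f (tabulate g) ≡ true
      go f g zero h rewrite h = refl
      go f g (suc x) h rewrite go f (λ y → g (suc y)) x h with f (g zero)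
      ... | true = refl
      ... | false = refl

    allFin-any : ∀ {n} (f : Fin n → Bool) → any f (allFin n) ≡ true → ∃ λ x → f x ≡ true
    allFin-any f = go f (λ y → y)
      where
      go : ∀ {m n} (f : Fin m → Bool) (g : Fin n → Fin m) → any f (tabulate g) ≡ true → ∃ λ x → f x ≡ true
      go {n = suc n} f g h with f (g zero) in eq
      ... | true = g zero , eq
      ... | false = go f (λ y → g (suc y)) h

    ≡ᵇ-true : ∀ {a b} → a ≡ b → (a ℕ.≡ᵇ b) ≡ true
    ≡ᵇ-true {zero} refl = refl
    ≡ᵇ-true {suc a} refl = ≡ᵇ-true {a} refl

    true-≡ᵇ : ∀ {a b} → (a ℕ.≡ᵇ b) ≡ true → a ≡ b
    true-≡ᵇ {a} {b} h = ℕ.≡ᵇ⇒≡ a b (subst 𝔹.T (sym h) _)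

    toℕ-red : ∀ k → toℕ (red (ℤ.+ k)) ≡ modN k p
    toℕ-red k = toℕ-fromℕ< (n%ℕd<d (ℤ.+ k) p)

    -- `paley` adds p - b to stay within the natural numbers; modulo p this is the difference a - b.
    difference : ∀ a b → a ⊝ b ≡ red (ℤ.+ (toℕ a ℕ.+ (p ℕ.∸ toℕ b)))
    difference a b = trans (cong₂ _⊕_ (sym (red-lift a)) (trans (cong ⊖_ (sym (red-lift b))) (sym (red-neg (lift b))))) (trans (sym (red-+ (lift a) (ℤ.- lift b))) (red-cong (~-sym {b = lift a ℤ.+ (ℤ.- lift b)} (ℤ.+ 1 ,~ eq))))
      where
      eq : ℤ.+ (toℕ a ℕ.+ (p ℕ.∸ toℕ b)) ≡ lift a ℤ.+ (ℤ.- lift b) ℤ.+ ℤ.+ 1 ℤ.* ℤ.+ p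
      eq = trans (ℤ.pos-+ (toℕ a) (p ℕ.∸ toℕ b)) (trans (cong (λ t → lift a ℤ.+ t) (trans (sym (ℤ.⊖-≥ (ℕ.<⇒≤ (toℕ<n b)))) (sym (ℤ.m-n≡m⊖n p (toℕ b))))) (l (lift a) (lift b) (ℤ.+ p)))
        where
        l : ∀ a b p → a ℤ.+ (p ℤ.- b) ≡ a ℤ.+ (ℤ.- b) ℤ.+ ℤ.+ 1 ℤ.* p
        l = ℤSolver.solve-∀

    square-red : ∀ x → x ⊗ x ≡ red (ℤ.+ (toℕ x ℕ.* toℕ x))
    square-red x = trans (cong₂ _⊗_ (sym (red-lift x)) (sym (red-lift x))) (trans (sym (red-* (lift x) (lift x))) (cong red (sym (ℤ.pos-* (toℕ x) (toℕ x)))))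

    squareMod : ∀ a b → IsSquare (a ⊝ b) → isSquareMod p (toℕ a ℕ.+ (p ℕ.∸ toℕ b)) ≡ true
    squareMod a b (x , e) = any-allFin _ x (≡ᵇ-true (trans (sym (toℕ-red (toℕ x ℕ.* toℕ x))) (trans (cong toℕ (trans (sym (square-red x)) (trans e (difference a b)))) (toℕ-red (toℕ a ℕ.+ (p ℕ.∸ toℕ b))))))

    squareMod⁻¹ : ∀ a b → isSquareMod p (toℕ a ℕ.+ (p ℕ.∸ toℕ b)) ≡ true → IsSquare (a ⊝ b)
    squareMod⁻¹ a b h with allFin-any (λ x → modN (toℕ x ℕ.* toℕ x) p ℕ.≡ᵇ modN (toℕ a ℕ.+ (p ℕ.∸ toℕ b)) p) h
    ... | x , e = x , trans (square-red x) (trans (toℕ-injective (trans (toℕ-red (toℕ x ℕ.* toℕ x)) (trans (true-≡ᵇ e) (sym (toℕ-red (toℕ a ℕ.+ (p ℕ.∸ toℕ b))))))) (sym (difference a b)))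

  module _ (χ-⊖𝟙 : χ (⊖ 𝟙) ≡ 1ℚ) where
    open Edges field′ χ-⊖𝟙 using (A₂; A₂-diag; A₂-sym; S; S-diag)

    private
      paley-square : ∀ {a b} → a ≢ b → IsSquare (a ⊝ b) → paley p a b ≡ true
      paley-square {a} {b} ne s rewrite ≡ᵇ-≢ ne = squareMod a b s

      paley-nonsquare : ∀ {a b} → a ≢ b → ¬ IsSquare (a ⊝ b) → paley p a b ≡ false
      paley-nonsquare {a} {b} ne ns rewrite ≡ᵇ-≢ ne with isSquareMod p (toℕ a ℕ.+ (p ℕ.∸ toℕ b)) in eq
      ... | false = refl
      ... | true = ⊥-elim (ns (squareMod⁻¹ a b eq))

    paley-A₂-≢ : ∀ {a b} → a ≢ b → (if paley p a b then 1ℚ else 0ℚ) ≡ ½ * A₂ a b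
    paley-A₂-≢ {a} {b} ne = case isSquare? (a ⊝ b) of λ
      { (yes s) → trans (cong (λ t → if t then 1ℚ else 0ℚ) (paley-square ne s)) (sym (cong₂ (λ d x → ½ * (1ℚ - d + x)) (δ-≢ ne) (χ-square (⊝-≢𝟘 ne) s)))
      ; (no ns) → trans (cong (λ t → if t then 1ℚ else 0ℚ) (paley-nonsquare ne ns)) (sym (cong₂ (λ d x → ½ * (1ℚ - d + x)) (δ-≢ ne) (χ-nonsquare ns))) }

    paley-A₂ : ∀ a b → (if does (a ≟ b) then 0ℚ else (if paley p a b then 1ℚ else 0ℚ)) ≡ ½ * A₂ a b
    paley-A₂ a b = by-cases (a ≟ b)
      where
      by-cases : (d : Dec (a ≡ b)) → (if does d then 0ℚ else (if paley p a b then 1ℚ else 0ℚ)) ≡ ½ * A₂ a b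
      by-cases (yes refl) = sym (cong (½ *_) (A₂-diag a))
      by-cases (no ne) = paley-A₂-≢ ne

    paley-sym : ∀ a b → paley p a b ≡ paley p b a
    paley-sym a b = case a ≟ b of λ
      { (yes refl) → refl
      ; (no ne) → inj (paley p a b) (paley p b a) (trans (paley-A₂-≢ ne) (trans (cong (½ *_) (A₂-sym a b)) (sym (paley-A₂-≢ λ e → ne (sym e))))) }
      where
      inj : ∀ x y → (if x then 1ℚ else 0ℚ) ≡ (if y then 1ℚ else 0ℚ) → x ≡ y
      inj true true _ = refl
      inj false false _ = refl
      inj true false ()
      inj false true ()

-- Choice of the scale and conclusion

cube-root : ∀ p → ∃ λ m → (m ℕ.* m ℕ.* m ℕ.≤ p) × (p ℕ.< suc m ℕ.* suc m ℕ.* suc m)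
cube-root zero = 0 , ℕ.z≤n , ℕ.s≤s ℕ.z≤n
cube-root (suc p) with cube-root p
... | m , lo , hi with suc p ℕ.<? suc m ℕ.* suc m ℕ.* suc m
... | yes h = m , ℕ.m≤n⇒m≤1+n lo , h
... | no h = suc m , ℕ.≮⇒≥ h , ℕ.≤-<-trans hi (ℕ.*-mono-< (ℕ.*-mono-< (ℕ.n<1+n (suc m)) (ℕ.n<1+n (suc m))) (ℕ.n<1+n (suc m)))

module Paley (q : ℕ) (isPrime : Prime (suc q)) (p%4≡1 : suc q % 4 ≡ 1) (large : 2097152 ℕ.≤ suc q) where
  private
    p : ℕ
    p = suc q
    N : ℚ
    N = # p

    open PrimeField q isPrime (ℕ.≤-trans (ℕ.≤ᵇ⇒≤ 3 2097152 _) large)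

    -1-square : Field.χ field′ (OddField.⊖_ field′ (OddField.𝟙 field′)) ≡ 1ℚ
    -1-square = χ-⊖𝟙 field′ (p ℕ./ 4) (trans (m≡m%n+[m/n]*n p 4) (cong₂ ℕ._+_ p%4≡1 (ℕ.*-comm (p ℕ./ 4) 4)))

    root : ∃ λ m → (m ℕ.* m ℕ.* m ℕ.≤ p) × (p ℕ.< suc m ℕ.* suc m ℕ.* suc m)
    root = cube-root p

    k : ℕ
    k = proj₁ root

    128≤k : 128 ℕ.≤ k
    -- A root below 128 would give p < 128³ = 2097152.
    128≤k = case 128 ℕ.≤? k of λ
      { (yes h) → h
      ; (no h) → ⊥-elim (ℕ.<-irrefl refl (ℕ.<-≤-trans (proj₂ (proj₂ root)) (ℕ.≤-trans (ℕ.*-mono-≤ (ℕ.*-mono-≤ (ℕ.≰⇒> h) (ℕ.≰⇒> h)) (ℕ.≰⇒> h)) large))) }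

    m : ℚ
    m = # k

    128≤m : # 128 ≤ m
    128≤m = #-mono 128≤k

    m³≤N : m * m * m ≤ N
    m³≤N = ≤-trans (≤-eq (trans (cong (_* m) (sym (#-* k k))) (sym (#-* (k ℕ.* k) k)))) (#-mono (proj₁ (proj₂ root)))

    N≤8m³ : N ≤ # 8 * (m * m * m)
    N≤8m³ = ≤-trans (#-mono (ℕ.<⇒≤ (proj₂ (proj₂ root)))) (≤-trans (≤-eq (trans (#-* (suc k ℕ.* suc k) (suc k)) (cong (_* # suc k) (#-* (suc k) (suc k)))))
      (≤-trans (*-mono (*-≥0 (#≥0 (suc k)) (#≥0 (suc k))) (+-≥0 (#≥0 k) (#≥0 k)) (*-mono (#≥0 (suc k)) (+-≥0 (#≥0 k) (#≥0 k)) double double) double) (≤-eq (l m))))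
      where
      double : # suc k ≤ m + m
      double = ≤-trans (≤-eq (#-+ 1 k)) (+-monoˡ-≤ m (#-mono (ℕ.≤-trans (ℕ.s≤s ℕ.z≤n) 128≤k)))
      l = solve 1 (λ m → (m :+ m) :* (m :+ m) :* (m :+ m) := :# 8 :* (m :* m :* m)) refl

    κ ρ y : ℚ
    κ = # 3 * (m * m)
    ρ = # 88 * (m * m * (m * m))
    y = # 128 * (m * m * (m * m) * (m * m * (m * m)))

    open Arithmetic m N κ ρ y 128≤m m³≤N N≤8m³ refl refl refl

    N≤κ² : N ≤ sq κ
    N≤κ² = ≤-trans N≤8m³ (≤-by (+-≥0 (*-≥0 (#≥0 8) (*-≥0 m³≥0 (diff≥0 1≤m))) (*-≥0 mm≥0 mm≥0)) (l m))
      where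
      l = solve 1 (λ m → :# 3 :* (m :* m) :* (:# 3 :* (m :* m))
        := :# 8 :* (m :* m :* m) :+ (:# 8 :* (m :* m :* m :* (m :- con 1ℚ)) :+ m :* m :* (m :* m))) refl

    2≤N : # 2 ≤ N
    2≤N = #-mono (ℕ.≤-trans (ℕ.≤ᵇ⇒≤ 2 2097152 _) large)

    R-bound : ∀ f → (∀ i → f i i ≡ 0ℚ) → sq (Edges.R-form field′ -1-square f) ≤ sq (ρ * ‖ f ‖²₂)
    R-bound f f0 = ≤-trans (Edges.R-form-bound field′ -1-square 2≤N z z≥0 hz f f0) (≤-trans (*-monoʳ-≤-nonNeg (sq ‖ f ‖²₂) {{nonNegative (sq≥0 ‖ f ‖²₂)}} constant) (≤-eq (l ρ ‖ f ‖²₂)))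
      where
      l = solve 2 (λ r x → r :* r :* (x :* x) := r :* x :* (r :* x)) refl
      z : ℚ
      -- 7100² slightly exceeds 1538 · 8⁵ = 50397184, and 7100 + 10 · 64 stays below 88² = 7744.
      z = # 7100 * pow 8
      z≥0 : 0ℚ ≤ z
      z≥0 = *-≥0 (#≥0 7100) (pow≥0 8)
      constant : z + # 10 * (N * N) ≤ sq ρ
      constant = ≤-trans (+-monoʳ-≤ z (≤-trans (*-monoˡ (# 10) (#≥0 10) N²) (*-monoˡ (# 10) (#≥0 10) (*-monoˡ (# 64) (#≥0 64) (pow-mono {6} {8} (ℕ.≤′-step (ℕ.≤′-step ℕ.≤′-refl)))))))
        (≤-by (*-≥0 (#≥0 4) (pow≥0 8)) (l′ m))
        where
        l′ = solve 1 (λ m → :# 88 :* (m :* m :* (m :* m)) :* (:# 88 :* (m :* m :* (m :* m)))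
          := :# 7100 :* (m :* (m :* (m :* (m :* (m :* (m :* (m :* (m :* con 1ℚ)))))))) :+ :# 10 :* (:# 64 :* (m :* (m :* (m :* (m
            :* (m :* (m :* (m :* (m :* con 1ℚ))))))))) :+ :# 4 :* (m :* (m :* (m :* (m :* (m :* (m :* (m :* (m :* con 1ℚ))))))))) refl
      hz : # 1538 * (N * N * N * N * N) ≤ sq z
      hz = ≤-trans (*-monoˡ (# 1538) (#≥0 1538) (≤-trans (≤-eq (l₁ N)) (*-mono NN²≥0 8m³≥0 (*-mono NN≥0 64≥0 N² N²) N≤8m³)))
        (≤-trans (≤-eq (l₂ m)) (≤-trans (*-monoˡ (# 50397184) (#≥0 50397184) (pow-suc 15)) (≤-by (*-≥0 (#≥0 12816) (pow≥0 16)) (l₃ m))))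
        where
        64≥0 : 0ℚ ≤ # 64 * pow 6
        64≥0 = *-≥0 (#≥0 64) (pow≥0 6)
        8m³≥0 : 0ℚ ≤ # 8 * (m * m * m)
        8m³≥0 = *-≥0 (#≥0 8) m³≥0
        NN²≥0 : 0ℚ ≤ N * N * (N * N)
        NN²≥0 = *-≥0 NN≥0 NN≥0
        l₁ = solve 1 (λ N → N :* N :* N :* N :* N := N :* N :* (N :* N) :* N) refl
        l₂ = solve 1 (λ m → :# 1538 :* (:# 64 :* (m :* (m :* (m :* (m :* (m :* (m :* con 1ℚ)))))) :* (:# 64 :* (m :* (m :* (m :* (m
            :* (m :* (m :* con 1ℚ))))))) :* (:# 8 :* (m :* m :* m)))
          := :# 50397184 :* (m :* (m :* (m :* (m :* (m :* (m :* (m :* (m :* (m :* (m :* (m :* (m :* (m :* (m :* (m :* con 1ℚ)))))))))))))))) refl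
        l₃ = solve 1 (λ m → :# 7100 :* (m :* (m :* (m :* (m :* (m :* (m :* (m :* (m :* con 1ℚ)))))))) :* (:# 7100 :* (m :* (m :* (m
            :* (m :* (m :* (m :* (m :* (m :* con 1ℚ)))))))))
          := :# 50397184 :* (m :* (m :* (m :* (m :* (m :* (m :* (m :* (m :* (m :* (m :* (m :* (m :* (m :* (m :* (m :* (m :* con 1ℚ))))))))))))))))
            :+ :# 12816 :* (m :* (m :* (m :* (m :* (m :* (m :* (m :* (m :* (m :* (m :* (m :* (m :* (m :* (m :* (m :* (m :* con 1ℚ))))))))))))))))) refl

    instance
      m-nonZero : NonZero m
      m-nonZero = >-nonZero 0<m

    -- Expressed through m ≤ p^{1/3} < m + 1 because p^{-2/3} is irrational.
    τ : ℚ
    τ = ℤ.+ 1 / 100 * (1/ m * 1/ m)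

    τmm : τ * (m * m) ≡ ℤ.+ 1 / 100
    τmm = trans (l (1/ m) m) (trans (cong (λ t → ℤ.+ 1 / 100 * (t * t)) (*-inverseˡ m)) refl)
      where
      l = solve 2 (λ i m → con (ℤ.+ 1 / 100) :* (i :* i) :* (m :* m) := con (ℤ.+ 1 / 100) :* (i :* m :* (i :* m))) refl

    τ≥0 : 0ℚ ≤ τ
    τ≥0 = cancel-≤ (m * m) (*->0 0<m 0<m) (subst₂ _≤_ (sym (*-zeroʳ (m * m))) (trans (sym τmm) (*-comm τ (m * m))) (*≤* (ℤ.+≤+ ℕ.z≤n)))

    ττ≥0 : 0ℚ ≤ τ * τ
    ττ≥0 = *-≥0 τ≥0 τ≥0

    1≤mm : 1ℚ ≤ m * m
    1≤mm = *-mono 0≤1 m≥0 1≤m 1≤m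

    h₁ : τ ≤ ℤ.+ 1 / 100
    h₁ = ≤-trans (≤-trans (≤-eq (sym (*-identityʳ τ))) (*-monoˡ τ τ≥0 1≤mm)) (≤-eq τmm)

    h₂ : τ * κ ≤ ℤ.+ 3 / 100
    h₂ = ≤-eq (trans (l τ (m * m)) (cong (# 3 *_) τmm))
      where
      l = solve 2 (λ t m → t :* (:# 3 :* m) := :# 3 :* (t :* m)) refl

    h₃ : τ * τ * N ≤ ℤ.+ 8 / 10000
    h₃ = ≤-trans (*-monoˡ (τ * τ) ττ≥0 N≤8m³) (≤-trans (≤-by (*-≥0 (*-≥0 (#≥0 8) ττ≥0) (*-≥0 m³≥0 (diff≥0 1≤m))) (l τ m)) (≤-eq (cong (λ t → # 8 * (t * t)) τmm)))
      where
      l = solve 2 (λ t m → :# 8 :* (t :* (m :* m) :* (t :* (m :* m)))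
        := t :* t :* (:# 8 :* (m :* m :* m)) :+ :# 8 :* (t :* t) :* (m :* m :* m :* (m :- con 1ℚ))) refl

    h₄ : τ * τ * ρ ≤ ℤ.+ 88 / 10000
    h₄ = ≤-eq (trans (l τ m) (cong (λ t → # 88 * (t * t)) τmm))
      where
      l = solve 2 (λ t m → t :* t :* (:# 88 :* (m :* m :* (m :* m))) := :# 88 :* (t :* (m :* m) :* (t :* (m :* m)))) refl

    h₅ : τ * τ * τ * (N * N) ≤ ℤ.+ 64 / 1000000
    h₅ = ≤-trans (*-monoˡ (τ * τ * τ) (*-≥0 ττ≥0 τ≥0) N²) (≤-eq (trans (l τ m) (cong (λ t → # 64 * (t * t * t)) τmm)))
      where
      l = solve 2 (λ t m → t :* t :* t :* (:# 64 :* (m :* (m :* (m :* (m :* (m :* (m :* con 1ℚ)))))))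
        := :# 64 :* (t :* (m :* m) :* (t :* (m :* m)) :* (t :* (m :* m)))) refl

    module LB = LowerBound field′ -1-square (paley p) (paley-sym -1-square) (paley-A₂ -1-square) τ κ ρ τ≥0 κ≥0 ρ≥0 N≤κ² R-bound h₁ h₂ h₃ h₄ h₅

  -- The value is nτ, and n ≥ m³ gives (nτ)³ = τ³n · n² ≥ (τm²)³ n with τm² = 1/100.
  lower : Σ FKParams λ α → FKFeasible (paley p) α × (cube (ℤ.+ 1 / 100) * ℕtoℚ p ≤ cube (FKValue (paley p) α))
  lower = LB.moments , LB.feasible , ≤-trans (≤-trans (≤-eq (trans (cong (λ t → t * t * t * N) (sym τmm)) (l₁ τ m N))) (*-monoˡ (τ * τ * τ * N) (*-≥0 (*-≥0 ττ≥0 τ≥0) N≥0) (*-mono m³≥0 N≥0 m³≤N m³≤N)))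
      (≤-eq (trans (l₂ τ N) (cong cube (sym (QuadraticForm.FKValue-∑ (paley p) (paley-sym -1-square) LB.moments)))))
    where
    l₁ = solve 3 (λ t m N → t :* (m :* m) :* (t :* (m :* m)) :* (t :* (m :* m)) :* N := t :* t :* t :* N :* (m :* m :* m :* (m :* m :* m))) refl
    l₂ = solve 2 (λ t N → t :* t :* t :* N :* (N :* N) := N :* t :* (N :* t) :* (N :* t)) refl

  -- The value na₁ is at most 8m · x by n ≤ 8m³, so a bound on the rescaled first moment x suffices.
  -- A nonpositive value is split off so that cubes can be compared.
  upper : ∀ (α : FKParams) → FKFeasible (paley p) α → (FKValue (paley p) α ≤ 0ℚ) ⊎ (cube (FKValue (paley p) α) ≤ cube (# 80000000000) * ℕtoℚ p)
  upper α feasible = case ≤-split (FKValue (paley p) α) 0ℚ of λ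
    { (inj₁ h) → inj₁ h
    ; (inj₂ h) → inj₂ (bound h) }
    where
    open GramBound field′ -1-square (paley p) (paley-sym -1-square) (paley-A₂ -1-square) α feasible zero κ ρ y κ≥0 ρ≥0 y≥0 N≤κ² R-bound using (gram-bound; pairsBound)
    open UpperForm field′ -1-square (paley p) (paley-sym -1-square) (paley-A₂ -1-square) α feasible zero
      using (a₁; a₂; a₃; a₄; gram; triangles₀; edges₀; edges₀-value; value-bound; link-test; kelner-test; kelner-link-test; triangles₀-bound; FKValue-∑)
    open Threshold a₁ a₂ a₃ a₄ gram triangles₀

    v : ∃ λ v → 0ℚ ≤ v × (a₄ ≡ v ⊎ a₄ ≡ - v) × a₄ ∈± v
    v = case ≤-total 0ℚ a₄ of λ
      { (inj₁ h) → a₄ , h , inj₁ refl , ±-≥0 h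
      ; (inj₂ h) → - a₄ , neg-≥0 h , inj₂ (sym (nn a₄)) , subst (_∈± - a₄) (nn a₄) (±-neg {(- a₄)} {(- a₄)} (±-≥0 (neg-≥0 h))) }
      where
      nn = solve 1 (λ a → :- (:- a) := a) refl

    x-bound : x ≤ # 10000000000
    x-bound = case ≤-split (# 2) x of λ
      { (inj₂ h) → ≤-trans (<⇒≤ h) (#-mono (ℕ.≤ᵇ⇒≤ 2 10000000000 _))
      ; (inj₁ 2≤x) → let link = subst (λ t → sq (a₂ * D) ≤ a₁ * (a₂ * D + a₃ * t)) edges₀-value link-test ; (u , 0≤u , a₄-u , a₄±) = v in
          x≤ 2≤x value-bound link (triangles₀-bound κ κ≥0 N≤κ²) (subst (λ t → sq (a₃ * t) ≤ a₁ * gram) edges₀-value kelner-test)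
            (subst (λ t → sq (# 2 * a₃ * t + a₄ * triangles₀) ≤ (a₂ * D + a₃ * t) * gram) edges₀-value kelner-link-test) u 0≤u a₄-u
            (gram-size {gram} {a₂} {a₃} {u} {pairsBound} (a₂≥0 2≤x value-bound) (a₃≥0 2≤x value-bound link) 0≤u pairs-size (gram-bound hy u 0≤u a₄± (a₂≥0 2≤x value-bound) (a₃≥0 2≤x value-bound link))) }

    bound : 0ℚ < FKValue (paley p) α → cube (FKValue (paley p) α) ≤ cube (# 80000000000) * ℕtoℚ p
    bound 0<V = ≤-trans (cube-mono V≥0 V≤) (≤-trans (≤-eq (l (# 80000000000) m)) (*-monoˡ (cube (# 80000000000)) (*-≥0 (*-≥0 (#≥0 80000000000) (#≥0 80000000000)) (#≥0 80000000000)) m³≤N))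
      where
      V : ℚ
      V = FKValue (paley p) α
      V≥0 : 0ℚ ≤ V
      V≥0 = <⇒≤ 0<V
      l = solve 2 (λ c m → c :* m :* (c :* m) :* (c :* m) := c :* c :* c :* (m :* m :* m)) refl
      cube-mono : ∀ {a b} → 0ℚ ≤ a → a ≤ b → cube a ≤ cube b
      cube-mono 0≤a h = *-mono (*-≥0 0≤a 0≤a) (≤-trans 0≤a h) (*-mono 0≤a (≤-trans 0≤a h) h h) h
      a₁≥0 : 0ℚ ≤ a₁
      a₁≥0 = cancel-≤ N 0<N (subst₂ _≤_ (sym (*-zeroʳ N)) FKValue-∑ V≥0)
      V≤ : V ≤ # 80000000000 * m
      V≤ = ≤-trans (≤-eq FKValue-∑) (≤-trans (*-monoʳ-≤-nonNeg a₁ {{nonNegative a₁≥0}} N≤8m³) (≤-trans (≤-eq (l₁ m a₁)) (≤-trans (*-monoˡ (# 8 * m) (*-≥0 (#≥0 8) m≥0) x-bound) (≤-eq (l₂ m)))))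
        where
        l₁ = solve 2 (λ m a → :# 8 :* (m :* m :* m) :* a := :# 8 :* m :* (a :* (m :* m))) refl
        l₂ = solve 1 (λ m → :# 8 :* m :* :# 10000000000 := :# 80000000000 :* m) refl

theorem5p1 : Σ ℚ λ c₁ → Σ ℚ λ c₂ → (0ℚ < c₁) × (c₁ ≤ c₂) ×
  Σ ℕ λ N → ∀ (p : ℕ) → Prime p → p % 4 ≡ 1 → N Data.Nat.≤ p →
    -- lower bound: FK₄(G_p) ≥ c₁ p^{1/3}
    (Σ FKParams λ α → FKFeasible (paley p) α ×
       (cube c₁ * ℕtoℚ p ≤ cube (FKValue (paley p) α)))
    -- upper bound: FK₄(G_p) ≤ c₂ p^{1/3}
    × (∀ (α : FKParams) → FKFeasible (paley p) α →
         (FKValue (paley p) α ≤ 0ℚ) ⊎ (cube (FKValue (paley p) α) ≤ cube c₂ * ℕtoℚ p))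
-- 1/100 is τm², 8 · 10¹⁰ combines n ≤ 8m³ with x ≤ 10¹⁰, and 2097152 = 128³ guarantees m ≥ 128.
theorem5p1 = ℤ.+ 1 / 100 , # 80000000000 , *<* (ℤ.+<+ (ℕ.s≤s ℕ.z≤n)) , ≤-trans {j = 1ℚ} (*≤* (ℤ.+≤+ (ℕ.s≤s ℕ.z≤n))) (1≤#suc 79999999999) , 2097152 , bounds
  where
  bounds : ∀ (p : ℕ) → Prime p → p % 4 ≡ 1 → 2097152 ℕ.≤ p →
    (Σ FKParams λ α → FKFeasible (paley p) α × (cube (ℤ.+ 1 / 100) * ℕtoℚ p ≤ cube (FKValue (paley p) α))) ×
    (∀ (α : FKParams) → FKFeasible (paley p) α → (FKValue (paley p) α ≤ 0ℚ) ⊎ (cube (FKValue (paley p) α) ≤ cube (# 80000000000) * ℕtoℚ p))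
  bounds (suc q) isPrime p%4≡1 large = Paley.lower q isPrime p%4≡1 large , Paley.upper q isPrime p%4≡1 large
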